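{- Let $n\geq 3$ and let $f\in\mathbb{Z}[t_1,\dots,t_n]$ be a nondegenerate $n$-ary quadratic form. Then $\delta(f)>0$.
   Context: $D_f\coloneqq f(\mathbb{Z}^n)\setminus\{0\}$. For $S\subset\mathbb{Z}$: $S$ is positive if it contains no negative integers, negative if it contains no positive integers, indefinite otherwise. The density of $S$ is $\lim_{N\to\infty}\#(S\cap[1,N])/N$ if $S$ is positive, $\lim_{N\to\infty}\#(S\cap[-N,-1])/N$ if $S$ is negative, and $\lim_{N\to\infty}\#(S\cap[-N,N])/(2N)$ if $S$ is indefinite (the limit being required to exist). $\delta(f)$ denotes the density of $D_f$. -}

module Defs where

open import Data.Nat as ℕ using (ℕ; zero; suc)
open import Data.Integer as ℤ using (ℤ; +_; -_)
open import Data.Fin using (Fin) renaming (zero to fzero; suc to fsuc)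
open import Data.List using (List; length)
open import Data.List.Membership.Propositional using (_∈_)
open import Data.List.Relation.Unary.Unique.Propositional using (Unique)
open import Data.Product using (Σ; _×_; ∃)
open import Relation.Binary.PropositionalEquality using (_≡_; _≢_)
open import Relation.Nullary using (¬_)
open import Function.Bundles using (_⇔_)

sumFin : (n : ℕ) → (Fin n → ℤ) → ℤ
sumFin zero    g = + 0
sumFin (suc n) g = g fzero ℤ.+ sumFin n (λ i → g (fsuc i))

-- An integral n-ary quadratic form is given by an integer coefficient
-- matrix c:  f(x) = Σ_i Σ_j c i j x_i x_j  (every f ∈ ℤ[t_1..t_n] homogeneous
-- of degree 2 arises this way, e.g. upper-triangular c).
evalQF : (n : ℕ) → (Fin n → Fin n → ℤ) → (Fin n → ℤ) → ℤ
evalQF n c x = sumFin n (λ i → sumFin n (λ j → c i j ℤ.* x i ℤ.* x j))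

-- Nondegenerate: the associated symmetric bilinear form (Gram matrix c + cᵀ)
-- has trivial radical, i.e. no nonzero integer vector in its kernel.
Nondegenerate : (n : ℕ) → (Fin n → Fin n → ℤ) → Set
Nondegenerate n c =
  (v : Fin n → ℤ) →
  (∀ i → sumFin n (λ j → (c i j ℤ.+ c j i) ℤ.* v j) ≡ + 0) →
  ∀ i → v i ≡ + 0

D : (n : ℕ) → (Fin n → Fin n → ℤ) → ℤ → Set
D n c m = (m ≢ + 0) × ∃ λ (x : Fin n → ℤ) → evalQF n c x ≡ m

IsPositive IsNegative IsIndefinite : (ℤ → Set) → Set
IsPositive S = ∀ m → S m → + 0 ℤ.≤ m
IsNegative S = ∀ m → S m → m ℤ.≤ + 0
IsIndefinite S = ¬ IsPositive S × ¬ IsNegative S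

CountIn : (ℤ → Set) → ℤ → ℤ → ℕ → Set
CountIn S lo hi k =
  Σ (List ℤ) λ xs → Unique xs × length xs ≡ k ×
    (∀ m → (m ∈ xs) ⇔ (S m × lo ℤ.≤ m × m ℤ.≤ hi))

-- The density lim_{N→∞} #(S ∩ [lo N, hi N]) / den N exists and is > 0.
-- Existence of the limit: the sequence of ratios is Cauchy (with ratios
-- compared by cross-multiplication: |k/d - k'/d'| < 1/(e+1)).
-- Positivity: the ratios are eventually ≥ 1/(d+1) for some d.
PositiveDensityWrt : (ℤ → Set) → (ℕ → ℤ) → (ℕ → ℤ) → (ℕ → ℕ) → Set
PositiveDensityWrt S lo hi den =
  ((e : ℕ) → ∃ λ M → ∀ N N' k k' → M ℕ.< N → M ℕ.< N' →
      CountIn S (lo N) (hi N) k → CountIn S (lo N') (hi N') k' →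
      ℤ.∣ (+ k) ℤ.* (+ den N') ℤ.- (+ k') ℤ.* (+ den N) ∣ ℕ.* suc e
        ℕ.< den N ℕ.* den N')
  × (∃ λ d → ∃ λ M → ∀ N k → M ℕ.< N →
      CountIn S (lo N) (hi N) k → den N ℕ.≤ suc d ℕ.* k)

DensityPositive : (ℤ → Set) → Set
DensityPositive S =
  (IsPositive S → PositiveDensityWrt S (λ _ → + 1) (λ N → + N) (λ N → N))
  × (IsNegative S → PositiveDensityWrt S (λ N → - (+ N)) (λ _ → - (+ 1)) (λ N → N))
  × (IsIndefinite S → PositiveDensityWrt S (λ N → - (+ N)) (λ N → + N) (λ N → 2 ℕ.* N))

{-# OPTIONS --safe #-}
-- Idea.  Diagonalise the form over ℚ: there are orthogonal integral vectors v i with a i = f (v i) ≠ 0,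
-- and one of them, v₁, may be taken with a₁ > 0.  On a residue class x + (multiples of L), with b x v₂
-- not too divisible, the values of f are f x + L t where t runs through
--   P = (ℓ₁ z + A₁ z²) + (ℓ₂ y₂ + A₂ y₂²) + (ℓ₃ y₃ + A₃ y₃²),   gcd (ℓ₂ , A₂) = 1,
-- and every prime ≤ w divides A₂.  A second moment shows that P represents all but a proportion O(1/b) of
-- the positive integers once w ≥ w₀(b).  Take z in [kH , (k+1)H) and y₂, y₃ in [0 , h) with h ≪ H: two points
-- with the same value and z′ = z + u satisfy Δ = u (ℓ₁ + A₁ u + 2 A₁ z), where Δ is the difference of the
-- (y₂ , y₃)-parts, that is a congruence for Δ modulo 2 A₁ u together with Δ ∈ [u α , u β].  Since u ≪ h this is counted cell
-- by cell, at the primes of A₂ exactly and at the others up to the divisor sum over g ∣ u, g = 1 or g > w;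
-- summing over u gives the expected number of coincidences for almost every pair, whatever the size of Δ.
-- Locally, Hensel's lemma moves x so that b x v₂ is not too divisible, unless f x is divisible by a
-- large square up to a constant.  Hence the represented integers agree, up to a set of density ≤ 1/E, with
-- a union of residue classes modulo L.
module Submission where

open import Data.Nat
open import Data.Nat.Properties
open import Data.Nat.Divisibility
open import Data.Nat.Tactic.RingSolver using (solve-∀)
import Data.Integer as ℤ
import Data.Integer.Properties as ℤP
import Data.Integer.Tactic.RingSolver as ℤR
open ℤ using (ℤ; +_; -[1+_])
open import Data.Product using (∃; _×_; _,_; proj₁; proj₂)
open import Data.Sum as Sum using (_⊎_; inj₁; inj₂)
open import Data.Empty using (⊥; ⊥-elim)
open import Function using (case_of_)
open import Relation.Nullary using (¬_; Dec; yes; no)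
open import Relation.Nullary.Decidable using (_×-dec_; _⊎-dec_; ¬?)
open import Relation.Binary.PropositionalEquality
open import Relation.Binary.Definitions using (tri<; tri≈; tri>)
import Data.Integer.Divisibility.Signed as S
open import Data.Nat.GCD using (gcd; gcd[m,n]∣m; gcd[m,n]∣n; gcd-greatest)
open import Data.Nat.Coprimality as Coprimality using (Coprime; coprime-divisor)
open import Data.Nat.DivMod using (_/_; _%_; m≡m%n+[m/n]*n; m%n<n; [m+n]%n≡m%n)
open import Data.Fin using (Fin; toℕ; fromℕ<) renaming (zero to fzero; suc to fsuc)
import Data.Fin.Properties as FinP
open import Defs
open import Data.Nat.Primality using (Prime; prime?; euclidsLemma; prime⇒nonZero; prime⇒nonTrivial; prime⇒irreducible; ¬prime⇒composite; prime[2])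
import Data.Nat.GCD as GCD
import Data.Integer.DivMod as ℤD
open import Data.Vec using (Vec; []; _∷_; lookup; tabulate)
import Data.Vec.Properties as VecP
open import Data.List using (List; []; _∷_; length)
open import Data.List.Membership.Propositional using (_∈_)
open import Data.List.Relation.Unary.Any using (here; there)
open import Data.List.Relation.Unary.Unique.Propositional using (Unique)
open import Data.List.Relation.Unary.AllPairs using ([]; _∷_)
import Data.List.Relation.Unary.All as All
open import Data.List.Membership.DecPropositional ℤ._≟_ using (_∈?_)
open import Function.Bundles using (Equivalence)

-- Finite sums

-- For `n = 3` an integer may be represented everywhere locally and still not by the form, so only
-- an average statement is sought, and the variance gives it. The number of collisions is needed
-- with its exact leading constant: a bound up to a constant factor would give a positive proportion
-- but no limit. Hence small primes may cause no loss at all, the slopes of `ℓ₁ z + A₁ z²` must be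
-- nearly constant on a window (`k` large), and the boxes must be covered by cells with small
-- relative loss. The signs of `A₂` and `A₃` are arbitrary and the binary part may split, so Δ = 0
-- can have many nontrivial solutions; these are estimated crudely. Fractions never occur:
-- reciprocals carry the denominator `H !`, and every estimate is an inequality between cleared
-- products. Negative integers are handled through the form `negate c`. Membership in the set of
-- values is not decidable a priori, so the density statements speak of decidable sets that agree
-- with it up to `N`.

∑ : ℕ → (ℕ → ℕ) → ℕ
∑ zero    f = 0
∑ (suc n) f = ∑ n f + f n

∑-cong : ∀ n {f g : ℕ → ℕ} → (∀ i → i < n → f i ≡ g i) → ∑ n f ≡ ∑ n g
∑-cong zero    eq = refl
∑-cong (suc n) eq = cong₂ _+_ (∑-cong n (λ i i<n → eq i (m<n⇒m<1+n i<n))) (eq n ≤-refl)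

∑-mono : ∀ n {f g : ℕ → ℕ} → (∀ i → i < n → f i ≤ g i) → ∑ n f ≤ ∑ n g
∑-mono zero    le = z≤n
∑-mono (suc n) le = +-mono-≤ (∑-mono n (λ i i<n → le i (m<n⇒m<1+n i<n))) (le n ≤-refl)

∑-const : ∀ n c → ∑ n (λ _ → c) ≡ n * c
∑-const zero    c = refl
∑-const (suc n) c = trans (cong (_+ c) (∑-const n c)) (+-comm (n * c) c)

∑-bound : ∀ n {f : ℕ → ℕ} c → (∀ i → i < n → f i ≤ c) → ∑ n f ≤ n * c
∑-bound n c le = ≤-trans (∑-mono n le) (≤-reflexive (∑-const n c))

∑-zero : ∀ n {f : ℕ → ℕ} → (∀ i → i < n → f i ≡ 0) → ∑ n f ≡ 0
∑-zero n eq = trans (∑-cong n eq) (trans (∑-const n 0) (*-zeroʳ n))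

∑-+ : ∀ n (f g : ℕ → ℕ) → ∑ n (λ i → f i + g i) ≡ ∑ n f + ∑ n g
∑-+ zero    f g = refl
∑-+ (suc n) f g = trans (cong (_+ (f n + g n)) (∑-+ n f g)) (interchange (∑ n f) (∑ n g) (f n) (g n))
  where
  interchange : ∀ a b c d → a + b + (c + d) ≡ a + c + (b + d)
  interchange = solve-∀

∑-*ˡ : ∀ n c (f : ℕ → ℕ) → ∑ n (λ i → c * f i) ≡ c * ∑ n f
∑-*ˡ zero    c f = sym (*-zeroʳ c)
∑-*ˡ (suc n) c f = trans (cong (_+ c * f n) (∑-*ˡ n c f)) (sym (*-distribˡ-+ c (∑ n f) (f n)))

∑-*ʳ : ∀ n c (f : ℕ → ℕ) → ∑ n (λ i → f i * c) ≡ ∑ n f * c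
∑-*ʳ n c f = trans (∑-cong n (λ i _ → *-comm (f i) c)) (trans (∑-*ˡ n c f) (*-comm c (∑ n f)))

∑-swap : ∀ n m (f : ℕ → ℕ → ℕ) → ∑ n (λ i → ∑ m (f i)) ≡ ∑ m (λ j → ∑ n (λ i → f i j))
∑-swap zero    m f = sym (∑-zero m (λ _ _ → refl))
∑-swap (suc n) m f = trans (cong (_+ ∑ m (f n)) (∑-swap n m f)) (sym (∑-+ m (λ j → ∑ n (λ i → f i j)) (f n)))

∑-split : ∀ a b (f : ℕ → ℕ) → ∑ (a + b) f ≡ ∑ a f + ∑ b (λ j → f (a + j))
∑-split a zero    f = trans (cong (λ n → ∑ n f) (+-identityʳ a)) (sym (+-identityʳ (∑ a f)))
∑-split a (suc b) f = trans (cong (λ n → ∑ n f) (+-suc a b))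
  (trans (cong (_+ f (a + b)) (∑-split a b f)) (+-assoc (∑ a f) _ (f (a + b))))

∑-range-mono : ∀ {a b} (f : ℕ → ℕ) → a ≤ b → ∑ a f ≤ ∑ b f
∑-range-mono {a} {b} f a≤b = begin
  ∑ a f                                      ≤⟨ m≤m+n _ _ ⟩
  ∑ a f + ∑ (b ∸ a) (λ j → f (a + j))        ≡⟨ ∑-split a (b ∸ a) f ⟨
  ∑ (a + (b ∸ a)) f                          ≡⟨ cong (λ n → ∑ n f) (m+[n∸m]≡n a≤b) ⟩
  ∑ b f                                      ∎
  where open ≤-Reasoning

∑-block : ∀ c m (f : ℕ → ℕ) → ∑ (c * m) f ≡ ∑ c (λ i → ∑ m (λ δ → f (i * m + δ)))
∑-block zero    m f = refl
∑-block (suc c) m f = begin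
  ∑ (m + c * m) f                                  ≡⟨ cong (λ n → ∑ n f) (+-comm m (c * m)) ⟩
  ∑ (c * m + m) f                                  ≡⟨ ∑-split (c * m) m f ⟩
  ∑ (c * m) f + ∑ m (λ δ → f (c * m + δ))          ≡⟨ cong (_+ ∑ m (λ δ → f (c * m + δ))) (∑-block c m f) ⟩
  ∑ (suc c) (λ i → ∑ m (λ δ → f (i * m + δ)))      ∎
  where open ≡-Reasoning

∑-term : ∀ n (f : ℕ → ℕ) {i} → i < n → f i ≤ ∑ n f
∑-term (suc n) f {i} i<1+n with m≤n⇒m<n∨m≡n (≤-pred i<1+n)
... | inj₁ i<n  = ≤-trans (∑-term n f i<n) (m≤m+n _ _)
... | inj₂ refl = m≤n+m (f n) (∑ n f)

∑-peel : ∀ n (g : ℕ → ℕ) → g 0 + ∑ n (λ i → g (suc i)) ≡ ∑ n g + g n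
∑-peel zero    g = +-comm (g 0) 0
∑-peel (suc n) g = trans (sym (+-assoc (g 0) _ (g (suc n)))) (cong (_+ g (suc n)) (∑-peel n g))

∑-periodic : ∀ a (f : ℕ → ℕ) → (∀ i → f (i + a) ≡ f i) → ∀ c → ∑ a (λ i → f (c + i)) ≡ ∑ a f
∑-periodic a f per zero    = refl
∑-periodic a f per (suc c) = trans (+-cancelˡ-≡ (f (c + 0)) _ _ rotate) (∑-periodic a f per c)
  where
  open ≡-Reasoning
  rotate : f (c + 0) + ∑ a (λ i → f (suc c + i)) ≡ f (c + 0) + ∑ a (λ i → f (c + i))
  rotate = begin
    f (c + 0) + ∑ a (λ i → f (suc c + i))   ≡⟨ cong (_+_ (f (c + 0))) (∑-cong a (λ i _ → cong f (sym (+-suc c i)))) ⟩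
    f (c + 0) + ∑ a (λ i → f (c + suc i))   ≡⟨ ∑-peel a (λ i → f (c + i)) ⟩
    ∑ a (λ i → f (c + i)) + f (c + a)       ≡⟨ cong (_+_ (∑ a (λ i → f (c + i)))) (trans (per c) (cong f (sym (+-identityʳ c)))) ⟩
    ∑ a (λ i → f (c + i)) + f (c + 0)       ≡⟨ +-comm _ (f (c + 0)) ⟩
    f (c + 0) + ∑ a (λ i → f (c + i))       ∎

-- Indicators

⟦_⟧ : ∀ {p} {P : Set p} → Dec P → ℕ
⟦ yes _ ⟧ = 1
⟦ no  _ ⟧ = 0

⟦⟧≤1 : ∀ {p} {P : Set p} (P? : Dec P) → ⟦ P? ⟧ ≤ 1
⟦⟧≤1 (yes _) = ≤-refl
⟦⟧≤1 (no  _) = z≤n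

⟦⟧-mono : ∀ {p q} {P : Set p} {Q : Set q} (P? : Dec P) (Q? : Dec Q) → (P → Q) → ⟦ P? ⟧ ≤ ⟦ Q? ⟧
⟦⟧-mono (no  _) Q?       f = z≤n
⟦⟧-mono (yes p) (yes q) f = ≤-refl
⟦⟧-mono (yes p) (no ¬q) f = ⊥-elim (¬q (f p))

⟦⟧-cong : ∀ {p q} {P : Set p} {Q : Set q} (P? : Dec P) (Q? : Dec Q) → (P → Q) → (Q → P) → ⟦ P? ⟧ ≡ ⟦ Q? ⟧
⟦⟧-cong P? Q? f g = ≤-antisym (⟦⟧-mono P? Q? f) (⟦⟧-mono Q? P? g)

⟦⟧-yes : ∀ {p} {P : Set p} (P? : Dec P) → P → ⟦ P? ⟧ ≡ 1
⟦⟧-yes (yes _) p = refl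
⟦⟧-yes (no ¬p) p = ⊥-elim (¬p p)

⟦⟧-no : ∀ {p} {P : Set p} (P? : Dec P) → ¬ P → ⟦ P? ⟧ ≡ 0
⟦⟧-no (yes p) ¬p = ⊥-elim (¬p p)
⟦⟧-no (no  _) ¬p = refl

⟦⟧-if : ∀ {p} {P : Set p} (P? : Dec P) {x y} → (P → x ≤ y) → ⟦ P? ⟧ * x ≤ y
⟦⟧-if (yes p) {x} f = ≤-trans (≤-reflexive (*-identityˡ x)) (f p)
⟦⟧-if (no  _) f = z≤n

⟦⟧-≤ : ∀ {p} {P : Set p} (P? : Dec P) {y} → (P → 1 ≤ y) → ⟦ P? ⟧ ≤ y
⟦⟧-≤ (yes p) f = f p
⟦⟧-≤ (no  _) f = z≤n

module _ {P : ℕ → Set} (P? : ∀ i → Dec (P i)) where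

  count : ℕ → ℕ
  count n = ∑ n (λ i → ⟦ P? i ⟧)

  count-none : ∀ n → (∀ i → i < n → ¬ P i) → count n ≡ 0
  count-none n none = ∑-zero n (λ i i<n → ⟦⟧-no (P? i) (none i i<n))

  count≤ : ∀ n → count n ≤ n
  count≤ n = ≤-trans (∑-bound n 1 (λ i _ → ⟦⟧≤1 (P? i))) (≤-reflexive (*-identityʳ n))

  count-unique : ∀ n → (∀ i j → i < j → j < n → P i → P j → ⊥) → count n ≤ 1
  count-unique zero    uniq = z≤n
  count-unique (suc n) uniq with P? n
  ... | no  _  = ≤-trans (≤-reflexive (+-identityʳ _)) (count-unique n (λ i j i<j j<n → uniq i j i<j (m<n⇒m<1+n j<n)))
  ... | yes pn = ≤-reflexive (cong (_+ 1) (count-none n (λ i i<n pi → uniq i n i<n ≤-refl pi pn)))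

  count-two : ∀ n → (∀ i j k → i < j → j < k → k < n → P i → P j → P k → ⊥) → count n ≤ 2
  count-two zero    few = z≤n
  count-two (suc n) few with P? n
  ... | no  _  = ≤-trans (≤-reflexive (+-identityʳ _)) (count-two n (λ i j k i<j j<k k<n → few i j k i<j j<k (m<n⇒m<1+n k<n)))
  ... | yes pn = +-monoˡ-≤ 1 (count-unique n (λ i j i<j j<n pi pj → few i j n i<j j<n ≤-refl pi pj pn))

-- Off the diagonal a pair is listed by its smaller index and its gap `suc s`. The gaps run over a
-- full range of length `h`, so pairs with an index beyond `h` are counted too; this removes the
-- dependence of the inner range on `b`.
∑-diagonals : ∀ h (F : ℕ → ℕ → ℕ) →
  ∑ h (λ a → ∑ h (F a)) ≤ ∑ h (λ b → F b b)
    + ∑ h (λ b → ∑ h (λ s → F (b + suc s) b)) + ∑ h (λ b → ∑ h (λ s → F b (b + suc s)))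
∑-diagonals h F = begin
  ∑ h (λ a → ∑ h (F a))                       ≤⟨ corner h ⟩
  ∑ h (λ b → F b b) + ∑ h (λ b → ∑ h (λ a → lower a b)) + ∑ h (λ b → ∑ h (λ a → upper b a))
     ≤⟨ +-mono-≤ (+-monoʳ-≤ (∑ h (λ b → F b b)) (∑-mono h (λ b _ → above h b (λ a → F a b))))
                 (∑-mono h (λ b _ → above h b (F b))) ⟩
  ∑ h (λ b → F b b) + ∑ h (λ b → ∑ h (λ s → F (b + suc s) b)) + ∑ h (λ b → ∑ h (λ s → F b (b + suc s))) ∎
  where
  open ≤-Reasoning
  lower upper : ℕ → ℕ → ℕ
  lower a b = ⟦ b <? a ⟧ * F a b
  upper b a = ⟦ b <? a ⟧ * F b a
  above : ∀ n b (G : ℕ → ℕ) → ∑ n (λ a → ⟦ b <? a ⟧ * G a) ≤ ∑ n (λ s → G (b + suc s))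
  above n b G with n ≤? suc b
  ... | yes n≤1+b = ≤-trans (≤-reflexive (∑-zero n (λ a a<n →
          cong (_* G a) (⟦⟧-no (b <? a) (λ b<a → <-irrefl refl (≤-trans b<a (≤-pred (≤-trans a<n n≤1+b)))))))) z≤n
  ... | no  n≰1+b = begin
    ∑ n (λ a → ⟦ b <? a ⟧ * G a)                 ≡⟨ cong (λ x → ∑ x (λ a → ⟦ b <? a ⟧ * G a)) (m+[n∸m]≡n (<⇒≤ (≰⇒> n≰1+b))) ⟨
    ∑ (suc b + r) (λ a → ⟦ b <? a ⟧ * G a)       ≡⟨ ∑-split (suc b) r (λ a → ⟦ b <? a ⟧ * G a) ⟩
    ∑ (suc b) (λ a → ⟦ b <? a ⟧ * G a) + ∑ r (λ j → ⟦ b <? suc b + j ⟧ * G (suc b + j))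
        ≤⟨ +-mono-≤ (≤-reflexive (∑-zero (suc b) (λ a a≤b → cong (_* G a) (⟦⟧-no (b <? a) (λ b<a → <-irrefl refl (≤-trans b<a (≤-pred a≤b)))))))
                    (∑-mono r (λ j _ → ⟦⟧-if (b <? suc b + j) (λ _ → ≤-reflexive (cong G (sym (+-suc b j)))))) ⟩
    0 + ∑ r (λ j → G (b + suc j))                ≤⟨ ∑-range-mono (λ j → G (b + suc j)) (m∸n≤m n (suc b)) ⟩
    ∑ n (λ s → G (b + suc s))                    ∎
    where r = n ∸ suc b
  cell : ∀ a b → F a b ≤ ⟦ b ≟ a ⟧ * F a b + (lower a b + upper a b)
  cell a b with <-cmp a b
  ... | tri< a<b a≢b b≮a rewrite ⟦⟧-no (b ≟ a) (λ e → a≢b (sym e)) | ⟦⟧-no (b <? a) b≮a | ⟦⟧-yes (a <? b) a<b = m≤m+n (F a b) 0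
  ... | tri≈ a≮b refl b≮a rewrite ⟦⟧-yes (a ≟ a) refl = ≤-trans (m≤m+n (F a a) 0) (m≤m+n _ _)
  ... | tri> a≮b a≢b b<a rewrite ⟦⟧-no (b ≟ a) (λ e → a≢b (sym e)) | ⟦⟧-yes (b <? a) b<a = ≤-trans (m≤m+n (F a b) 0) (m≤m+n _ _)
  single : ∀ n a → ∑ n (λ b → ⟦ b ≟ a ⟧ * F a b) ≤ F a a
  single n a = begin
    ∑ n (λ b → ⟦ b ≟ a ⟧ * F a b)   ≡⟨ ∑-cong n (λ b _ → at b) ⟩
    ∑ n (λ b → ⟦ b ≟ a ⟧ * F a a)   ≡⟨ ∑-*ʳ n (F a a) (λ b → ⟦ b ≟ a ⟧) ⟩
    count (_≟ a) n * F a a          ≤⟨ *-monoˡ-≤ (F a a) (count-unique (_≟ a) n (λ i j i<j _ i≡a j≡a → <-irrefl (trans i≡a (sym j≡a)) i<j)) ⟩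
    1 * F a a                       ≡⟨ *-identityˡ (F a a) ⟩
    F a a                           ∎
    where
    at : ∀ b → ⟦ b ≟ a ⟧ * F a b ≡ ⟦ b ≟ a ⟧ * F a a
    at b with b ≟ a
    ... | yes refl = refl
    ... | no  _    = refl
  corner : ∀ n → ∑ n (λ a → ∑ n (F a)) ≤ ∑ n (λ b → F b b) + ∑ n (λ b → ∑ n (λ a → lower a b)) + ∑ n (λ b → ∑ n (λ a → upper b a))
  corner n = begin
    ∑ n (λ a → ∑ n (F a))   ≤⟨ ∑-mono n (λ a _ → ∑-mono n (λ b _ → cell a b)) ⟩
    ∑ n (λ a → ∑ n (λ b → ⟦ b ≟ a ⟧ * F a b + (lower a b + upper a b)))
      ≡⟨ ∑-cong n (λ a _ → trans (∑-+ n _ _) (cong (_+_ (∑ n (λ b → ⟦ b ≟ a ⟧ * F a b))) (∑-+ n (lower a) (upper a)))) ⟩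
    ∑ n (λ a → ∑ n (λ b → ⟦ b ≟ a ⟧ * F a b) + (∑ n (lower a) + ∑ n (upper a)))
      ≡⟨ trans (∑-+ n _ _) (cong (_+_ (∑ n (λ a → ∑ n (λ b → ⟦ b ≟ a ⟧ * F a b)))) (∑-+ n _ _)) ⟩
    ∑ n (λ a → ∑ n (λ b → ⟦ b ≟ a ⟧ * F a b)) + (∑ n (λ a → ∑ n (lower a)) + ∑ n (λ a → ∑ n (upper a)))
      ≤⟨ +-mono-≤ (∑-mono n (λ a _ → single n a)) (≤-reflexive (cong (_+ ∑ n (λ a → ∑ n (upper a))) (∑-swap n n lower))) ⟩
    ∑ n (λ a → F a a) + (∑ n (λ b → ∑ n (λ a → lower a b)) + ∑ n (λ a → ∑ n (upper a)))
      ≡⟨ +-assoc (∑ n (λ a → F a a)) _ _ ⟨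
    ∑ n (λ b → F b b) + ∑ n (λ b → ∑ n (λ a → lower a b)) + ∑ n (λ b → ∑ n (λ a → upper b a)) ∎

count-blocks : ∀ {P : ℕ → Set} (P? : ∀ i → Dec (P i)) c d →
  (∀ i → i < c → ∀ δ ε → δ < ε → ε < d → P (i * d + δ) → P (i * d + ε) → ⊥) → count P? (c * d) ≤ c
count-blocks P? c d uniq = begin
  count P? (c * d)                                  ≡⟨ ∑-block c d (λ i → ⟦ P? i ⟧) ⟩
  ∑ c (λ i → ∑ d (λ δ → ⟦ P? (i * d + δ) ⟧))        ≤⟨ ∑-bound c 1 (λ i i<c → count-unique (λ δ → P? (i * d + δ)) d (uniq i i<c)) ⟩
  c * 1                                             ≡⟨ *-identityʳ c ⟩
  c                                                 ∎
  where open ≤-Reasoning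

-- Reduces an inequality to an equation for the ring solver.
≤-from : ∀ {a b x y} r → x ≤ y → a + y + r ≡ b + x → a ≤ b
≤-from {a} {b} {x} {y} r x≤y eq = +-cancelʳ-≤ x a b (begin
  a + x       ≤⟨ +-monoʳ-≤ a x≤y ⟩
  a + y       ≤⟨ m≤m+n (a + y) r ⟩
  a + y + r   ≡⟨ eq ⟩
  b + x       ∎)
  where open ≤-Reasoning

-- Linear congruences

pos-∸ : ∀ {i j} → i ≤ j → + j ℤ.- + i ≡ + (j ∸ i)
pos-∸ {i} {j} i≤j = trans (ℤP.[+m]-[+n]≡m⊖n j i) (ℤP.⊖-≥ i≤j)

S-subst : ∀ {k x y} → x ≡ y → k S.∣ x → k S.∣ y
S-subst refl d = d

∣-gap : ∀ {d i j} → i < j → j < d → ¬ (+ d S.∣ (+ j ℤ.- + i))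
∣-gap {d} {i} {j} i<j j<d d∣ = <-irrefl refl (begin-strict
  d       ≤⟨ ∣⇒≤ ⦃ >-nonZero (m<n⇒0<n∸m i<j) ⦄ (S.∣⇒∣ᵤ (S-subst (pos-∸ (<⇒≤ i<j)) d∣)) ⟩
  j ∸ i   ≤⟨ m∸n≤m j i ⟩
  j       <⟨ j<d ⟩
  d       ∎)
  where open ≤-Reasoning

∣-coprime : ∀ {m} x y → Coprime m ℤ.∣ y ∣ → + m S.∣ (y ℤ.* x) → + m S.∣ x
∣-coprime x y co d = S.∣ᵤ⇒∣ (coprime-divisor co (subst (_ ∣_) (ℤP.abs-* y x) (S.∣⇒∣ᵤ d)))

coprime-∣ˡ : ∀ {a b c} → a ∣ b → Coprime b c → Coprime a c
coprime-∣ˡ a∣b co (d∣a , d∣c) = co (∣-trans d∣a a∣b , d∣c)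

coprime-* : ∀ {x a b} → Coprime x a → Coprime x b → Coprime x (a * b)
coprime-* {x} {a} {b} ca cb {d} (d∣x , d∣ab) =
  cb (d∣x , coprime-divisor {d} {a} {b} (λ (e∣d , e∣a) → ca (∣-trans e∣d d∣x , e∣a)) d∣ab)

gcd-split : ∀ a α → 1 ≤ a → ∃ λ g → ∃ λ d → ∃ λ α′ → a ≡ g * d × α ≡ α′ ℤ.* + g × Coprime d ℤ.∣ α′ ∣
gcd-split a α 1≤a with gcd[m,n]∣m a ℤ.∣ α ∣ | S.∣ᵤ⇒∣ {+ gcd a ℤ.∣ α ∣} {α} (gcd[m,n]∣n a ℤ.∣ α ∣)
... | divides d eq | S.divides α′ eq′ = g , d , α′ , trans eq (*-comm d g) , eq′ , coprime
  where
  g = gcd a ℤ.∣ α ∣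
  instance
    g≢0 : NonZero g
    g≢0 = ≢-nonZero (λ g≡0 → <-irrefl refl (≤-trans 1≤a (≤-reflexive (trans eq (trans (cong (d *_) g≡0) (*-zeroʳ d))))))
  coprime : Coprime d ℤ.∣ α′ ∣
  coprime {e} (e∣d , e∣α′) = ∣1⇒≡1 (*-cancelʳ-∣ g (subst (e * g ∣_) (sym (*-identityˡ g)) (gcd-greatest
    (subst (e * g ∣_) (sym eq) (*-monoˡ-∣ g e∣d))
    (subst (e * g ∣_) (sym (trans (cong ℤ.∣_∣ eq′) (ℤP.abs-* α′ (+ g)))) (*-monoˡ-∣ g e∣α′)))))

linear-spread : ∀ g d α′ c i j → 1 ≤ g * d → Coprime d ℤ.∣ α′ ∣ →
  + (g * d) S.∣ (α′ ℤ.* + g ℤ.* + i ℤ.+ c) → + (g * d) S.∣ (α′ ℤ.* + g ℤ.* + j ℤ.+ c) → + d S.∣ (+ j ℤ.- + i)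
linear-spread g d α′ c i j 1≤a co p q =
  ∣-coprime (+ j ℤ.- + i) α′ co (S.*-cancelʳ-∣ (+ g) {+ d} {α′ ℤ.* (+ j ℤ.- + i)} ⦃ g≢0 ⦄
    (subst (S._∣ ((α′ ℤ.* (+ j ℤ.- + i)) ℤ.* + g)) (trans (ℤP.pos-* g d) (ℤP.*-comm (+ g) (+ d)))
      (S-subst (eqn α′ (+ g) (+ i) (+ j) c) (S.∣m∣n⇒∣m-n q p))))
  where
  eqn : ∀ α′ g i j c → (α′ ℤ.* g ℤ.* j ℤ.+ c) ℤ.- (α′ ℤ.* g ℤ.* i ℤ.+ c) ≡ (α′ ℤ.* (j ℤ.- i)) ℤ.* g
  eqn = ℤR.solve-∀
  g≢0 : ℤ.NonZero (+ g)
  g≢0 = ≢-nonZero (λ { refl → <-irrefl refl 1≤a })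

block-diff : ∀ i d δ ε → + (i * d + ε) ℤ.- + (i * d + δ) ≡ + ε ℤ.- + δ
block-diff i d δ ε = trans (cong₂ ℤ._-_ (ℤP.pos-+ (i * d) ε) (ℤP.pos-+ (i * d) δ)) (eqn (+ (i * d)) (+ ε) (+ δ))
  where
  eqn : ∀ x e f → (x ℤ.+ e) ℤ.- (x ℤ.+ f) ≡ e ℤ.- f
  eqn = ℤR.solve-∀

-- By `linear-spread` two solutions differ by a multiple of `d`, so a block of length `d` holds at
-- most one.
linear-count : ∀ g d α′ c k → 1 ≤ g * d → Coprime d ℤ.∣ α′ ∣ →
  count (λ y → + (g * d) S.∣? (α′ ℤ.* + g ℤ.* + y ℤ.+ c)) (k * d) ≤ k
linear-count g d α′ c k 1≤a co = count-blocks (λ y → + (g * d) S.∣? (α′ ℤ.* + g ℤ.* + y ℤ.+ c)) k d (λ i _ δ ε δ<ε ε<d p q →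
  ∣-gap δ<ε ε<d (S-subst (block-diff i d δ ε) (linear-spread g d α′ c (i * d + δ) (i * d + ε) 1≤a co p q)))

-- For fixed `y′` the congruence in `y` is solvable only if the gcd `g₁` of `a` and `α` divides the
-- rest, and then has at most `g₁` solutions per period. This divisibility is a congruence of the
-- same kind in `y′`; the final `g` is the gcd of `a`, `α` and `β`.
linear₂-count : ∀ a α β c → 1 ≤ a → ∃ λ g → g ∣ a × (+ g S.∣ α) × (+ g S.∣ β) ×
  ∑ a (λ y′ → ∑ a (λ y → ⟦ + a S.∣? (α ℤ.* + y ℤ.+ (β ℤ.* + y′ ℤ.+ c)) ⟧)) ≤ a * g
linear₂-count a α β c 1≤a with gcd-split a α 1≤a
... | g₁ , d₁ , α′ , refl , refl , co₁ with gcd-split g₁ β (n≢0⇒n>0 (λ { refl → <-irrefl refl 1≤a }))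
...   | g₂ , d₂ , β′ , refl , refl , co₂ =
  g₂ , ∣m⇒∣m*n d₁ (m∣m*n d₂) , S.∣n⇒∣m*n α′ (S.∣ᵤ⇒∣ (m∣m*n d₂)) , S.divides β′ refl , (begin
  ∑ a (λ y′ → ∑ a (λ y → ⟦ + a S.∣? (α ℤ.* + y ℤ.+ rhs y′) ⟧))    ≤⟨ ∑-mono a (λ y′ _ → inner y′) ⟩
  ∑ a (λ y′ → g₁ * ⟦ + g₁ S.∣? rhs y′ ⟧)                          ≡⟨ ∑-*ˡ a g₁ _ ⟩
  g₁ * count (λ y′ → + g₁ S.∣? rhs y′) a                          ≡⟨ cong (λ n → g₁ * count (λ y′ → + g₁ S.∣? rhs y′) n) (arr g₂ d₂ d₁) ⟩
  g₁ * count (λ y′ → + g₁ S.∣? rhs y′) ((d₁ * g₂) * d₂)           ≤⟨ *-monoʳ-≤ g₁ (linear-count g₂ d₂ β′ c (d₁ * g₂) g₁≥1 co₂) ⟩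
  g₁ * (d₁ * g₂)                                                  ≡⟨ *-assoc g₁ d₁ g₂ ⟨
  a * g₂                                                          ∎)
  where
  open ≤-Reasoning
  rhs : ℕ → ℤ
  rhs y′ = β′ ℤ.* + g₂ ℤ.* + y′ ℤ.+ c
  g₁≥1 : 1 ≤ g₁
  g₁≥1 = n≢0⇒n>0 (λ e → <-irrefl refl (≤-trans 1≤a (≤-reflexive (cong (_* d₁) e))))
  arr : ∀ g₂ d₂ d₁ → g₂ * d₂ * d₁ ≡ d₁ * g₂ * d₂
  arr = solve-∀
  inner : ∀ y′ → ∑ a (λ y → ⟦ + a S.∣? (α ℤ.* + y ℤ.+ rhs y′) ⟧) ≤ g₁ * ⟦ + g₁ S.∣? rhs y′ ⟧
  inner y′ with + g₁ S.∣? rhs y′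
  ... | yes _ = ≤-trans (linear-count g₁ d₁ α′ (rhs y′) g₁ 1≤a co₁) (≤-reflexive (sym (*-identityʳ g₁)))
  ... | no ∤  = ≤-trans (≤-reflexive (count-none (λ y → + a S.∣? (α ℤ.* + y ℤ.+ rhs y′)) a (λ y _ p →
          ∤ (S.∣m+n∣m⇒∣n {m = α′ ℤ.* + g₁ ℤ.* + y} {n = rhs y′} (S.∣-trans {+ g₁} {+ (g₁ * d₁)} (S.∣ᵤ⇒∣ (m∣m*n d₁)) p) (S.∣m⇒∣m*n {m = α′ ℤ.* + g₁} (+ y) (S.divides α′ refl)))))) z≤n

-- The value 0 off the divisors lets a sum over all `g ≤ a` stand for a divisor sum.
codivisor : ℕ → ℕ → ℕ
codivisor a g with g ∣? a
... | yes (divides c _) = c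
... | no  _             = 0

codivisor-* : ∀ a g → g ∣ a → codivisor a g * g ≡ a
codivisor-* a g g∣a with g ∣? a
... | yes (divides c eq) = sym eq
... | no  ∤              = ⊥-elim (∤ g∣a)

multiples-count : ∀ c g → count (λ s → g ∣? s) (c * g) ≤ c
multiples-count c g = count-blocks (λ s → g ∣? s) c g (λ i _ δ ε δ<ε ε<g p q →
  ∣-gap δ<ε ε<g (S-subst (block-diff i g δ ε) (S.∣m∣n⇒∣m-n (S.∣ᵤ⇒∣ {+ g} {+ (i * g + ε)} q) (S.∣ᵤ⇒∣ {+ g} {+ (i * g + δ)} p))))

-- Equals `a²` times the sum of `1 / g` over the divisors `g` of `a`.
divisorSum : ℕ → ℕ
divisorSum a = ∑ (suc a) (λ g → g * (codivisor a g * codivisor a g))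

-- The inner sum over all common divisors replaces the gcd of `a`, `s` and `t`, which is one of its
-- terms. A divisor `g` of `a` divides at most `a / g` residues in each coordinate.
gcd-sum : ∀ a →
  ∑ a (λ s → ∑ a (λ t → ∑ (suc a) (λ g → g * (⟦ g ∣? a ⟧ * (⟦ g ∣? s ⟧ * ⟦ g ∣? t ⟧))))) ≤ divisorSum a
gcd-sum a = begin
  ∑ a (λ s → ∑ a (λ t → ∑ (suc a) (λ g → g * (⟦ g ∣? a ⟧ * (⟦ g ∣? s ⟧ * ⟦ g ∣? t ⟧)))))
    ≡⟨ ∑-cong a (λ s _ → ∑-swap a (suc a) (λ t g → g * (⟦ g ∣? a ⟧ * (⟦ g ∣? s ⟧ * ⟦ g ∣? t ⟧)))) ⟩
  ∑ a (λ s → ∑ (suc a) (λ g → ∑ a (λ t → g * (⟦ g ∣? a ⟧ * (⟦ g ∣? s ⟧ * ⟦ g ∣? t ⟧)))))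
    ≡⟨ ∑-swap a (suc a) (λ s g → ∑ a (λ t → g * (⟦ g ∣? a ⟧ * (⟦ g ∣? s ⟧ * ⟦ g ∣? t ⟧)))) ⟩
  ∑ (suc a) (λ g → ∑ a (λ s → ∑ a (λ t → g * (⟦ g ∣? a ⟧ * (⟦ g ∣? s ⟧ * ⟦ g ∣? t ⟧)))))
    ≤⟨ ∑-mono (suc a) (λ g _ → per g) ⟩
  divisorSum a ∎
  where
  open ≤-Reasoning
  per : ∀ g → ∑ a (λ s → ∑ a (λ t → g * (⟦ g ∣? a ⟧ * (⟦ g ∣? s ⟧ * ⟦ g ∣? t ⟧)))) ≤ g * (codivisor a g * codivisor a g)
  per g with g ∣? a
  ... | no _ = ≤-reflexive (trans (∑-zero a (λ s _ → ∑-zero a (λ t _ → *-zeroʳ g))) (sym (*-zeroʳ g)))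
  ... | yes (divides c refl) = begin
    ∑ a (λ s → ∑ a (λ t → g * (1 * (⟦ g ∣? s ⟧ * ⟦ g ∣? t ⟧))))
      ≡⟨ ∑-cong a (λ s _ → trans (∑-cong a (λ t _ → arr g ⟦ g ∣? s ⟧ ⟦ g ∣? t ⟧)) (∑-*ˡ a (⟦ g ∣? s ⟧ * g) (λ t → ⟦ g ∣? t ⟧))) ⟩
    ∑ a (λ s → ⟦ g ∣? s ⟧ * g * K)        ≡⟨ trans (∑-*ʳ a K _) (cong (_* K) (∑-*ʳ a g _)) ⟩
    K * g * K                             ≤⟨ *-mono-≤ (*-monoˡ-≤ g K≤c) K≤c ⟩
    c * g * c                             ≡⟨ arr′ c g ⟩
    g * (c * c)                           ∎
    where
    K = count (λ s → g ∣? s) a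
    K≤c : K ≤ c
    K≤c = multiples-count c g
    arr : ∀ g x y → g * (1 * (x * y)) ≡ x * g * y
    arr = solve-∀
    arr′ : ∀ c g → c * g * c ≡ g * (c * c)
    arr′ = solve-∀

-- The gcd with `A` is split off until it becomes 1. That `B` contains only primes of `A` is
-- recorded in the form in which it is applied: whatever is coprime to `A` is coprime to `B`.
coprime-part : ∀ A m → 1 ≤ m → ∃ λ B → ∃ λ a → m ≡ B * a × Coprime a A × (∀ x → Coprime x A → Coprime x B)
coprime-part A m 1≤m = go m m ≤-refl 1≤m
  where
  go : ∀ fuel m → m ≤ fuel → 1 ≤ m → ∃ λ B → ∃ λ a → m ≡ B * a × Coprime a A × (∀ x → Coprime x A → Coprime x B)
  go zero    m m≤0 1≤m = ⊥-elim (<-irrefl refl (≤-trans 1≤m m≤0))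
  go (suc n) m m≤n 1≤m with gcd m A ≟ 1 | gcd[m,n]∣m m A
  ... | yes g≡1 | _ = 1 , m , sym (*-identityˡ m) , Coprimality.gcd≡1⇒coprime g≡1 , λ x _ (_ , d∣1) → ∣1⇒≡1 d∣1
  ... | no  g≢1 | divides q eq with go n q q≤n q≥1
    where
    g = gcd m A
    g≥1 : 1 ≤ g
    g≥1 = n≢0⇒n>0 (λ g≡0 → <-irrefl refl (≤-trans 1≤m (≤-reflexive (trans eq (trans (cong (q *_) g≡0) (*-zeroʳ q))))))
    q≥1 : 1 ≤ q
    q≥1 = n≢0⇒n>0 (λ q≡0 → <-irrefl refl (≤-trans 1≤m (≤-reflexive (trans eq (cong (_* g) q≡0)))))
    q≤n : q ≤ n
    q≤n = ≤-pred (≤-trans (≤-trans (m<m*n q g ⦃ >-nonZero q≥1 ⦄ (≤∧≢⇒< g≥1 (λ e → g≢1 (sym e)))) (≤-reflexive (sym eq))) m≤n)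
  ...   | B , a , q≡ , co , cl = gcd m A * B , a
          , trans eq (trans (cong (_* gcd m A) q≡) (arr B a (gcd m A))) , co
          , λ x cx → coprime-* (λ (d∣x , d∣g) → cx (d∣x , ∣-trans d∣g (gcd[m,n]∣n m A))) (cl x cx)
    where
    arr : ∀ B a g → B * a * g ≡ g * B * a
    arr = solve-∀

-- Congruences between values of a binary quadratic polynomial

quad : ℤ → ℤ → ℕ → ℤ
quad ℓ A y = (ℓ ℤ.+ A ℤ.* + y) ℤ.* + y

quad-diff : ∀ ℓ A y y′ → quad ℓ A y′ ℤ.- quad ℓ A y ≡ (ℓ ℤ.+ A ℤ.* (+ y′ ℤ.+ + y)) ℤ.* (+ y′ ℤ.- + y)
quad-diff ℓ A y y′ = eqn ℓ A (+ y) (+ y′)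
  where
  eqn : ∀ ℓ A y y′ → (ℓ ℤ.+ A ℤ.* y′) ℤ.* y′ ℤ.- (ℓ ℤ.+ A ℤ.* y) ℤ.* y ≡ (ℓ ℤ.+ A ℤ.* (y′ ℤ.+ y)) ℤ.* (y′ ℤ.- y)
  eqn = ℤR.solve-∀

quad-cong : ∀ {m} ℓ A y y′ → + m S.∣ (+ y′ ℤ.- + y) → + m S.∣ (quad ℓ A y′ ℤ.- quad ℓ A y)
quad-cong ℓ A y y′ d = S-subst (sym (quad-diff ℓ A y y′)) (S.∣n⇒∣m*n (ℓ ℤ.+ A ℤ.* (+ y′ ℤ.+ + y)) d)

∣-add-multiple : ∀ k m δ → + m S.∣ (+ (k * m + δ) ℤ.- + δ)
∣-add-multiple k m δ = S.divides (+ k) (trans (cong (ℤ._- + δ) (trans (ℤP.pos-+ (k * m) δ) (cong (ℤ._+ + δ) (ℤP.pos-* k m)))) (eqn (+ k) (+ m) (+ δ)))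
  where
  eqn : ∀ k m δ → (k ℤ.* m ℤ.+ δ) ℤ.- δ ≡ k ℤ.* m
  eqn = ℤR.solve-∀

∣-refl-diff : ∀ m y → + m S.∣ (+ y ℤ.- + y)
∣-refl-diff m y = S.divides (+ 0) (ℤP.+-inverseʳ (+ y))

∣-flip : ∀ {k} x y → k S.∣ (x ℤ.- y) → k S.∣ (y ℤ.- x)
∣-flip x y d = S-subst (eqn x y) (S.∣m⇒∣-m d)
  where
  eqn : ∀ x y → ℤ.- (x ℤ.- y) ≡ y ℤ.- x
  eqn = ℤR.solve-∀

∑⁴ : ℕ → (ℕ → ℕ → ℕ → ℕ → ℕ) → ℕ
∑⁴ n F = ∑ n (λ b → ∑ n (λ d → ∑ n (λ c → ∑ n (λ a → F b d c a))))

∑⁴-mono : ∀ n {F G : ℕ → ℕ → ℕ → ℕ → ℕ} → (∀ b d c a → b < n → d < n → c < n → a < n → F b d c a ≤ G b d c a) → ∑⁴ n F ≤ ∑⁴ n G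
∑⁴-mono n le = ∑-mono n (λ b b< → ∑-mono n (λ d d< → ∑-mono n (λ c c< → ∑-mono n (λ a a< → le b d c a b< d< c< a<))))

∑⁴-cong : ∀ n {F G : ℕ → ℕ → ℕ → ℕ → ℕ} → (∀ b d c a → b < n → d < n → c < n → a < n → F b d c a ≡ G b d c a) → ∑⁴ n F ≡ ∑⁴ n G
∑⁴-cong n le = ∑-cong n (λ b b< → ∑-cong n (λ d d< → ∑-cong n (λ c c< → ∑-cong n (λ a a< → le b d c a b< d< c< a<))))

∑⁴-range-mono : ∀ {m n} (F : ℕ → ℕ → ℕ → ℕ → ℕ) → m ≤ n → ∑⁴ m F ≤ ∑⁴ n F
∑⁴-range-mono {m} {n} F m≤n =
  ≤-trans (∑-mono m (λ b _ → ≤-trans (∑-mono m (λ d _ → ≤-trans (∑-mono m (λ c _ → ∑-range-mono (F b d c) m≤n))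
    (∑-range-mono _ m≤n))) (∑-range-mono _ m≤n))) (∑-range-mono _ m≤n)

∑⁴-*ˡ : ∀ n k (F : ℕ → ℕ → ℕ → ℕ → ℕ) → ∑⁴ n (λ b d c a → k * F b d c a) ≡ k * ∑⁴ n F
∑⁴-*ˡ n k F = trans (∑-cong n (λ b _ → trans (∑-cong n (λ d _ → trans (∑-cong n (λ c _ → ∑-*ˡ n k _)) (∑-*ˡ n k _))) (∑-*ˡ n k _))) (∑-*ˡ n k _)

∑⁴-+ : ∀ n (F G : ℕ → ℕ → ℕ → ℕ → ℕ) → ∑⁴ n (λ b d c a → F b d c a + G b d c a) ≡ ∑⁴ n F + ∑⁴ n G
∑⁴-+ n F G = trans (∑-cong n (λ b _ → trans (∑-cong n (λ d _ → trans (∑-cong n (λ c _ → ∑-+ n _ _)) (∑-+ n _ _))) (∑-+ n _ _))) (∑-+ n _ _)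

∑⁴-const : ∀ n k → ∑⁴ n (λ _ _ _ _ → k) ≡ n * n * n * n * k
∑⁴-const n k = trans (∑-cong n (λ b _ → trans (∑-cong n (λ d _ → trans (∑-cong n (λ c _ → ∑-const n k)) (∑-const n _))) (∑-const n _)))
  (trans (∑-const n _) (arr n k))
  where
  arr : ∀ n k → n * (n * (n * (n * k))) ≡ n * n * n * n * k
  arr = solve-∀

∑-∑⁴-swap : ∀ m n (F : ℕ → ℕ → ℕ → ℕ → ℕ → ℕ) → ∑ m (λ i → ∑⁴ n (F i)) ≡ ∑⁴ n (λ b d c a → ∑ m (λ i → F i b d c a))
∑-∑⁴-swap m n F = trans (∑-swap m n _) (∑-cong n (λ b _ → trans (∑-swap m n _) (∑-cong n (λ d _ →
  trans (∑-swap m n _) (∑-cong n (λ c _ → ∑-swap m n _))))))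

∑-swap-pairs : ∀ n (F : ℕ → ℕ → ℕ → ℕ → ℕ) →
  ∑ n (λ b → ∑ n (λ d → ∑ n (λ c → ∑ n (λ a → F b d c a)))) ≡ ∑ n (λ c → ∑ n (λ a → ∑ n (λ b → ∑ n (λ d → F b d c a))))
∑-swap-pairs n F = begin
  ∑ n (λ b → ∑ n (λ d → ∑ n (λ c → ∑ n (λ a → F b d c a))))  ≡⟨ ∑-cong n (λ b _ → ∑-swap n n _) ⟩
  ∑ n (λ b → ∑ n (λ c → ∑ n (λ d → ∑ n (λ a → F b d c a))))  ≡⟨ ∑-swap n n _ ⟩
  ∑ n (λ c → ∑ n (λ b → ∑ n (λ d → ∑ n (λ a → F b d c a))))  ≡⟨ ∑-cong n (λ c _ → ∑-cong n (λ b _ → ∑-swap n n _)) ⟩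
  ∑ n (λ c → ∑ n (λ b → ∑ n (λ a → ∑ n (λ d → F b d c a))))  ≡⟨ ∑-cong n (λ c _ → ∑-swap n n _) ⟩
  ∑ n (λ c → ∑ n (λ a → ∑ n (λ b → ∑ n (λ d → F b d c a))))  ∎
  where open ≡-Reasoning

-- ∑⁴ n ranges over (y₂′, y₃′, y₃, y₂), and Δ compares the two values.
module BinaryDifference (ℓ₂ A₂ ℓ₃ A₃ : ℤ) where

  Δ : ℕ → ℕ → ℕ → ℕ → ℤ
  Δ b d c a = (quad ℓ₂ A₂ a ℤ.- quad ℓ₂ A₂ b) ℤ.+ (quad ℓ₃ A₃ c ℤ.- quad ℓ₃ A₃ d)

  Δ-diff : ∀ b d c a b′ d′ c′ a′ r → (Δ b′ d′ c′ a′ ℤ.- r) ≡ (Δ b d c a ℤ.- r) ℤ.+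
    (((quad ℓ₂ A₂ a′ ℤ.- quad ℓ₂ A₂ a) ℤ.- (quad ℓ₂ A₂ b′ ℤ.- quad ℓ₂ A₂ b)) ℤ.+ ((quad ℓ₃ A₃ c′ ℤ.- quad ℓ₃ A₃ c) ℤ.- (quad ℓ₃ A₃ d′ ℤ.- quad ℓ₃ A₃ d)))
  Δ-diff b d c a b′ d′ c′ a′ r = eqn (quad ℓ₂ A₂ a) (quad ℓ₂ A₂ b) (quad ℓ₃ A₃ c) (quad ℓ₃ A₃ d)
                                     (quad ℓ₂ A₂ a′) (quad ℓ₂ A₂ b′) (quad ℓ₃ A₃ c′) (quad ℓ₃ A₃ d′) r
    where
    eqn : ∀ a b c d a′ b′ c′ d′ r → ((a′ ℤ.- b′) ℤ.+ (c′ ℤ.- d′)) ℤ.- r ≡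
      (((a ℤ.- b) ℤ.+ (c ℤ.- d)) ℤ.- r) ℤ.+ (((a′ ℤ.- a) ℤ.- (b′ ℤ.- b)) ℤ.+ ((c′ ℤ.- c) ℤ.- (d′ ℤ.- d)))
    eqn = ℤR.solve-∀

  Δ-cong : ∀ {m} b d c a b′ d′ c′ a′ r → + m S.∣ (+ b′ ℤ.- + b) → + m S.∣ (+ d′ ℤ.- + d) → + m S.∣ (+ c′ ℤ.- + c) → + m S.∣ (+ a′ ℤ.- + a) →
    + m S.∣ (Δ b d c a ℤ.- r) → + m S.∣ (Δ b′ d′ c′ a′ ℤ.- r)
  Δ-cong b d c a b′ d′ c′ a′ r mb md mc ma p = S-subst (sym (Δ-diff b d c a b′ d′ c′ a′ r))
    (S.∣m∣n⇒∣m+n p (S.∣m∣n⇒∣m+n (S.∣m∣n⇒∣m-n (quad-cong ℓ₂ A₂ a a′ ma) (quad-cong ℓ₂ A₂ b b′ mb))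
                                 (S.∣m∣n⇒∣m-n (quad-cong ℓ₃ A₃ c c′ mc) (quad-cong ℓ₃ A₃ d d′ md))))

  hit : ℕ → ℤ → ℕ → ℕ → ℕ → ℕ → ℕ
  hit m r b d c a = ⟦ + m S.∣? (Δ b d c a ℤ.- r) ⟧

  hit-cong : ∀ m r b d c a b′ d′ c′ a′ → + m S.∣ (+ b′ ℤ.- + b) → + m S.∣ (+ d′ ℤ.- + d) → + m S.∣ (+ c′ ℤ.- + c) → + m S.∣ (+ a′ ℤ.- + a) →
    hit m r b′ d′ c′ a′ ≡ hit m r b d c a
  hit-cong m r b d c a b′ d′ c′ a′ mb md mc ma = ⟦⟧-cong (+ m S.∣? (Δ b′ d′ c′ a′ ℤ.- r)) (+ m S.∣? (Δ b d c a ℤ.- r))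
    (Δ-cong b′ d′ c′ a′ b d c a r (∣-flip (+ b′) (+ b) mb) (∣-flip (+ d′) (+ d) md) (∣-flip (+ c′) (+ c) mc) (∣-flip (+ a′) (+ a) ma))
    (Δ-cong b d c a b′ d′ c′ a′ r mb md mc ma)

  -- With the gaps `s` and `t` fixed the squares of `b` and `d` cancel and Δ becomes affine in them.
  -- This reduces the count of solutions to a linear congruence in two unknowns.
  Δ-shift : ∀ b d s t r → Δ b d (d + t) (b + s) ℤ.- r ≡
    ((+ 2 ℤ.* A₂) ℤ.* + s) ℤ.* + b ℤ.+ (((+ 2 ℤ.* A₃) ℤ.* + t) ℤ.* + d ℤ.+ (quad ℓ₂ A₂ s ℤ.+ quad ℓ₃ A₃ t ℤ.- r))
  Δ-shift b d s t r = trans (cong₂ (λ x y → ((ℓ₂ ℤ.+ A₂ ℤ.* x) ℤ.* x ℤ.- quad ℓ₂ A₂ b) ℤ.+ ((ℓ₃ ℤ.+ A₃ ℤ.* y) ℤ.* y ℤ.- quad ℓ₃ A₃ d) ℤ.- r) (ℤP.pos-+ b s) (ℤP.pos-+ d t))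
    (eqn ℓ₂ A₂ ℓ₃ A₃ (+ b) (+ s) (+ d) (+ t) r)
    where
    eqn : ∀ ℓ₂ A₂ ℓ₃ A₃ b s d t r → ((ℓ₂ ℤ.+ A₂ ℤ.* (b ℤ.+ s)) ℤ.* (b ℤ.+ s) ℤ.- (ℓ₂ ℤ.+ A₂ ℤ.* b) ℤ.* b) ℤ.+ ((ℓ₃ ℤ.+ A₃ ℤ.* (d ℤ.+ t)) ℤ.* (d ℤ.+ t) ℤ.- (ℓ₃ ℤ.+ A₃ ℤ.* d) ℤ.* d) ℤ.- r ≡
      ((+ 2 ℤ.* A₂) ℤ.* s) ℤ.* b ℤ.+ (((+ 2 ℤ.* A₃) ℤ.* t) ℤ.* d ℤ.+ ((ℓ₂ ℤ.+ A₂ ℤ.* s) ℤ.* s ℤ.+ (ℓ₃ ℤ.+ A₃ ℤ.* t) ℤ.* t ℤ.- r))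
    eqn = ℤR.solve-∀

  -- As `a` is prime to `2 A₂ A₃`, the gcd of `a` with the slopes `2 A₂ s` and `2 A₃ t` is the gcd
  -- of `a`, `s` and `t`, and `gcd-sum` adds these up.
  coprime-count : ∀ a r → 1 ≤ a → Coprime a 2 → Coprime a ℤ.∣ A₂ ∣ → Coprime a ℤ.∣ A₃ ∣ → ∑⁴ a (hit a r) ≤ a * divisorSum a
  coprime-count a r 1≤a co2 coA₂ coA₃ = begin
    ∑⁴ a (hit a r)
      ≡⟨ ∑-cong a (λ b _ → ∑-cong a (λ d _ → trans (sym (∑-periodic a (λ c → ∑ a (hit a r b d c)) (λ c → ∑-cong a (λ e _ → perc b d c e)) d))
           (∑-cong a (λ t _ → sym (∑-periodic a (hit a r b d (d + t)) (pera b d (d + t)) b))))) ⟩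
    ∑ a (λ b → ∑ a (λ d → ∑ a (λ t → ∑ a (λ s → hit a r b d (d + t) (b + s)))))
      ≡⟨ ∑-swap-pairs a (λ b d t s → hit a r b d (d + t) (b + s)) ⟩
    ∑ a (λ t → ∑ a (λ s → ∑ a (λ b → ∑ a (λ d → hit a r b d (d + t) (b + s)))))
      ≡⟨ ∑-cong a (λ t _ → ∑-cong a (λ s _ → ∑-swap a a _)) ⟩
    ∑ a (λ t → ∑ a (λ s → ∑ a (λ d → ∑ a (λ b → hit a r b d (d + t) (b + s)))))
      ≤⟨ ∑-mono a (λ t _ → ∑-mono a (λ s _ → line t s)) ⟩
    ∑ a (λ t → ∑ a (λ s → a * W t s))
      ≡⟨ trans (∑-cong a (λ t _ → ∑-*ˡ a a (W t))) (∑-*ˡ a a _) ⟩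
    a * ∑ a (λ t → ∑ a (W t))
      ≤⟨ *-monoʳ-≤ a (gcd-sum a) ⟩
    a * divisorSum a ∎
    where
    open ≤-Reasoning
    W : ℕ → ℕ → ℕ
    W t s = ∑ (suc a) (λ g → g * (⟦ g ∣? a ⟧ * (⟦ g ∣? t ⟧ * ⟦ g ∣? s ⟧)))
    add-self : ∀ x → + a S.∣ (+ (x + a) ℤ.- + x)
    add-self x = subst (λ n → + a S.∣ (+ n ℤ.- + x)) (trans (cong (_+ x) (*-identityˡ a)) (+-comm a x)) (∣-add-multiple 1 a x)
    perc : ∀ b d c e → hit a r b d (c + a) e ≡ hit a r b d c e
    perc b d c e = hit-cong a r b d c e b d (c + a) e (∣-refl-diff a b) (∣-refl-diff a d) (add-self c) (∣-refl-diff a e)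
    pera : ∀ b d c e → hit a r b d c (e + a) ≡ hit a r b d c e
    pera b d c e = hit-cong a r b d c e b d c (e + a) (∣-refl-diff a b) (∣-refl-diff a d) (∣-refl-diff a c) (add-self e)
    2A-coprime : ∀ A → Coprime a ℤ.∣ A ∣ → Coprime a ℤ.∣ + 2 ℤ.* A ∣
    2A-coprime A co = subst (Coprime a) (sym (ℤP.abs-* (+ 2) A)) (coprime-* co2 co)
    line : ∀ t s → ∑ a (λ d → ∑ a (λ b → hit a r b d (d + t) (b + s))) ≤ a * W t s
    line t s with linear₂-count a ((+ 2 ℤ.* A₂) ℤ.* + s) ((+ 2 ℤ.* A₃) ℤ.* + t) (quad ℓ₂ A₂ s ℤ.+ quad ℓ₃ A₃ t ℤ.- r) 1≤a
    ... | g , g∣a , g∣α , g∣β , bound = begin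
      ∑ a (λ d → ∑ a (λ b → hit a r b d (d + t) (b + s)))
        ≡⟨ ∑-cong a (λ d _ → ∑-cong a (λ b _ → cong (λ x → ⟦ + a S.∣? x ⟧) (Δ-shift b d s t r))) ⟩
      _ ≤⟨ bound ⟩
      a * g ≡⟨ cong (a *_) g-value ⟨
      a * (g * (⟦ g ∣? a ⟧ * (⟦ g ∣? t ⟧ * ⟦ g ∣? s ⟧)))
        ≤⟨ *-monoʳ-≤ a (∑-term (suc a) (λ g → g * (⟦ g ∣? a ⟧ * (⟦ g ∣? t ⟧ * ⟦ g ∣? s ⟧))) (s≤s (∣⇒≤ ⦃ >-nonZero 1≤a ⦄ g∣a))) ⟩
      a * W t s ∎
      where
      g∣s : g ∣ s
      g∣s = S.∣⇒∣ᵤ (∣-coprime (+ s) (+ 2 ℤ.* A₂) (coprime-∣ˡ g∣a (2A-coprime A₂ coA₂)) g∣α)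
      g∣t : g ∣ t
      g∣t = S.∣⇒∣ᵤ (∣-coprime (+ t) (+ 2 ℤ.* A₃) (coprime-∣ˡ g∣a (2A-coprime A₃ coA₃)) g∣β)
      g-value : g * (⟦ g ∣? a ⟧ * (⟦ g ∣? t ⟧ * ⟦ g ∣? s ⟧)) ≡ g
      g-value rewrite ⟦⟧-yes (g ∣? a) g∣a | ⟦⟧-yes (g ∣? t) g∣t | ⟦⟧-yes (g ∣? s) g∣s = *-identityʳ g

  -- At the primes of A₂ the polynomial y₂ ↦ quad ℓ₂ A₂ y₂ is injective, so these primes do not affect the count.
  modular-count : ∀ B a r → 1 ≤ a → Coprime a 2 → Coprime a ℤ.∣ A₂ ∣ → Coprime a ℤ.∣ A₃ ∣ → Coprime ℤ.∣ ℓ₂ ∣ ℤ.∣ A₂ ∣ →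
    (∀ x → Coprime x ℤ.∣ A₂ ∣ → Coprime x B) → ∑⁴ (B * a) (hit (B * a) r) ≤ B * B * B * (a * divisorSum a)
  modular-count B a r 1≤a co2 coA₂ coA₃ coℓ closed = begin
    ∑⁴ m (hit m r)
      ≤⟨ ∑-mono m (λ b _ → ∑-mono m (λ d _ → ∑-mono m (λ c _ → last b d c))) ⟩
    ∑ m (λ b → ∑ m (λ d → ∑ m (λ c → ∑ a (hit a r b d c))))
      ≡⟨ ∑-cong m (λ b _ → ∑-cong m (λ d _ → fold (λ c → ∑ a (hit a r b d c)) (λ i c → ∑-cong a (λ e _ →
           hit-cong a r b d c e b d (i * a + c) e (∣-refl-diff a b) (∣-refl-diff a d) (∣-add-multiple i a c) (∣-refl-diff a e))))) ⟩
    ∑ m (λ b → ∑ m (λ d → B * ∑ a (λ c → ∑ a (hit a r b d c))))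
      ≡⟨ ∑-cong m (λ b _ → trans (∑-*ˡ m B _) (cong (B *_) (fold (λ d → ∑ a (λ c → ∑ a (hit a r b d c))) (λ i d → ∑-cong a (λ c _ → ∑-cong a (λ e _ →
           hit-cong a r b d c e b (i * a + d) c e (∣-refl-diff a b) (∣-add-multiple i a d) (∣-refl-diff a c) (∣-refl-diff a e))))))) ⟩
    ∑ m (λ b → B * (B * ∑ a (λ d → ∑ a (λ c → ∑ a (hit a r b d c)))))
      ≡⟨ trans (∑-*ˡ m B _) (cong (B *_) (trans (∑-*ˡ m B _) (cong (B *_) (fold (λ b → ∑ a (λ d → ∑ a (λ c → ∑ a (hit a r b d c)))) (λ i b → ∑-cong a (λ d _ → ∑-cong a (λ c _ → ∑-cong a (λ e _ →
           hit-cong a r b d c e (i * a + b) d c e (∣-add-multiple i a b) (∣-refl-diff a d) (∣-refl-diff a c) (∣-refl-diff a e))))))))) ⟩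
    B * (B * (B * ∑⁴ a (hit a r)))
      ≤⟨ *-monoʳ-≤ B (*-monoʳ-≤ B (*-monoʳ-≤ B (coprime-count a r 1≤a co2 coA₂ coA₃))) ⟩
    B * (B * (B * (a * divisorSum a)))
      ≡⟨ arr B (a * divisorSum a) ⟩
    B * B * B * (a * divisorSum a) ∎
    where
    open ≤-Reasoning
    m = B * a
    arr : ∀ B x → B * (B * (B * x)) ≡ B * B * B * x
    arr = solve-∀
    fold : ∀ (G : ℕ → ℕ) → (∀ i c → G (i * a + c) ≡ G c) → ∑ m G ≡ B * ∑ a G
    fold G per = trans (∑-block B a G) (trans (∑-cong B (λ i _ → ∑-cong a (λ c _ → per i c))) (∑-const B (∑ a G)))
    -- The divided difference of `quad ℓ₂ A₂` is congruent to `ℓ₂` modulo `A₂`, hence a unit at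
    -- every prime of `B`.
    lead : ∀ x → Coprime ℤ.∣ ℓ₂ ℤ.+ A₂ ℤ.* x ∣ ℤ.∣ A₂ ∣
    lead x {e} (e∣sum , e∣A) = coℓ (S.∣⇒∣ᵤ {+ e} {ℓ₂} (S.∣m+n∣n⇒∣m {m = ℓ₂} {n = A₂ ℤ.* x} (S.∣ᵤ⇒∣ e∣sum) (S.∣m⇒∣m*n {m = A₂} x (S.∣ᵤ⇒∣ e∣A))) , e∣A)
    last : ∀ b d c → ∑ m (hit m r b d c) ≤ ∑ a (hit a r b d c)
    last b d c = begin
      ∑ m (hit m r b d c)                                         ≡⟨ ∑-block B a (hit m r b d c) ⟩
      ∑ B (λ j → ∑ a (λ i → hit m r b d c (j * a + i)))           ≡⟨ ∑-swap B a _ ⟩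
      ∑ a (λ i → ∑ B (λ j → hit m r b d c (j * a + i)))           ≤⟨ ∑-mono a (λ i _ → column i) ⟩
      ∑ a (hit a r b d c)                                         ∎
      where
      -- Above a residue `i` modulo `a` at most one of the `B` lifts `j * a + i` is a solution
      -- modulo `B * a`.
      column : ∀ i → ∑ B (λ j → hit m r b d c (j * a + i)) ≤ hit a r b d c i
      column i with + a S.∣? (Δ b d c i ℤ.- r)
      ... | no ∤  = ≤-reflexive (count-none (λ j → + m S.∣? (Δ b d c (j * a + i) ℤ.- r)) B (λ j _ p →
              ∤ (Δ-cong b d c (j * a + i) b d c i r (∣-refl-diff a b) (∣-refl-diff a d) (∣-refl-diff a c) (∣-flip (+ (j * a + i)) (+ i) (∣-add-multiple j a i))
                  (S.∣-trans {+ a} {+ m} (S.∣ᵤ⇒∣ (n∣m*n B)) p))))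
      ... | yes _ = count-unique (λ j → + m S.∣? (Δ b d c (j * a + i) ℤ.- r)) B (λ j k j<k k<B p q →
              ∣-gap j<k k<B (cancel j k (S-subst (difference j k) (S.∣m∣n⇒∣m-n (toB k q) (toB j p)))))
        where
        toB : ∀ j → + m S.∣ (Δ b d c (j * a + i) ℤ.- r) → + B S.∣ (Δ b d c (j * a + i) ℤ.- r)
        toB j p = S.∣-trans {+ B} {+ m} (S.∣ᵤ⇒∣ (m∣m*n a)) p
        slope : ℕ → ℕ → ℤ
        slope j k = ℓ₂ ℤ.+ A₂ ℤ.* (+ (k * a + i) ℤ.+ + (j * a + i))
        positions : ∀ j k → + (k * a + i) ℤ.- + (j * a + i) ≡ + a ℤ.* (+ k ℤ.- + j)
        positions j k = trans (cong₂ ℤ._-_ (step k) (step j)) (eqn (+ k) (+ j) (+ a) (+ i))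
          where
          step : ∀ k → + (k * a + i) ≡ + k ℤ.* + a ℤ.+ + i
          step k = trans (ℤP.pos-+ (k * a) i) (cong (ℤ._+ + i) (ℤP.pos-* k a))
          eqn : ∀ k j a i → (k ℤ.* a ℤ.+ i) ℤ.- (j ℤ.* a ℤ.+ i) ≡ a ℤ.* (k ℤ.- j)
          eqn = ℤR.solve-∀
        difference : ∀ j k → (Δ b d c (k * a + i) ℤ.- r) ℤ.- (Δ b d c (j * a + i) ℤ.- r) ≡ slope j k ℤ.* (+ a ℤ.* (+ k ℤ.- + j))
        difference j k = trans (eqn (quad ℓ₂ A₂ (k * a + i)) (quad ℓ₂ A₂ (j * a + i)) (quad ℓ₂ A₂ b) (quad ℓ₃ A₃ c ℤ.- quad ℓ₃ A₃ d) r)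
          (trans (quad-diff ℓ₂ A₂ (j * a + i) (k * a + i)) (cong (slope j k ℤ.*_) (positions j k)))
          where
          eqn : ∀ x y b c r → ((x ℤ.- b) ℤ.+ c ℤ.- r) ℤ.- ((y ℤ.- b) ℤ.+ c ℤ.- r) ≡ x ℤ.- y
          eqn = ℤR.solve-∀
        cancel : ∀ j k → + B S.∣ (slope j k ℤ.* (+ a ℤ.* (+ k ℤ.- + j))) → + B S.∣ (+ k ℤ.- + j)
        cancel j k p = ∣-coprime (+ k ℤ.- + j) (+ a) (Coprimality.sym (closed a coA₂))
          (∣-coprime (+ a ℤ.* (+ k ℤ.- + j)) (slope j k) (Coprimality.sym (closed ℤ.∣ slope j k ∣ (lead (+ (k * a + i) ℤ.+ + (j * a + i))))) p)

-- Pairs of points with equal values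

∑⁴-*ʳ : ∀ n k (F : ℕ → ℕ → ℕ → ℕ → ℕ) → ∑⁴ n (λ b d c a → F b d c a * k) ≡ ∑⁴ n F * k
∑⁴-*ʳ n k F = trans (∑⁴-cong n (λ b d c a _ _ _ _ → *-comm (F b d c a) k)) (trans (∑⁴-*ˡ n k F) (*-comm k (∑⁴ n F)))

∑⁴-block : ∀ c m (F : ℕ → ℕ → ℕ → ℕ → ℕ) → ∑⁴ (c * m) F ≡
  ∑⁴ c (λ i j k l → ∑⁴ m (λ β δ γ α → F (i * m + β) (j * m + δ) (k * m + γ) (l * m + α)))
∑⁴-block c m F = begin
  ∑ (c * m) (λ b → ∑ (c * m) (λ d → ∑ (c * m) (λ e → ∑ (c * m) (λ a → F b d e a))))
    ≡⟨ ∑-cong (c * m) (λ b _ → block³ (F b)) ⟩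
  ∑ (c * m) (λ b → ∑ c (λ j → ∑ c (λ k → ∑ c (λ l → inner b j k l))))
    ≡⟨ ∑-block c m _ ⟩
  ∑ c (λ i → ∑ m (λ β → ∑ c (λ j → ∑ c (λ k → ∑ c (λ l → inner (i * m + β) j k l)))))
    ≡⟨ ∑-cong c (λ i _ → trans (∑-swap m c _) (∑-cong c (λ j _ → trans (∑-swap m c _) (∑-cong c (λ k _ → ∑-swap m c _))))) ⟩
  ∑ c (λ i → ∑ c (λ j → ∑ c (λ k → ∑ c (λ l → ∑ m (λ β → inner (i * m + β) j k l))))) ∎
  where
  open ≡-Reasoning
  inner : ℕ → ℕ → ℕ → ℕ → ℕ
  inner b j k l = ∑ m (λ δ → ∑ m (λ γ → ∑ m (λ α → F b (j * m + δ) (k * m + γ) (l * m + α))))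
  block² : ∀ (G : ℕ → ℕ → ℕ) → ∑ (c * m) (λ e → ∑ (c * m) (G e)) ≡
    ∑ c (λ k → ∑ c (λ l → ∑ m (λ γ → ∑ m (λ α → G (k * m + γ) (l * m + α)))))
  block² G = trans (∑-cong (c * m) (λ e _ → ∑-block c m (G e))) (trans (∑-block c m _) (∑-cong c (λ k _ → ∑-swap m c _)))
  block³ : ∀ (G : ℕ → ℕ → ℕ → ℕ) → ∑ (c * m) (λ d → ∑ (c * m) (λ e → ∑ (c * m) (G d e))) ≡
    ∑ c (λ j → ∑ c (λ k → ∑ c (λ l → ∑ m (λ δ → ∑ m (λ γ → ∑ m (λ α → G (j * m + δ) (k * m + γ) (l * m + α)))))))
  block³ G = trans (∑-cong (c * m) (λ d _ → block² (G d))) (trans (∑-block c m _)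
    (∑-cong c (λ j _ → trans (∑-swap m c _) (∑-cong c (λ k _ → ∑-swap m c _)))))

quad-variation : ∀ ℓ A n m y y′ → y < n → y′ < n → ℤ.∣ + y′ ℤ.- + y ∣ ≤ m →
  ℤ.∣ quad ℓ A y′ ℤ.- quad ℓ A y ∣ ≤ 2 * n * (ℤ.∣ ℓ ∣ + ℤ.∣ A ∣) * m
quad-variation ℓ A n m y y′ y<n y′<n close = begin
  ℤ.∣ quad ℓ A y′ ℤ.- quad ℓ A y ∣                                 ≡⟨ cong ℤ.∣_∣ (quad-diff ℓ A y y′) ⟩
  ℤ.∣ (ℓ ℤ.+ A ℤ.* (+ y′ ℤ.+ + y)) ℤ.* (+ y′ ℤ.- + y) ∣            ≡⟨ ℤP.abs-* (ℓ ℤ.+ A ℤ.* (+ y′ ℤ.+ + y)) _ ⟩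
  ℤ.∣ ℓ ℤ.+ A ℤ.* (+ y′ ℤ.+ + y) ∣ * ℤ.∣ + y′ ℤ.- + y ∣            ≤⟨ *-mono-≤ slope close ⟩
  2 * n * (ℤ.∣ ℓ ∣ + ℤ.∣ A ∣) * m                                  ∎
  where
  open ≤-Reasoning
  arr : ∀ n l a → l + a * (n + n) + l * (2 * n) ≡ 2 * n * (l + a) + l
  arr = solve-∀
  l≤ : ℤ.∣ ℓ ∣ ≤ ℤ.∣ ℓ ∣ * (2 * n)
  l≤ = m≤m*n ℤ.∣ ℓ ∣ (2 * n) ⦃ >-nonZero (≤-trans (≤-trans (s≤s z≤n) y<n) (m≤m+n n (n + 0))) ⦄
  slope : ℤ.∣ ℓ ℤ.+ A ℤ.* (+ y′ ℤ.+ + y) ∣ ≤ 2 * n * (ℤ.∣ ℓ ∣ + ℤ.∣ A ∣)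
  slope = begin
    ℤ.∣ ℓ ℤ.+ A ℤ.* (+ y′ ℤ.+ + y) ∣             ≤⟨ ℤP.∣i+j∣≤∣i∣+∣j∣ ℓ (A ℤ.* (+ y′ ℤ.+ + y)) ⟩
    ℤ.∣ ℓ ∣ + ℤ.∣ A ℤ.* (+ y′ ℤ.+ + y) ∣         ≡⟨ cong (_+_ ℤ.∣ ℓ ∣) (ℤP.abs-* A (+ y′ ℤ.+ + y)) ⟩
    ℤ.∣ ℓ ∣ + ℤ.∣ A ∣ * (y′ + y)                 ≤⟨ +-monoʳ-≤ ℤ.∣ ℓ ∣ (*-monoʳ-≤ ℤ.∣ A ∣ (+-mono-≤ (<⇒≤ y′<n) (<⇒≤ y<n))) ⟩
    ℤ.∣ ℓ ∣ + ℤ.∣ A ∣ * (n + n)                  ≤⟨ ≤-from 0 l≤ (trans (+-identityʳ _) (arr n ℤ.∣ ℓ ∣ ℤ.∣ A ∣)) ⟩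
    2 * n * (ℤ.∣ ℓ ∣ + ℤ.∣ A ∣)                  ∎

quad-bound : ∀ ℓ A h y → y < h → ℤ.∣ quad ℓ A y ∣ ≤ (ℤ.∣ ℓ ∣ + ℤ.∣ A ∣) * (h * h)
quad-bound ℓ A h y y<h = begin
  ℤ.∣ (ℓ ℤ.+ A ℤ.* + y) ℤ.* + y ∣           ≡⟨ ℤP.abs-* (ℓ ℤ.+ A ℤ.* + y) (+ y) ⟩
  ℤ.∣ ℓ ℤ.+ A ℤ.* + y ∣ * y                 ≤⟨ *-mono-≤ (≤-trans (ℤP.∣i+j∣≤∣i∣+∣j∣ ℓ (A ℤ.* + y))
                                                 (≤-reflexive (cong (_+_ ℤ.∣ ℓ ∣) (ℤP.abs-* A (+ y))))) (<⇒≤ y<h) ⟩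
  (ℤ.∣ ℓ ∣ + ℤ.∣ A ∣ * y) * h               ≤⟨ *-monoˡ-≤ h (+-mono-≤ (m≤m*n ℤ.∣ ℓ ∣ h ⦃ h≢0 ⦄) (*-monoʳ-≤ ℤ.∣ A ∣ (<⇒≤ y<h))) ⟩
  (ℤ.∣ ℓ ∣ * h + ℤ.∣ A ∣ * h) * h           ≡⟨ arr ℤ.∣ ℓ ∣ ℤ.∣ A ∣ h ⟩
  (ℤ.∣ ℓ ∣ + ℤ.∣ A ∣) * (h * h)             ∎
  where
  open ≤-Reasoning
  h≢0 : NonZero h
  h≢0 = >-nonZero (≤-trans (s≤s z≤n) y<h)
  arr : ∀ l a h → (l * h + a * h) * h ≡ (l + a) * (h * h)
  arr = solve-∀

≤-+abs : ∀ x → x ℤ.≤ + ℤ.∣ x ∣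
≤-+abs (+ n)    = ℤP.≤-refl
≤-+abs -[1+ n ] = ℤ.-≤+

abs-≤⇒≤+ : ∀ x y {e} → ℤ.∣ x ℤ.- y ∣ ≤ e → x ℤ.≤ y ℤ.+ + e
abs-≤⇒≤+ x y {e} le = subst (ℤ._≤ y ℤ.+ + e) (eqn x y) (ℤP.+-monoʳ-≤ y (ℤP.≤-trans (≤-+abs (x ℤ.- y)) (ℤ.+≤+ le)))
  where
  eqn : ∀ x y → y ℤ.+ (x ℤ.- y) ≡ x
  eqn = ℤR.solve-∀

block-close : ∀ i m δ ε → δ < m → ε < m → ℤ.∣ + (i * m + ε) ℤ.- + (i * m + δ) ∣ ≤ m
block-close i m δ ε δ<m ε<m = begin
  ℤ.∣ + (i * m + ε) ℤ.- + (i * m + δ) ∣   ≡⟨ cong ℤ.∣_∣ (block-diff i m δ ε) ⟩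
  ℤ.∣ + ε ℤ.- + δ ∣                       ≡⟨ cong ℤ.∣_∣ (ℤP.[+m]-[+n]≡m⊖n ε δ) ⟩
  ℤ.∣ ε ℤ.⊖ δ ∣                           ≤⟨ ℤP.∣m⊝n∣≤m⊔n ε δ ⟩
  ε ⊔ δ                                   ≤⟨ ⊔-lub (<⇒≤ ε<m) (<⇒≤ δ<m) ⟩
  m                                       ∎
  where open ≤-Reasoning

block-range : ∀ {i c m δ} → i < c → δ < m → i * m + δ < c * m
block-range {i} {c} {m} {δ} i<c δ<m = begin-strict
  i * m + δ   <⟨ +-monoʳ-< (i * m) δ<m ⟩
  i * m + m   ≡⟨ +-comm (i * m) m ⟩
  suc i * m   ≤⟨ *-monoˡ-≤ m i<c ⟩
  c * m       ∎
  where open ≤-Reasoning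

module Cells (ℓ₂ A₂ ℓ₃ A₃ : ℤ) where

  open BinaryDifference ℓ₂ A₂ ℓ₃ A₃ public

  C : ℕ
  C = ℤ.∣ ℓ₂ ∣ + ℤ.∣ A₂ ∣ + (ℤ.∣ ℓ₃ ∣ + ℤ.∣ A₃ ∣)

  Δ-bound : ∀ h b d c a → b < h → d < h → c < h → a < h → ℤ.∣ Δ b d c a ∣ ≤ 2 * C * (h * h)
  Δ-bound h b d c a b< d< c< a< = begin
    ℤ.∣ Δ b d c a ∣ ≤⟨ ℤP.∣i+j∣≤∣i∣+∣j∣ (q₂ a ℤ.- q₂ b) (q₃ c ℤ.- q₃ d) ⟩
    ℤ.∣ q₂ a ℤ.- q₂ b ∣ + ℤ.∣ q₃ c ℤ.- q₃ d ∣
      ≤⟨ +-mono-≤ (ℤP.∣i-j∣≤∣i∣+∣j∣ (q₂ a) (q₂ b)) (ℤP.∣i-j∣≤∣i∣+∣j∣ (q₃ c) (q₃ d)) ⟩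
    ℤ.∣ q₂ a ∣ + ℤ.∣ q₂ b ∣ + (ℤ.∣ q₃ c ∣ + ℤ.∣ q₃ d ∣)
      ≤⟨ +-mono-≤ (+-mono-≤ (quad-bound ℓ₂ A₂ h a a<) (quad-bound ℓ₂ A₂ h b b<)) (+-mono-≤ (quad-bound ℓ₃ A₃ h c c<) (quad-bound ℓ₃ A₃ h d d<)) ⟩
    _ ≡⟨ arr (ℤ.∣ ℓ₂ ∣ + ℤ.∣ A₂ ∣) (ℤ.∣ ℓ₃ ∣ + ℤ.∣ A₃ ∣) (h * h) ⟩
    2 * C * (h * h) ∎
    where
    open ≤-Reasoning
    q₂ q₃ : ℕ → ℤ
    q₂ = quad ℓ₂ A₂
    q₃ = quad ℓ₃ A₃
    arr : ∀ x y k → x * k + x * k + (y * k + y * k) ≡ 2 * (x + y) * k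
    arr = solve-∀

  Δ-variation : ∀ n m b d c a b′ d′ c′ a′ → b < n → d < n → c < n → a < n → b′ < n → d′ < n → c′ < n → a′ < n →
    ℤ.∣ + b′ ℤ.- + b ∣ ≤ m → ℤ.∣ + d′ ℤ.- + d ∣ ≤ m → ℤ.∣ + c′ ℤ.- + c ∣ ≤ m → ℤ.∣ + a′ ℤ.- + a ∣ ≤ m →
    ℤ.∣ Δ b′ d′ c′ a′ ℤ.- Δ b d c a ∣ ≤ 4 * n * C * m
  Δ-variation n m b d c a b′ d′ c′ a′ b< d< c< a< b′< d′< c′< a′< mb md mc ma = begin
    ℤ.∣ Δ b′ d′ c′ a′ ℤ.- Δ b d c a ∣   ≡⟨ cong ℤ.∣_∣ (eqn (q₂ a′) (q₂ b′) (q₃ c′) (q₃ d′) (q₂ a) (q₂ b) (q₃ c) (q₃ d)) ⟩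
    ℤ.∣ (Δa ℤ.- Δb) ℤ.+ (Δc ℤ.- Δd) ∣   ≤⟨ ℤP.∣i+j∣≤∣i∣+∣j∣ (Δa ℤ.- Δb) (Δc ℤ.- Δd) ⟩
    ℤ.∣ Δa ℤ.- Δb ∣ + ℤ.∣ Δc ℤ.- Δd ∣   ≤⟨ +-mono-≤ (ℤP.∣i-j∣≤∣i∣+∣j∣ Δa Δb) (ℤP.∣i-j∣≤∣i∣+∣j∣ Δc Δd) ⟩
    ℤ.∣ Δa ∣ + ℤ.∣ Δb ∣ + (ℤ.∣ Δc ∣ + ℤ.∣ Δd ∣)
      ≤⟨ +-mono-≤ (+-mono-≤ (quad-variation ℓ₂ A₂ n m a a′ a< a′< ma) (quad-variation ℓ₂ A₂ n m b b′ b< b′< mb))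
                  (+-mono-≤ (quad-variation ℓ₃ A₃ n m c c′ c< c′< mc) (quad-variation ℓ₃ A₃ n m d d′ d< d′< md)) ⟩
    _ ≡⟨ arr n (ℤ.∣ ℓ₂ ∣ + ℤ.∣ A₂ ∣) (ℤ.∣ ℓ₃ ∣ + ℤ.∣ A₃ ∣) m ⟩
    4 * n * C * m ∎
    where
    open ≤-Reasoning
    q₂ q₃ : ℕ → ℤ
    q₂ = quad ℓ₂ A₂
    q₃ = quad ℓ₃ A₃
    Δa Δb Δc Δd : ℤ
    Δa = q₂ a′ ℤ.- q₂ a
    Δb = q₂ b′ ℤ.- q₂ b
    Δc = q₃ c′ ℤ.- q₃ c
    Δd = q₃ d′ ℤ.- q₃ d
    eqn : ∀ a′ b′ c′ d′ a b c d → ((a′ ℤ.- b′) ℤ.+ (c′ ℤ.- d′)) ℤ.- ((a ℤ.- b) ℤ.+ (c ℤ.- d)) ≡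
      ((a′ ℤ.- a) ℤ.- (b′ ℤ.- b)) ℤ.+ ((c′ ℤ.- c) ℤ.- (d′ ℤ.- d))
    eqn = ℤR.solve-∀
    arr : ∀ n x y m → 2 * n * x * m + 2 * n * x * m + (2 * n * y * m + 2 * n * y * m) ≡ 4 * n * (x + y) * m
    arr = solve-∀

  Between : ℤ → ℤ → ℕ → ℕ → ℕ → ℕ → Set
  Between lo hi b d c a = lo ℤ.≤ Δ b d c a × Δ b d c a ℤ.≤ hi

  between? : ∀ lo hi b d c a → Dec (Between lo hi b d c a)
  between? lo hi b d c a = (lo ℤ.≤? Δ b d c a) ×-dec (Δ b d c a ℤ.≤? hi)

  -- In a cell of side `m` a hit depends only on the residues, and Δ varies by at most `e`. So a
  -- cell with one point in `[lo , hi]` lies wholly in the widened interval: it holds at most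
  -- `∑⁴ m (hit m r)` hits, against `m⁴` points counted on the right.
  cell-bound : ∀ c m r lo hi h e → h ≤ c * m → 4 * (c * m) * C * m ≤ e →
    m * m * m * m * ∑⁴ h (λ b d c a → hit m r b d c a * ⟦ between? lo hi b d c a ⟧)
      ≤ ∑⁴ m (hit m r) * ∑⁴ (c * m) (λ b d c a → ⟦ between? (lo ℤ.- + e) (hi ℤ.+ + e) b d c a ⟧)
  cell-bound c m r lo hi h e h≤cm var≤e = begin
    m⁴ * ∑⁴ h weight                       ≤⟨ *-monoʳ-≤ m⁴ (∑⁴-range-mono weight h≤cm) ⟩
    m⁴ * ∑⁴ (c * m) weight                 ≡⟨ cong (m⁴ *_) (∑⁴-block c m weight) ⟩
    m⁴ * ∑⁴ c (λ i j k l → ∑⁴ m (λ β δ γ α → weight (i * m + β) (j * m + δ) (k * m + γ) (l * m + α)))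
      ≡⟨ ∑⁴-*ˡ c m⁴ _ ⟨
    ∑⁴ c (λ i j k l → m⁴ * ∑⁴ m (λ β δ γ α → weight (i * m + β) (j * m + δ) (k * m + γ) (l * m + α)))
      ≤⟨ ∑⁴-mono c (λ i j k l i< j< k< l< → cell i j k l i< j< k< l<) ⟩
    ∑⁴ c (λ i j k l → N * Y i j k l)       ≡⟨ ∑⁴-*ˡ c N Y ⟩
    N * ∑⁴ c Y                             ≡⟨ cong (N *_) (∑⁴-block c m wide) ⟨
    N * ∑⁴ (c * m) wide                    ∎
    where
    open ≤-Reasoning
    m⁴ = m * m * m * m
    N = ∑⁴ m (hit m r)
    weight wide Y : ℕ → ℕ → ℕ → ℕ → ℕ
    weight b d c a = hit m r b d c a * ⟦ between? lo hi b d c a ⟧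
    wide b d c a = ⟦ between? (lo ℤ.- + e) (hi ℤ.+ + e) b d c a ⟧
    Y i j k l = ∑⁴ m (λ β δ γ α → wide (i * m + β) (j * m + δ) (k * m + γ) (l * m + α))
    sub-e : ∀ x y → x ℤ.≤ y ℤ.+ + e → x ℤ.- + e ℤ.≤ y
    sub-e x y le = subst (x ℤ.- + e ℤ.≤_) (eqn y (+ e)) (ℤP.+-monoˡ-≤ (ℤ.- + e) le)
      where
      eqn : ∀ y e → (y ℤ.+ e) ℤ.- e ≡ y
      eqn = ℤR.solve-∀
    cell : ∀ i j k l → i < c → j < c → k < c → l < c →
      m⁴ * ∑⁴ m (λ β δ γ α → weight (i * m + β) (j * m + δ) (k * m + γ) (l * m + α)) ≤ N * Y i j k l
    cell i j k l i< j< k< l< = begin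
      m⁴ * ∑⁴ m (λ β δ γ α → weight (i * m + β) (j * m + δ) (k * m + γ) (l * m + α))   ≡⟨ ∑⁴-*ˡ m m⁴ _ ⟨
      ∑⁴ m (λ β δ γ α → m⁴ * weight (i * m + β) (j * m + δ) (k * m + γ) (l * m + α))   ≤⟨ ∑⁴-mono m point ⟩
      ∑⁴ m (λ β δ γ α → hit m r β δ γ α * Y i j k l)                                   ≡⟨ ∑⁴-*ʳ m (Y i j k l) (hit m r) ⟩
      N * Y i j k l                                                                    ∎
      where
      full : ∀ β δ γ α → β < m → δ < m → γ < m → α < m → Between lo hi (i * m + β) (j * m + δ) (k * m + γ) (l * m + α) → m⁴ ≤ Y i j k l
      full β δ γ α β< δ< γ< α< (lo≤ , ≤hi) = begin
        m⁴                                ≡⟨ trans (∑⁴-const m 1) (*-identityʳ m⁴) ⟨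
        ∑⁴ m (λ _ _ _ _ → 1)              ≤⟨ ∑⁴-mono m (λ β′ δ′ γ′ α′ β′< δ′< γ′< α′< → ≤-reflexive (sym (⟦⟧-yes (between? _ _ _ _ _ _) (
            let v = Δ-variation (c * m) m (i * m + β) (j * m + δ) (k * m + γ) (l * m + α) (i * m + β′) (j * m + δ′) (k * m + γ′) (l * m + α′)
                      (block-range i< β<) (block-range j< δ<) (block-range k< γ<) (block-range l< α<)
                      (block-range i< β′<) (block-range j< δ′<) (block-range k< γ′<) (block-range l< α′<)
                      (block-close i m β β′ β< β′<) (block-close j m δ δ′ δ< δ′<) (block-close k m γ γ′ γ< γ′<) (block-close l m α α′ α< α′<)
                v′ = ≤-trans v var≤e
                P = Δ (i * m + β) (j * m + δ) (k * m + γ) (l * m + α)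
                P′ = Δ (i * m + β′) (j * m + δ′) (k * m + γ′) (l * m + α′)
            in sub-e lo P′ (ℤP.≤-trans lo≤ (abs-≤⇒≤+ P P′ (subst (_≤ e) (ℤP.∣i-j∣≡∣j-i∣ P′ P) v′)))
             , ℤP.≤-trans (abs-≤⇒≤+ P′ P v′) (ℤP.+-monoˡ-≤ (+ e) ≤hi))))) ⟩
        Y i j k l                         ∎
      point : ∀ β δ γ α → β < m → δ < m → γ < m → α < m →
        m⁴ * weight (i * m + β) (j * m + δ) (k * m + γ) (l * m + α) ≤ hit m r β δ γ α * Y i j k l
      point β δ γ α β< δ< γ< α< = begin
        m⁴ * (hit m r b d c′ a * R)    ≡⟨ arr m⁴ (hit m r b d c′ a) R ⟩
        hit m r b d c′ a * (R * m⁴)    ≡⟨ cong (_* (R * m⁴)) (hit-cong m r β δ γ α b d c′ a (∣-add-multiple i m β) (∣-add-multiple j m δ) (∣-add-multiple k m γ) (∣-add-multiple l m α)) ⟩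
        hit m r β δ γ α * (R * m⁴)     ≤⟨ *-monoʳ-≤ (hit m r β δ γ α) (⟦⟧-if (between? lo hi b d c′ a) (full β δ γ α β< δ< γ< α<)) ⟩
        hit m r β δ γ α * Y i j k l    ∎
        where
        b = i * m + β
        d = j * m + δ
        c′ = k * m + γ
        a = l * m + α
        R = ⟦ between? lo hi b d c′ a ⟧
        arr : ∀ x y z → x * (y * z) ≡ y * (z * x)
        arr = solve-∀

-- Reciprocals with common denominator X !

module _ {P : ℕ → Set} (P? : ∀ i → Dec (P i)) where

  count-span : ∀ n → count P? n ≡ 0 ⊎
    (∃ λ i → ∃ λ j → i ≤ j × j < n × P i × P j × count P? n ≤ suc (j ∸ i))
  count-span zero    = inj₁ refl
  count-span (suc n) with P? n | count-span n
  ... | no  _ | inj₁ eq = inj₁ (trans (+-identityʳ _) eq)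
  ... | no  _ | inj₂ (i , j , i≤j , j<n , pi , pj , le) = inj₂ (i , j , i≤j , m<n⇒m<1+n j<n , pi , pj , ≤-trans (≤-reflexive (+-identityʳ _)) le)
  ... | yes p | inj₁ eq = inj₂ (n , n , ≤-refl , ≤-refl , p , p , ≤-trans (≤-reflexive (cong (_+ 1) eq)) (s≤s z≤n))
  ... | yes p | inj₂ (i , j , i≤j , j<n , pi , pj , le) = inj₂ (i , n , <⇒≤ (≤-trans (s≤s i≤j) j<n) , ≤-refl , pi , p , (begin
      count P? n + 1        ≤⟨ +-monoˡ-≤ 1 le ⟩
      suc (j ∸ i) + 1       ≡⟨ +-comm (suc (j ∸ i)) 1 ⟩
      suc (suc (j ∸ i))     ≡⟨ cong suc (+-∸-assoc 1 i≤j) ⟨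
      suc (suc j ∸ i)       ≤⟨ s≤s (∸-monoˡ-≤ i j<n) ⟩
      suc (n ∸ i)           ∎))
    where open ≤-Reasoning

∣-factorial : ∀ x X → 1 ≤ x → x ≤ X → x ∣ X !
∣-factorial (suc x) X _ x≤X = ∣-trans (m∣m*n (x !)) (m≤n⇒m!∣n! x≤X)

module Reciprocals (X : ℕ) where

  F : ℕ
  F = X !

  F≥1 : 1 ≤ F
  F≥1 = positive X
    where
    positive : ∀ n → 1 ≤ n !
    positive zero    = ≤-refl
    positive (suc n) = *-mono-≤ (s≤s (z≤n {n})) (positive n)

  -- Stands for `F / x`. At `x = 0` it is 0, which removes the terms with a zero factor from all
  -- sums below.
  inv : ℕ → ℕ
  inv x = codivisor F x

  *-inv : ∀ x → 1 ≤ x → x ≤ X → x * inv x ≡ F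
  *-inv x 1≤x x≤X = trans (*-comm x (inv x)) (codivisor-* F x (∣-factorial x X 1≤x x≤X))

  inv-0 : inv 0 ≡ 0
  inv-0 with 0 ∣? F
  ... | yes 0∣F = ⊥-elim (<-irrefl refl (≤-trans F≥1 (≤-reflexive (0∣⇒≡0 0∣F))))
  ... | no  _   = refl

  inv≤F : ∀ x → x ≤ X → inv x ≤ F
  inv≤F zero    _   = ≤-trans (≤-reflexive inv-0) z≤n
  inv≤F (suc x) x≤X = ≤-trans (m≤m+n (inv (suc x)) (x * inv (suc x))) (≤-reflexive (*-inv (suc x) (s≤s z≤n) x≤X))

  module Harmonic (α γ x : ℕ) (1≤α : 1 ≤ α) where

    β : ℕ
    β = α + γ

    In : ℕ → Set
    In k = k * α ≤ x × x ≤ k * β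

    in? : ∀ k → Dec (In k)
    in? k = (k * α ≤? x) ×-dec (x ≤? k * β)

    -- With the denominator `F` cleared, the sum of `1 / k` over the integers `k ≤ X` between
    -- `x / β` and `x / α`.
    harmonic : ℕ
    harmonic = ∑ (suc X) (λ k → inv k * ⟦ in? k ⟧)

    n : ℕ
    n = count in? (suc X)

    -- The interval from `x / β` to `x / α` has length `γ x / (α β)`, and the number of integers in
    -- it exceeds the length by at most 1.
    number : α * β * n ≤ γ * x + α * β
    number with count-span in? (suc X)
    ... | inj₁ n≡0 = ≤-trans (≤-reflexive (trans (cong (α * β *_) n≡0) (*-zeroʳ (α * β)))) z≤n
    ... | inj₂ (i , j , i≤j , _ , (_ , x≤iβ) , (jα≤x , _) , n≤) = begin
      α * β * n                ≤⟨ *-monoʳ-≤ (α * β) n≤ ⟩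
      α * β * suc (j ∸ i)      ≤⟨ ≤-from 0 (+-mono-≤ (*-monoʳ-≤ β jα≤x) (*-monoʳ-≤ α x≤iβ)) (trans (+-identityʳ _) eqn) ⟩
      γ * x + α * β            ∎
      where
      open ≤-Reasoning
      eqn : α * β * suc (j ∸ i) + (β * x + α * (i * β)) ≡ γ * x + α * β + (β * (j * α) + α * x)
      eqn = trans (poly α γ x i (j ∸ i)) (cong (λ t → γ * x + α * β + (β * (t * α) + α * x)) (m+[n∸m]≡n i≤j))
        where
        poly : ∀ α γ x i t → α * (α + γ) * suc t + ((α + γ) * x + α * (i * (α + γ))) ≡ γ * x + α * (α + γ) + ((α + γ) * ((i + t) * α) + α * x)
        poly = solve-∀

    x*harmonic : x * harmonic ≤ β * F * n
    x*harmonic = begin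
      x * harmonic                                       ≡⟨ ∑-*ˡ (suc X) x _ ⟨
      ∑ (suc X) (λ k → x * (inv k * ⟦ in? k ⟧))          ≤⟨ ∑-mono (suc X) (λ k k≤X → term k (≤-pred k≤X)) ⟩
      ∑ (suc X) (λ k → β * F * ⟦ in? k ⟧)                ≡⟨ ∑-*ˡ (suc X) (β * F) _ ⟩
      β * F * n                                          ∎
      where
      open ≤-Reasoning
      arr : ∀ x y z → x * (y * z) ≡ z * (x * y)
      arr = solve-∀
      arr′ : ∀ k β i → k * β * i ≡ β * (k * i)
      arr′ = solve-∀
      xinv : ∀ k → k ≤ X → x ≤ k * β → x * inv k ≤ β * F
      xinv zero    _   _  = ≤-trans (≤-reflexive (trans (cong (x *_) inv-0) (*-zeroʳ x))) z≤n
      xinv (suc k) k≤X le = ≤-trans (*-monoˡ-≤ (inv (suc k)) le) (≤-reflexive (trans (arr′ (suc k) β (inv (suc k))) (cong (β *_) (*-inv (suc k) (s≤s z≤n) k≤X))))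
      term : ∀ k → k ≤ X → x * (inv k * ⟦ in? k ⟧) ≤ β * F * ⟦ in? k ⟧
      term k k≤X with in? k
      ... | yes (_ , le) = subst (_≤ β * F * 1) (*-assoc x (inv k) 1) (*-monoˡ-≤ 1 (xinv k k≤X le))
      ... | no _ = ≤-reflexive (trans (cong (x *_) (*-zeroʳ (inv k))) (trans (*-zeroʳ x) (sym (*-zeroʳ (β * F)))))

    -- Each `1 / k` is at most `β / x`; multiplied with `number` this bounds the sum by
    -- `γ / α + β / x`.
    harmonic-bound : α * x * harmonic ≤ F * (γ * x + α * β)
    harmonic-bound = begin
      α * x * harmonic       ≡⟨ *-assoc α x harmonic ⟩
      α * (x * harmonic)     ≤⟨ *-monoʳ-≤ α x*harmonic ⟩
      α * (β * F * n)        ≡⟨ arr α β F n ⟩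
      F * (α * β * n)        ≤⟨ *-monoʳ-≤ F number ⟩
      F * (γ * x + α * β)    ∎
      where
      open ≤-Reasoning
      arr : ∀ α β F n → α * (β * F * n) ≡ F * (α * β * n)
      arr = solve-∀

    harmonic≤F*n : harmonic ≤ F * n
    harmonic≤F*n = ≤-trans (∑-mono (suc X) (λ k k≤X → *-monoˡ-≤ ⟦ in? k ⟧ (inv≤F k (≤-pred k≤X)))) (≤-reflexive (∑-*ˡ (suc X) F _))

    -- For `x < β` at most one `k` qualifies, and `1 / k ≤ 1`. For `x ≥ β` both terms of
    -- `harmonic-bound` are at most 1.
    harmonic≤2F : γ ≤ α → harmonic ≤ 2 * F
    harmonic≤2F γ≤α with x <? β
    ... | yes x<β = ≤-trans harmonic≤F*n (≤-trans (*-monoʳ-≤ F {n} {2} (<⇒≤ n<2)) (≤-reflexive (*-comm F 2)))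
      where
      open ≤-Reasoning
      βn : β * n ≤ x + β
      βn = *-cancelˡ-≤ α ⦃ >-nonZero 1≤α ⦄ (begin
        α * (β * n)     ≡⟨ *-assoc α β n ⟨
        α * β * n       ≤⟨ number ⟩
        γ * x + α * β   ≤⟨ +-monoˡ-≤ (α * β) (*-monoˡ-≤ x γ≤α) ⟩
        α * x + α * β   ≡⟨ *-distribˡ-+ α x β ⟨
        α * (x + β)     ∎)
      n<2 : n < 2
      n<2 = *-cancelˡ-< β n 2 (begin-strict
        β * n     ≤⟨ βn ⟩
        x + β     <⟨ +-monoˡ-< β x<β ⟩
        β + β     ≡⟨ arr β ⟩
        β * 2     ∎)
        where
        arr : ∀ b → b + b ≡ b * 2
        arr = solve-∀
    ... | no x≮β = *-cancelˡ-≤ (α * x) ⦃ >-nonZero (*-mono-≤ 1≤α (≤-trans (≤-trans 1≤α (m≤m+n α γ)) β≤x)) ⦄ (begin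
        α * x * harmonic        ≤⟨ harmonic-bound ⟩
        F * (γ * x + α * β)     ≤⟨ *-monoʳ-≤ F (+-mono-≤ (*-monoˡ-≤ x γ≤α) (*-monoʳ-≤ α β≤x)) ⟩
        F * (α * x + α * x)     ≡⟨ arr F (α * x) ⟩
        α * x * (2 * F)         ∎)
      where
      open ≤-Reasoning
      β≤x = ≮⇒≥ x≮β
      arr : ∀ f y → f * (y + y) ≡ y * (2 * f)
      arr = solve-∀

  tail : ℕ → ℕ → ℕ
  tail w N = ∑ (suc N) (λ g → ⟦ w <? g ⟧ * (inv g * inv g))

  tail-bound : ∀ w N → N ≤ X → w * tail w N ≤ F * F
  tail-bound w N N≤X with N ≤? w
  ... | yes N≤w = ≤-trans (≤-reflexive (trans (cong (w *_) (∑-zero (suc N) (λ g g≤N →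
          cong (_* (inv g * inv g)) (⟦⟧-no (w <? g) (λ w<g → <-irrefl refl (≤-trans w<g (≤-trans (≤-pred g≤N) N≤w))))))) (*-zeroʳ w))) z≤n
  ... | no N≰w = ≤-trans (m≤m+n _ _) (telescope N N≤X (<⇒≤ (≰⇒> N≰w)))
    where
    open ≤-Reasoning
    -- 1/w² + … is compared with 1/w − 1/N.
    step : ∀ n → suc (suc n) ≤ X → inv (suc (suc n)) * inv (suc (suc n)) + F * inv (suc (suc n)) ≤ F * inv (suc n)
    step n le = *-cancelˡ-≤ (suc (suc n) * suc (suc n) * suc n) (begin
      suc (suc n) * suc (suc n) * suc n * (i * i + F * i)
        ≡⟨ arr (suc n) i F ⟩
      suc n * ((suc (suc n) * i) * (suc (suc n) * i)) + suc (suc n) * suc n * F * (suc (suc n) * i)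
        ≡⟨ cong₂ (λ s t → suc n * (s * s) + suc (suc n) * suc n * F * t) eq eq ⟩
      suc n * (F * F) + suc (suc n) * suc n * F * F
        ≤⟨ ≤-from 0 (m≤m+n 0 (F * F)) (trans (+-identityʳ _) (arr′ n F)) ⟩
      suc (suc n) * suc (suc n) * F * F
        ≡⟨ cong (suc (suc n) * suc (suc n) * F *_) (*-inv (suc n) (s≤s z≤n) (<⇒≤ le)) ⟨
      suc (suc n) * suc (suc n) * F * (suc n * inv (suc n))
        ≡⟨ arr″ (suc (suc n) * suc (suc n)) F (suc n) (inv (suc n)) ⟩
      suc (suc n) * suc (suc n) * suc n * (F * inv (suc n)) ∎)
      where
      i = inv (suc (suc n))
      eq = *-inv (suc (suc n)) (s≤s z≤n) le
      arr : ∀ m i F → suc m * suc m * m * (i * i + F * i) ≡ m * ((suc m * i) * (suc m * i)) + suc m * m * F * (suc m * i)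
      arr = solve-∀
      arr′ : ∀ n F → suc n * (F * F) + suc (suc n) * suc n * F * F + (F * F) ≡ suc (suc n) * suc (suc n) * F * F + 0
      arr′ = solve-∀
      arr″ : ∀ s F m j → s * F * (m * j) ≡ s * m * (F * j)
      arr″ = solve-∀
    telescope : ∀ N → N ≤ X → w ≤ N → w * tail w N + w * (F * inv N) ≤ F * F
    telescope N N≤X w≤N with m≤n⇒m<n∨m≡n w≤N
    telescope N N≤X w≤N | inj₂ refl = begin
      w * tail w w + w * (F * inv w)
        ≡⟨ cong (_+ w * (F * inv w)) (trans (cong (w *_) (∑-zero (suc w) (λ g g≤w → cong (_* (inv g * inv g)) (⟦⟧-no (w <? g) (λ w<g → <-irrefl refl (≤-trans w<g (≤-pred g≤w))))))) (*-zeroʳ w)) ⟩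
      w * (F * inv w)   ≡⟨ arr w F (inv w) ⟩
      F * (w * inv w)   ≤⟨ *-monoʳ-≤ F (w*inv w N≤X) ⟩
      F * F             ∎
      where
      arr : ∀ w F i → w * (F * i) ≡ F * (w * i)
      arr = solve-∀
      w*inv : ∀ w → w ≤ X → w * inv w ≤ F
      w*inv zero    _  = z≤n
      w*inv (suc w) le = ≤-reflexive (*-inv (suc w) (s≤s z≤n) le)
    telescope (suc zero) N≤X w≤N | inj₁ (s≤s z≤n) = z≤n
    telescope (suc (suc n)) N≤X w≤N | inj₁ (s≤s w≤n) = begin
      w * (tail w (suc n) + ⟦ w <? suc (suc n) ⟧ * (i * i)) + w * (F * i)   ≤⟨ +-monoˡ-≤ (w * (F * i)) (*-monoʳ-≤ w (+-monoʳ-≤ (tail w (suc n)) (⟦⟧-if (w <? suc (suc n)) (λ _ → ≤-refl)))) ⟩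
      w * (tail w (suc n) + i * i) + w * (F * i)                            ≡⟨ arr w (tail w (suc n)) (i * i) (F * i) ⟩
      w * tail w (suc n) + w * (i * i + F * i)                              ≤⟨ +-monoʳ-≤ (w * tail w (suc n)) (*-monoʳ-≤ w (step n N≤X)) ⟩
      w * tail w (suc n) + w * (F * inv (suc n))                            ≤⟨ telescope (suc n) (<⇒≤ N≤X) w≤n ⟩
      F * F                                                                 ∎
      where
      i = inv (suc (suc n))
      arr : ∀ w t x y → w * (t + x) + w * y ≡ w * t + w * (x + y)
      arr = solve-∀

-- Collisions at a given gap `u` in `z`

count-≤ : ∀ {P : ℕ → Set} {Q : Set} (P? : ∀ i → Dec (P i)) (Q? : Dec Q) n → (∀ i → i < n → P i → Q) →
  (∀ i j → i < j → j < n → P i → P j → ⊥) → count P? n ≤ ⟦ Q? ⟧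
count-≤ P? (yes _) n _   uniq = count-unique P? n uniq
count-≤ P? (no ¬q) n imp _    = ≤-reflexive (count-none P? n (λ i i<n p → ¬q (imp i i<n p)))

⟦⟧-*-dec : ∀ {P Q : Set} (P? : Dec P) (Q? : Dec Q) → ⟦ P? ×-dec Q? ⟧ ≡ ⟦ P? ⟧ * ⟦ Q? ⟧
⟦⟧-*-dec (yes _) (yes _) = refl
⟦⟧-*-dec (yes _) (no  _) = refl
⟦⟧-*-dec (no  _) (yes _) = refl
⟦⟧-*-dec (no  _) (no  _) = refl

-- All that is kept of `g` having no prime factor up to `w`.
Rough : ℕ → ℕ → Set
Rough w g = g ≡ 1 ⊎ w < g

rough? : ∀ w g → Dec (Rough w g)
rough? w g = (g ≟ 1) ⊎-dec (w <? g)

-- The hypothesis `rough` says that `A₂` contains all primes of `2 A₁ A₃` and all primes up to `w`,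
-- in the form in which it is applied to the part of a modulus that is prime to `A₂`.
module Pairs (ℓ₁ A₁ : ℕ) (ℓ₂ A₂ ℓ₃ A₃ : ℤ) (w : ℕ) (1≤A₁ : 1 ≤ A₁) (coℓ : Coprime ℤ.∣ ℓ₂ ∣ ℤ.∣ A₂ ∣)
  (rough : ∀ g → Coprime g ℤ.∣ A₂ ∣ → Coprime g 2 × Coprime g A₁ × Coprime g ℤ.∣ A₃ ∣ × Rough w g) where

  open Cells ℓ₂ A₂ ℓ₃ A₃ public

  module Weights (X : ℕ) where

    open Reciprocals X public

    -- With `u = g * k` this is `F³ / (g u)`: the factor `1 / u` is the expected density of a
    -- congruence modulo `u`, and `1 / g` measures the excess caused by a common divisor `g`.
    weight : ℕ → ℕ → ℕ
    weight g k = ⟦ rough? w g ⟧ * (inv g * inv g * inv k)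

    factorisations : ℕ → ℕ
    factorisations u = ∑ (suc X) (λ g → ∑ (suc X) (λ k → ⟦ g * k ≟ u ⟧ * weight g k))

    -- The part `a` of the modulus prime to `A₂` is prime to `2 A₁`, so it divides `u`; the divisors
    -- `g` in `divisorSum a` are therefore rough divisors of `u`. The primes in `B` cause no excess
    -- over the expected density.
    modulus-count : ∀ u r → 1 ≤ u → u ≤ X → let m = 2 * A₁ * u in
      2 * A₁ * (F * F * F) * ∑⁴ m (hit m r) ≤ m * m * m * m * factorisations u
    modulus-count u r 1≤u u≤X with coprime-part ℤ.∣ A₂ ∣ (2 * A₁ * u) (*-mono-≤ (*-mono-≤ (s≤s (z≤n {1})) 1≤A₁) 1≤u)
    ... | B , a , m≡Ba , coA₂ , closed with rough a coA₂
    ...   | co2 , coA₁ , coA₃ , _ = begin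
      2 * A₁ * (F * F * F) * ∑⁴ m (hit m r)
        ≤⟨ *-monoʳ-≤ (2 * A₁ * (F * F * F)) (subst (λ m → ∑⁴ m (hit m r) ≤ B * B * B * (a * divisorSum a)) (sym m≡Ba) (modular-count B a r a≥1 co2 coA₂ coA₃ coℓ closed)) ⟩
      2 * A₁ * (F * F * F) * (B * B * B * (a * divisorSum a))
        ≡⟨ trans (sym (*-assoc (2 * A₁ * (F * F * F)) (B * B * B) (a * divisorSum a))) (trans (sym (*-assoc (2 * A₁ * (F * F * F) * (B * B * B)) a (divisorSum a)))
             (sym (∑-*ˡ (suc a) (2 * A₁ * (F * F * F) * (B * B * B) * a) (λ g → g * (codivisor a g * codivisor a g))))) ⟩
      ∑ (suc a) (λ g → 2 * A₁ * (F * F * F) * (B * B * B) * a * (g * (codivisor a g * codivisor a g)))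
        ≤⟨ ∑-mono (suc a) (λ g _ → term g) ⟩
      ∑ (suc a) (λ g → m * m * m * m * row g)
        ≡⟨ ∑-*ˡ (suc a) (m * m * m * m) row ⟩
      m * m * m * m * ∑ (suc a) row
        ≤⟨ *-monoʳ-≤ (m * m * m * m) (∑-range-mono row (s≤s a≤X)) ⟩
      m * m * m * m * factorisations u ∎
      where
      open ≤-Reasoning
      m = 2 * A₁ * u
      row : ℕ → ℕ
      row g = ∑ (suc X) (λ k → ⟦ g * k ≟ u ⟧ * weight g k)
      m≥1 : 1 ≤ m
      m≥1 = *-mono-≤ (*-mono-≤ (s≤s (z≤n {1})) 1≤A₁) 1≤u
      a≥1 : 1 ≤ a
      a≥1 = n≢0⇒n>0 (λ { refl → <-irrefl refl (≤-trans m≥1 (≤-reflexive (trans m≡Ba (*-zeroʳ B)))) })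
      a∣u : a ∣ u
      a∣u = coprime-divisor (coprime-* co2 coA₁) (divides B m≡Ba)
      a≤u : a ≤ u
      a≤u = ∣⇒≤ ⦃ >-nonZero 1≤u ⦄ a∣u
      a≤X : a ≤ X
      a≤X = ≤-trans a≤u u≤X
      term : ∀ g → 2 * A₁ * (F * F * F) * (B * B * B) * a * (g * (codivisor a g * codivisor a g)) ≤ m * m * m * m * row g
      term g with g ∣? a
      ... | no _ = ≤-trans (≤-reflexive (trans (cong (2 * A₁ * (F * F * F) * (B * B * B) * a *_) (*-zeroʳ g)) (*-zeroʳ (2 * A₁ * (F * F * F) * (B * B * B) * a)))) z≤n
      ... | yes (divides c a≡cg) with ∣-trans (divides {g} c a≡cg) a∣u
      ...   | divides k u≡kg = begin
        2 * A₁ * (F * F * F) * (B * B * B) * a * (g * (c * c))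
          ≡⟨ cong (λ z → 2 * A₁ * (F * F * F) * (B * B * B) * z * (g * (c * c))) a≡cg ⟩
        2 * A₁ * (F * F * F) * (B * B * B) * (c * g) * (g * (c * c))
          ≡⟨ cong₂ (λ s t → 2 * A₁ * (s * s * t) * (B * B * B) * (c * g) * (g * (c * c))) (*-inv g g≥1 g≤X) (*-inv k k≥1 k≤X) ⟨
        2 * A₁ * (g * inv g * (g * inv g) * (k * inv k)) * (B * B * B) * (c * g) * (g * (c * c))
          ≡⟨ arr A₁ g (inv g) k (inv k) B c ⟩
        (B * (c * g)) * (B * (c * g)) * (B * (c * g)) * (2 * A₁ * (k * g)) * (inv g * inv g * inv k)
          ≡⟨ cong₂ (λ s t → s * s * s * t * (inv g * inv g * inv k)) (sym (trans m≡Ba (cong (B *_) a≡cg))) (cong (2 * A₁ *_) (sym u≡kg)) ⟩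
        m * m * m * m * (inv g * inv g * inv k)
          ≤⟨ *-monoʳ-≤ (m * m * m * m) (≤-trans (≤-reflexive value) (∑-term (suc X) (λ k → ⟦ g * k ≟ u ⟧ * weight g k) (s≤s k≤X))) ⟩
        m * m * m * m * row g ∎
        where
        g≥1 : 1 ≤ g
        g≥1 = n≢0⇒n>0 (λ { refl → <-irrefl refl (≤-trans a≥1 (≤-reflexive (trans a≡cg (*-zeroʳ c)))) })
        k≥1 : 1 ≤ k
        k≥1 = n≢0⇒n>0 (λ { refl → <-irrefl refl (≤-trans 1≤u (≤-reflexive u≡kg)) })
        g≤X : g ≤ X
        g≤X = ≤-trans (∣⇒≤ ⦃ >-nonZero a≥1 ⦄ (divides c a≡cg)) a≤X
        k≤X : k ≤ X
        k≤X = ≤-trans (∣⇒≤ ⦃ >-nonZero 1≤u ⦄ (divides g (trans u≡kg (*-comm k g)))) u≤X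
        rough-g : Rough w g
        rough-g = proj₂ (proj₂ (proj₂ (rough g (coprime-∣ˡ (divides c a≡cg) coA₂))))
        value : inv g * inv g * inv k ≡ ⟦ g * k ≟ u ⟧ * weight g k
        value rewrite ⟦⟧-yes (g * k ≟ u) (trans (*-comm g k) (sym u≡kg)) | ⟦⟧-yes (rough? w g) rough-g =
          sym (trans (*-identityˡ _) (*-identityˡ _))
        arr : ∀ A₁ g i k j B c → 2 * A₁ * (g * i * (g * i) * (k * j)) * (B * B * B) * (c * g) * (g * (c * c)) ≡
          (B * (c * g)) * (B * (c * g)) * (B * (c * g)) * (2 * A₁ * (k * g)) * (i * i * j)
        arr = solve-∀

  -- `Y` and `H` fix the range of `z`, and `h` that of `y₂` and `y₃`. `h₀` bounds every modulus that
  -- can occur, so whole cells stay inside a box of side `h + h₀`. The slopes Δ / u lie between `α`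
  -- and `α + γ` even after widening by `8 * A₁ * C * (h + h₀)`, a bound for the variation of Δ on a
  -- cell divided by `u`.
  module Box (h h₀ Y H : ℕ)
    (small : ∀ u → u * (2 * A₁ * Y) ≤ 2 * C * (h * h) → 2 * A₁ * u ≤ h₀) (α γ : ℕ)
    (α-eq : 2 * A₁ * Y ≡ α + 8 * A₁ * C * (h + h₀))
    (γ-eq : ℓ₁ + h₀ + 2 * A₁ * (Y + H) + 8 * A₁ * C * (h + h₀) ≡ α + γ) where

    open Weights H public

    β : ℕ
    β = α + γ

    -- (q₁ (z + u) − q₁ z) for q₁ z = ℓ₁ z + A₁ z²
    step : ℕ → ℕ → ℕ
    step u z = u * (ℓ₁ + A₁ * u + 2 * A₁ * z)

    pairs : ℕ → ℕ
    pairs u = ∑ H (λ z → ∑⁴ h (λ b d c a → ⟦ Δ b d c a ℤ.≟ + step u (Y + z) ⟧))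

    near : ℕ → ℕ
    near u = ∑⁴ (h + h₀) (λ b d c a → ⟦ between? (+ (u * α)) (+ (u * β)) b d c a ⟧)

    -- The gap between the two values of the `z`-part would exceed the largest possible absolute
    -- value of Δ; `small` is this comparison solved for `u`.
    pairs-large : ∀ u → ¬ (2 * A₁ * u ≤ h₀) → pairs u ≡ 0
    pairs-large u large = ∑-zero H (λ z _ → ∑-zero h (λ b b< → ∑-zero h (λ d d< → ∑-zero h (λ c c< → ∑-zero h (λ a a< →
      ⟦⟧-no (Δ b d c a ℤ.≟ + step u (Y + z)) (λ eq → large (small u (begin
        u * (2 * A₁ * Y)          ≤⟨ *-monoʳ-≤ u (≤-trans (*-monoʳ-≤ (2 * A₁) (m≤m+n Y z)) (m≤n+m _ _)) ⟩
        step u (Y + z)            ≡⟨ cong ℤ.∣_∣ eq ⟨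
        ℤ.∣ Δ b d c a ∣           ≤⟨ Δ-bound h b d c a b< d< c< a< ⟩
        2 * C * (h * h)           ∎))))))))
      where open ≤-Reasoning

    -- A collision determines `z` as (Δ - r) / m with `m = 2 A₁ u`, so the sum over `z` is at most
    -- the indicator of a congruence and a range for Δ. Cells of side `m` separate these two
    -- conditions.
    pairs-small : ∀ u → 1 ≤ u → u ≤ H → 2 * A₁ * u ≤ h₀ → 2 * A₁ * (F * F * F) * pairs u ≤ near u * factorisations u
    pairs-small u 1≤u u≤H m≤h₀ = *-cancelˡ-≤ (m * m * m * m) ⦃ >-nonZero (*-mono-≤ (*-mono-≤ (*-mono-≤ m≥1 m≥1) m≥1) m≥1) ⦄ (begin
      m⁴ * (K * pairs u)                                ≡⟨ arr m⁴ K (pairs u) ⟩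
      K * (m⁴ * pairs u)                                ≤⟨ *-monoʳ-≤ K (*-monoʳ-≤ m⁴ to-residues) ⟩
      K * (m⁴ * ∑⁴ h (λ b d c a → hit m r b d c a * ⟦ between? lo hi b d c a ⟧))
                                                        ≤⟨ *-monoʳ-≤ K (cell-bound k m r lo hi h (ε * u) h≤km var≤e) ⟩
      K * (∑⁴ m (hit m r) * ∑⁴ (k * m) wide)            ≡⟨ *-assoc K _ _ ⟨
      K * ∑⁴ m (hit m r) * ∑⁴ (k * m) wide              ≤⟨ *-mono-≤ (modulus-count u r 1≤u u≤H) widen ⟩
      m⁴ * factorisations u * near u                    ≡⟨ trans (*-assoc m⁴ _ _) (cong (m⁴ *_) (*-comm (factorisations u) (near u))) ⟩
      m⁴ * (near u * factorisations u)                  ∎)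
      where
      open ≤-Reasoning
      m = 2 * A₁ * u
      m⁴ = m * m * m * m
      K = 2 * A₁ * (F * F * F)
      ε = 8 * A₁ * C * (h + h₀)
      m≥1 : 1 ≤ m
      m≥1 = *-mono-≤ (*-mono-≤ (s≤s (z≤n {1})) 1≤A₁) 1≤u
      instance
        m≢0 : NonZero m
        m≢0 = >-nonZero m≥1
      -- Rounding up covers the box; the overshoot is at most `m`, hence at most `h₀`.
      k = suc (h / m)
      r lo hi : ℤ
      r = + (u * (ℓ₁ + A₁ * u))
      lo = + (u * (2 * A₁ * Y))
      hi = + (u * (ℓ₁ + h₀ + 2 * A₁ * (Y + H)))
      wide : ℕ → ℕ → ℕ → ℕ → ℕ
      wide b d c a = ⟦ between? (lo ℤ.- + (ε * u)) (hi ℤ.+ + (ε * u)) b d c a ⟧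
      arr : ∀ a b c → a * (b * c) ≡ b * (a * c)
      arr = solve-∀
      h≤km : h ≤ k * m
      h≤km = ≤-trans (≤-reflexive (m≡m%n+[m/n]*n h m)) (+-monoˡ-≤ (h / m * m) (<⇒≤ (m%n<n h m)))
      km≤ : k * m ≤ h + h₀
      km≤ = ≤-trans (≤-reflexive (+-comm m (h / m * m))) (+-mono-≤ (≤-trans (m≤n+m (h / m * m) (h % m)) (≤-reflexive (sym (m≡m%n+[m/n]*n h m)))) m≤h₀)
      var≤e : 4 * (k * m) * C * m ≤ ε * u
      var≤e = begin
        4 * (k * m) * C * m                    ≤⟨ *-monoˡ-≤ m (*-monoˡ-≤ C (*-monoʳ-≤ 4 km≤)) ⟩
        4 * (h + h₀) * C * (2 * A₁ * u)        ≡⟨ arr″ A₁ C (h + h₀) u ⟩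
        ε * u                                  ∎
        where
        arr″ : ∀ A C n u → 4 * n * C * (2 * A * u) ≡ 8 * A * C * n * u
        arr″ = solve-∀
      to-residues : pairs u ≤ ∑⁴ h (λ b d c a → hit m r b d c a * ⟦ between? lo hi b d c a ⟧)
      to-residues = begin
        pairs u ≡⟨ ∑-∑⁴-swap H h (λ z b d c a → ⟦ Δ b d c a ℤ.≟ + step u (Y + z) ⟧) ⟩
        ∑⁴ h (λ b d c a → ∑ H (λ z → ⟦ Δ b d c a ℤ.≟ + step u (Y + z) ⟧))
          ≤⟨ ∑⁴-mono h (λ b d c a _ _ _ _ → ≤-trans
               (count-≤ (λ z → Δ b d c a ℤ.≟ + step u (Y + z)) ((+ m S.∣? (Δ b d c a ℤ.- r)) ×-dec between? lo hi b d c a) H (located b d c a) (unique b d c a))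
               (≤-reflexive (⟦⟧-*-dec (+ m S.∣? (Δ b d c a ℤ.- r)) (between? lo hi b d c a)))) ⟩
        ∑⁴ h (λ b d c a → hit m r b d c a * ⟦ between? lo hi b d c a ⟧) ∎
        where
        unique : ∀ b d c a i j → i < j → j < H → Δ b d c a ≡ + step u (Y + i) → Δ b d c a ≡ + step u (Y + j) → ⊥
        unique b d c a i j i<j _ p q = <-irrefl (ℤP.+-injective (trans (sym p) q))
          (*-monoʳ-< u ⦃ >-nonZero 1≤u ⦄ (+-monoʳ-< (ℓ₁ + A₁ * u) (*-monoʳ-< (2 * A₁) ⦃ >-nonZero (*-mono-≤ (s≤s (z≤n {1})) 1≤A₁) ⦄ (+-monoʳ-< Y i<j))))
        located : ∀ b d c a z → z < H → Δ b d c a ≡ + step u (Y + z) → (+ m S.∣ (Δ b d c a ℤ.- r)) × Between lo hi b d c a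
        located b d c a z z<H eq = S.divides (+ (Y + z)) quotient-eq
          , subst (lo ℤ.≤_) (sym eq) (ℤ.+≤+ (*-monoʳ-≤ u (≤-trans (*-monoʳ-≤ (2 * A₁) (m≤m+n Y z)) (m≤n+m _ _))))
          , subst (ℤ._≤ hi) (sym eq) (ℤ.+≤+ (*-monoʳ-≤ u (+-mono-≤ (+-monoʳ-≤ ℓ₁ (≤-trans (≤-trans (m≤m+n (A₁ * u) (A₁ * u)) (≤-reflexive (dbl A₁ u))) m≤h₀)) (*-monoʳ-≤ (2 * A₁) (+-monoʳ-≤ Y (<⇒≤ z<H))))))
          where
          dbl : ∀ A u → A * u + A * u ≡ 2 * A * u
          dbl = solve-∀
          split : ∀ u l n → u * (l + n) ≡ u * n + u * l
          split = solve-∀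
          prod : ∀ u A y → u * (2 * A * y) ≡ y * (2 * A * u)
          prod = solve-∀
          cancel : ∀ x y → x ℤ.+ y ℤ.- y ≡ x
          cancel = ℤR.solve-∀
          quotient-eq : Δ b d c a ℤ.- r ≡ + (Y + z) ℤ.* + m
          quotient-eq = trans (cong (ℤ._- r) (trans eq (trans (cong +_ (split u (ℓ₁ + A₁ * u) (2 * A₁ * (Y + z)))) (ℤP.pos-+ (u * (2 * A₁ * (Y + z))) (u * (ℓ₁ + A₁ * u))))))
            (trans (cancel (+ (u * (2 * A₁ * (Y + z)))) r) (trans (cong +_ (prod u A₁ (Y + z))) (ℤP.pos-* (Y + z) m)))
      widen : ∑⁴ (k * m) wide ≤ near u
      widen = ≤-trans (∑⁴-mono (k * m) (λ b d c a _ _ _ _ → ⟦⟧-mono (between? _ _ b d c a) (between? _ _ b d c a)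
        (λ (p , q) → subst (ℤ._≤ Δ b d c a) lo-eq p , subst (Δ b d c a ℤ.≤_) hi-eq q)))
        (∑⁴-range-mono (λ b d c a → ⟦ between? (+ (u * α)) (+ (u * β)) b d c a ⟧) km≤)
        where
        lo-eq : lo ℤ.- + (ε * u) ≡ + (u * α)
        lo-eq = trans (cong (λ s → + (u * s) ℤ.- + (ε * u)) α-eq) (trans (pos-∸ {ε * u} {u * (α + ε)} (≤-trans (m≤n+m (ε * u) (u * α)) (≤-reflexive (sym split)))) (cong +_ (trans (cong (_∸ ε * u) split) (m+n∸n≡m (u * α) (ε * u)))))
          where
          split : u * (α + ε) ≡ u * α + ε * u
          split = trans (*-distribˡ-+ u α ε) (cong (_+_ (u * α)) (*-comm u ε))
        hi-eq : hi ℤ.+ + (ε * u) ≡ + (u * β)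
        hi-eq = trans (sym (ℤP.pos-+ (u * (ℓ₁ + h₀ + 2 * A₁ * (Y + H))) (ε * u))) (cong +_ (trans (split u (ℓ₁ + h₀ + 2 * A₁ * (Y + H)) ε) (cong (u *_) γ-eq)))
          where
          split : ∀ u x e → u * x + e * u ≡ u * (x + e)
          split = solve-∀

    pairs-bound : ∀ u → 1 ≤ u → u ≤ H → 2 * A₁ * (F * F * F) * pairs u ≤ near u * factorisations u
    pairs-bound u 1≤u u≤H with 2 * A₁ * u ≤? h₀
    ... | yes m≤h₀ = pairs-small u 1≤u u≤H m≤h₀
    ... | no  m≰h₀ = ≤-trans (≤-reflexive (trans (cong (2 * A₁ * (F * F * F) *_) (pairs-large u m≰h₀)) (*-zeroʳ (2 * A₁ * (F * F * F))))) z≤n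

    -- The order of summation is exchanged here: the quadruple is fixed, and the factorisations
    -- `g * k` of the gaps that its Δ allows vary.
    density : ℕ → ℕ → ℕ → ℕ → ℕ
    density b d c a = ∑ (suc H) (λ g → ∑ (suc H) (λ k → weight g k * ⟦ between? (+ (g * k * α)) (+ (g * k * β)) b d c a ⟧))

    all-pairs-bound : 2 * A₁ * (F * F * F) * ∑ H (λ s → pairs (suc s)) ≤ ∑⁴ (h + h₀) density
    all-pairs-bound = begin
      2 * A₁ * (F * F * F) * ∑ H (λ s → pairs (suc s))      ≡⟨ ∑-*ˡ H (2 * A₁ * (F * F * F)) (λ s → pairs (suc s)) ⟨
      ∑ H (λ s → 2 * A₁ * (F * F * F) * pairs (suc s))      ≤⟨ ∑-mono H (λ s s<H → pairs-bound (suc s) (s≤s z≤n) s<H) ⟩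
      ∑ H (λ s → near (suc s) * factorisations (suc s))
        ≡⟨ ∑-cong H (λ s _ → trans (sym (∑-*ˡ (suc H) (near (suc s)) _)) (∑-cong (suc H) (λ g _ → sym (∑-*ˡ (suc H) (near (suc s)) _)))) ⟩
      ∑ H (λ s → ∑ (suc H) (λ g → ∑ (suc H) (λ k → near (suc s) * (⟦ g * k ≟ suc s ⟧ * weight g k))))
        ≡⟨ trans (∑-swap H (suc H) _) (∑-cong (suc H) (λ g _ → ∑-swap H (suc H) _)) ⟩
      ∑ (suc H) (λ g → ∑ (suc H) (λ k → ∑ H (λ s → near (suc s) * (⟦ g * k ≟ suc s ⟧ * weight g k))))
        ≤⟨ ∑-mono (suc H) (λ g _ → ∑-mono (suc H) (λ k _ → collect g k)) ⟩
      ∑ (suc H) (λ g → ∑ (suc H) (λ k → weight g k * near (g * k)))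
        ≡⟨ ∑-cong (suc H) (λ g _ → ∑-cong (suc H) (λ k _ → sym (∑⁴-*ˡ (h + h₀) (weight g k) _))) ⟩
      ∑ (suc H) (λ g → ∑ (suc H) (λ k → ∑⁴ (h + h₀) (λ b d c a → weight g k * ⟦ between? (+ (g * k * α)) (+ (g * k * β)) b d c a ⟧)))
        ≡⟨ trans (∑-cong (suc H) (λ g _ → ∑-∑⁴-swap (suc H) (h + h₀) _)) (∑-∑⁴-swap (suc H) (h + h₀) _) ⟩
      ∑⁴ (h + h₀) density ∎
      where
      open ≤-Reasoning
      collect : ∀ g k → ∑ H (λ s → near (suc s) * (⟦ g * k ≟ suc s ⟧ * weight g k)) ≤ weight g k * near (g * k)
      collect g k = begin
        ∑ H (λ s → near (suc s) * (⟦ g * k ≟ suc s ⟧ * weight g k))    ≡⟨ ∑-cong H (λ s _ → at s) ⟩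
        ∑ H (λ s → ⟦ g * k ≟ suc s ⟧ * (weight g k * near (g * k)))    ≡⟨ ∑-*ʳ H _ _ ⟩
        count (λ s → g * k ≟ suc s) H * (weight g k * near (g * k))
          ≤⟨ *-monoˡ-≤ (weight g k * near (g * k)) (count-unique (λ s → g * k ≟ suc s) H (λ i j i<j _ p q → <-irrefl (suc-injective (trans (sym p) q)) i<j)) ⟩
        1 * (weight g k * near (g * k))                                ≡⟨ *-identityˡ _ ⟩
        weight g k * near (g * k)                                      ∎
        where
        at : ∀ s → near (suc s) * (⟦ g * k ≟ suc s ⟧ * weight g k) ≡ ⟦ g * k ≟ suc s ⟧ * (weight g k * near (g * k))
        at s with g * k ≟ suc s
        ... | yes eq rewrite eq = arr (near (suc s)) (weight g k)
          where
          arr : ∀ x y → x * (1 * y) ≡ 1 * (y * x)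
          arr = solve-∀
        ... | no _ = *-zeroʳ (near (suc s))

-- Crude bounds for small and for zero differences

abs-nonneg-diff : ∀ x y {Z} → + 0 ℤ.≤ x → + 0 ℤ.≤ y → x ℤ.≤ + Z → y ℤ.≤ + Z → ℤ.∣ x ℤ.- y ∣ ≤ Z
abs-nonneg-diff (+ x) (+ y) _ _ (ℤ.+≤+ x≤Z) (ℤ.+≤+ y≤Z) = ≤-trans (≤-reflexive (cong ℤ.∣_∣ (ℤP.[+m]-[+n]≡m⊖n x y))) (≤-trans (ℤP.∣m⊝n∣≤m⊔n x y) (⊔-lub x≤Z y≤Z))

abs-pos : ∀ {x : ℤ} → x ≢ + 0 → 1 ≤ ℤ.∣ x ∣
abs-pos x≢0 = n≢0⇒n>0 (λ e → x≢0 (ℤP.∣i∣≡0⇒i≡0 e))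

module Sparse (ℓ₂ A₂ ℓ₃ A₃ : ℤ) (A₂≢0 : A₂ ≢ + 0) (A₃≢0 : A₃ ≢ + 0) where

  open Cells ℓ₂ A₂ ℓ₃ A₃

  slope-large : ∀ i j → ℤ.∣ ℓ₂ ∣ ≤ i → j ≤ ℤ.∣ ℓ₂ ℤ.+ A₂ ℤ.* (+ j ℤ.+ + i) ∣
  slope-large i j ℓ≤i = +-cancelʳ-≤ i j _ (begin
    j + i                                            ≤⟨ m≤n*m (j + i) ℤ.∣ A₂ ∣ ⦃ >-nonZero (abs-pos A₂≢0) ⦄ ⟩
    ℤ.∣ A₂ ∣ * (j + i)                               ≡⟨ ℤP.abs-* A₂ (+ j ℤ.+ + i) ⟨
    ℤ.∣ A₂ ℤ.* (+ j ℤ.+ + i) ∣                       ≡⟨ cong ℤ.∣_∣ (eqn ℓ₂ (A₂ ℤ.* (+ j ℤ.+ + i))) ⟩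
    ℤ.∣ (ℓ₂ ℤ.+ A₂ ℤ.* (+ j ℤ.+ + i)) ℤ.- ℓ₂ ∣       ≤⟨ ℤP.∣i-j∣≤∣i∣+∣j∣ (ℓ₂ ℤ.+ A₂ ℤ.* (+ j ℤ.+ + i)) ℓ₂ ⟩
    ℤ.∣ ℓ₂ ℤ.+ A₂ ℤ.* (+ j ℤ.+ + i) ∣ + ℤ.∣ ℓ₂ ∣     ≤⟨ +-monoʳ-≤ _ ℓ≤i ⟩
    ℤ.∣ ℓ₂ ℤ.+ A₂ ℤ.* (+ j ℤ.+ + i) ∣ + i            ∎)
    where
    open ≤-Reasoning
    eqn : ∀ l x → x ≡ (l ℤ.+ x) ℤ.- l
    eqn = ℤR.solve-∀

  -- Beyond |ℓ₂| the polynomial quad ℓ₂ A₂ separates points quadratically.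
  thin-line : ∀ n Z s b d c → Z < s * s → ∑ n (λ a → ⟦ between? (+ 0) (+ Z) b d c a ⟧) ≤ ℤ.∣ ℓ₂ ∣ + s
  thin-line n Z s b d c Z<s² = begin
    ∑ n f                                            ≤⟨ ∑-range-mono f (m≤n+m n L) ⟩
    ∑ (L + n) f                                      ≡⟨ ∑-split L n f ⟩
    ∑ L f + ∑ n (λ j → f (L + j))                    ≤⟨ +-mono-≤ (count≤ (λ a → between? (+ 0) (+ Z) b d c a) L) far ⟩
    L + s                                            ∎
    where
    open ≤-Reasoning
    L = ℤ.∣ ℓ₂ ∣
    f : ℕ → ℕ
    f a = ⟦ between? (+ 0) (+ Z) b d c a ⟧
    close : ∀ i j → i ≤ j → Between (+ 0) (+ Z) b d c (L + i) → Between (+ 0) (+ Z) b d c (L + j) → (j ∸ i) * (j ∸ i) ≤ Z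
    close i j i≤j (lo , hi) (lo′ , hi′) = begin
      (j ∸ i) * (j ∸ i)             ≤⟨ *-monoˡ-≤ (j ∸ i) (≤-trans (m∸n≤m j i) (m≤n+m j L)) ⟩
      (L + j) * (j ∸ i)             ≤⟨ *-monoˡ-≤ (j ∸ i) (slope-large (L + i) (L + j) (m≤m+n L i)) ⟩
      ℤ.∣ slope ∣ * (j ∸ i)         ≡⟨ cong (λ t → ℤ.∣ slope ∣ * ℤ.∣ t ∣) gap ⟨
      ℤ.∣ slope ∣ * ℤ.∣ + (L + j) ℤ.- + (L + i) ∣   ≡⟨ ℤP.abs-* slope (+ (L + j) ℤ.- + (L + i)) ⟨
      ℤ.∣ slope ℤ.* (+ (L + j) ℤ.- + (L + i)) ∣     ≡⟨ cong ℤ.∣_∣ (quad-diff ℓ₂ A₂ (L + i) (L + j)) ⟨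
      ℤ.∣ quad ℓ₂ A₂ (L + j) ℤ.- quad ℓ₂ A₂ (L + i) ∣ ≡⟨ cong ℤ.∣_∣ (eqn (quad ℓ₂ A₂ (L + j)) (quad ℓ₂ A₂ (L + i)) (quad ℓ₂ A₂ b) (quad ℓ₃ A₃ c ℤ.- quad ℓ₃ A₃ d)) ⟩
      ℤ.∣ Δ b d c (L + j) ℤ.- Δ b d c (L + i) ∣     ≤⟨ abs-nonneg-diff (Δ b d c (L + j)) (Δ b d c (L + i)) lo′ lo hi′ hi ⟩
      Z                             ∎
      where
      slope : ℤ
      slope = ℓ₂ ℤ.+ A₂ ℤ.* (+ (L + j) ℤ.+ + (L + i))
      gap : + (L + j) ℤ.- + (L + i) ≡ + (j ∸ i)
      gap = trans (pos-∸ (+-monoʳ-≤ L i≤j)) (cong +_ ([m+n]∸[m+o]≡n∸o L j i))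
      eqn : ∀ x y b t → x ℤ.- y ≡ ((x ℤ.- b) ℤ.+ t) ℤ.- ((y ℤ.- b) ℤ.+ t)
      eqn = ℤR.solve-∀
    far : ∑ n (λ j → f (L + j)) ≤ s
    far with count-span (λ j → between? (+ 0) (+ Z) b d c (L + j)) n
    ... | inj₁ eq = ≤-trans (≤-reflexive eq) z≤n
    ... | inj₂ (i , j , i≤j , _ , pi , pj , le) = ≤-trans le (≰⇒> (λ s≤gap → <-irrefl refl (begin-strict
          Z                     <⟨ Z<s² ⟩
          s * s                 ≤⟨ *-mono-≤ s≤gap s≤gap ⟩
          (j ∸ i) * (j ∸ i)     ≤⟨ close i j i≤j pi pj ⟩
          Z                     ∎)))

  thin : ∀ n Z s → Z < s * s → ∑⁴ n (λ b d c a → ⟦ between? (+ 0) (+ Z) b d c a ⟧) ≤ n * n * n * (ℤ.∣ ℓ₂ ∣ + s)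
  thin n Z s Z<s² = ≤-trans (∑-bound n _ (λ b _ → ∑-bound n _ (λ d _ → ∑-bound n _ (λ c _ → thin-line n Z s b d c Z<s²))))
    (≤-reflexive (arr n (ℤ.∣ ℓ₂ ∣ + s)))
    where
    arr : ∀ n k → n * (n * (n * k)) ≡ n * n * n * k
    arr = solve-∀

  -- The second divided difference of quad is the constant A₃, so three roots modulo s spread out.
  three-roots : ∀ s r c₁ c₂ c₃ δ → + s S.∣ (quad ℓ₃ A₃ c₁ ℤ.- r) → + s S.∣ (quad ℓ₃ A₃ c₂ ℤ.- r) → + s S.∣ (quad ℓ₃ A₃ c₃ ℤ.- r) →
    c₁ < c₂ → c₂ < c₃ → c₃ ∸ c₁ ≤ δ → s ≤ ℤ.∣ A₃ ∣ * (δ * δ * δ)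
  three-roots s r c₁ c₂ c₃ δ p₁ p₂ p₃ c₁<c₂ c₂<c₃ c₃-c₁≤δ = begin
    s                                                          ≤⟨ ∣⇒≤ ⦃ nz ⦄ (subst (s ∣_) abs-eq (S.∣⇒∣ᵤ divided)) ⟩
    ℤ.∣ A₃ ∣ * ((c₂ ∸ c₁) * (c₃ ∸ c₂) * (c₃ ∸ c₁))             ≤⟨ *-monoʳ-≤ ℤ.∣ A₃ ∣ (*-mono-≤ (*-mono-≤
        (≤-trans (∸-monoˡ-≤ c₁ (<⇒≤ c₂<c₃)) c₃-c₁≤δ) (≤-trans (∸-monoʳ-≤ c₃ (<⇒≤ c₁<c₂)) c₃-c₁≤δ)) c₃-c₁≤δ) ⟩
    ℤ.∣ A₃ ∣ * (δ * δ * δ)                                     ∎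
    where
    open ≤-Reasoning
    x y z : ℤ
    x = + c₂ ℤ.- + c₁
    y = + c₃ ℤ.- + c₂
    z = + c₃ ℤ.- + c₁
    q = quad ℓ₃ A₃
    eqn : ∀ ℓ A a b c r → (c ℤ.- b) ℤ.* (((ℓ ℤ.+ A ℤ.* a) ℤ.* a) ℤ.- r) ℤ.- (c ℤ.- a) ℤ.* (((ℓ ℤ.+ A ℤ.* b) ℤ.* b) ℤ.- r) ℤ.+ (b ℤ.- a) ℤ.* (((ℓ ℤ.+ A ℤ.* c) ℤ.* c) ℤ.- r)
      ≡ A ℤ.* ((b ℤ.- a) ℤ.* (c ℤ.- b) ℤ.* (c ℤ.- a))
    eqn = ℤR.solve-∀
    divided : + s S.∣ (A₃ ℤ.* (x ℤ.* y ℤ.* z))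
    divided = S-subst (eqn ℓ₃ A₃ (+ c₁) (+ c₂) (+ c₃) r)
      (S.∣m∣n⇒∣m+n (S.∣m∣n⇒∣m-n (S.∣n⇒∣m*n y p₁) (S.∣n⇒∣m*n z p₂)) (S.∣n⇒∣m*n x p₃))
    abs-eq : ℤ.∣ A₃ ℤ.* (x ℤ.* y ℤ.* z) ∣ ≡ ℤ.∣ A₃ ∣ * ((c₂ ∸ c₁) * (c₃ ∸ c₂) * (c₃ ∸ c₁))
    abs-eq = trans (ℤP.abs-* A₃ (x ℤ.* y ℤ.* z)) (cong (ℤ.∣ A₃ ∣ *_) (trans (ℤP.abs-* (x ℤ.* y) z) (cong₂ _*_ (trans (ℤP.abs-* x y)
      (cong₂ _*_ (cong ℤ.∣_∣ (pos-∸ (<⇒≤ c₁<c₂))) (cong ℤ.∣_∣ (pos-∸ (<⇒≤ c₂<c₃))))) (cong ℤ.∣_∣ (pos-∸ (<⇒≤ (<-trans c₁<c₂ c₂<c₃)))))))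
    nz : NonZero (ℤ.∣ A₃ ∣ * ((c₂ ∸ c₁) * (c₃ ∸ c₂) * (c₃ ∸ c₁)))
    nz = >-nonZero (*-mono-≤ (abs-pos A₃≢0) (*-mono-≤ (*-mono-≤ (m<n⇒0<n∸m c₁<c₂) (m<n⇒0<n∸m c₂<c₃)) (m<n⇒0<n∸m (<-trans c₁<c₂ c₂<c₃))))

  -- By `three-roots` a block of length `δ` holds at most two roots once `s` exceeds `∣ A₃ ∣ δ³`.
  roots-count : ∀ s r k δ → ℤ.∣ A₃ ∣ * (δ * δ * δ) < s → count (λ c → + s S.∣? (quad ℓ₃ A₃ c ℤ.- r)) (k * δ) ≤ 2 * k
  roots-count s r k δ big = begin
    count P? (k * δ)                                   ≡⟨ ∑-block k δ _ ⟩
    ∑ k (λ i → ∑ δ (λ ε → ⟦ P? (i * δ + ε) ⟧))         ≤⟨ ∑-bound k 2 (λ i _ → count-two (λ ε → P? (i * δ + ε)) δ (λ e₁ e₂ e₃ e₁<e₂ e₂<e₃ e₃<δ p₁ p₂ p₃ →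
        <⇒≱ big (three-roots s r (i * δ + e₁) (i * δ + e₂) (i * δ + e₃) δ p₁ p₂ p₃ (+-monoʳ-< (i * δ) e₁<e₂) (+-monoʳ-< (i * δ) e₂<e₃)
          (≤-trans (≤-reflexive ([m+n]∸[m+o]≡n∸o (i * δ) e₃ e₁)) (≤-trans (m∸n≤m e₃ e₁) (<⇒≤ e₃<δ)))))) ⟩
    k * 2                                              ≡⟨ *-comm k 2 ⟩
    2 * k                                              ∎
    where
    open ≤-Reasoning
    P? : ∀ c → Dec (+ s S.∣ (quad ℓ₃ A₃ c ℤ.- r))
    P? c = + s S.∣? (quad ℓ₃ A₃ c ℤ.- r)

  chord : ∀ b s → quad ℓ₂ A₂ (b + s) ℤ.- quad ℓ₂ A₂ b ≡ (ℓ₂ ℤ.+ A₂ ℤ.* (+ 2 ℤ.* + b ℤ.+ + s)) ℤ.* + s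
  chord b s = trans (cong (λ x → (ℓ₂ ℤ.+ A₂ ℤ.* x) ℤ.* x ℤ.- quad ℓ₂ A₂ b) (ℤP.pos-+ b s)) (eqn ℓ₂ A₂ (+ b) (+ s))
    where
    eqn : ∀ ℓ A b s → (ℓ ℤ.+ A ℤ.* (b ℤ.+ s)) ℤ.* (b ℤ.+ s) ℤ.- (ℓ ℤ.+ A ℤ.* b) ℤ.* b ≡ (ℓ ℤ.+ A ℤ.* (+ 2 ℤ.* b ℤ.+ s)) ℤ.* s
    eqn = ℤR.solve-∀

  -- The chord over a gap `s` is a multiple of `s`, and it is an affine function of `b` with nonzero
  -- slope `2 A₂ s`, so it takes each value at most once.
  chord-count : ∀ h s x → 1 ≤ s → ∑ h (λ b → ⟦ (quad ℓ₂ A₂ (b + s) ℤ.- quad ℓ₂ A₂ b) ℤ.- x ℤ.≟ + 0 ⟧) ≤ ⟦ + s S.∣? x ⟧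
  chord-count h s x 1≤s = count-≤ (λ b → (quad ℓ₂ A₂ (b + s) ℤ.- quad ℓ₂ A₂ b) ℤ.- x ℤ.≟ + 0) (+ s S.∣? x) h
    (λ b _ eq → S.divides (ℓ₂ ℤ.+ A₂ ℤ.* (+ 2 ℤ.* + b ℤ.+ + s)) (trans (sym (ℤP.i-j≡0⇒i≡j _ x eq)) (chord b s)))
    (λ b b′ b<b′ _ p q → distinct b b′ b<b′ (trans (ℤP.i-j≡0⇒i≡j _ x q) (sym (ℤP.i-j≡0⇒i≡j _ x p))))
    where
    distinct : ∀ b b′ → b < b′ → quad ℓ₂ A₂ (b′ + s) ℤ.- quad ℓ₂ A₂ b′ ≡ quad ℓ₂ A₂ (b + s) ℤ.- quad ℓ₂ A₂ b → ⊥
    distinct b b′ b<b′ eq = <-irrefl (sym (trans (sym abs-eq) (cong ℤ.∣_∣ zero-product))) positive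
      where
      product : ℤ
      product = (A₂ ℤ.* + 2) ℤ.* ((+ b′ ℤ.- + b) ℤ.* + s)
      eqn : ∀ ℓ A b b′ s → (A ℤ.* + 2) ℤ.* ((b′ ℤ.- b) ℤ.* s) ≡ (ℓ ℤ.+ A ℤ.* (+ 2 ℤ.* b′ ℤ.+ s)) ℤ.* s ℤ.- (ℓ ℤ.+ A ℤ.* (+ 2 ℤ.* b ℤ.+ s)) ℤ.* s
      eqn = ℤR.solve-∀
      zero-product : product ≡ + 0
      zero-product = trans (eqn ℓ₂ A₂ (+ b) (+ b′) (+ s)) (ℤP.i≡j⇒i-j≡0 (trans (sym (chord b′ s)) (trans eq (chord b s))))
      abs-eq : ℤ.∣ product ∣ ≡ ℤ.∣ A₂ ∣ * 2 * ((b′ ∸ b) * s)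
      abs-eq = trans (ℤP.abs-* (A₂ ℤ.* + 2) _) (cong₂ _*_ (ℤP.abs-* A₂ (+ 2)) (trans (ℤP.abs-* (+ b′ ℤ.- + b) (+ s)) (cong (λ t → ℤ.∣ t ∣ * s) (pos-∸ (<⇒≤ b<b′)))))
      positive : 0 < ℤ.∣ A₂ ∣ * 2 * ((b′ ∸ b) * s)
      positive = *-mono-≤ (*-mono-≤ (abs-pos A₂≢0) (s≤s (z≤n {1}))) (*-mono-≤ (m<n⇒0<n∸m b<b′) 1≤s)

  zeros : ℕ → ℕ
  zeros h = ∑⁴ h (λ b d c a → ⟦ Δ b d c a ℤ.≟ + 0 ⟧)

  -- For `a = b` at most two `c` fit each pair of `b` and `d`. Otherwise the gap of `a` and `b`
  -- divides the difference of the two values of `quad ℓ₃ A₃`, and `c`, `d` and the gap determine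
  -- `b`. Gaps up to `∣ A₃ ∣ δ³` are counted trivially; for each larger one `roots-count` leaves at
  -- most `2 k` choices of `c`.
  zeros-bound : ∀ k δ → let h = k * δ in zeros h ≤ h * h * (2 + 2 * (ℤ.∣ A₃ ∣ * (δ * δ * δ) + 2 * k))
  zeros-bound k δ = begin
    zeros h
      ≡⟨ ∑-swap h h _ ⟩
    ∑ h (λ d → ∑ h (λ b → ∑ h (λ c → ∑ h (λ a → Z b d c a))))
      ≡⟨ ∑-cong h (λ d _ → ∑-swap h h _) ⟩
    ∑ h (λ d → ∑ h (λ c → ∑ h (λ b → ∑ h (λ a → Z b d c a))))
      ≤⟨ ∑-mono h (λ d _ → ∑-mono h (λ c _ → ≤-trans (∑-diagonals h (λ b a → Z b d c a))
           (+-mono-≤ (+-mono-≤ (≤-refl {∑ h (λ b → Z b d c b)}) (down d c)) (up d c)))) ⟩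
    ∑ h (λ d → ∑ h (λ c → ∑ h (λ b → Z b d c b) + V d c + V d c))
      ≡⟨ ∑-cong h (λ d _ → trans (∑-+ h _ _) (cong (_+ ∑ h (V d)) (∑-+ h _ _))) ⟩
    ∑ h (λ d → ∑ h (λ c → ∑ h (λ b → Z b d c b)) + ∑ h (V d) + ∑ h (V d))
      ≤⟨ ∑-bound h (h * 2 + (h * s₀ + h * (2 * k)) + (h * s₀ + h * (2 * k))) (λ d _ → +-mono-≤ (+-mono-≤ (diag d) (off d)) (off d)) ⟩
    h * (h * 2 + (h * s₀ + h * (2 * k)) + (h * s₀ + h * (2 * k)))
      ≡⟨ arr h s₀ k ⟩
    h * h * (2 + 2 * (s₀ + 2 * k)) ∎
    where
    open ≤-Reasoning
    h = k * δ
    s₀ = ℤ.∣ A₃ ∣ * (δ * δ * δ)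
    arr : ∀ h s k → h * (h * 2 + (h * s + h * (2 * k)) + (h * s + h * (2 * k))) ≡ h * h * (2 + 2 * (s + 2 * k))
    arr = solve-∀
    Z : ℕ → ℕ → ℕ → ℕ → ℕ
    Z b d c a = ⟦ Δ b d c a ℤ.≟ + 0 ⟧
    V : ℕ → ℕ → ℕ
    V d c = ∑ h (λ s → ⟦ + suc s S.∣? (quad ℓ₃ A₃ c ℤ.- quad ℓ₃ A₃ d) ⟧)
    up : ∀ d c → ∑ h (λ b → ∑ h (λ s → Z b d c (b + suc s))) ≤ V d c
    up d c = ≤-trans (≤-reflexive (∑-swap h h _)) (∑-mono h (λ s _ → ≤-trans
      (∑-mono h (λ b _ → ⟦⟧-mono (Δ b d c (b + suc s) ℤ.≟ + 0) (_ ℤ.≟ + 0) (trans (eqn (quad ℓ₂ A₂ (b + suc s) ℤ.- quad ℓ₂ A₂ b) (quad ℓ₃ A₃ c) (quad ℓ₃ A₃ d)))))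
      (≤-trans (chord-count h (suc s) (quad ℓ₃ A₃ d ℤ.- quad ℓ₃ A₃ c) (s≤s z≤n))
        (⟦⟧-mono (+ suc s S.∣? _) (+ suc s S.∣? _) (∣-flip (quad ℓ₃ A₃ d) (quad ℓ₃ A₃ c))))))
      where
      eqn : ∀ x c d → x ℤ.- (d ℤ.- c) ≡ x ℤ.+ (c ℤ.- d)
      eqn = ℤR.solve-∀
    down : ∀ d c → ∑ h (λ b → ∑ h (λ s → Z (b + suc s) d c b)) ≤ V d c
    down d c = ≤-trans (≤-reflexive (∑-swap h h _)) (∑-mono h (λ s _ → ≤-trans
      (∑-mono h (λ b _ → ⟦⟧-mono (Δ (b + suc s) d c b ℤ.≟ + 0) (_ ℤ.≟ + 0) (λ e → trans (eqn (quad ℓ₂ A₂ (b + suc s)) (quad ℓ₂ A₂ b) (quad ℓ₃ A₃ c ℤ.- quad ℓ₃ A₃ d)) (cong ℤ.-_ e))))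
      (chord-count h (suc s) (quad ℓ₃ A₃ c ℤ.- quad ℓ₃ A₃ d) (s≤s z≤n))))
      where
      eqn : ∀ x y t → (x ℤ.- y) ℤ.- t ≡ ℤ.- ((y ℤ.- x) ℤ.+ t)
      eqn = ℤR.solve-∀
    diag : ∀ d → ∑ h (λ c → ∑ h (λ b → Z b d c b)) ≤ h * 2
    diag d = begin
      ∑ h (λ c → ∑ h (λ b → Z b d c b))   ≡⟨ ∑-swap h h _ ⟩
      ∑ h (λ b → ∑ h (λ c → Z b d c b))   ≤⟨ ∑-bound h 2 (λ b _ → count-two (λ c → Δ b d c b ℤ.≟ + 0) h (λ c₁ c₂ c₃ c₁<c₂ c₂<c₃ _ p₁ p₂ p₃ →
          <-irrefl refl (three-roots (suc (ℤ.∣ A₃ ∣ * ((c₃ ∸ c₁) * (c₃ ∸ c₁) * (c₃ ∸ c₁)))) (quad ℓ₃ A₃ d) c₁ c₂ c₃ (c₃ ∸ c₁) (same b c₁ p₁) (same b c₂ p₂) (same b c₃ p₃) c₁<c₂ c₂<c₃ ≤-refl))) ⟩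
      h * 2                               ∎
      where
      eqn : ∀ x t → (x ℤ.- x) ℤ.+ t ≡ t
      eqn = ℤR.solve-∀
      same : ∀ {s} b c → Δ b d c b ≡ + 0 → + s S.∣ (quad ℓ₃ A₃ c ℤ.- quad ℓ₃ A₃ d)
      same b c e = S.divides (+ 0) (trans (sym (eqn (quad ℓ₂ A₂ b) (quad ℓ₃ A₃ c ℤ.- quad ℓ₃ A₃ d))) e)
    off : ∀ d → ∑ h (V d) ≤ h * s₀ + h * (2 * k)
    off d = begin
      ∑ h (V d)                                                     ≡⟨ ∑-swap h h _ ⟩
      ∑ h G                                                         ≤⟨ ∑-range-mono G (m≤n+m h s₀) ⟩
      ∑ (s₀ + h) G                                                  ≡⟨ ∑-split s₀ h G ⟩
      ∑ s₀ G + ∑ h (λ j → G (s₀ + j))                               ≤⟨ +-mono-≤ (∑-bound s₀ h (λ s _ → count≤ (λ c → + suc s S.∣? (quad ℓ₃ A₃ c ℤ.- quad ℓ₃ A₃ d)) h))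
                                                                         (∑-bound h (2 * k) (λ j _ → roots-count (suc (s₀ + j)) (quad ℓ₃ A₃ d) k δ (s≤s (m≤m+n s₀ j)))) ⟩
      s₀ * h + h * (2 * k)                                          ≡⟨ cong (_+ h * (2 * k)) (*-comm s₀ h) ⟩
      h * s₀ + h * (2 * k)                                          ∎
      where
      G : ℕ → ℕ
      G s = ∑ h (λ c → ⟦ + suc s S.∣? (quad ℓ₃ A₃ c ℤ.- quad ℓ₃ A₃ d) ⟧)

-- Collisions summed over all gaps

∑⁴-reverse : ∀ n (F : ℕ → ℕ → ℕ → ℕ → ℕ) → ∑⁴ n F ≡ ∑⁴ n (λ b d c a → F a c d b)
∑⁴-reverse n F = begin
  ∑⁴ n F                                                        ≡⟨ ∑-swap-pairs n F ⟩
  ∑ n (λ b → ∑ n (λ d → ∑ n (λ c → ∑ n (λ a → F c a b d))))     ≡⟨ ∑-swap n n _ ⟩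
  ∑ n (λ d → ∑ n (λ b → ∑ n (λ c → ∑ n (λ a → F c a b d))))     ≡⟨ ∑-cong n (λ d _ → ∑-cong n (λ b _ → ∑-swap n n _)) ⟩
  ∑⁴ n (λ b d c a → F a c d b)                                  ∎
  where open ≡-Reasoning

module PositivePairs (ℓ₁ A₁ : ℕ) (ℓ₂ A₂ ℓ₃ A₃ : ℤ) (w : ℕ) (1≤A₁ : 1 ≤ A₁) (coℓ : Coprime ℤ.∣ ℓ₂ ∣ ℤ.∣ A₂ ∣)
  (rough : ∀ g → Coprime g ℤ.∣ A₂ ∣ → Coprime g 2 × Coprime g A₁ × Coprime g ℤ.∣ A₃ ∣ × Rough w g)
  (A₂≢0 : A₂ ≢ + 0) (A₃≢0 : A₃ ≢ + 0) where

  open Pairs ℓ₁ A₁ ℓ₂ A₂ ℓ₃ A₃ w 1≤A₁ coℓ rough public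
  open Sparse ℓ₂ A₂ ℓ₃ A₃ A₂≢0 A₃≢0 public

  Δ-reverse : ∀ b d c a → Δ a c d b ≡ ℤ.- Δ b d c a
  Δ-reverse b d c a = eqn (quad ℓ₂ A₂ a) (quad ℓ₂ A₂ b) (quad ℓ₃ A₃ c) (quad ℓ₃ A₃ d)
    where
    eqn : ∀ a b c d → (b ℤ.- a) ℤ.+ (d ℤ.- c) ≡ ℤ.- ((a ℤ.- b) ℤ.+ (c ℤ.- d))
    eqn = ℤR.solve-∀

  positives : ℕ → ℕ
  positives n = ∑⁴ n (λ b d c a → ⟦ + 1 ℤ.≤? Δ b d c a ⟧)

  -- Exchanging the two points changes the sign of Δ. This half compensates the factor 2 for ordered
  -- pairs in the second moment, so the leading constant stays exact.
  positives-half : ∀ n → 2 * positives n ≤ n * n * n * n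
  positives-half n = begin
    2 * positives n                                                        ≡⟨ cong (_+_ (positives n)) (trans (+-identityʳ _) (∑⁴-reverse n _)) ⟩
    positives n + ∑⁴ n (λ b d c a → ⟦ + 1 ℤ.≤? Δ a c d b ⟧)                ≡⟨ ∑⁴-+ n _ _ ⟨
    ∑⁴ n (λ b d c a → ⟦ + 1 ℤ.≤? Δ b d c a ⟧ + ⟦ + 1 ℤ.≤? Δ a c d b ⟧)     ≤⟨ ∑⁴-mono n (λ b d c a _ _ _ _ →
        subst (λ y → ⟦ + 1 ℤ.≤? Δ b d c a ⟧ + ⟦ + 1 ℤ.≤? y ⟧ ≤ 1) (sym (Δ-reverse b d c a)) (either (Δ b d c a))) ⟩
    ∑⁴ n (λ _ _ _ _ → 1)                                                   ≡⟨ trans (∑⁴-const n 1) (*-identityʳ _) ⟩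
    n * n * n * n                                                          ∎
    where
    open ≤-Reasoning
    either : ∀ x → ⟦ + 1 ℤ.≤? x ⟧ + ⟦ + 1 ℤ.≤? ℤ.- x ⟧ ≤ 1
    either x with + 1 ℤ.≤? x | + 1 ℤ.≤? ℤ.- x
    ... | yes _  | no _  = ≤-refl
    ... | no _   | yes _ = ≤-refl
    ... | no _   | no _  = z≤n
    either (+ suc n) | yes _ | yes ()
    either (+ zero) | yes (ℤ.+≤+ ()) | yes _

  module Count (h h₀ Y H : ℕ)
    (small : ∀ u → u * (2 * A₁ * Y) ≤ 2 * C * (h * h) → 2 * A₁ * u ≤ h₀) (α γ : ℕ) (1≤α : 1 ≤ α)
    (α-eq : 2 * A₁ * Y ≡ α + 8 * A₁ * C * (h + h₀))
    (γ-eq : ℓ₁ + h₀ + 2 * A₁ * (Y + H) + 8 * A₁ * C * (h + h₀) ≡ α + γ) (γ≤α : γ ≤ α) (1≤w : 1 ≤ w) where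

    open Box h h₀ Y H small α γ α-eq γ-eq public

    F³ : ℕ
    F³ = F * F * F

    densityAt : ℤ → ℕ
    densityAt x = ∑ (suc H) (λ g → ∑ (suc H) (λ k → weight g k * ⟦ (+ (g * k * α) ℤ.≤? x) ×-dec (x ℤ.≤? + (g * k * β)) ⟧))

    weight-0ˡ : ∀ k → weight 0 k ≡ 0
    weight-0ˡ k = trans (cong (λ i → ⟦ rough? w 0 ⟧ * (i * i * inv k)) inv-0) (*-zeroʳ ⟦ rough? w 0 ⟧)

    weight-0ʳ : ∀ g → weight g 0 ≡ 0
    weight-0ʳ g = trans (cong (λ i → ⟦ rough? w g ⟧ * (inv g * inv g * i)) inv-0) (trans (cong (⟦ rough? w g ⟧ *_) (*-zeroʳ (inv g * inv g))) (*-zeroʳ ⟦ rough? w g ⟧))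

    densityAt-nonpositive : ∀ x → x ℤ.≤ + 0 → densityAt x ≡ 0
    densityAt-nonpositive x x≤0 = ∑-zero (suc H) (λ g _ → ∑-zero (suc H) (λ k _ → at g k))
      where
      at : ∀ g k → weight g k * ⟦ (+ (g * k * α) ℤ.≤? x) ×-dec (x ℤ.≤? + (g * k * β)) ⟧ ≡ 0
      at zero    k = cong (_* ⟦ (+ 0 ℤ.≤? x) ×-dec (x ℤ.≤? + 0) ⟧) (weight-0ˡ k)
      at (suc g) zero = cong (_* ⟦ (+ (g * 0 * α) ℤ.≤? x) ×-dec (x ℤ.≤? + (g * 0 * β)) ⟧) (weight-0ʳ (suc g))
      at (suc g) (suc k) = trans (cong (weight (suc g) (suc k) *_) (⟦⟧-no ((_ ℤ.≤? x) ×-dec (x ℤ.≤? _)) (λ (p , _) →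
        <⇒≱ (*-mono-≤ (s≤s (z≤n {k + g * suc k})) 1≤α) (ℤP.drop‿+≤+ (ℤP.≤-trans p x≤0))))) (*-zeroʳ (weight (suc g) (suc k)))

    -- `g = 1` gives the main term. For `g > w` the range of `k` is the harmonic range of `g α` and
    -- `g γ`, whose sum is at most `2 F`, and the squares of `1 / g` form the tail.
    densityAt-bound : ∀ x → densityAt (+ x) ≤ F * F * Harmonic.harmonic α γ x 1≤α + 2 * F * tail w H
    densityAt-bound x = begin
      densityAt (+ x)                                                          ≤⟨ ∑-mono (suc H) (λ g g≤H → row g (≤-pred g≤H)) ⟩
      ∑ (suc H) (λ g → ⟦ g ≟ 1 ⟧ * (F * F * harm) + 2 * F * (⟦ w <? g ⟧ * (inv g * inv g)))
        ≡⟨ trans (∑-+ (suc H) _ _) (cong₂ _+_ (∑-*ʳ (suc H) (F * F * harm) _) (∑-*ˡ (suc H) (2 * F) _)) ⟩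
      count (_≟ 1) (suc H) * (F * F * harm) + 2 * F * tail w H
        ≤⟨ +-monoˡ-≤ (2 * F * tail w H) (*-monoˡ-≤ (F * F * harm) (count-unique (_≟ 1) (suc H) (λ i j i<j _ p q → <-irrefl (trans p (sym q)) i<j))) ⟩
      1 * (F * F * harm) + 2 * F * tail w H                                    ≡⟨ cong (_+ 2 * F * tail w H) (*-identityˡ _) ⟩
      F * F * harm + 2 * F * tail w H                                          ∎
      where
      open ≤-Reasoning
      harm = Harmonic.harmonic α γ x 1≤α
      sector? : ∀ g k → Dec (+ (g * k * α) ℤ.≤ + x × + x ℤ.≤ + (g * k * β))
      sector? g k = (+ (g * k * α) ℤ.≤? + x) ×-dec (+ x ℤ.≤? + (g * k * β))
      sector : ℕ → ℕ → ℕ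
      sector g k = ⟦ sector? g k ⟧
      factor : ∀ g → ∑ (suc H) (λ k → weight g k * sector g k) ≡ ⟦ rough? w g ⟧ * (inv g * inv g * ∑ (suc H) (λ k → inv k * sector g k))
      factor g = trans (∑-cong (suc H) (λ k _ → arr ⟦ rough? w g ⟧ (inv g * inv g) (inv k) (sector g k)))
        (trans (∑-*ˡ (suc H) (⟦ rough? w g ⟧ * (inv g * inv g)) (λ k → inv k * sector g k)) (*-assoc ⟦ rough? w g ⟧ (inv g * inv g) (∑ (suc H) (λ k → inv k * sector g k))))
        where
        arr : ∀ r i j s → r * (i * j) * s ≡ r * i * (j * s)
        arr = solve-∀
      reorder : ∀ g k s → g * k * s ≡ k * (g * s)
      reorder = solve-∀
      row : ∀ g → g ≤ H → ∑ (suc H) (λ k → weight g k * sector g k) ≤ ⟦ g ≟ 1 ⟧ * (F * F * harm) + 2 * F * (⟦ w <? g ⟧ * (inv g * inv g))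
      row zero    _   = ≤-trans (≤-reflexive (∑-zero (suc H) (λ k _ → cong (_* sector 0 k) (weight-0ˡ k)))) z≤n
      row g@(suc g′) g≤H = ≤-trans (≤-reflexive (factor g)) (⟦⟧-if (rough? w g) λ
        { (inj₁ g≡1) → ≤-trans (one g≡1) (m≤m+n _ _)
        ; (inj₂ w<g) → ≤-trans (far w<g) (m≤n+m _ _) })
        where
        one : g ≡ 1 → inv g * inv g * ∑ (suc H) (λ k → inv k * sector g k) ≤ ⟦ g ≟ 1 ⟧ * (F * F * harm)
        one refl = ≤-trans (*-mono-≤ (*-mono-≤ (inv≤F 1 g≤H) (inv≤F 1 g≤H)) (∑-mono (suc H) (λ k _ → *-monoʳ-≤ (inv k)
          (⟦⟧-mono (sector? 1 k) (Harmonic.in? α γ x 1≤α k) (λ (p , q) →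
             subst (λ s → s * α ≤ x) (*-identityˡ k) (ℤP.drop‿+≤+ p) , subst (λ s → x ≤ s * β) (*-identityˡ k) (ℤP.drop‿+≤+ q))))))
          (≤-reflexive (sym (*-identityˡ _)))
        far : w < g → inv g * inv g * ∑ (suc H) (λ k → inv k * sector g k) ≤ 2 * F * (⟦ w <? g ⟧ * (inv g * inv g))
        far w<g = begin
          inv g * inv g * ∑ (suc H) (λ k → inv k * sector g k)
            ≤⟨ *-monoʳ-≤ (inv g * inv g) (∑-mono (suc H) (λ k _ → *-monoʳ-≤ (inv k) (⟦⟧-mono (sector? g k) (Harmonic.in? (g * α) (g * γ) x gα≥1 k) (λ (p , q) →
                 subst (_≤ x) (reorder g k α) (ℤP.drop‿+≤+ p) , subst (x ≤_) (trans (reorder g k β) (cong (k *_) (*-distribˡ-+ g α γ))) (ℤP.drop‿+≤+ q))))) ⟩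
          inv g * inv g * Harmonic.harmonic (g * α) (g * γ) x gα≥1
            ≤⟨ *-monoʳ-≤ (inv g * inv g) (Harmonic.harmonic≤2F (g * α) (g * γ) x gα≥1 (*-monoʳ-≤ g γ≤α)) ⟩
          inv g * inv g * (2 * F)    ≡⟨ *-comm (inv g * inv g) (2 * F) ⟩
          2 * F * (inv g * inv g)    ≡⟨ cong (2 * F *_) (trans (cong (_* (inv g * inv g)) (⟦⟧-yes (w <? g) w<g)) (*-identityˡ _)) ⟨
          2 * F * (⟦ w <? g ⟧ * (inv g * inv g)) ∎
          where
          gα≥1 : 1 ≤ g * α
          gα≥1 = *-mono-≤ (s≤s (z≤n {g′})) 1≤α

    -- `main e / (w e α)` is `γ / α + 1 / e + 2 / w`: the harmonic sum, its rounding error for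
    -- differences of at least `e β`, and the tail.
    main : ℕ → ℕ
    main e = w * e * γ + w * α + 2 * e * α

    w*density : ∀ x → w * densityAt (+ x) ≤ w * (F * F * Harmonic.harmonic α γ x 1≤α) + 2 * F³
    w*density x = begin
      w * densityAt (+ x)                             ≤⟨ *-monoʳ-≤ w (densityAt-bound x) ⟩
      w * (F * F * harm + 2 * F * tail w H)           ≡⟨ arr w (F * F * harm) F (tail w H) ⟩
      w * (F * F * harm) + 2 * F * (w * tail w H)     ≤⟨ +-monoʳ-≤ (w * (F * F * harm)) (*-monoʳ-≤ (2 * F) (tail-bound w H ≤-refl)) ⟩
      w * (F * F * harm) + 2 * F * (F * F)            ≡⟨ cong (_+_ (w * (F * F * harm))) (arr′ F) ⟩
      w * (F * F * harm) + 2 * F³                     ∎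
      where
      open ≤-Reasoning
      harm = Harmonic.harmonic α γ x 1≤α
      arr : ∀ w x F t → w * (x + 2 * F * t) ≡ w * x + 2 * F * (w * t)
      arr = solve-∀
      arr′ : ∀ F → 2 * F * (F * F) ≡ 2 * (F * F * F)
      arr′ = solve-∀

    density-small : ∀ e x → w * e * α * densityAt (+ x) ≤ 4 * (w * e * α) * F³
    density-small e x = begin
      w * e * α * densityAt (+ x)                        ≡⟨ arr w e α (densityAt (+ x)) ⟩
      e * α * (w * densityAt (+ x))                      ≤⟨ *-monoʳ-≤ (e * α) (w*density x) ⟩
      e * α * (w * (F * F * harm) + 2 * F³)              ≤⟨ *-monoʳ-≤ (e * α) (+-mono-≤ (*-monoʳ-≤ w (*-monoʳ-≤ (F * F) (Harmonic.harmonic≤2F α γ x 1≤α γ≤α)))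
                                                              (*-monoˡ-≤ F³ (*-monoʳ-≤ 2 1≤w))) ⟩
      e * α * (w * (F * F * (2 * F)) + 2 * w * F³)       ≡⟨ arr′ e α w F ⟩
      4 * (w * e * α) * F³                               ∎
      where
      open ≤-Reasoning
      harm = Harmonic.harmonic α γ x 1≤α
      arr : ∀ w e α x → w * e * α * x ≡ e * α * (w * x)
      arr = solve-∀
      arr′ : ∀ e α w F → e * α * (w * (F * F * (2 * F)) + 2 * w * (F * F * F)) ≡ 4 * (w * e * α) * (F * F * F)
      arr′ = solve-∀

    density-large : ∀ e x → 1 ≤ x → e * β ≤ x → w * e * α * densityAt (+ x) ≤ F³ * main e
    density-large e x 1≤x eβ≤x = begin
      w * e * α * densityAt (+ x)                        ≡⟨ arr w e α (densityAt (+ x)) ⟩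
      e * α * (w * densityAt (+ x))                      ≤⟨ *-monoʳ-≤ (e * α) (w*density x) ⟩
      e * α * (w * (F * F * harm) + 2 * F³)              ≡⟨ arr₂ e α w F harm ⟩
      w * F * F * (e * α * harm) + 2 * e * α * F³        ≤⟨ +-monoˡ-≤ (2 * e * α * F³) (*-monoʳ-≤ (w * F * F) eα-harm) ⟩
      w * F * F * (F * (e * γ + α)) + 2 * e * α * F³     ≡⟨ arr₃ w e α γ F ⟩
      F³ * main e                                        ∎
      where
      open ≤-Reasoning
      harm = Harmonic.harmonic α γ x 1≤α
      arr : ∀ w e α x → w * e * α * x ≡ e * α * (w * x)
      arr = solve-∀
      arr₂ : ∀ e α w F k → e * α * (w * (F * F * k) + 2 * (F * F * F)) ≡ w * F * F * (e * α * k) + 2 * e * α * (F * F * F)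
      arr₂ = solve-∀
      arr₃ : ∀ w e α γ F → w * F * F * (F * (e * γ + α)) + 2 * e * α * (F * F * F) ≡ (F * F * F) * (w * e * γ + w * α + 2 * e * α)
      arr₃ = solve-∀
      arr₄ : ∀ x e α k → x * (e * α * k) ≡ e * (α * x * k)
      arr₄ = solve-∀
      arr₅ : ∀ e F γ x α b → e * (F * (γ * x + α * b)) ≡ F * (e * γ * x + α * (e * b))
      arr₅ = solve-∀
      arr₆ : ∀ e F γ x α → F * (e * γ * x + α * x) ≡ x * (F * (e * γ + α))
      arr₆ = solve-∀
      eα-harm : e * α * harm ≤ F * (e * γ + α)
      eα-harm = *-cancelˡ-≤ x ⦃ >-nonZero 1≤x ⦄ (begin
        x * (e * α * harm)                   ≡⟨ arr₄ x e α harm ⟩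
        e * (α * x * harm)                   ≤⟨ *-monoʳ-≤ e (Harmonic.harmonic-bound α γ x 1≤α) ⟩
        e * (F * (γ * x + α * β))            ≡⟨ arr₅ e F γ x α β ⟩
        F * (e * γ * x + α * (e * β))        ≤⟨ *-monoʳ-≤ F (+-monoʳ-≤ (e * γ * x) (*-monoʳ-≤ α eβ≤x)) ⟩
        F * (e * γ * x + α * x)              ≡⟨ arr₆ e F γ x α ⟩
        x * (F * (e * γ + α))                ∎)

    -- Differences up to `e β` get only the constant bound 4 (times `F³`); they are rare by `thin`.
    -- The larger ones get the bound with the correct leading term.
    density-point : ∀ e x → w * e * α * densityAt x ≤
      F³ * main e * ⟦ + 1 ℤ.≤? x ⟧ + 4 * (w * e * α) * F³ * ⟦ (+ 0 ℤ.≤? x) ×-dec (x ℤ.≤? + (e * β)) ⟧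
    density-point e -[1+ n ] = ≤-trans (≤-reflexive (trans (cong (w * e * α *_) (densityAt-nonpositive -[1+ n ] ℤ.-≤+)) (*-zeroʳ (w * e * α)))) z≤n
    density-point e (+ zero) = ≤-trans (≤-reflexive (trans (cong (w * e * α *_) (densityAt-nonpositive (+ 0) ℤP.≤-refl)) (*-zeroʳ (w * e * α)))) z≤n
    density-point e (+ suc x) with ≤-total (suc x) (e * β)
    ... | inj₁ x≤ = ≤-trans (density-small e (suc x)) (≤-trans (≤-reflexive (trans (sym (*-identityʳ _))
            (cong (4 * (w * e * α) * F³ *_) (sym (⟦⟧-yes ((+ 0 ℤ.≤? + suc x) ×-dec (+ suc x ℤ.≤? + (e * β))) (ℤ.+≤+ z≤n , ℤ.+≤+ x≤)))))) (m≤n+m _ _))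
    ... | inj₂ x≥ = ≤-trans (density-large e (suc x) (s≤s z≤n) x≥) (≤-trans (≤-reflexive (trans (sym (*-identityʳ _))
            (cong (F³ * main e *_) (sym (⟦⟧-yes (+ 1 ℤ.≤? + suc x) (ℤ.+≤+ (s≤s z≤n))))))) (m≤m+n _ _))

    positivePairs : ℕ
    positivePairs = ∑ H (λ s → pairs (suc s))

    positivePairs-bound : ∀ e s → e * β < s * s → let n = h + h₀ in
      4 * A₁ * (w * e * α) * positivePairs ≤ n * n * n * n * main e + 8 * (w * e * α) * (n * n * n * (ℤ.∣ ℓ₂ ∣ + s))
    positivePairs-bound e s eβ<s² = *-cancelˡ-≤ F³ ⦃ >-nonZero (*-mono-≤ (*-mono-≤ F≥1 F≥1) F≥1) ⦄ (begin
      F³ * (4 * A₁ * W * positivePairs)                       ≡⟨ arr F³ A₁ W positivePairs ⟩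
      2 * (W * (2 * A₁ * F³ * positivePairs))                 ≤⟨ *-monoʳ-≤ 2 (*-monoʳ-≤ W all-pairs-bound) ⟩
      2 * (W * ∑⁴ n density)                                  ≡⟨ cong (2 *_) (∑⁴-*ˡ n W density) ⟨
      2 * ∑⁴ n (λ b d c a → W * density b d c a)              ≤⟨ *-monoʳ-≤ 2 (∑⁴-mono n (λ b d c a _ _ _ _ → density-point e (Δ b d c a))) ⟩
      2 * ∑⁴ n (λ b d c a → F³ * main e * ⟦ + 1 ℤ.≤? Δ b d c a ⟧ + 4 * W * F³ * ⟦ between? (+ 0) (+ (e * β)) b d c a ⟧)
        ≡⟨ cong (2 *_) (trans (∑⁴-+ n _ _) (cong₂ _+_ (∑⁴-*ˡ n (F³ * main e) _) (∑⁴-*ˡ n (4 * W * F³) _))) ⟩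
      2 * (F³ * main e * positives n + 4 * W * F³ * Thin)     ≡⟨ arr₂ F³ (main e) (positives n) W Thin ⟩
      F³ * (2 * positives n * main e + 8 * W * Thin)          ≤⟨ *-monoʳ-≤ F³ (+-mono-≤ (*-monoˡ-≤ (main e) (positives-half n)) (*-monoʳ-≤ (8 * W) (thin n (e * β) s eβ<s²))) ⟩
      F³ * (n * n * n * n * main e + 8 * W * (n * n * n * (ℤ.∣ ℓ₂ ∣ + s))) ∎)
      where
      open ≤-Reasoning
      n = h + h₀
      W = w * e * α
      Thin = ∑⁴ n (λ b d c a → ⟦ between? (+ 0) (+ (e * β)) b d c a ⟧)
      arr : ∀ F A W p → F * (4 * A * W * p) ≡ 2 * (W * (2 * A * F * p))
      arr = solve-∀
      arr₂ : ∀ F m p W t → 2 * (F * m * p + 4 * W * F * t) ≡ F * (2 * p * m + 8 * W * t)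
      arr₂ = solve-∀

-- Second moment

amgm : ∀ x y → 2 * x * y ≤ x * x + y * y
amgm x y with ≤-total x y
... | inj₁ x≤y = subst (λ y → 2 * x * y ≤ x * x + y * y) (m+[n∸m]≡n x≤y) (≤-from 0 (z≤n {(y ∸ x) * (y ∸ x)}) (eqn x (y ∸ x)))
  where
  eqn : ∀ x d → 2 * x * (x + d) + d * d + 0 ≡ x * x + (x + d) * (x + d) + 0
  eqn = solve-∀
... | inj₂ y≤x = subst (λ x → 2 * x * y ≤ x * x + y * y) (m+[n∸m]≡n y≤x) (≤-from 0 (z≤n {(x ∸ y) * (x ∸ y)}) (eqn y (x ∸ y)))
  where
  eqn : ∀ y d → 2 * (y + d) * y + d * d + 0 ≡ (y + d) * (y + d) + y * y + 0
  eqn = solve-∀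

-- Each zero of `R` contributes `S₁²` to the sum of the squares of `n R j - S₁`. A lower bound `P`
-- takes the place of `S₁` in the hypothesis, because only that is at hand for the number of points.
chebyshev : ∀ n (R : ℕ → ℕ) E P → 1 ≤ P → P ≤ ∑ n R → E * ∑ n (λ j → R j * R j) * n ≤ (E + 1) * (P * P) →
  E * count (λ j → R j ≟ 0) n ≤ n
chebyshev n R E P 1≤P P≤S₁ second = *-cancelʳ-≤ (E * Z) n (S₁ * S₁) ⦃ >-nonZero (*-mono-≤ (≤-trans 1≤P P≤S₁) (≤-trans 1≤P P≤S₁)) ⦄
  (≤-from 0 (+-mono-≤ (*-monoʳ-≤ E summed) (*-monoʳ-≤ n (≤-trans second (*-monoʳ-≤ (E + 1) (*-mono-≤ P≤S₁ P≤S₁))))) (trans (+-identityʳ _) (eqn E Z S₁ n S₂)))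
  where
  open ≤-Reasoning
  S₁ = ∑ n R
  S₂ = ∑ n (λ j → R j * R j)
  Z = count (λ j → R j ≟ 0) n
  eqn : ∀ E Z S n T → E * Z * (S * S) + (E * (n * n * T + n * (S * S)) + n * ((E + 1) * (S * S))) ≡ n * (S * S) + (E * (Z * (S * S) + 2 * n * S * S) + n * (E * T * n))
  eqn = solve-∀
  point : ∀ j → ⟦ R j ≟ 0 ⟧ * (S₁ * S₁) + 2 * n * S₁ * R j ≤ n * n * (R j * R j) + S₁ * S₁
  point j with R j ≟ 0
  ... | yes eq rewrite eq = ≤-reflexive (arr S₁ n)
    where
    arr : ∀ s n → 1 * (s * s) + 2 * n * s * 0 ≡ n * n * 0 + s * s
    arr = solve-∀
  ... | no _ = ≤-trans (≤-reflexive (arr n S₁ (R j))) (≤-trans (amgm (n * R j) S₁) (≤-reflexive (cong (_+ S₁ * S₁) (arr′ n (R j)))))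
    where
    arr : ∀ n s r → 2 * n * s * r ≡ 2 * (n * r) * s
    arr = solve-∀
    arr′ : ∀ n r → n * r * (n * r) ≡ n * n * (r * r)
    arr′ = solve-∀
  summed : Z * (S₁ * S₁) + 2 * n * S₁ * S₁ ≤ n * n * S₂ + n * (S₁ * S₁)
  summed = begin
    Z * (S₁ * S₁) + 2 * n * S₁ * S₁                                   ≡⟨ trans (∑-+ n _ _) (cong₂ _+_ (∑-*ʳ n (S₁ * S₁) _) (∑-*ˡ n (2 * n * S₁) R)) ⟨
    ∑ n (λ j → ⟦ R j ≟ 0 ⟧ * (S₁ * S₁) + 2 * n * S₁ * R j)            ≤⟨ ∑-mono n (λ j _ → point j) ⟩
    ∑ n (λ j → n * n * (R j * R j) + S₁ * S₁)                         ≡⟨ trans (∑-+ n _ _) (cong₂ _+_ (∑-*ˡ n (n * n) _) (∑-const n (S₁ * S₁))) ⟩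
    n * n * S₂ + n * (S₁ * S₁)                                        ∎

∑-* : ∀ n m (f g : ℕ → ℕ) → ∑ n f * ∑ m g ≡ ∑ n (λ i → ∑ m (λ j → f i * g j))
∑-* n m f g = trans (sym (∑-*ʳ n (∑ m g) f)) (∑-cong n (λ i _ → sym (∑-*ˡ m (f i) g)))

shift-nonneg : ∀ x K → ℤ.∣ x ∣ ≤ K → ∃ λ m → x ℤ.+ + K ≡ + m × m ≤ 2 * K
shift-nonneg (+ n) K n≤K = n + K , sym (ℤP.pos-+ n K) , ≤-trans (+-monoˡ-≤ K n≤K) (≤-reflexive (cong (_+_ K) (sym (+-identityʳ K))))
shift-nonneg -[1+ n ] K n<K = K ∸ suc n , ℤP.⊖-≥ n<K , ≤-trans (m∸n≤m K (suc n)) (m≤m+n K (K + 0))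

module SecondMoment (ℓ₁ A₁ : ℕ) (ℓ₂ A₂ ℓ₃ A₃ : ℤ) (h Y H : ℕ) where

  open Cells ℓ₂ A₂ ℓ₃ A₃

  q₁ : ℕ → ℕ
  q₁ z = ℓ₁ * z + A₁ * z * z

  step : ℕ → ℕ → ℕ
  step u z = u * (ℓ₁ + A₁ * u + 2 * A₁ * z)

  q₁-step : ∀ z u → q₁ (z + u) ≡ q₁ z + step u z
  q₁-step z u = eqn ℓ₁ A₁ z u
    where
    eqn : ∀ l A z u → l * (z + u) + A * (z + u) * (z + u) ≡ l * z + A * z * z + u * (l + A * u + 2 * A * z)
    eqn = solve-∀

  value : ℕ → ℕ → ℕ → ℤ
  value z c a = + q₁ (Y + z) ℤ.+ (quad ℓ₂ A₂ a ℤ.+ quad ℓ₃ A₃ c)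

  -- No value on the box is smaller, since the binary part is at least `- C h²`; so the values are
  -- labelled by `j ≥ 0`.
  origin : ℤ
  origin = + q₁ Y ℤ.- + (C * (h * h))

  width : ℕ
  width = step H Y + 2 * (C * (h * h)) + 1

  R : ℕ → ℕ
  R j = ∑ H (λ z → ∑ h (λ c → ∑ h (λ a → ⟦ value z c a ℤ.≟ origin ℤ.+ + j ⟧)))

  in-window : ∀ z c a → z < H → c < h → a < h → ∃ λ j → j < width × value z c a ≡ origin ℤ.+ + j
  in-window z c a z<H c<h a<h with shift-nonneg (quad ℓ₂ A₂ a ℤ.+ quad ℓ₃ A₃ c) (C * (h * h)) bound
    where
    bound : ℤ.∣ quad ℓ₂ A₂ a ℤ.+ quad ℓ₃ A₃ c ∣ ≤ C * (h * h)
    bound = ≤-trans (ℤP.∣i+j∣≤∣i∣+∣j∣ (quad ℓ₂ A₂ a) (quad ℓ₃ A₃ c)) (≤-trans (+-mono-≤ (quad-bound ℓ₂ A₂ h a a<h) (quad-bound ℓ₃ A₃ h c c<h))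
      (≤-reflexive (sym (*-distribʳ-+ (h * h) (ℤ.∣ ℓ₂ ∣ + ℤ.∣ A₂ ∣) (ℤ.∣ ℓ₃ ∣ + ℤ.∣ A₃ ∣)))))
  ... | m , eq , m≤ = step z Y + m , ≤-trans (s≤s (+-mono-≤ step-mono m≤)) (≤-reflexive (+-comm 1 _)) , (begin
    value z c a                                                          ≡⟨ cong (λ s → + s ℤ.+ Q) (q₁-step Y z) ⟩
    + (q₁ Y + step z Y) ℤ.+ Q                                            ≡⟨ cong (ℤ._+ Q) (ℤP.pos-+ (q₁ Y) (step z Y)) ⟩
    (+ q₁ Y ℤ.+ + step z Y) ℤ.+ Q                                        ≡⟨ eqn (+ q₁ Y) (+ step z Y) Q (+ (C * (h * h))) ⟩
    origin ℤ.+ (+ step z Y ℤ.+ (Q ℤ.+ + (C * (h * h))))                   ≡⟨ cong (λ s → origin ℤ.+ (+ step z Y ℤ.+ s)) eq ⟩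
    origin ℤ.+ (+ step z Y ℤ.+ + m)                                       ≡⟨ cong (ℤ._+_ origin) (sym (ℤP.pos-+ (step z Y) m)) ⟩
    origin ℤ.+ + (step z Y + m)                                           ∎)
    where
    open ≡-Reasoning
    Q = quad ℓ₂ A₂ a ℤ.+ quad ℓ₃ A₃ c
    eqn : ∀ x s q k → (x ℤ.+ s) ℤ.+ q ≡ (x ℤ.- k) ℤ.+ (s ℤ.+ (q ℤ.+ k))
    eqn = ℤR.solve-∀
    step-mono : step z Y ≤ step H Y
    step-mono = *-mono-≤ (<⇒≤ z<H) (+-monoˡ-≤ (2 * A₁ * Y) (+-monoʳ-≤ ℓ₁ (*-monoʳ-≤ A₁ (<⇒≤ z<H))))

  first-moment : H * (h * h) ≤ ∑ width R
  first-moment = begin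
    H * (h * h)                                                   ≡⟨ cong (λ x → H * (h * x)) (sym (*-identityʳ h)) ⟩
    H * (h * (h * 1))                                             ≡⟨ trans (∑-cong H (λ _ _ → trans (∑-cong h (λ _ _ → ∑-const h 1)) (∑-const h _))) (∑-const H _) ⟨
    ∑ H (λ z → ∑ h (λ c → ∑ h (λ a → 1)))                         ≤⟨ ∑-mono H (λ z z< → ∑-mono h (λ c c< → ∑-mono h (λ a a< → once z c a z< c< a<))) ⟩
    ∑ H (λ z → ∑ h (λ c → ∑ h (λ a → ∑ width (λ j → ind z c a j)))) ≡⟨ ∑-cong H (λ z _ → ∑-cong h (λ c _ → ∑-swap h width _)) ⟩
    ∑ H (λ z → ∑ h (λ c → ∑ width (λ j → ∑ h (λ a → ind z c a j)))) ≡⟨ ∑-cong H (λ z _ → ∑-swap h width _) ⟩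
    ∑ H (λ z → ∑ width (λ j → ∑ h (λ c → ∑ h (λ a → ind z c a j)))) ≡⟨ ∑-swap H width _ ⟩
    ∑ width R                                                     ∎
    where
    open ≤-Reasoning
    ind : ℕ → ℕ → ℕ → ℕ → ℕ
    ind z c a j = ⟦ value z c a ℤ.≟ origin ℤ.+ + j ⟧
    once : ∀ z c a → z < H → c < h → a < h → 1 ≤ ∑ width (ind z c a)
    once z c a z< c< a< = let j , j< , eq = in-window z c a z< c< a<
      in ≤-trans (≤-reflexive (sym (⟦⟧-yes (value z c a ℤ.≟ origin ℤ.+ + j) eq))) (∑-term width (ind z c a) j<)

  collisions : ℕ → ℕ → ℕ
  collisions z z′ = ∑⁴ h (λ b d c a → ⟦ value z c a ℤ.≟ value z′ d b ⟧)

  positive : ℕ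
  positive = ∑ H (λ s → ∑ H (λ z → ∑⁴ h (λ b d c a → ⟦ Δ b d c a ℤ.≟ + step (suc s) (Y + z) ⟧)))

  -- Two points with equal values have the same `z`, and then Δ = 0, or a gap `suc s`; in the second
  -- case both orders of the points are bounded by the same count.
  second-moment : ∑ width (λ j → R j * R j) ≤ H * ∑⁴ h (λ b d c a → ⟦ Δ b d c a ℤ.≟ + 0 ⟧) + 2 * positive
  second-moment = begin
    ∑ width (λ j → R j * R j)
      ≡⟨ ∑-cong width (λ j _ → trans (∑-* H H _ _) (∑-cong H (λ z _ → ∑-cong H (λ z′ _ → expand j z z′)))) ⟩
    ∑ width (λ j → ∑ H (λ z → ∑ H (λ z′ → ∑⁴ h (λ b d c a → ind z c a j * ind z′ d b j))))
      ≡⟨ ∑-swap width H _ ⟩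
    ∑ H (λ z → ∑ width (λ j → ∑ H (λ z′ → ∑⁴ h (λ b d c a → ind z c a j * ind z′ d b j))))
      ≡⟨ ∑-cong H (λ z _ → ∑-swap width H _) ⟩
    ∑ H (λ z → ∑ H (λ z′ → ∑ width (λ j → ∑⁴ h (λ b d c a → ind z c a j * ind z′ d b j))))
      ≡⟨ ∑-cong H (λ z _ → ∑-cong H (λ z′ _ → ∑-∑⁴-swap width h _)) ⟩
    ∑ H (λ z → ∑ H (λ z′ → ∑⁴ h (λ b d c a → ∑ width (λ j → ind z c a j * ind z′ d b j))))
      ≤⟨ ∑-mono H (λ z _ → ∑-mono H (λ z′ _ → ∑⁴-mono h (λ b d c a _ _ _ _ → collision z z′ b d c a))) ⟩
    ∑ H (λ z → ∑ H (collisions z))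
      ≤⟨ ∑-diagonals H collisions ⟩
    ∑ H (λ z → collisions z z) + ∑ H (λ z → ∑ H (λ s → collisions (z + suc s) z)) + ∑ H (λ z → ∑ H (λ s → collisions z (z + suc s)))
      ≤⟨ +-mono-≤ (+-mono-≤ (∑-bound H _ (λ z _ → ∑⁴-mono h (λ b d c a _ _ _ _ → ⟦⟧-mono (_ ℤ.≟ _) (Δ b d c a ℤ.≟ + 0) (level z b d c a))))
           (≤-trans (≤-reflexive (∑-swap H H _)) (∑-mono H (λ s _ → ∑-mono H (λ z _ → below z s)))))
           (≤-trans (≤-reflexive (∑-swap H H _)) (∑-mono H (λ s _ → ∑-mono H (λ z _ → ∑⁴-mono h (λ b d c a _ _ _ _ → ⟦⟧-mono (_ ℤ.≟ _) (Δ b d c a ℤ.≟ _) (rise z s b d c a)))))) ⟩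
    H * ∑⁴ h (λ b d c a → ⟦ Δ b d c a ℤ.≟ + 0 ⟧) + positive + positive
      ≡⟨ arr (H * ∑⁴ h (λ b d c a → ⟦ Δ b d c a ℤ.≟ + 0 ⟧)) positive ⟩
    H * ∑⁴ h (λ b d c a → ⟦ Δ b d c a ℤ.≟ + 0 ⟧) + 2 * positive ∎
    where
    open ≤-Reasoning
    arr : ∀ x y → x + y + y ≡ x + 2 * y
    arr = solve-∀
    ind : ℕ → ℕ → ℕ → ℕ → ℕ
    ind z c a j = ⟦ value z c a ℤ.≟ origin ℤ.+ + j ⟧
    expand : ∀ j z z′ → ∑ h (λ c → ∑ h (λ a → ind z c a j)) * ∑ h (λ c → ∑ h (λ a → ind z′ c a j)) ≡ ∑⁴ h (λ b d c a → ind z c a j * ind z′ d b j)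
    expand j z z′ = ≡.begin
      X * ∑ h (λ d → ∑ h (λ b → ind z′ d b j))                        ≡.≡⟨ cong (X *_) (∑-swap h h _) ⟩
      X * ∑ h (λ b → ∑ h (λ d → ind z′ d b j))                        ≡.≡⟨ trans (sym (∑-*ˡ h X _)) (∑-cong h (λ b _ → sym (∑-*ˡ h X _))) ⟩
      ∑ h (λ b → ∑ h (λ d → X * ind z′ d b j))                        ≡.≡⟨ ∑-cong h (λ b _ → ∑-cong h (λ d _ → trans (sym (∑-*ʳ h (ind z′ d b j) _)) (∑-cong h (λ c _ → sym (∑-*ʳ h (ind z′ d b j) _))))) ⟩
      ∑⁴ h (λ b d c a → ind z c a j * ind z′ d b j)                   ≡.∎
      where
      module ≡ = ≡-Reasoning
      X = ∑ h (λ c → ∑ h (λ a → ind z c a j))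
    collision : ∀ z z′ b d c a → ∑ width (λ j → ind z c a j * ind z′ d b j) ≤ ⟦ value z c a ℤ.≟ value z′ d b ⟧
    collision z z′ b d c a = ≤-trans (≤-reflexive (∑-cong width (λ j _ → sym (⟦⟧-*-dec (value z c a ℤ.≟ origin ℤ.+ + j) (value z′ d b ℤ.≟ origin ℤ.+ + j)))))
      (count-≤ (λ j → (value z c a ℤ.≟ origin ℤ.+ + j) ×-dec (value z′ d b ℤ.≟ origin ℤ.+ + j)) (value z c a ℤ.≟ value z′ d b) width
        (λ j _ (p , q) → trans p (sym q))
        (λ i j i<j _ (p , _) (q , _) → <-irrefl (ℤP.+-injective (cancel origin (trans (sym p) q))) i<j))
      where
      cancel : ∀ s {x y} → s ℤ.+ x ≡ s ℤ.+ y → x ≡ y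
      cancel s {x} {y} e = trans (sym (eqn s x)) (trans (cong (ℤ._- s) e) (eqn s y))
        where
        eqn : ∀ s x → (s ℤ.+ x) ℤ.- s ≡ x
        eqn = ℤR.solve-∀
    difference : ∀ x y a b c d → x ℤ.+ (a ℤ.+ c) ≡ (x ℤ.+ y) ℤ.+ (b ℤ.+ d) → (a ℤ.- b) ℤ.+ (c ℤ.- d) ≡ y
    difference x y a b c d e = trans (eqn x a b c d) (trans (cong (ℤ._- (x ℤ.+ (b ℤ.+ d))) e) (eqn′ x y b d))
      where
      eqn : ∀ x a b c d → (a ℤ.- b) ℤ.+ (c ℤ.- d) ≡ (x ℤ.+ (a ℤ.+ c)) ℤ.- (x ℤ.+ (b ℤ.+ d))
      eqn = ℤR.solve-∀
      eqn′ : ∀ x y b d → ((x ℤ.+ y) ℤ.+ (b ℤ.+ d)) ℤ.- (x ℤ.+ (b ℤ.+ d)) ≡ y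
      eqn′ = ℤR.solve-∀
    level : ∀ z b d c a → value z c a ≡ value z d b → Δ b d c a ≡ + 0
    level z b d c a e = difference (+ q₁ (Y + z)) (+ 0) (quad ℓ₂ A₂ a) (quad ℓ₂ A₂ b) (quad ℓ₃ A₃ c) (quad ℓ₃ A₃ d)
      (trans e (cong (ℤ._+ (quad ℓ₂ A₂ b ℤ.+ quad ℓ₃ A₃ d)) (sym (ℤP.+-identityʳ (+ q₁ (Y + z))))))
    value-step : ∀ z s c a → value (z + suc s) c a ≡ (+ q₁ (Y + z) ℤ.+ + step (suc s) (Y + z)) ℤ.+ (quad ℓ₂ A₂ a ℤ.+ quad ℓ₃ A₃ c)
    value-step z s c a = cong (ℤ._+ (quad ℓ₂ A₂ a ℤ.+ quad ℓ₃ A₃ c))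
      (trans (cong (λ t → + q₁ t) (sym (+-assoc Y z (suc s)))) (trans (cong +_ (q₁-step (Y + z) (suc s))) (ℤP.pos-+ (q₁ (Y + z)) (step (suc s) (Y + z)))))
    rise : ∀ z s b d c a → value z c a ≡ value (z + suc s) d b → Δ b d c a ≡ + step (suc s) (Y + z)
    rise z s b d c a e = difference (+ q₁ (Y + z)) (+ step (suc s) (Y + z)) (quad ℓ₂ A₂ a) (quad ℓ₂ A₂ b) (quad ℓ₃ A₃ c) (quad ℓ₃ A₃ d) (trans e (value-step z s d b))
    below : ∀ z s → collisions (z + suc s) z ≤ ∑⁴ h (λ b d c a → ⟦ Δ b d c a ℤ.≟ + step (suc s) (Y + z) ⟧)
    below z s = ≤-trans (≤-reflexive (∑⁴-reverse h _)) (∑⁴-mono h (λ b d c a _ _ _ _ → ⟦⟧-mono (_ ℤ.≟ _) (Δ b d c a ℤ.≟ _) (λ e → rise z s b d c a (sym e))))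

-- One window

cancelˡ : ∀ k {a b} → 1 ≤ k → k * a ≤ k * b → a ≤ b
cancelˡ k {a} {b} 1≤k le = *-cancelˡ-≤ k ⦃ >-nonZero 1≤k ⦄ le

-- `l` is the ratio of `H` to `h`. The inequality gives `2 A u ≤ 2 C h / (k l)`, which is at most
-- `h₀` because `h = 16 B h₀` and `l ≥ 32 C B`.
steps-small : ∀ A C B h₀ k l u → 1 ≤ C → 1 ≤ B → 1 ≤ h₀ → 1 ≤ k → 32 * C * B ≤ l → let h = 16 * B * h₀ in
  u * (2 * A * (k * (l * h))) ≤ 2 * C * (h * h) → 2 * A * u ≤ h₀
steps-small A C B h₀ k l u 1≤C 1≤B 1≤h₀ 1≤k bound le = cancelˡ (32 * C * B) (*-mono-≤ (*-mono-≤ (s≤s (z≤n {31})) 1≤C) 1≤B)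
  (cancelˡ h (*-mono-≤ (*-mono-≤ (s≤s (z≤n {15})) 1≤B) 1≤h₀) (begin
    h * (32 * C * B * (2 * A * u))        ≤⟨ *-monoʳ-≤ h (*-monoˡ-≤ (2 * A * u) bound) ⟩
    h * (l * (2 * A * u))                 ≤⟨ m≤n*m (h * (l * (2 * A * u))) k ⦃ >-nonZero 1≤k ⦄ ⟩
    k * (h * (l * (2 * A * u)))           ≡⟨ arr A B h₀ k l u ⟩
    u * (2 * A * (k * (l * h)))           ≤⟨ le ⟩
    2 * C * (h * h)                       ≡⟨ arr′ C B h₀ ⟩
    h * (32 * C * B * h₀)                 ∎))
  where
  open ≤-Reasoning
  h = 16 * B * h₀
  arr : ∀ A B h₀ k l u → k * (16 * B * h₀ * (l * (2 * A * u))) ≡ u * (2 * A * (k * (l * (16 * B * h₀))))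
  arr = solve-∀
  arr′ : ∀ C B h₀ → 2 * C * (16 * B * h₀ * (16 * B * h₀)) ≡ 16 * B * h₀ * (32 * C * B * h₀)
  arr′ = solve-∀

correction-small : ∀ A C h h₀ → h₀ ≤ h → 8 * A * C * (h + h₀) ≤ 16 * A * C * h
correction-small A C h h₀ h₀≤h = ≤-trans (*-monoʳ-≤ (8 * A * C) (+-monoʳ-≤ h h₀≤h)) (≤-reflexive (arr A C h))
  where
  arr : ∀ A C h → 8 * A * C * (h + h) ≡ 16 * A * C * h
  arr = solve-∀

-- `γ / α` should be `1 / k`, the relative change of slope across a window of length `H` at
-- `Y = k H`. The other terms are of size `h`, and `H = B (2 + 64 C) h` keeps them within a relative
-- error `1 / B`.
ratio-bound : ∀ A C B h h₀ k l₁ ε α → 1 ≤ A → 1 ≤ B → 1 ≤ k → h₀ ≤ h → l₁ ≤ h → ε ≤ 16 * A * C * h →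
  let λ′ = B * (2 + 64 * C) ; H = λ′ * h ; γ = l₁ + h₀ + 2 * A * H + 2 * ε in
  2 * A * (k * H) ≡ α + ε → k * γ * B ≤ (B + 1) * α
ratio-bound A C B h h₀ k l₁ ε α 1≤A 1≤B 1≤k h₀≤h l₁≤h ε≤ α-eq = +-cancelʳ-≤ ((B + 1) * ε) _ _ (begin
  k * γ * B + (B + 1) * ε
    ≤⟨ +-mono-≤ (*-monoˡ-≤ B (*-monoʳ-≤ k (+-mono-≤ (+-monoˡ-≤ (2 * A * H) (+-mono-≤ (≤-trans l₁≤h (m≤n*m h A ⦃ >-nonZero 1≤A ⦄)) (≤-trans h₀≤h (m≤n*m h A ⦃ >-nonZero 1≤A ⦄)))) (*-monoʳ-≤ 2 ε≤))))
                (≤-trans (*-monoʳ-≤ (B + 1) ε≤) (≤-trans (*-monoˡ-≤ (16 * A * C * h) (+-monoʳ-≤ B 1≤B)) (m≤n*m _ k ⦃ >-nonZero 1≤k ⦄))) ⟩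
  k * (A * h + A * h + 2 * A * H + 2 * (16 * A * C * h)) * B + k * ((B + B) * (16 * A * C * h))
    ≤⟨ ≤-from (2 * (A * B * k * h) + 64 * (A * B * C * k * h)) (z≤n {0}) (arr A C B h k) ⟩
  (B + 1) * (2 * A * (k * H))             ≡⟨ cong ((B + 1) *_) α-eq ⟩
  (B + 1) * (α + ε)                       ≡⟨ *-distribˡ-+ (B + 1) α ε ⟩
  (B + 1) * α + (B + 1) * ε               ∎)
  where
  open ≤-Reasoning
  H = B * (2 + 64 * C) * h
  γ = l₁ + h₀ + 2 * A * H + 2 * ε
  arr : ∀ A C B h k → k * (A * h + A * h + 2 * A * (B * (2 + 64 * C) * h) + 2 * (16 * A * C * h)) * B + k * ((B + B) * (16 * A * C * h)) + 0
      + (2 * (A * B * k * h) + 64 * (A * B * C * k * h)) ≡ (B + 1) * (2 * A * (k * (B * (2 + 64 * C) * h))) + 0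
  arr = solve-∀

-- `n / h` is `1 + 1 / (16 B)`; the lower binomial coefficients 4, 6, 4, 1 add up to 15, which is
-- less than 16.
fourth-power : ∀ B h₀ → 1 ≤ B → let h = 16 * B * h₀ ; n = h + h₀ in n * n * n * n * B ≤ (B + 1) * (h * h * h * h)
fourth-power B h₀ 1≤B = begin
  n * n * n * n * B                                                         ≡⟨ arr h h₀ B ⟩
  B * (h * h * h * h) + h₀ * B * (4 * (h * h * h) + 6 * (h * h * h₀) + 4 * (h * h₀ * h₀) + h₀ * h₀ * h₀)
    ≤⟨ +-monoʳ-≤ (B * (h * h * h * h)) (*-monoʳ-≤ (h₀ * B) (+-mono-≤ (+-mono-≤ (+-monoʳ-≤ (4 * (h * h * h)) (*-monoʳ-≤ 6 (*-monoʳ-≤ (h * h) h₀≤h)))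
         (*-monoʳ-≤ 4 (*-mono-≤ (*-monoʳ-≤ h h₀≤h) h₀≤h))) (*-mono-≤ (*-mono-≤ h₀≤h h₀≤h) h₀≤h))) ⟩
  B * (h * h * h * h) + h₀ * B * (4 * (h * h * h) + 6 * (h * h * h) + 4 * (h * h * h) + h * h * h)
    ≤⟨ ≤-from (h₀ * B * (h * h * h)) (z≤n {0}) (arr′ (B * (h * h * h * h)) h₀ B (h * h * h)) ⟩
  B * (h * h * h * h) + h * h * h * h                                       ≡⟨ arr″ B (h * h * h * h) ⟩
  (B + 1) * (h * h * h * h)                                                 ∎
  where
  open ≤-Reasoning
  h = 16 * B * h₀
  n = h + h₀
  h₀≤h : h₀ ≤ h
  h₀≤h = m≤n*m h₀ (16 * B) ⦃ >-nonZero (*-mono-≤ (s≤s (z≤n {15})) 1≤B) ⦄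
  arr : ∀ h h₀ B → (h + h₀) * (h + h₀) * (h + h₀) * (h + h₀) * B ≡ B * (h * h * h * h) + h₀ * B * (4 * (h * h * h) + 6 * (h * h * h₀) + 4 * (h * h₀ * h₀) + h₀ * h₀ * h₀)
  arr = solve-∀
  arr′ : ∀ x h₀ B c → x + h₀ * B * (4 * c + 6 * c + 4 * c + c) + 0 + h₀ * B * c ≡ x + c * (16 * B * h₀) + 0
  arr′ = solve-∀
  arr″ : ∀ B x → B * x + x ≡ (B + 1) * x
  arr″ = solve-∀

-- With `B₁ = 8 B` the main term loses `3 / B₁` (ratio of slopes, `1 / e` for `e = k B₁`, and
-- `2 / w`), the enlarged box `1 / B₁` and the thin set `1 / B₁`. Multiplied out, the loss stays
-- below `1 / B`.
positive-share : ∀ A B k w α γ n⁴ h⁴ N T → 1 ≤ B → 1 ≤ k → 1 ≤ w → 1 ≤ α →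
  let B₁ = 8 * B ; e = k * B₁ in
  2 * k * B₁ ≤ w → k * γ * B₁ ≤ (B₁ + 1) * α → n⁴ * B₁ ≤ (B₁ + 1) * h⁴ → 8 * k * B₁ * T ≤ h⁴ →
  4 * A * (w * e * α) * N ≤ n⁴ * (w * e * γ + w * α + 2 * e * α) + 8 * (w * e * α) * T →
  4 * A * k * B * N ≤ (B + 1) * h⁴
positive-share A B k w α γ n⁴ h⁴ N T 1≤B 1≤k 1≤w 1≤α w-large γ-small n-small T-small base =
  cancelˡ (64 * B) (*-mono-≤ (s≤s (z≤n {63})) 1≤B) (cancelˡ W W≥1 (begin
    W * (64 * B * (4 * A * k * B * N))                      ≡⟨ arr₁ A B k W N ⟩
    k * B₁ * B₁ * (4 * A * W * N)                           ≤⟨ *-monoʳ-≤ (k * B₁ * B₁) base ⟩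
    k * B₁ * B₁ * (n⁴ * main + 8 * W * T)                   ≡⟨ arr₂ k B₁ n⁴ main W T ⟩
    n⁴ * B₁ * (k * main * B₁) + W * B₁ * (8 * k * B₁ * T)   ≤⟨ +-mono-≤ (*-mono-≤ n-small main-small) (*-monoʳ-≤ (W * B₁) T-small) ⟩
    (B₁ + 1) * h⁴ * ((B₁ + 3) * W) + W * B₁ * h⁴            ≤⟨ ≤-from 0 (*-monoʳ-≤ (3 * (W * h⁴)) 1≤B) (arr₃ B h⁴ W) ⟩
    W * ((64 * (B * B) + 43 * B) * h⁴)                      ≤⟨ ≤-from (21 * (W * B * h⁴)) (z≤n {0}) (arr₄ B h⁴ W) ⟩
    W * (64 * B * ((B + 1) * h⁴))                           ∎))
  where
  open ≤-Reasoning
  B₁ = 8 * B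
  e = k * B₁
  W = w * e * α
  main = w * e * γ + w * α + 2 * e * α
  W≥1 : 1 ≤ W
  W≥1 = *-mono-≤ (*-mono-≤ 1≤w (*-mono-≤ 1≤k (*-mono-≤ (s≤s (z≤n {7})) 1≤B))) 1≤α
  main-small : k * main * B₁ ≤ (B₁ + 3) * W
  main-small = begin
    k * main * B₁                                                   ≡⟨ m₁ k B₁ w γ α ⟩
    w * e * (k * γ * B₁) + W + e * α * (2 * k * B₁)                 ≤⟨ +-mono-≤ (+-monoˡ-≤ W (*-monoʳ-≤ (w * e) γ-small)) (*-monoʳ-≤ (e * α) w-large) ⟩
    w * e * ((B₁ + 1) * α) + W + e * α * w                          ≡⟨ m₂ w e B₁ α ⟩
    (B₁ + 3) * W                                                    ∎
    where
    m₁ : ∀ k B w γ α → k * (w * (k * B) * γ + w * α + 2 * (k * B) * α) * B ≡ w * (k * B) * (k * γ * B) + w * (k * B) * α + k * B * α * (2 * k * B)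
    m₁ = solve-∀
    m₂ : ∀ w e B α → w * e * ((B + 1) * α) + w * e * α + e * α * w ≡ (B + 3) * (w * e * α)
    m₂ = solve-∀
  arr₁ : ∀ A B k W N → W * (64 * B * (4 * A * k * B * N)) ≡ k * (8 * B) * (8 * B) * (4 * A * W * N)
  arr₁ = solve-∀
  arr₂ : ∀ k B n m W T → k * B * B * (n * m + 8 * W * T) ≡ n * B * (k * m * B) + W * B * (8 * k * B * T)
  arr₂ = solve-∀
  arr₃ : ∀ B h W → (8 * B + 1) * h * ((8 * B + 3) * W) + W * (8 * B) * h + 3 * (W * h) * B + 0 ≡ W * ((64 * (B * B) + 43 * B) * h) + 3 * (W * h) * 1
  arr₃ = solve-∀
  arr₄ : ∀ B h W → W * ((64 * (B * B) + 43 * B) * h) + 0 + 21 * (W * B * h) ≡ W * (64 * B * ((B + 1) * h)) + 0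
  arr₄ = solve-∀

-- The thin set has at most `16 h³ t` quadruples, and `h = 16 B δ t` with `δ ≥ 8 k` makes this at
-- most `h⁴ / (8 k B)`.
thin-share : ∀ B k L t δ → L ≤ t → 8 * k ≤ δ → let h₀ = δ * t ; h = 16 * B * h₀ ; n = h + h₀ in 1 ≤ B →
  8 * k * B * (n * n * n * (L + t)) ≤ h * h * h * h
thin-share B k L t δ L≤t 8k≤δ 1≤B = begin
  8 * k * B * (n * n * n * (L + t))               ≤⟨ *-monoʳ-≤ (8 * k * B) (*-mono-≤ (*-mono-≤ (*-mono-≤ n≤ n≤) n≤) (+-monoˡ-≤ t L≤t)) ⟩
  8 * k * B * ((h + h) * (h + h) * (h + h) * (t + t))   ≡⟨ arr k B h t ⟩
  h * h * h * (16 * B * t * (8 * k))              ≤⟨ *-monoʳ-≤ (h * h * h) (*-monoʳ-≤ (16 * B * t) 8k≤δ) ⟩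
  h * h * h * (16 * B * t * δ)                    ≡⟨ cong (h * h * h *_) (arr′ B t δ) ⟩
  h * h * h * h                                   ∎
  where
  open ≤-Reasoning
  h₀ = δ * t
  h = 16 * B * h₀
  n = h + h₀
  n≤ : n ≤ h + h
  n≤ = +-monoʳ-≤ h (m≤n*m h₀ (16 * B) ⦃ >-nonZero (*-mono-≤ (s≤s (z≤n {15})) 1≤B) ⦄)
  arr : ∀ k B h t → 8 * k * B * ((h + h) * (h + h) * (h + h) * (t + t)) ≡ h * h * h * (16 * B * t * (8 * k))
  arr = solve-∀
  arr′ : ∀ B t δ → 16 * B * t * δ ≡ 16 * B * (δ * t)
  arr′ = solve-∀

-- For large `t` the zero differences number at most `6 h³ / δ`; the factor `A K B l` in `δ` is
-- chosen to make this negligible.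
zeros-share : ∀ A a B E₄ k K l t δ zeros → 1 ≤ E₄ → k ≤ K → δ ≡ 16 * A * K * B * l → 1 + a * (δ * δ * δ) ≤ t → let h = E₄ * (δ * t) in
  zeros ≤ h * h * (2 + 2 * (a * (δ * δ * δ) + 2 * (E₄ * t))) → zeros * (l * h) * (2 * A * k * B) ≤ h * h * h * h
zeros-share A a B E₄ k K l t δ zeros 1≤E₄ k≤K δ-eq t-large bound = begin
  zeros * (l * h) * (2 * A * k * B)
    ≤⟨ *-monoˡ-≤ (2 * A * k * B) (*-monoˡ-≤ (l * h) (≤-trans bound (*-monoʳ-≤ (h * h) inner))) ⟩
  h * h * (6 * (E₄ * t)) * (l * h) * (2 * A * k * B)        ≡⟨ arr h E₄ t l A k B ⟩
  h * h * h * (E₄ * t * (12 * A * k * B * l))               ≤⟨ *-monoʳ-≤ (h * h * h) (*-monoʳ-≤ (E₄ * t) factor) ⟩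
  h * h * h * (E₄ * t * δ)                                  ≡⟨ cong (h * h * h *_) (arr′ E₄ t δ) ⟩
  h * h * h * h                                             ∎
  where
  open ≤-Reasoning
  h = E₄ * (δ * t)
  s = a * (δ * δ * δ)
  t≤ : t ≤ E₄ * t
  t≤ = m≤n*m t E₄ ⦃ >-nonZero 1≤E₄ ⦄
  inner : 2 + 2 * (s + 2 * (E₄ * t)) ≤ 6 * (E₄ * t)
  inner = ≤-from 0 (*-monoʳ-≤ 2 (≤-trans t-large t≤)) (arr″ s (E₄ * t))
    where
    arr″ : ∀ s x → 2 + 2 * (s + 2 * x) + 2 * x + 0 ≡ 6 * x + 2 * (1 + s)
    arr″ = solve-∀
  factor : 12 * A * k * B * l ≤ δ
  factor = ≤-trans (*-monoˡ-≤ l (*-monoˡ-≤ B (*-mono-≤ (*-monoˡ-≤ A {12} {16} (m≤m+n 12 4)) k≤K))) (≤-reflexive (sym δ-eq))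
  arr : ∀ h E t l A k B → h * h * (6 * (E * t)) * (l * h) * (2 * A * k * B) ≡ h * h * h * (E * t * (12 * A * k * B * l))
  arr = solve-∀
  arr′ : ∀ E t δ → E * t * δ ≡ E * (δ * t)
  arr′ = solve-∀

-- The leading term of the width is `2 A k H²`. Each of the four others is at most `A H²`, so
-- `k ≥ 2 B` makes them a proportion of at most `1 / B`.
width-share : ∀ A B C k l l₁ h → 1 ≤ A → 1 ≤ l → 1 ≤ h → 2 * B ≤ k → l₁ ≤ h → 2 * C ≤ l → let H = l * h ; Y = k * H in
  (H * (l₁ + A * H + 2 * A * Y) + 2 * (C * (h * h)) + 1) * B ≤ (B + 1) * (2 * A * k * (H * H))
width-share A B C k l l₁ h 1≤A 1≤l 1≤h 2B≤k l₁≤h 2C≤l = begin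
  (H * (l₁ + A * H + 2 * A * Y) + 2 * (C * (h * h)) + 1) * B   ≡⟨ arr₁ A B C k H l₁ h ⟩
  (H * l₁ + A * (H * H) + 2 * C * (h * h) + 1) * B + B * (2 * A * k * (H * H))
    ≤⟨ +-monoˡ-≤ (B * (2 * A * k * (H * H))) (≤-trans (*-monoˡ-≤ B (+-mono-≤ (+-mono-≤ (+-monoˡ-≤ (A * (H * H)) x₁) x₂) x₃)) (≤-trans (≤-reflexive (arr₂ A B H)) (*-monoˡ-≤ (2 * A * (H * H)) 2B≤k))) ⟩
  k * (2 * A * (H * H)) + B * (2 * A * k * (H * H))            ≡⟨ arr₃ A B k H ⟩
  (B + 1) * (2 * A * k * (H * H))                              ∎
  where
  open ≤-Reasoning
  H = l * h
  Y = k * H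
  h≤H : h ≤ H
  h≤H = m≤n*m h l ⦃ >-nonZero 1≤l ⦄
  grow : H * H ≤ A * (H * H)
  grow = m≤n*m (H * H) A ⦃ >-nonZero 1≤A ⦄
  x₁ : H * l₁ ≤ A * (H * H)
  x₁ = ≤-trans (*-monoʳ-≤ H (≤-trans l₁≤h h≤H)) grow
  x₂ : 2 * C * (h * h) ≤ A * (H * H)
  x₂ = ≤-trans (≤-trans (*-monoˡ-≤ (h * h) 2C≤l) (≤-trans (≤-reflexive (sym (*-assoc l h h))) (*-monoʳ-≤ H h≤H))) grow
  x₃ : 1 ≤ A * (H * H)
  x₃ = ≤-trans (*-mono-≤ (≤-trans 1≤h h≤H) (≤-trans 1≤h h≤H)) grow
  arr₁ : ∀ A B C k H l₁ h → (H * (l₁ + A * H + 2 * A * (k * H)) + 2 * (C * (h * h)) + 1) * B ≡ (H * l₁ + A * (H * H) + 2 * C * (h * h) + 1) * B + B * (2 * A * k * (H * H))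
  arr₁ = solve-∀
  arr₂ : ∀ A B H → (A * (H * H) + A * (H * H) + A * (H * H) + A * (H * H)) * B ≡ 2 * B * (2 * A * (H * H))
  arr₂ = solve-∀
  arr₃ : ∀ A B k H → k * (2 * A * (H * H)) + B * (2 * A * k * (H * H)) ≡ (B + 1) * (2 * A * k * (H * H))
  arr₃ = solve-∀

-- The collisions exceed their expected number by a factor of at most `1 + 2 / B`, the width its
-- leading term by at most `1 + 1 / B`; for `B = 4 E` the product is at most `1 + 1 / E`.
variance-small : ∀ A E k h H h⁴ zeros N S width → 1 ≤ A → 1 ≤ E → 1 ≤ k → h⁴ ≡ h * h * (h * h) → let B = 4 * E in
  S ≤ H * zeros + 2 * N → 4 * A * k * B * N ≤ (B + 1) * h⁴ → zeros * H * (2 * A * k * B) ≤ h⁴ →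
  width * B ≤ (B + 1) * (2 * A * k * (H * H)) → E * S * width ≤ (E + 1) * (H * (h * h) * (H * (h * h)))
variance-small A E k h H h⁴ zeros N S width 1≤A 1≤E 1≤k h⁴-eq S≤ N-share zeros-sh width-sh =
  cancelˡ (B * B * (2 * A * k)) (*-mono-≤ (*-mono-≤ B≥1 B≥1) (*-mono-≤ (*-mono-≤ (s≤s (z≤n {1})) 1≤A) 1≤k)) (begin
    B * B * (2 * A * k) * (E * S * width)                              ≡⟨ arr₁ B A k E S width ⟩
    E * (S * (2 * A * k * B)) * (width * B)                            ≤⟨ *-mono-≤ (*-monoʳ-≤ E S-share) width-sh ⟩
    E * ((B + 2) * h⁴) * ((B + 1) * (2 * A * k * (H * H)))             ≡⟨ arr₂ E A k h⁴ (H * H) ⟩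
    2 * A * k * (E * (16 * E * E + 12 * E + 2)) * (h⁴ * (H * H))       ≤⟨ *-monoˡ-≤ (h⁴ * (H * H)) (*-monoʳ-≤ (2 * A * k) cubic) ⟩
    2 * A * k * ((E + 1) * (B * B)) * (h⁴ * (H * H))                   ≡⟨ cong (λ x → 2 * A * k * ((E + 1) * (B * B)) * (x * (H * H))) h⁴-eq ⟩
    2 * A * k * ((E + 1) * (B * B)) * (h * h * (h * h) * (H * H))      ≡⟨ arr₃ A k E B h H ⟩
    B * B * (2 * A * k) * ((E + 1) * (H * (h * h) * (H * (h * h))))    ∎)
  where
  open ≤-Reasoning
  B = 4 * E
  B≥1 : 1 ≤ B
  B≥1 = *-mono-≤ (s≤s (z≤n {3})) 1≤E
  S-share : S * (2 * A * k * B) ≤ (B + 2) * h⁴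
  S-share = begin
    S * (2 * A * k * B)                                        ≤⟨ *-monoˡ-≤ (2 * A * k * B) S≤ ⟩
    (H * zeros + 2 * N) * (2 * A * k * B)                      ≡⟨ s₁ H zeros N A k B ⟩
    zeros * H * (2 * A * k * B) + 4 * A * k * B * N            ≤⟨ +-mono-≤ zeros-sh N-share ⟩
    h⁴ + (B + 1) * h⁴                                          ≡⟨ s₂ B h⁴ ⟩
    (B + 2) * h⁴                                               ∎
    where
    s₁ : ∀ H z N A k B → (H * z + 2 * N) * (2 * A * k * B) ≡ z * H * (2 * A * k * B) + 4 * A * k * B * N
    s₁ = solve-∀
    s₂ : ∀ B x → x + (B + 1) * x ≡ (B + 2) * x
    s₂ = solve-∀
  cubic : E * (16 * E * E + 12 * E + 2) ≤ (E + 1) * (B * B)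
  cubic = ≤-from (2 * (E * E)) (*-monoʳ-≤ (2 * E) 1≤E) (c E)
    where
    c : ∀ E → E * (16 * E * E + 12 * E + 2) + 2 * E * E + 2 * (E * E) ≡ (E + 1) * (4 * E * (4 * E)) + 2 * E * 1
    c = solve-∀
  arr₁ : ∀ B A k E S w → B * B * (2 * A * k) * (E * S * w) ≡ E * (S * (2 * A * k * B)) * (w * B)
  arr₁ = solve-∀
  arr₂ : ∀ E A k x y → E * ((4 * E + 2) * x) * ((4 * E + 1) * (2 * A * k * y)) ≡ 2 * A * k * (E * (16 * E * E + 12 * E + 2)) * (x * y)
  arr₂ = solve-∀
  arr₃ : ∀ A k E B h H → 2 * A * k * ((E + 1) * (B * B)) * (h * h * (h * h) * (H * H)) ≡ B * B * (2 * A * k) * ((E + 1) * (H * (h * h) * (H * (h * h))))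
  arr₃ = solve-∀

-- Almost every integer is represented

∑-witness : ∀ n (f : ℕ → ℕ) → 1 ≤ ∑ n f → ∃ λ i → i < n × 1 ≤ f i
∑-witness (suc n) f pos with f n in eq
... | suc _ = n , ≤-refl , subst (1 ≤_) (sym eq) (s≤s z≤n)
... | zero  = let i , i<n , p = ∑-witness n f (subst (1 ≤_) (+-identityʳ _) pos) in i , m<n⇒m<1+n i<n , p

⟦⟧-witness : ∀ {P : Set} (P? : Dec P) → 1 ≤ ⟦ P? ⟧ → P
⟦⟧-witness (yes p) _ = p

-- `r` is the integer part of the square root of `T / G`.
scaled-root : ∀ G T → 1 ≤ G → ∃ λ r → G * (r * r) ≤ T × T < G * (suc r * suc r)
scaled-root G zero    1≤G = 0 , ≤-reflexive (*-zeroʳ G) , ≤-trans 1≤G (≤-reflexive (sym (*-identityʳ G)))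
scaled-root G (suc T) 1≤G with scaled-root G T 1≤G
... | r , lo , hi with suc T <? G * (suc r * suc r)
...   | yes hi′ = r , ≤-trans lo (n≤1+n T) , hi′
...   | no ¬hi  = suc r , ≮⇒≥ ¬hi , ≤-<-trans hi (*-monoʳ-< G ⦃ >-nonZero 1≤G ⦄ (*-mono-< (n<1+n (suc r)) (n<1+n (suc r))))

module Representation (ℓ₁ A₁ : ℕ) (ℓ₂ A₂ ℓ₃ A₃ : ℤ) (w : ℕ) (1≤A₁ : 1 ≤ A₁) (coℓ : Coprime ℤ.∣ ℓ₂ ∣ ℤ.∣ A₂ ∣)
  (rough : ∀ g → Coprime g ℤ.∣ A₂ ∣ → Coprime g 2 × Coprime g A₁ × Coprime g ℤ.∣ A₃ ∣ × Rough w g)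
  (A₂≢0 : A₂ ≢ + 0) (A₃≢0 : A₃ ≢ + 0) where

  open PositivePairs ℓ₁ A₁ ℓ₂ A₂ ℓ₃ A₃ w 1≤A₁ coℓ rough A₂≢0 A₃≢0

  Represented : ℤ → Set
  Represented x = ∃ λ z → ∃ λ c → ∃ λ a → x ≡ + (ℓ₁ * z + A₁ * z * z) ℤ.+ (quad ℓ₂ A₂ a ℤ.+ quad ℓ₃ A₃ c)

  1≤C : 1 ≤ C
  1≤C = ≤-trans (abs-pos A₂≢0) (≤-trans (m≤n+m ℤ.∣ A₂ ∣ ℤ.∣ ℓ₂ ∣) (m≤m+n _ _))

  module Scale (E K₁ : ℕ) (1≤E : 1 ≤ E) (1≤K₁ : 1 ≤ K₁) (w-large : 2 * K₁ * (8 * (4 * E)) ≤ w) where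

    -- The remaining free parameter is `t`, to which `h₀`, `h` and `H` are proportional. `1 / B` is
    -- the loss allowed in the variance, `1 / B₁` that in each part of the collision count, and
    -- `ratio` is `H / h`. `δ` makes the zero differences negligible; `t₀` makes `t` exceed `ℓ₁`,
    -- `∣ ℓ₂ ∣`, the term `∣ A₃ ∣ δ³` and the constant in `gap`.
    B B₁ ratio δ t₀ : ℕ
    B     = 4 * E
    B₁    = 8 * B
    ratio = B₁ * (2 + 64 * C)
    δ     = 16 * A₁ * K₁ * B * ratio
    t₀    = ℓ₁ + ℤ.∣ ℓ₂ ∣ + (1 + ℤ.∣ A₃ ∣ * (δ * δ * δ)) + suc (64 * (A₁ * (K₁ * K₁) * (B₁ * B₁) * ratio * δ))

    1≤B : 1 ≤ B
    1≤B = *-mono-≤ (s≤s (z≤n {3})) 1≤E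

    1≤B₁ : 1 ≤ B₁
    1≤B₁ = *-mono-≤ (s≤s (z≤n {7})) 1≤B

    1≤ratio : 1 ≤ ratio
    1≤ratio = *-mono-≤ 1≤B₁ (s≤s (z≤n {1 + 64 * C}))

    1≤δ : 1 ≤ δ
    1≤δ = *-mono-≤ (*-mono-≤ (*-mono-≤ (*-mono-≤ (s≤s (z≤n {15})) 1≤A₁) 1≤K₁) 1≤B) 1≤ratio

    1≤w : 1 ≤ w
    1≤w = ≤-trans (*-mono-≤ (*-mono-≤ (s≤s (z≤n {1})) 1≤K₁) 1≤B₁) w-large

    module At (t : ℕ) (t₀≤t : t₀ ≤ t) where

      h₀ h H : ℕ
      h₀ = δ * t
      h  = 16 * B₁ * h₀
      H  = ratio * h

      1≤t : 1 ≤ t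
      1≤t = ≤-trans (≤-trans (s≤s z≤n) (m≤n+m _ (ℓ₁ + ℤ.∣ ℓ₂ ∣ + (1 + ℤ.∣ A₃ ∣ * (δ * δ * δ))))) t₀≤t

      1≤h₀ : 1 ≤ h₀
      1≤h₀ = *-mono-≤ 1≤δ 1≤t

      h₀≤h : h₀ ≤ h
      h₀≤h = m≤n*m h₀ (16 * B₁) ⦃ >-nonZero (*-mono-≤ (s≤s (z≤n {15})) 1≤B₁) ⦄

      t≤h : t ≤ h
      t≤h = ≤-trans (m≤n*m t δ ⦃ >-nonZero 1≤δ ⦄) h₀≤h

      h≤H : h ≤ H
      h≤H = m≤n*m h ratio ⦃ >-nonZero 1≤ratio ⦄

      ℓ₁≤t : ℓ₁ ≤ t
      ℓ₁≤t = ≤-trans (≤-trans (m≤m+n ℓ₁ ℤ.∣ ℓ₂ ∣) (≤-trans (m≤m+n _ _) (m≤m+n _ _))) t₀≤t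

      ℓ₂≤t : ℤ.∣ ℓ₂ ∣ ≤ t
      ℓ₂≤t = ≤-trans (≤-trans (m≤n+m ℤ.∣ ℓ₂ ∣ ℓ₁) (≤-trans (m≤m+n _ _) (m≤m+n _ _))) t₀≤t

      ℓ₁≤h : ℓ₁ ≤ h
      ℓ₁≤h = ≤-trans ℓ₁≤t t≤h

      1≤h : 1 ≤ h
      1≤h = ≤-trans 1≤h₀ h₀≤h

      module At-k (k : ℕ) (2B≤k : 2 * B ≤ k) (k≤K₁ : k ≤ K₁) where

        -- `α` is the least slope `2 A₁ Y` lowered by the cell variation `ε`; `γ` collects
        -- everything that raises the largest slope above `α`, so `ε` occurs in it twice.
        Y ε α γ : ℕ
        Y = k * H
        ε = 8 * A₁ * C * (h + h₀)
        α = 2 * A₁ * Y ∸ ε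
        γ = ℓ₁ + h₀ + 2 * A₁ * H + 2 * ε

        2≤k : 2 ≤ k
        2≤k = ≤-trans (*-monoʳ-≤ 2 1≤B) 2B≤k

        1≤k : 1 ≤ k
        1≤k = ≤-trans (s≤s z≤n) 2≤k

        32CB₁≤ratio : 32 * C * B₁ ≤ ratio
        32CB₁≤ratio = ≤-from (B₁ * (2 + 32 * C)) (z≤n {0}) (arr C B₁)
          where
          arr : ∀ C B → 32 * C * B + 0 + B * (2 + 32 * C) ≡ B * (2 + 64 * C) + 0
          arr = solve-∀

        ε≤ : ε ≤ 16 * A₁ * C * h
        ε≤ = correction-small A₁ C h h₀ h₀≤h

        ε≤2A₁Y : ε ≤ 2 * A₁ * Y
        ε≤2A₁Y = begin
          ε                          ≤⟨ ε≤ ⟩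
          16 * A₁ * C * h            ≤⟨ ≤-from (16 * A₁ * C * h) (z≤n {0}) (arr A₁ C h) ⟩
          A₁ * (32 * C) * h          ≤⟨ *-monoˡ-≤ h (*-monoʳ-≤ A₁ (≤-trans (m≤m*n (32 * C) B₁ ⦃ >-nonZero 1≤B₁ ⦄) 32CB₁≤ratio)) ⟩
          A₁ * ratio * h             ≡⟨ *-assoc A₁ ratio h ⟩
          A₁ * H                     ≤⟨ *-mono-≤ (m≤n*m A₁ 2) (m≤n*m H k ⦃ >-nonZero 1≤k ⦄) ⟩
          2 * A₁ * Y                 ∎
          where
          open ≤-Reasoning
          arr : ∀ A C h → 16 * A * C * h + 0 + 16 * A * C * h ≡ A * (32 * C) * h + 0
          arr = solve-∀

        α-eq : 2 * A₁ * Y ≡ α + ε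
        α-eq = sym (m∸n+n≡m ε≤2A₁Y)

        γ-eq : ℓ₁ + h₀ + 2 * A₁ * (Y + H) + 8 * A₁ * C * (h + h₀) ≡ α + γ
        γ-eq = trans (split ℓ₁ h₀ A₁ Y H ε) (trans (cong (λ s → ℓ₁ + h₀ + s + 2 * A₁ * H + ε) α-eq) (join ℓ₁ h₀ α ε (2 * A₁ * H)))
          where
          split : ∀ l h A Y H e → l + h + 2 * A * (Y + H) + e ≡ l + h + 2 * A * Y + 2 * A * H + e
          split = solve-∀
          join : ∀ l h α e x → l + h + (α + e) + x + e ≡ α + (l + h + x + 2 * e)
          join = solve-∀

        ratio-small : k * γ * B₁ ≤ (B₁ + 1) * α
        ratio-small = ratio-bound A₁ C B₁ h h₀ k ℓ₁ ε α 1≤A₁ 1≤B₁ 1≤k h₀≤h ℓ₁≤h ε≤ α-eq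

        γ≤α : γ ≤ α
        γ≤α = cancelˡ (B₁ + 1) (m≤n+m 1 B₁) (≤-trans (≤-trans (*-monoˡ-≤ γ grow) (≤-reflexive (arr k γ B₁))) ratio-small)
          where
          grow : B₁ + 1 ≤ k * B₁
          grow = ≤-trans (+-monoʳ-≤ B₁ 1≤B₁) (≤-trans (≤-reflexive (cong (_+_ B₁) (sym (+-identityʳ B₁)))) (*-monoˡ-≤ B₁ 2≤k))
          arr : ∀ k γ B → k * B * γ ≡ k * γ * B
          arr = solve-∀

        1≤γ : 1 ≤ γ
        1≤γ = ≤-trans 1≤h₀ (≤-trans (m≤n+m h₀ ℓ₁) (≤-trans (m≤m+n _ _) (m≤m+n _ _)))

        1≤α : 1 ≤ α
        1≤α = ≤-trans 1≤γ γ≤α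

        open Count h h₀ Y H (λ u → steps-small A₁ C B₁ h₀ k ratio u 1≤C 1≤B₁ 1≤h₀ 1≤k 32CB₁≤ratio) α γ 1≤α α-eq γ-eq γ≤α 1≤w
          using (positivePairs-bound; positivePairs; β)
        open SecondMoment ℓ₁ A₁ ℓ₂ A₂ ℓ₃ A₃ h Y H public

        -- The left side is bounded linearly in `t`, since `γ ≤ α ≤ 2 A₁ k H` and `H` is a multiple
        -- of `t`; `t₀` contains the constant.
        gap : k * B₁ * β < t * t
        gap = begin-strict
          k * B₁ * (α + γ)                                       ≤⟨ *-monoʳ-≤ (k * B₁) (≤-trans (+-monoʳ-≤ α γ≤α) (+-mono-≤ α≤ α≤)) ⟩
          k * B₁ * (2 * A₁ * Y + 2 * A₁ * Y)                     ≡⟨ arr k B₁ A₁ ratio δ t ⟩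
          64 * (A₁ * (k * k) * (B₁ * B₁) * ratio * δ) * t        ≤⟨ *-monoˡ-≤ t (*-monoʳ-≤ 64 (*-monoˡ-≤ δ (*-monoˡ-≤ ratio (*-monoˡ-≤ (B₁ * B₁) (*-monoʳ-≤ A₁ (*-mono-≤ k≤K₁ k≤K₁)))))) ⟩
          64 * (A₁ * (K₁ * K₁) * (B₁ * B₁) * ratio * δ) * t      <⟨ *-monoˡ-< t ⦃ >-nonZero 1≤t ⦄ (≤-trans (m≤n+m _ (ℓ₁ + ℤ.∣ ℓ₂ ∣ + (1 + ℤ.∣ A₃ ∣ * (δ * δ * δ)))) t₀≤t) ⟩
          t * t                                                  ∎
          where
          open ≤-Reasoning
          α≤ : α ≤ 2 * A₁ * Y
          α≤ = m∸n≤m (2 * A₁ * Y) ε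
          arr : ∀ k B A r δ t → k * B * (2 * A * (k * (r * (16 * B * (δ * t)))) + 2 * A * (k * (r * (16 * B * (δ * t))))) ≡ 64 * (A * (k * k) * (B * B) * r * δ) * t
          arr = solve-∀

        8k≤δ : 8 * k ≤ δ
        8k≤δ = begin
          8 * k                         ≤⟨ *-mono-≤ (m≤m+n 8 8) k≤K₁ ⟩
          16 * K₁                       ≤⟨ m≤m*n (16 * K₁) (A₁ * B * ratio) ⦃ >-nonZero (*-mono-≤ (*-mono-≤ 1≤A₁ 1≤B) 1≤ratio) ⦄ ⟩
          16 * K₁ * (A₁ * B * ratio)    ≡⟨ arr A₁ K₁ B ratio ⟩
          δ                             ∎
          where
          open ≤-Reasoning
          arr : ∀ A K B r → 16 * K * (A * B * r) ≡ 16 * A * K * B * r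
          arr = solve-∀

        pairs-share : 4 * A₁ * k * B * positivePairs ≤ (B + 1) * (h * h * h * h)
        pairs-share = positive-share A₁ B k w α γ (n * n * n * n) (h * h * h * h) positivePairs (n * n * n * (ℤ.∣ ℓ₂ ∣ + t)) 1≤B 1≤k 1≤w 1≤α
          (≤-trans (*-monoˡ-≤ B₁ (*-monoʳ-≤ 2 k≤K₁)) w-large) ratio-small (fourth-power B₁ h₀ 1≤B₁)
          (thin-share B₁ k ℤ.∣ ℓ₂ ∣ t δ ℓ₂≤t 8k≤δ 1≤B₁) (positivePairs-bound (k * B₁) t gap)
          where n = h + h₀

        collisions-share : zeros h * H * (2 * A₁ * k * B) ≤ h * h * h * h
        collisions-share = zeros-share A₁ ℤ.∣ A₃ ∣ B (16 * B₁) k K₁ ratio t δ (zeros h) (*-mono-≤ (s≤s (z≤n {15})) 1≤B₁) k≤K₁ refl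
          (≤-trans (≤-trans (m≤n+m (1 + ℤ.∣ A₃ ∣ * (δ * δ * δ)) (ℓ₁ + ℤ.∣ ℓ₂ ∣)) (m≤m+n _ _)) t₀≤t)
          (subst (λ x → zeros x ≤ x * x * (2 + 2 * (ℤ.∣ A₃ ∣ * (δ * δ * δ) + 2 * (16 * B₁ * t)))) (arr B₁ t δ) (zeros-bound (16 * B₁ * t) δ))
          where
          arr : ∀ B t δ → 16 * B * t * δ ≡ 16 * B * (δ * t)
          arr = solve-∀

        width-bound : width * B ≤ (B + 1) * (2 * A₁ * k * (H * H))
        width-bound = width-share A₁ B C k ratio ℓ₁ h 1≤A₁ 1≤ratio 1≤h 2B≤k ℓ₁≤h
          (≤-trans (≤-trans (*-monoˡ-≤ C {2} {32} (s≤s (s≤s z≤n))) (m≤m*n (32 * C) B₁ ⦃ >-nonZero 1≤B₁ ⦄)) 32CB₁≤ratio)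

        width-crude : width ≤ 4 * A₁ * K₁ * (H * H)
        width-crude = cancelˡ B 1≤B (begin
          B * width                                   ≡⟨ *-comm B width ⟩
          width * B                                   ≤⟨ width-bound ⟩
          (B + 1) * (2 * A₁ * k * (H * H))            ≤⟨ *-mono-≤ (+-monoʳ-≤ B 1≤B) (*-monoˡ-≤ (H * H) (*-monoʳ-≤ (2 * A₁) k≤K₁)) ⟩
          (B + B) * (2 * A₁ * K₁ * (H * H))           ≡⟨ arr B A₁ K₁ (H * H) ⟩
          B * (4 * A₁ * K₁ * (H * H))                 ∎)
          where
          open ≤-Reasoning
          arr : ∀ B A K x → (B + B) * (2 * A * K * x) ≡ B * (4 * A * K * x)
          arr = solve-∀

        window : E * count (λ j → R j ≟ 0) width ≤ width
        window = chebyshev width R E (H * (h * h)) (*-mono-≤ (≤-trans 1≤h h≤H) (*-mono-≤ 1≤h 1≤h)) first-moment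
          (variance-small A₁ E k h H (h * h * h * h) (zeros h) positivePairs _ width 1≤A₁ 1≤E 1≤k (*-assoc (h * h) h h) second-moment pairs-share collisions-share width-bound)

        represented : ∀ j → R j ≢ 0 → Represented (origin ℤ.+ + j)
        represented j R≢0 =
          let z , _ , p = ∑-witness H _ (n≢0⇒n>0 R≢0)
              c , _ , p = ∑-witness h _ p
              a , _ , p = ∑-witness h _ p
          in Y + z , c , a , sym (⟦⟧-witness (value z c a ℤ.≟ origin ℤ.+ + j) p)

        -- Only the integers from `q₁ Y` up to `q₁ (Y + H)` are kept and the margins `C h²` on both
        -- sides dropped, so that consecutive windows fit together.
        window-missing : ∀ (ν : ℕ → ℕ) → (∀ i → ν i ≤ 1) → (∀ i → Represented (+ i) → ν i ≡ 0) →
          E * ∑ (step H Y) (λ i → ν (q₁ Y + i)) ≤ 4 * A₁ * K₁ * (H * H)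
        window-missing ν ν≤1 ν-rep = ≤-trans (≤-trans (*-monoʳ-≤ E (begin
          ∑ (step H Y) (λ i → ν (q₁ Y + i))                              ≤⟨ ∑-mono (step H Y) (λ i _ → missing i) ⟩
          ∑ (step H Y) (λ i → ⟦ R (K + i) ≟ 0 ⟧)                         ≤⟨ m≤n+m _ _ ⟩
          ∑ K (λ j → ⟦ R j ≟ 0 ⟧) + ∑ (step H Y) (λ i → ⟦ R (K + i) ≟ 0 ⟧)   ≡⟨ ∑-split K (step H Y) _ ⟨
          ∑ (K + step H Y) (λ j → ⟦ R j ≟ 0 ⟧)                           ≤⟨ ∑-range-mono _ fits ⟩
          count (λ j → R j ≟ 0) width                                    ∎)) window) width-crude
          where
          open ≤-Reasoning
          K = C * (h * h)
          fits : K + step H Y ≤ width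
          fits = ≤-from (K + 1) (z≤n {0}) (arr K (step H Y))
            where
            arr : ∀ K s → K + s + 0 + (K + 1) ≡ s + 2 * K + 1 + 0
            arr = solve-∀
          position : ∀ i → origin ℤ.+ + (K + i) ≡ + (q₁ Y + i)
          position i = trans (cong (ℤ._+_ origin) (ℤP.pos-+ K i)) (trans (eqn (+ q₁ Y) (+ K) (+ i)) (sym (ℤP.pos-+ (q₁ Y) i)))
            where
            eqn : ∀ q k i → (q ℤ.- k) ℤ.+ (k ℤ.+ i) ≡ q ℤ.+ i
            eqn = ℤR.solve-∀
          missing : ∀ i → ν (q₁ Y + i) ≤ ⟦ R (K + i) ≟ 0 ⟧
          missing i = by (R (K + i) ≟ 0)
            where
            by : (zero? : Dec (R (K + i) ≡ 0)) → ν (q₁ Y + i) ≤ ⟦ zero? ⟧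
            by (yes _)   = ν≤1 (q₁ Y + i)
            by (no  R≢0) = ≤-reflexive (ν-rep (q₁ Y + i) (subst Represented (position i) (represented (K + i) R≢0)))

-- The windows for `k` from `K₀` to `K₁ - 1` tile the integers between `q K₀` and `q K₁`. Below
-- `q K₀` everything is given up, but with `K₁ = K₀ E` this is at most a proportion `2 / E²` of the
-- whole, and the windows together miss at most `4 / E`.
cover : ∀ ℓ A E K₀ K₁ H (ν : ℕ → ℕ) → 1 ≤ A → 1 ≤ E → 1 ≤ K₀ → K₁ ≡ K₀ * E → ℓ ≤ H → (∀ i → ν i ≤ 1) →
  (∀ k → K₀ ≤ k → k ≤ K₁ → E * ∑ (H * (ℓ + A * H + 2 * A * (k * H))) (λ i → ν (ℓ * (k * H) + A * (k * H) * (k * H) + i)) ≤ 4 * A * K₁ * (H * H)) →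
  E * (E * ∑ (A * (K₁ * K₁) * (H * H)) ν) ≤ 6 * E * (A * (K₁ * K₁) * (H * H))
cover ℓ A E K₀ K₁ H ν 1≤A 1≤E 1≤K₀ K₁-eq ℓ≤H ν≤1 window-missing = begin
  E * (E * ∑ (A * (K₁ * K₁) * (H * H)) ν)                 ≤⟨ *-monoʳ-≤ E (*-monoʳ-≤ E (∑-range-mono ν reach)) ⟩
  E * (E * ∑ (q (K₀ + N)) ν)                              ≤⟨ *-monoʳ-≤ E (windows N ≤-refl) ⟩
  E * (E * q K₀ + N * V)                                  ≤⟨ *-monoʳ-≤ E (+-mono-≤ (*-monoʳ-≤ E start-small) (*-monoˡ-≤ V (m∸n≤m K₁ K₀))) ⟩
  E * (E * (2 * (A * (K₀ * K₀) * (H * H))) + K₁ * V)      ≡⟨ subst (λ K → E * (E * (2 * (A * (K₀ * K₀) * (H * H))) + K * (4 * A * K * (H * H))) ≡ (2 + 4 * E) * (A * (K * K) * (H * H))) (sym K₁-eq) (collect A K₀ E (H * H)) ⟩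
  (2 + 4 * E) * (A * (K₁ * K₁) * (H * H))                 ≤⟨ *-monoˡ-≤ (A * (K₁ * K₁) * (H * H)) (≤-trans (+-monoˡ-≤ (4 * E) (*-monoʳ-≤ 2 1≤E)) (≤-reflexive (sym (*-distribʳ-+ E 2 4)))) ⟩
  6 * E * (A * (K₁ * K₁) * (H * H))                       ∎
  where
  open ≤-Reasoning
  q : ℕ → ℕ
  q k = ℓ * (k * H) + A * (k * H) * (k * H)
  V N : ℕ
  V = 4 * A * K₁ * (H * H)
  N = K₁ ∸ K₀
  K₀+N : K₀ + N ≡ K₁
  K₀+N = m+[n∸m]≡n (≤-trans (m≤m*n K₀ E ⦃ >-nonZero 1≤E ⦄) (≤-reflexive (sym K₁-eq)))
  collect : ∀ A K E x → E * (E * (2 * (A * (K * K) * x)) + K * E * (4 * A * (K * E) * x)) ≡ (2 + 4 * E) * (A * (K * E * (K * E)) * x)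
  collect = solve-∀
  reach : A * (K₁ * K₁) * (H * H) ≤ q (K₀ + N)
  reach = begin
    A * (K₁ * K₁) * (H * H)                 ≡⟨ arr A K₁ H ⟩
    A * (K₁ * H) * (K₁ * H)                 ≤⟨ m≤n+m _ (ℓ * (K₁ * H)) ⟩
    q K₁                                    ≡⟨ cong q K₀+N ⟨
    q (K₀ + N)                              ∎
    where
    arr : ∀ A K H → A * (K * K) * (H * H) ≡ A * (K * H) * (K * H)
    arr = solve-∀
  start-small : q K₀ ≤ 2 * (A * (K₀ * K₀) * (H * H))
  start-small = ≤-trans (+-monoˡ-≤ (A * (K₀ * H) * (K₀ * H)) (*-monoˡ-≤ (K₀ * H) ℓ≤)) (≤-reflexive (arr A K₀ H))
    where
    ℓ≤ : ℓ ≤ A * (K₀ * H)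
    ℓ≤ = ≤-trans ℓ≤H (≤-trans (m≤n*m H K₀ ⦃ >-nonZero 1≤K₀ ⦄) (m≤n*m (K₀ * H) A ⦃ >-nonZero 1≤A ⦄))
    arr : ∀ A K H → A * (K * H) * (K * H) + A * (K * H) * (K * H) ≡ 2 * (A * (K * K) * (H * H))
    arr = solve-∀
  windows : ∀ j → j ≤ N → E * ∑ (q (K₀ + j)) ν ≤ E * q K₀ + j * V
  windows zero    _   = begin
    E * ∑ (q (K₀ + 0)) ν   ≤⟨ *-monoʳ-≤ E (∑-bound (q (K₀ + 0)) 1 (λ i _ → ν≤1 i)) ⟩
    E * (q (K₀ + 0) * 1)   ≡⟨ cong (E *_) (trans (*-identityʳ _) (cong q (+-identityʳ K₀))) ⟩
    E * q K₀               ≤⟨ m≤m+n _ _ ⟩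
    E * q K₀ + 0 * V       ∎
  windows (suc j) j<N = begin
    E * ∑ (q (K₀ + suc j)) ν                                ≡⟨ cong (λ x → E * ∑ x ν) (trans (cong q (+-suc K₀ j)) (q-next ℓ A k H)) ⟩
    E * ∑ (q k + σ) ν                                       ≡⟨ cong (E *_) (∑-split (q k) σ ν) ⟩
    E * (∑ (q k) ν + ∑ σ (λ i → ν (q k + i)))               ≡⟨ *-distribˡ-+ E (∑ (q k) ν) _ ⟩
    E * ∑ (q k) ν + E * ∑ σ (λ i → ν (q k + i))             ≤⟨ +-mono-≤ (windows j (<⇒≤ j<N)) (window-missing k (m≤m+n K₀ j) (≤-trans (+-monoʳ-≤ K₀ (<⇒≤ j<N)) (≤-reflexive K₀+N))) ⟩
    E * q K₀ + j * V + V                                    ≡⟨ arr (E * q K₀) j V ⟩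
    E * q K₀ + suc j * V                                    ∎
    where
    k = K₀ + j
    σ = H * (ℓ + A * H + 2 * A * (k * H))
    q-next : ∀ ℓ A k H → ℓ * (suc k * H) + A * (suc k * H) * (suc k * H) ≡ ℓ * (k * H) + A * (k * H) * (k * H) + H * (ℓ + A * H + 2 * A * (k * H))
    q-next = solve-∀
    arr : ∀ x j V → x + j * V + V ≡ x + suc j * V
    arr = solve-∀

-- The covering reaches only the lengths `G (r + 1)²`. Any `T` lies between consecutive ones, and
-- `(r + 1)² ≤ 4 r²` turns the constant 6 into 24.
rescale : ∀ A E K s r T (ν : ℕ → ℕ) H → let G = A * (K * s * (K * s)) in 1 ≤ E → 1 ≤ r → H ≡ s * suc r →
  G * (r * r) ≤ T → T < G * (suc r * suc r) → E * (E * ∑ (A * (K * K) * (H * H)) ν) ≤ 6 * E * (A * (K * K) * (H * H)) → E * ∑ T ν ≤ 24 * T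
rescale A E K s r T ν _ 1≤E 1≤r refl Gr²≤T T<Gt² covered = cancelˡ E 1≤E (begin
  E * (E * ∑ T ν)                               ≤⟨ *-monoʳ-≤ E (*-monoʳ-≤ E (∑-range-mono ν (≤-trans (<⇒≤ T<Gt²) (≤-reflexive (sym square))))) ⟩
  E * (E * ∑ (A * (K * K) * (H * H)) ν)         ≤⟨ covered ⟩
  6 * E * (A * (K * K) * (H * H))               ≡⟨ cong (6 * E *_) square ⟩
  6 * E * (G * (t * t))                         ≤⟨ *-monoʳ-≤ (6 * E) (*-monoʳ-≤ G t²≤4r²) ⟩
  6 * E * (G * (4 * (r * r)))                   ≡⟨ four E G (r * r) ⟩
  E * (24 * (G * (r * r)))                      ≤⟨ *-monoʳ-≤ E (*-monoʳ-≤ 24 Gr²≤T) ⟩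
  E * (24 * T)                                  ∎)
  where
  open ≤-Reasoning
  t = suc r
  G = A * (K * s * (K * s))
  H = s * t
  square : A * (K * K) * (H * H) ≡ G * (t * t)
  square = arr A K s t
    where
    arr : ∀ A K s t → A * (K * K) * (s * t * (s * t)) ≡ A * (K * s * (K * s)) * (t * t)
    arr = solve-∀
  four : ∀ E G x → 6 * E * (G * (4 * x)) ≡ E * (24 * (G * x))
  four = solve-∀
  t²≤4r² : t * t ≤ 4 * (r * r)
  t²≤4r² = ≤-trans (*-mono-≤ t≤2r t≤2r) (≤-reflexive (sq r))
    where
    t≤2r : t ≤ 2 * r
    t≤2r = ≤-trans (+-monoˡ-≤ r 1≤r) (≤-reflexive (cong (_+_ r) (sym (+-identityʳ r))))
    sq : ∀ r → 2 * r * (2 * r) ≡ 4 * (r * r)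
    sq = solve-∀

-- This is `2 K₁ B₁` for `K₁ = 8 E²` and `B₁ = 32 E`; then the tail `2 / w` is at most `1 / (k B₁)`
-- in every window `k ≤ K₁`.
scaleRoughness : ℕ → ℕ
scaleRoughness E = 2 * (8 * E * E) * (8 * (4 * E))

-- Precision `E = 24 b` absorbs the constant 24 of the covering.
roughness : ℕ → ℕ
roughness b = scaleRoughness (24 * b)

module AlmostAll (ℓ₁ A₁ : ℕ) (ℓ₂ A₂ ℓ₃ A₃ : ℤ) (w : ℕ) (1≤A₁ : 1 ≤ A₁) (coℓ : Coprime ℤ.∣ ℓ₂ ∣ ℤ.∣ A₂ ∣)
  (rough : ∀ g → Coprime g ℤ.∣ A₂ ∣ → Coprime g 2 × Coprime g A₁ × Coprime g ℤ.∣ A₃ ∣ × Rough w g)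
  (A₂≢0 : A₂ ≢ + 0) (A₃≢0 : A₃ ≢ + 0) where

  open Representation ℓ₁ A₁ ℓ₂ A₂ ℓ₃ A₃ w 1≤A₁ coℓ rough A₂≢0 A₃≢0

  -- `K₀ = 8 E` is the least `k` that satisfies the condition `k ≥ 2 B` of a window.
  module Cover (E K₀ K₁ : ℕ) (1≤E : 1 ≤ E) (1≤K₀ : 1 ≤ K₀) (1≤K₁ : 1 ≤ K₁) (K₀-eq : 8 * E ≡ K₀) (K₁-eq : K₁ ≡ K₀ * E) (w-large : 2 * K₁ * (8 * (4 * E)) ≤ w) where

    ratio B₁ δ t₀ s G : ℕ
    ratio = Scale.ratio E K₁ 1≤E 1≤K₁ w-large
    B₁ = Scale.B₁ E K₁ 1≤E 1≤K₁ w-large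
    δ = Scale.δ E K₁ 1≤E 1≤K₁ w-large
    t₀ = Scale.t₀ E K₁ 1≤E 1≤K₁ w-large
    s = ratio * (16 * B₁ * δ)
    G = A₁ * (K₁ * s * (K₁ * s))

    1≤G : 1 ≤ G
    1≤G = *-mono-≤ 1≤A₁ (*-mono-≤ 1≤g 1≤g)
      where
      1≤g : 1 ≤ K₁ * s
      1≤g = *-mono-≤ 1≤K₁ (*-mono-≤ (Scale.1≤ratio E K₁ 1≤E 1≤K₁ w-large) (*-mono-≤ (*-mono-≤ (s≤s (z≤n {15})) (Scale.1≤B₁ E K₁ 1≤E 1≤K₁ w-large)) (Scale.1≤δ E K₁ 1≤E 1≤K₁ w-large)))

    bound-at : ∀ r T → G * (t₀ * t₀) ≤ T → G * (r * r) ≤ T → T < G * (suc r * suc r) → ∀ (ν : ℕ → ℕ) → (∀ i → ν i ≤ 1) → (∀ i → Represented (+ i) → ν i ≡ 0) → E * ∑ T ν ≤ 24 * T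
    bound-at r T T₀≤T Gr²≤T T<Gt² ν ν≤1 ν-rep =
      rescale A₁ E K₁ s r T ν (Scale.At.H E K₁ 1≤E 1≤K₁ w-large t (<⇒≤ t₀<t)) 1≤E (≤-trans 1≤t₀ (≤-pred t₀<t)) (arr ratio B₁ δ t) Gr²≤T T<Gt²
        (cover ℓ₁ A₁ E K₀ K₁ _ ν 1≤A₁ 1≤E 1≤K₀ K₁-eq (≤-trans (Scale.At.ℓ₁≤h E K₁ 1≤E 1≤K₁ w-large t (<⇒≤ t₀<t)) (Scale.At.h≤H E K₁ 1≤E 1≤K₁ w-large t (<⇒≤ t₀<t))) ν≤1
          (λ k K₀≤k k≤K₁ → Scale.At.At-k.window-missing E K₁ 1≤E 1≤K₁ w-large t (<⇒≤ t₀<t) k (≤-trans (≤-reflexive (trans (eight E) K₀-eq)) K₀≤k) k≤K₁ ν ν≤1 ν-rep))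
      where
      t = suc r
      t₀<t : t₀ < t
      t₀<t = ≰⇒> (λ t≤t₀ → <-irrefl refl (<-≤-trans T<Gt² (≤-trans (*-monoʳ-≤ G (*-mono-≤ t≤t₀ t≤t₀)) T₀≤T)))
      1≤t₀ : 1 ≤ t₀
      1≤t₀ = ≤-trans (s≤s z≤n) (m≤n+m _ (ℓ₁ + ℤ.∣ ℓ₂ ∣ + (1 + ℤ.∣ A₃ ∣ * (δ * δ * δ))))
      arr : ∀ r B δ t → r * (16 * B * (δ * t)) ≡ r * (16 * B * δ) * t
      arr = solve-∀
      eight : ∀ E → 2 * (4 * E) ≡ 8 * E
      eight = solve-∀

    T₀ : ℕ
    T₀ = G * (t₀ * t₀)

    bound : ∀ T → T₀ ≤ T → ∀ (ν : ℕ → ℕ) → (∀ i → ν i ≤ 1) → (∀ i → Represented (+ i) → ν i ≡ 0) → E * ∑ T ν ≤ 24 * T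
    bound T T₀≤T = let r , lo , hi = scaled-root G T 1≤G in bound-at r T T₀≤T lo hi

  -- An arbitrary 0-1 function `ν` vanishing on represented integers takes the place of the
  -- indicator of the others, because representability comes without a decision procedure.
  AlmostAllUpTo : ℕ → ℕ → ℕ → Set
  AlmostAllUpTo E m T₀ = ∀ T → T₀ ≤ T → ∀ (ν : ℕ → ℕ) → (∀ i → ν i ≤ 1) → (∀ i → Represented (+ i) → ν i ≡ 0) → E * ∑ T ν ≤ m * T

  almost-all-scaled : ∀ E → 1 ≤ E → scaleRoughness E ≤ w → ∃ (AlmostAllUpTo E 24)
  almost-all-scaled E 1≤E w-large = Cover.T₀ E (8 * E) (8 * E * E) 1≤E 1≤K₀ (*-mono-≤ 1≤K₀ 1≤E) refl refl w-large
                                  , Cover.bound E (8 * E) (8 * E * E) 1≤E 1≤K₀ (*-mono-≤ 1≤K₀ 1≤E) refl refl w-large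
    where
    1≤K₀ : 1 ≤ 8 * E
    1≤K₀ = *-mono-≤ (s≤s (z≤n {7})) 1≤E

  almost-all : ∀ b → 1 ≤ b → roughness b ≤ w → ∃ (AlmostAllUpTo b 1)
  almost-all b 1≤b w-large =
    let T₀ , bound = almost-all-scaled (24 * b) (*-mono-≤ (s≤s (z≤n {23})) 1≤b) w-large
    in T₀ , λ T T₀≤T ν ν≤1 ν-rep → cancelˡ 24 {b * ∑ T ν} {1 * T} (s≤s z≤n) (≤-trans (≤-reflexive (sym (*-assoc 24 b (∑ T ν)))) (≤-trans (bound T T₀≤T ν ν≤1 ν-rep) (≤-reflexive (cong (24 *_) (sym (*-identityˡ T))))))

-- Orthogonal bases

sumFin-cong : ∀ n {f g : Fin n → ℤ} → (∀ i → f i ≡ g i) → sumFin n f ≡ sumFin n g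
sumFin-cong zero    eq = refl
sumFin-cong (suc n) eq = cong₂ ℤ._+_ (eq fzero) (sumFin-cong n (λ i → eq (fsuc i)))

sumFin-zero : ∀ n {f : Fin n → ℤ} → (∀ i → f i ≡ + 0) → sumFin n f ≡ + 0
sumFin-zero zero    eq = refl
sumFin-zero (suc n) eq = cong₂ ℤ._+_ (eq fzero) (sumFin-zero n (λ i → eq (fsuc i)))

sumFin-+ : ∀ n (f g : Fin n → ℤ) → sumFin n (λ i → f i ℤ.+ g i) ≡ sumFin n f ℤ.+ sumFin n g
sumFin-+ zero    f g = refl
sumFin-+ (suc n) f g = trans (cong (ℤ._+_ (f fzero ℤ.+ g fzero)) (sumFin-+ n (λ i → f (fsuc i)) (λ i → g (fsuc i))))
  (interchange (f fzero) (g fzero) (sumFin n (λ i → f (fsuc i))) (sumFin n (λ i → g (fsuc i))))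
  where
  interchange : ∀ a b c d → (a ℤ.+ b) ℤ.+ (c ℤ.+ d) ≡ (a ℤ.+ c) ℤ.+ (b ℤ.+ d)
  interchange = ℤR.solve-∀

sumFin-*ˡ : ∀ n s (f : Fin n → ℤ) → sumFin n (λ i → s ℤ.* f i) ≡ s ℤ.* sumFin n f
sumFin-*ˡ zero    s f = sym (ℤP.*-zeroʳ s)
sumFin-*ˡ (suc n) s f = trans (cong (ℤ._+_ (s ℤ.* f fzero)) (sumFin-*ˡ n s (λ i → f (fsuc i)))) (sym (ℤP.*-distribˡ-+ s (f fzero) _))

sumFin-swap : ∀ m n (f : Fin m → Fin n → ℤ) → sumFin m (λ i → sumFin n (f i)) ≡ sumFin n (λ j → sumFin m (λ i → f i j))
sumFin-swap zero    n f = sym (sumFin-zero n (λ _ → refl))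
sumFin-swap (suc m) n f = trans (cong (ℤ._+_ (sumFin n (f fzero))) (sumFin-swap m n (λ i → f (fsuc i)))) (sym (sumFin-+ n (f fzero) _))

sumFin-single : ∀ n (f : Fin n → ℤ) i → (∀ j → j ≢ i → f j ≡ + 0) → sumFin n f ≡ f i
sumFin-single (suc n) f fzero    off = trans (cong (ℤ._+_ (f fzero)) (sumFin-zero n (λ j → off (fsuc j) (λ ())))) (ℤP.+-identityʳ _)
sumFin-single (suc n) f (fsuc i) off = trans (cong₂ ℤ._+_ (off fzero (λ ())) (sumFin-single n (λ j → f (fsuc j)) i (λ j j≢i → off (fsuc j) (λ e → j≢i (FinP.suc-injective e))))) (ℤP.+-identityˡ _)

Vector : ℕ → Set
Vector n = Fin n → ℤ

comb : ∀ {N} m → Vector m → (Fin m → Vector N) → Vector N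
comb m coef u k = sumFin m (λ i → coef i ℤ.* u i k)

record Span {N m : ℕ} (u : Fin m → Vector N) (x : Vector N) : Set where
  constructor spanned
  field
    coefficients : Vector m
    expansion    : ∀ k → x k ≡ comb m coefficients u k

lin : ∀ {N} → ℤ → Vector N → ℤ → Vector N → Vector N
lin s x t y k = s ℤ.* x k ℤ.+ t ℤ.* y k

comb-lin : ∀ {N} m (u : Fin m → Vector N) s α t β k → comb m (lin s α t β) u k ≡ lin s (comb m α u) t (comb m β u) k
comb-lin m u s α t β k = trans (sumFin-cong m (λ i → eqn s (α i) t (β i) (u i k)))
  (trans (sumFin-+ m _ _) (cong₂ ℤ._+_ (sumFin-*ˡ m s _) (sumFin-*ˡ m t _)))
  where
  eqn : ∀ s a t b x → (s ℤ.* a ℤ.+ t ℤ.* b) ℤ.* x ≡ s ℤ.* (a ℤ.* x) ℤ.+ t ℤ.* (b ℤ.* x)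
  eqn = ℤR.solve-∀

span-cong : ∀ {N m} {u : Fin m → Vector N} {x y} → (∀ k → x k ≡ y k) → Span u x → Span u y
span-cong eq (spanned coef p) = spanned coef λ k → trans (sym (eq k)) (p k)

span-lin : ∀ {N m} {u : Fin m → Vector N} {x y} s t → Span u x → Span u y → Span u (lin s x t y)
span-lin {m = m} {u} s t (spanned α p) (spanned β q) = spanned (lin s α t β) λ k →
  trans (cong₂ (λ a b → s ℤ.* a ℤ.+ t ℤ.* b) (p k) (q k)) (sym (comb-lin m u s α t β k))

δ-vector : ∀ {n} → Fin n → Vector n
δ-vector fzero    fzero    = + 1
δ-vector fzero    (fsuc j) = + 0
δ-vector (fsuc i) fzero    = + 0
δ-vector (fsuc i) (fsuc j) = δ-vector i j

δ-self : ∀ {n} (i : Fin n) → δ-vector i i ≡ + 1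
δ-self fzero    = refl
δ-self (fsuc i) = δ-self i

δ-other : ∀ {n} (i j : Fin n) → j ≢ i → δ-vector i j ≡ + 0
δ-other fzero    fzero    ne = ⊥-elim (ne refl)
δ-other fzero    (fsuc j) ne = refl
δ-other (fsuc i) fzero    ne = refl
δ-other (fsuc i) (fsuc j) ne = δ-other i j (λ e → ne (cong fsuc e))

sumFin-δ : ∀ n i (f : Fin n → ℤ) → sumFin n (λ j → δ-vector i j ℤ.* f j) ≡ f i
sumFin-δ n i f = trans (sumFin-single n _ i (λ j j≢i → trans (cong (ℤ._* f j) (δ-other i j j≢i)) (ℤP.*-zeroˡ (f j)))) (trans (cong (ℤ._* f i) (δ-self i)) (ℤP.*-identityˡ (f i)))

span-generator : ∀ {N m} (u : Fin m → Vector N) i → Span u (u i)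
span-generator {m = m} u i = spanned (δ-vector i) λ k → sym (sumFin-δ m i (λ j → u j k))

span-0 : ∀ {N m} {u : Fin m → Vector N} → Span u (λ _ → + 0)
span-0 {m = m} {u} = spanned (λ _ → + 0) λ k → sym (sumFin-zero m (λ i → ℤP.*-zeroˡ (u i k)))

span-comb : ∀ {N m} {u : Fin m → Vector N} m′ coef (x : Fin m′ → Vector N) → (∀ i → Span u (x i)) → Span u (comb m′ coef x)
span-comb zero    coef x mem = span-0
span-comb (suc m′) coef x mem = span-cong (λ k → cong (ℤ._+_ (coef fzero ℤ.* x fzero k)) (ℤP.*-identityˡ _))
  (span-lin (coef fzero) (+ 1) (mem fzero) (span-comb m′ (λ i → coef (fsuc i)) (λ i → x (fsuc i)) (λ i → mem (fsuc i))))

span-trans : ∀ {N m m′} {u : Fin m → Vector N} {x : Fin m′ → Vector N} {y} → (∀ i → Span u (x i)) → Span x y → Span u y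
span-trans {m′ = m′} {x = x} mem (spanned coef p) = span-cong (λ k → sym (p k)) (span-comb m′ coef x mem)

module Orthogonalisation {N : ℕ} (b : Vector N → Vector N → ℤ)
  (b-cong : ∀ {x y} z → (∀ k → x k ≡ y k) → b x z ≡ b y z)
  (b-sym : ∀ x y → b x y ≡ b y x)
  (b-lin : ∀ s x t y z → b (lin s x t y) z ≡ s ℤ.* b x z ℤ.+ t ℤ.* b y z) where

  b-linʳ : ∀ z s x t y → b z (lin s x t y) ≡ s ℤ.* b z x ℤ.+ t ℤ.* b z y
  b-linʳ z s x t y = trans (b-sym z _) (trans (b-lin s x t y z) (cong₂ (λ p q → s ℤ.* p ℤ.+ t ℤ.* q) (b-sym x z) (b-sym y z)))

  b-0 : ∀ z → b (λ _ → + 0) z ≡ + 0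
  b-0 z = b-lin (+ 0) (λ _ → + 0) (+ 0) (λ _ → + 0) z

  b-comb : ∀ m coef (u : Fin m → Vector N) z → b (comb m coef u) z ≡ sumFin m (λ i → coef i ℤ.* b (u i) z)
  b-comb zero    coef u z = b-0 z
  b-comb (suc m) coef u z = trans (b-cong z (λ k → cong (ℤ._+_ (coef fzero ℤ.* u fzero k)) (sym (ℤP.*-identityˡ _))))
    (trans (b-lin (coef fzero) (u fzero) (+ 1) (comb m (λ i → coef (fsuc i)) (λ i → u (fsuc i))) z)
      (cong (ℤ._+_ (coef fzero ℤ.* b (u fzero) z)) (trans (ℤP.*-identityˡ _) (b-comb m (λ i → coef (fsuc i)) (λ i → u (fsuc i)) z))))

  span-orthogonal : ∀ {m} (u : Fin m → Vector N) {x} z → Span u x → (∀ i → b (u i) z ≡ + 0) → b x z ≡ + 0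
  span-orthogonal {m} u z (spanned coef p) orth = trans (b-cong z p) (trans (b-comb m coef u z)
    (sumFin-zero m (λ i → trans (cong (coef i ℤ.*_) (orth i)) (ℤP.*-zeroʳ (coef i)))))

  NondegenerateOn : ∀ m → (Fin m → Vector N) → Set
  NondegenerateOn m u = ∀ coef → (∀ j → b (comb m coef u) (u j) ≡ + 0) → ∀ i → coef i ≡ + 0

  -- `index` is a common denominator: over ℤ the orthogonal family need not span the generators,
  -- only a multiple of each.
  record OrthogonalBasis {m} (u : Fin m → Vector N) : Set where
    field
      v          : Fin m → Vector N
      index      : ℤ
      index≢0    : index ≢ + 0
      orthogonal : ∀ i j → i ≢ j → b (v i) (v j) ≡ + 0
      anisotropic : ∀ i → b (v i) (v i) ≢ + 0
      inside     : ∀ i → Span u (v i)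
      outside    : ∀ i → Span v (λ k → index ℤ.* u i k)

  *-nonzero : ∀ {x y : ℤ} → x ≢ + 0 → y ≢ + 0 → x ℤ.* y ≢ + 0
  *-nonzero {x} x≢0 y≢0 e with ℤP.i*j≡0⇒i≡0∨j≡0 x e
  ... | inj₁ x≡0 = x≢0 x≡0
  ... | inj₂ y≡0 = y≢0 y≡0

  cancel-nonzero : ∀ g {x} → g ≢ + 0 → g ℤ.* x ≡ + 0 → x ≡ + 0
  cancel-nonzero g g≢0 e with ℤP.i*j≡0⇒i≡0∨j≡0 g e
  ... | inj₁ g≡0 = ⊥-elim (g≢0 g≡0)
  ... | inj₂ x≡0 = x≡0

  module Pivot {m} (u : Fin (suc m) → Vector N) (nondegenerate : NondegenerateOn (suc m) u) where

    u₀ : Vector N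
    u₀ = u fzero

    rest : Fin m → Vector N
    rest i = u (fsuc i)

    -- If `u₀` is isotropic, nondegeneracy supplies `rest j` with `b u₀ (rest j)` nonzero; the norms
    -- of `u₀ + rest j` and `u₀ - rest j` differ by four times this number, so they are not both 0.
    -- The coefficient of `u₀` stays 1, so that `u₀` can be recovered from the pivot.
    pivot : ∃ λ s → b (lin (+ 1) u₀ (+ 1) (comb m s rest)) (lin (+ 1) u₀ (+ 1) (comb m s rest)) ≢ + 0
    pivot with b u₀ u₀ ℤ.≟ + 0
    ... | no  anis = (λ _ → + 0) , λ e → anis (trans (sym same) e)
      where
      zero-sum : ∀ k → lin (+ 1) u₀ (+ 1) (comb m (λ _ → + 0) rest) k ≡ u₀ k
      zero-sum k = trans (cong (λ t → + 1 ℤ.* u₀ k ℤ.+ + 1 ℤ.* t) (sumFin-zero m (λ i → ℤP.*-zeroˡ (rest i k)))) (eqn (u₀ k))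
        where
        eqn : ∀ x → + 1 ℤ.* x ℤ.+ + 1 ℤ.* + 0 ≡ x
        eqn = ℤR.solve-∀
      same : b (lin (+ 1) u₀ (+ 1) (comb m (λ _ → + 0) rest)) (lin (+ 1) u₀ (+ 1) (comb m (λ _ → + 0) rest)) ≡ b u₀ u₀
      same = trans (b-cong _ zero-sum) (trans (b-sym u₀ _) (b-cong u₀ zero-sum))
    ... | yes iso with FinP.any? (λ j → ¬? (b u₀ (rest j) ℤ.≟ + 0))
    ...   | no none = ⊥-elim (one≢zero (nondegenerate (δ-vector fzero) (λ j → trans (b-cong (u j) (λ k → sumFin-δ (suc m) fzero (λ i → u i k))) (perp j)) fzero))
      where
      one≢zero : + 1 ≢ + 0
      one≢zero ()
      perp : ∀ j → b u₀ (u j) ≡ + 0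
      perp fzero    = iso
      perp (fsuc j) with b u₀ (rest j) ℤ.≟ + 0
      ... | yes e = e
      ... | no ne = ⊥-elim (none (j , ne))
    ...   | yes (j , hit) = choose (b (p (+ 1)) (p (+ 1)) ℤ.≟ + 0)
      where
      p : ℤ → Vector N
      p s = lin (+ 1) u₀ (+ 1) (comb m (λ i → s ℤ.* δ-vector j i) rest)
      p-eq : ∀ s k → p s k ≡ lin (+ 1) u₀ s (rest j) k
      p-eq s k = cong (ℤ._+_ (+ 1 ℤ.* u₀ k)) (trans (ℤP.*-identityˡ _) (trans (sumFin-cong m (λ i → ℤP.*-assoc s (δ-vector j i) (rest i k)))
        (trans (sumFin-*ˡ m s _) (cong (s ℤ.*_) (sumFin-δ m j (λ i → rest i k))))))
      norm : ∀ s → b (p s) (p s) ≡ s ℤ.* (+ 2 ℤ.* b u₀ (rest j)) ℤ.+ s ℤ.* s ℤ.* b (rest j) (rest j)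
      norm s = trans (b-cong (p s) (p-eq s)) (trans (b-sym _ (p s)) (trans (b-cong _ (p-eq s))
        (trans (b-lin (+ 1) u₀ s (rest j) _) (trans (cong₂ (λ x y → + 1 ℤ.* x ℤ.+ s ℤ.* y) (b-linʳ u₀ (+ 1) u₀ s (rest j)) (b-linʳ (rest j) (+ 1) u₀ s (rest j)))
        (trans (cong₂ (λ x y → + 1 ℤ.* (+ 1 ℤ.* x ℤ.+ s ℤ.* b u₀ (rest j)) ℤ.+ s ℤ.* (+ 1 ℤ.* y ℤ.+ s ℤ.* b (rest j) (rest j))) iso (b-sym (rest j) u₀))
          (eqn s (b u₀ (rest j)) (b (rest j) (rest j))))))))
        where
        eqn : ∀ s x y → + 1 ℤ.* (+ 1 ℤ.* + 0 ℤ.+ s ℤ.* x) ℤ.+ s ℤ.* (+ 1 ℤ.* x ℤ.+ s ℤ.* y) ≡ s ℤ.* (+ 2 ℤ.* x) ℤ.+ s ℤ.* s ℤ.* y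
        eqn = ℤR.solve-∀
      choose : Dec (b (p (+ 1)) (p (+ 1)) ≡ + 0) → ∃ λ s → b (lin (+ 1) u₀ (+ 1) (comb m s rest)) (lin (+ 1) u₀ (+ 1) (comb m s rest)) ≢ + 0
      choose (no ne) = (λ i → + 1 ℤ.* δ-vector j i) , ne
      choose (yes e) = (λ i → ℤ.- + 1 ℤ.* δ-vector j i) , λ e′ → *-nonzero {+ 4} (λ ()) hit
        (trans (eqn (b u₀ (rest j)) (b (rest j) (rest j))) (cong₂ ℤ._-_ (trans (sym (norm (+ 1))) e) (trans (sym (norm (ℤ.- + 1))) e′)))
        where
        eqn : ∀ x y → + 4 ℤ.* x ≡ (+ 1 ℤ.* (+ 2 ℤ.* x) ℤ.+ + 1 ℤ.* + 1 ℤ.* y) ℤ.- (ℤ.- + 1 ℤ.* (+ 2 ℤ.* x) ℤ.+ ℤ.- + 1 ℤ.* ℤ.- + 1 ℤ.* y)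
        eqn = ℤR.solve-∀

  module Step {m} (u : Fin (suc m) → Vector N) (nondegenerate : NondegenerateOn (suc m) u) (s : Vector m)
    (G≢0 : b (lin (+ 1) (u fzero) (+ 1) (comb m s (λ i → u (fsuc i)))) (lin (+ 1) (u fzero) (+ 1) (comb m s (λ i → u (fsuc i)))) ≢ + 0) where

    u₀ : Vector N
    u₀ = u fzero

    rest : Fin m → Vector N
    rest i = u (fsuc i)

    p : Vector N
    p = lin (+ 1) u₀ (+ 1) (comb m s rest)

    G : ℤ
    G = b p p

    -- Orthogonal projection along `p`, multiplied by `G` to stay integral.
    rest′ : Fin m → Vector N
    rest′ i = lin G (rest i) (ℤ.- b p (rest i)) p

    rest′-perp : ∀ i → b (rest′ i) p ≡ + 0
    rest′-perp i = trans (b-lin G (rest i) (ℤ.- b p (rest i)) p p) (trans (cong (λ x → G ℤ.* x ℤ.+ ℤ.- b p (rest i) ℤ.* G) (b-sym (rest i) p)) (eqn G (b p (rest i))))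
      where
      eqn : ∀ g x → g ℤ.* x ℤ.+ ℤ.- x ℤ.* g ≡ + 0
      eqn = ℤR.solve-∀

    t : Vector m → ℤ
    t coef = sumFin m (λ i → coef i ℤ.* b p (rest i))

    lift : Vector m → Vector (suc m)
    lift coef fzero    = ℤ.- t coef
    lift coef (fsuc i) = lin G coef (ℤ.- t coef) s i

    lift-comb : ∀ coef k → comb m coef rest′ k ≡ comb (suc m) (lift coef) u k
    lift-comb coef k = trans (sumFin-cong m (λ i → eqn (coef i) G (rest i k) (b p (rest i)) (p k)))
      (trans (sumFin-+ m _ _) (trans (cong₂ ℤ._+_ (sumFin-*ˡ m G _) (trans (sumFin-*ˡ m (ℤ.- p k) _) refl))
        (trans (eqn′ G (comb m coef rest k) (u₀ k) (comb m s rest k) (t coef)) (cong (ℤ._+_ (ℤ.- t coef ℤ.* u₀ k)) (sym (comb-lin m rest G coef (ℤ.- t coef) s k))))))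
      where
      eqn : ∀ c g r x p → c ℤ.* (g ℤ.* r ℤ.+ ℤ.- x ℤ.* p) ≡ g ℤ.* (c ℤ.* r) ℤ.+ ℤ.- p ℤ.* (c ℤ.* x)
      eqn = ℤR.solve-∀
      eqn′ : ∀ g c u r t → g ℤ.* c ℤ.+ ℤ.- (+ 1 ℤ.* u ℤ.+ + 1 ℤ.* r) ℤ.* t ≡ ℤ.- t ℤ.* u ℤ.+ (g ℤ.* c ℤ.+ ℤ.- t ℤ.* r)
      eqn′ = ℤR.solve-∀

    -- A combination of `rest′` orthogonal to all of `rest′` is orthogonal to `p`, hence to every
    -- `rest j` and to `u₀`. So its coordinates with respect to `u` vanish: the first gives
    -- `t coef = 0`, after which the others are `G` times the coefficients.
    nondegenerate′ : NondegenerateOn m rest′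
    nondegenerate′ coef perp i = cancel-nonzero G G≢0 (trans (sym (eqn (coef i) G (t coef) (s i) t≡0)) (vanish (fsuc i)))
      where
      y : Vector N
      y = comb m coef rest′
      y-p : b y p ≡ + 0
      y-p = span-orthogonal rest′ p (spanned coef λ _ → refl) rest′-perp
      annihilated : ∀ g x q z → g ℤ.* x ℤ.+ ℤ.- q ℤ.* z ≡ + 0 → z ≡ + 0 → g ℤ.* x ≡ + 0
      annihilated g x q .(+ 0) e refl = trans (eqn₁ g x q) e
        where
        eqn₁ : ∀ g x q → g ℤ.* x ≡ g ℤ.* x ℤ.+ ℤ.- q ℤ.* + 0
        eqn₁ = ℤR.solve-∀
      y-rest : ∀ j → b y (rest j) ≡ + 0
      y-rest j = cancel-nonzero G G≢0 (annihilated G (b y (rest j)) (b p (rest j)) (b y p) (trans (sym (b-linʳ y G (rest j) (ℤ.- b p (rest j)) p)) (perp j)) y-p)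
      y-comb : b y (comb m s rest) ≡ + 0
      y-comb = trans (b-sym y _) (span-orthogonal rest y (spanned s λ _ → refl) (λ j → trans (b-sym (rest j) y) (y-rest j)))
      y-u₀ : b y u₀ ≡ + 0
      y-u₀ = trans (eqn₃ (b y u₀)) (trans (cong (λ z → (+ 1 ℤ.* b y u₀ ℤ.+ + 1 ℤ.* z)) (sym y-comb)) (trans (sym (b-linʳ y (+ 1) u₀ (+ 1) (comb m s rest))) y-p))
        where
        eqn₃ : ∀ x → x ≡ + 1 ℤ.* x ℤ.+ + 1 ℤ.* + 0
        eqn₃ = ℤR.solve-∀
      vanish : ∀ i → lift coef i ≡ + 0
      vanish = nondegenerate (lift coef) (λ { fzero → trans (b-cong u₀ (λ k → sym (lift-comb coef k))) y-u₀
                                            ; (fsuc j) → trans (b-cong (rest j) (λ k → sym (lift-comb coef k))) (y-rest j) })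
      t≡0 : t coef ≡ + 0
      t≡0 = trans (sym (ℤP.neg-involutive (t coef))) (cong ℤ.-_ (vanish fzero))
      eqn : ∀ c g t s → t ≡ + 0 → g ℤ.* c ℤ.+ ℤ.- t ℤ.* s ≡ g ℤ.* c
      eqn c g .(+ 0) s refl = eqn₄ c g s
        where
        eqn₄ : ∀ c g s → g ℤ.* c ℤ.+ ℤ.- + 0 ℤ.* s ≡ g ℤ.* c
        eqn₄ = ℤR.solve-∀

    p-in : Span u p
    p-in = span-lin (+ 1) (+ 1) (span-generator u fzero) (span-comb m s rest (λ i → span-generator u (fsuc i)))

    rest′-in : ∀ i → Span u (rest′ i)
    rest′-in i = span-lin G (ℤ.- b p (rest i)) (span-generator u (fsuc i)) p-in

  orthogonal-basis : ∀ m (u : Fin m → Vector N) → NondegenerateOn m u → OrthogonalBasis u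
  orthogonal-basis zero    u _ = record { v = λ () ; index = + 1 ; index≢0 = λ () ; orthogonal = λ () ; anisotropic = λ () ; inside = λ () ; outside = λ () }
  orthogonal-basis (suc m) u nondegenerate = extend (proj₁ pivot) (proj₂ pivot)
    where
    open Pivot u nondegenerate using (pivot)
    extend : ∀ s → b (lin (+ 1) (u fzero) (+ 1) (comb m s (λ i → u (fsuc i)))) (lin (+ 1) (u fzero) (+ 1) (comb m s (λ i → u (fsuc i)))) ≢ + 0 → OrthogonalBasis u
    extend s G≢0 = record
      { v = v ; index = I.index ℤ.* G ; index≢0 = *-nonzero I.index≢0 G≢0
      ; orthogonal = orthogonal ; anisotropic = anisotropic ; inside = inside ; outside = outside }
      where
      open Step u nondegenerate s G≢0
      module I = OrthogonalBasis (orthogonal-basis m rest′ nondegenerate′)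
      v : Fin (suc m) → Vector N
      v fzero    = p
      v (fsuc i) = I.v i
      tail-perp : ∀ i → b (I.v i) p ≡ + 0
      tail-perp i = span-orthogonal rest′ p (I.inside i) rest′-perp
      orthogonal : ∀ i j → i ≢ j → b (v i) (v j) ≡ + 0
      orthogonal fzero    fzero    ne = ⊥-elim (ne refl)
      orthogonal fzero    (fsuc j) ne = trans (b-sym p _) (tail-perp j)
      orthogonal (fsuc i) fzero    ne = tail-perp i
      orthogonal (fsuc i) (fsuc j) ne = I.orthogonal i j (λ e → ne (cong fsuc e))
      anisotropic : ∀ i → b (v i) (v i) ≢ + 0
      anisotropic fzero    = G≢0
      anisotropic (fsuc i) = I.anisotropic i
      inside : ∀ i → Span u (v i)
      inside fzero    = p-in
      inside (fsuc i) = span-trans rest′-in (I.inside i)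
      old : ∀ {x} → Span I.v x → Span v x
      old = span-trans (λ i → span-generator v (fsuc i))
      κ = I.index ℤ.* G
      -- `G * rest i` is `rest′ i + b p (rest i) * p`, and `I.index` brings `rest′ i` into the span
      -- of the smaller family.
      outside-rest : ∀ i → Span v (λ k → κ ℤ.* rest i k)
      outside-rest i = span-cong (λ k → eqn I.index G (rest i k) (b p (rest i)) (p k)) (span-lin (+ 1) (I.index ℤ.* b p (rest i)) (old (I.outside i)) (span-generator v fzero))
        where
        eqn : ∀ d g r x p → + 1 ℤ.* (d ℤ.* (g ℤ.* r ℤ.+ ℤ.- x ℤ.* p)) ℤ.+ d ℤ.* x ℤ.* p ≡ d ℤ.* g ℤ.* r
        eqn = ℤR.solve-∀
      outside : ∀ i → Span v (λ k → κ ℤ.* u i k)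
      outside (fsuc i) = outside-rest i
      outside fzero = span-cong (λ k → trans (cong (λ z → κ ℤ.* p k ℤ.+ ℤ.- + 1 ℤ.* z) (scaled k)) (eqn κ (u₀ k) (comb m s rest k)))
        (span-lin κ (ℤ.- + 1) (span-generator v fzero) (span-comb m s (λ i k → κ ℤ.* rest i k) outside-rest))
        where
        scaled : ∀ k → comb m s (λ i k → κ ℤ.* rest i k) k ≡ κ ℤ.* comb m s rest k
        scaled k = trans (sumFin-cong m (λ i → eqn′ (s i) κ (rest i k))) (sumFin-*ˡ m κ _)
          where
          eqn′ : ∀ s d r → s ℤ.* (d ℤ.* r) ≡ d ℤ.* (s ℤ.* r)
          eqn′ = ℤR.solve-∀
        eqn : ∀ d u r → d ℤ.* (+ 1 ℤ.* u ℤ.+ + 1 ℤ.* r) ℤ.+ ℤ.- + 1 ℤ.* (d ℤ.* r) ≡ d ℤ.* u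
        eqn = ℤR.solve-∀

-- Quadratic forms

module Form (n : ℕ) (c : Fin n → Fin n → ℤ) where

  f : Vector n → ℤ
  f = evalQF n c

  row : Vector n → Fin n → ℤ
  row x i = sumFin n (λ j → (c i j ℤ.+ c j i) ℤ.* x j)

  b : Vector n → Vector n → ℤ
  b x y = sumFin n (λ i → row x i ℤ.* y i)

  row-cong : ∀ {x y} → (∀ k → x k ≡ y k) → ∀ i → row x i ≡ row y i
  row-cong eq i = sumFin-cong n (λ j → cong ((c i j ℤ.+ c j i) ℤ.*_) (eq j))

  b-cong : ∀ {x y} z → (∀ k → x k ≡ y k) → b x z ≡ b y z
  b-cong z eq = sumFin-cong n (λ i → cong (ℤ._* z i) (row-cong eq i))

  b-expanded : ∀ x y → b x y ≡ sumFin n (λ i → sumFin n (λ j → (c i j ℤ.+ c j i) ℤ.* x j ℤ.* y i))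
  b-expanded x y = sumFin-cong n (λ i → trans (ℤP.*-comm (row x i) (y i)) (trans (sym (sumFin-*ˡ n (y i) _)) (sumFin-cong n (λ j → ℤP.*-comm (y i) _))))

  b-sym : ∀ x y → b x y ≡ b y x
  b-sym x y = trans (b-expanded x y) (trans (sumFin-swap n n _) (trans (sumFin-cong n (λ j → sumFin-cong n (λ i → eqn (c i j) (c j i) (x j) (y i)))) (sym (b-expanded y x))))
    where
    eqn : ∀ p q x y → (p ℤ.+ q) ℤ.* x ℤ.* y ≡ (q ℤ.+ p) ℤ.* y ℤ.* x
    eqn = ℤR.solve-∀

  b-lin : ∀ s x t y z → b (lin s x t y) z ≡ s ℤ.* b x z ℤ.+ t ℤ.* b y z
  b-lin s x t y z = trans (sumFin-cong n (λ i → trans (cong (ℤ._* z i) (row-lin i)) (eqn s (row x i) t (row y i) (z i))))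
    (trans (sumFin-+ n (λ i → s ℤ.* (row x i ℤ.* z i)) (λ i → t ℤ.* (row y i ℤ.* z i))) (cong₂ ℤ._+_ (sumFin-*ˡ n s (λ i → row x i ℤ.* z i)) (sumFin-*ˡ n t (λ i → row y i ℤ.* z i))))
    where
    eqn : ∀ s p t q z → (s ℤ.* p ℤ.+ t ℤ.* q) ℤ.* z ≡ s ℤ.* (p ℤ.* z) ℤ.+ t ℤ.* (q ℤ.* z)
    eqn = ℤR.solve-∀
    eqn′ : ∀ k s x t y → k ℤ.* (s ℤ.* x ℤ.+ t ℤ.* y) ≡ s ℤ.* (k ℤ.* x) ℤ.+ t ℤ.* (k ℤ.* y)
    eqn′ = ℤR.solve-∀
    row-lin : ∀ i → row (lin s x t y) i ≡ s ℤ.* row x i ℤ.+ t ℤ.* row y i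
    row-lin i = trans (sumFin-cong n (λ j → eqn′ (c i j ℤ.+ c j i) s (x j) t (y j))) (trans (sumFin-+ n (λ j → s ℤ.* ((c i j ℤ.+ c j i) ℤ.* x j)) (λ j → t ℤ.* ((c i j ℤ.+ c j i) ℤ.* y j))) (cong₂ ℤ._+_ (sumFin-*ˡ n s (λ j → (c i j ℤ.+ c j i) ℤ.* x j)) (sumFin-*ˡ n t (λ j → (c i j ℤ.+ c j i) ℤ.* y j))))

  open Orthogonalisation b b-cong b-sym b-lin public

  f-cong : ∀ {x y} → (∀ k → x k ≡ y k) → f x ≡ f y
  f-cong eq = sumFin-cong n (λ i → sumFin-cong n (λ j → cong₂ (λ p q → c i j ℤ.* p ℤ.* q) (eq i) (eq j)))

  ∬ : (Fin n → Fin n → ℤ) → ℤ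
  ∬ F = sumFin n (λ i → sumFin n (F i))

  ∬-cong : ∀ F G → (∀ i j → F i j ≡ G i j) → ∬ F ≡ ∬ G
  ∬-cong F G eq = sumFin-cong n (λ i → sumFin-cong n (eq i))

  ∬-+ : ∀ F G → ∬ (λ i j → F i j ℤ.+ G i j) ≡ ∬ F ℤ.+ ∬ G
  ∬-+ F G = trans (sumFin-cong n (λ i → sumFin-+ n (F i) (G i))) (sumFin-+ n (λ i → sumFin n (F i)) (λ i → sumFin n (G i)))

  ∬-*ˡ : ∀ s F → ∬ (λ i j → s ℤ.* F i j) ≡ s ℤ.* ∬ F
  ∬-*ˡ s F = trans (sumFin-cong n (λ i → sumFin-*ˡ n s (F i))) (sumFin-*ˡ n s (λ i → sumFin n (F i)))

  term : Vector n → Vector n → Fin n → Fin n → ℤ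
  term x y i j = c i j ℤ.* x i ℤ.* y j

  mixed : ∀ x y → ∬ (term x y) ℤ.+ ∬ (term y x) ≡ b x y
  mixed x y = trans (cong (ℤ._+ ∬ (term y x)) (sumFin-swap n n (term x y)))
    (trans (sym (∬-+ (λ i j → term x y j i) (term y x)))
      (trans (∬-cong (λ i j → term x y j i ℤ.+ term y x i j) (λ i j → (c i j ℤ.+ c j i) ℤ.* x j ℤ.* y i) (λ i j → eqn (c i j) (c j i) (x j) (y i))) (sym (b-expanded x y))))
    where
    eqn : ∀ p q x y → q ℤ.* x ℤ.* y ℤ.+ p ℤ.* y ℤ.* x ≡ (p ℤ.+ q) ℤ.* x ℤ.* y
    eqn = ℤR.solve-∀

  -- Along a line `f` is a quadratic polynomial. All polynomials `ℓ y + A y²` of the window argument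
  -- arise from this, with `ℓ` from a value of `b` and `A` from a value of `f`.
  f-shift : ∀ x s y → f (lin (+ 1) x s y) ≡ f x ℤ.+ (s ℤ.* b x y ℤ.+ s ℤ.* s ℤ.* f y)
  f-shift x s y = trans (∬-cong (term (lin (+ 1) x s y) (lin (+ 1) x s y)) (λ i j → term x x i j ℤ.+ (s ℤ.* (term x y i j ℤ.+ term y x i j) ℤ.+ s ℤ.* s ℤ.* term y y i j))
      (λ i j → eqn (c i j) s (x i) (x j) (y i) (y j)))
    (trans (∬-+ (term x x) (λ i j → s ℤ.* (term x y i j ℤ.+ term y x i j) ℤ.+ s ℤ.* s ℤ.* term y y i j))
      (cong (ℤ._+_ (f x)) (trans (∬-+ (λ i j → s ℤ.* (term x y i j ℤ.+ term y x i j)) (λ i j → s ℤ.* s ℤ.* term y y i j))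
        (cong₂ ℤ._+_ (trans (∬-*ˡ s (λ i j → term x y i j ℤ.+ term y x i j)) (cong (s ℤ.*_) (trans (∬-+ (term x y) (term y x)) (mixed x y)))) (∬-*ˡ (s ℤ.* s) (term y y))))))
    where
    eqn : ∀ c s xi xj yi yj → c ℤ.* (+ 1 ℤ.* xi ℤ.+ s ℤ.* yi) ℤ.* (+ 1 ℤ.* xj ℤ.+ s ℤ.* yj) ≡
      c ℤ.* xi ℤ.* xj ℤ.+ (s ℤ.* (c ℤ.* xi ℤ.* yj ℤ.+ c ℤ.* yi ℤ.* xj) ℤ.+ s ℤ.* s ℤ.* (c ℤ.* yi ℤ.* yj))
    eqn = ℤR.solve-∀

  b-self : ∀ x → b x x ≡ + 2 ℤ.* f x
  b-self x = trans (sym (mixed x x)) (eqn (f x))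
    where
    eqn : ∀ p → p ℤ.+ p ≡ + 2 ℤ.* p
    eqn = ℤR.solve-∀

  standard : Fin n → Vector n
  standard = δ-vector

  comb-standard : ∀ x k → comb n x standard k ≡ x k
  comb-standard x k = trans (sumFin-single n (λ i → x i ℤ.* standard i k) k (λ i i≢k → trans (cong (x i ℤ.*_) (δ-other i k (λ e → i≢k (sym e)))) (ℤP.*-zeroʳ (x i)))) (trans (cong (x k ℤ.*_) (δ-self k)) (ℤP.*-identityʳ (x k)))

  nondegenerate-standard : Nondegenerate n c → NondegenerateOn n standard
  nondegenerate-standard nondegenerate x perp = nondegenerate x (λ i → trans (sym (at i)) (perp i))
    where
    at : ∀ i → b (comb n x standard) (standard i) ≡ row x i
    at i = trans (b-cong (standard i) (comb-standard x)) (trans (sumFin-cong n (λ j → ℤP.*-comm (row x j) (standard i j))) (sumFin-δ n i (row x)))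

  module Basis (basis : OrthogonalBasis standard) where

    open OrthogonalBasis basis public

    norm : Fin n → ℤ
    norm i = b (v i) (v i)

    a : Fin n → ℤ
    a i = f (v i)

    a≢0 : ∀ i → a i ≢ + 0
    a≢0 i e = anisotropic i (trans (b-self (v i)) (cong (+ 2 ℤ.*_) e))

    spans : ∀ x → Span v (λ k → index ℤ.* x k)
    spans x = span-cong (λ k → trans (sumFin-cong n (λ i → eqn (x i) index (standard i k))) (trans (sumFin-*ˡ n index _) (cong (index ℤ.*_) (comb-standard x k))))
      (span-comb n x (λ i k → index ℤ.* standard i k) outside)
      where
      eqn : ∀ x d s → x ℤ.* (d ℤ.* s) ≡ d ℤ.* (x ℤ.* s)
      eqn = ℤR.solve-∀

    β : Vector n → Vector n
    β x = Span.coefficients (spans x)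

    b-scale : ∀ d x z → b (λ k → d ℤ.* x k) z ≡ d ℤ.* b x z
    b-scale d x z = trans (b-cong z (λ k → eqn d (x k))) (trans (b-lin d x (+ 0) x z) (eqn′ d (b x z)))
      where
      eqn : ∀ d x → d ℤ.* x ≡ d ℤ.* x ℤ.+ + 0 ℤ.* x
      eqn = ℤR.solve-∀
      eqn′ : ∀ d y → d ℤ.* y ℤ.+ + 0 ℤ.* y ≡ d ℤ.* y
      eqn′ = ℤR.solve-∀

    b-coordinates : ∀ x i → index ℤ.* b x (v i) ≡ β x i ℤ.* norm i
    b-coordinates x i = trans (sym (b-scale index x (v i))) (trans (b-cong (v i) (Span.expansion (spans x))) (trans (b-comb n (β x) v (v i))
      (sumFin-single n (λ j → β x j ℤ.* b (v j) (v i)) i (λ j j≢i → trans (cong (β x j ℤ.*_) (orthogonal j i j≢i)) (ℤP.*-zeroʳ (β x j))))))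

    -- In the orthogonal coordinates the form is diagonal; `index` enters once for each argument of
    -- `b`.
    f-coordinates : ∀ x → index ℤ.* (index ℤ.* (+ 2 ℤ.* f x)) ≡ sumFin n (λ i → β x i ℤ.* (β x i ℤ.* norm i))
    f-coordinates x = trans (cong (λ t → index ℤ.* (index ℤ.* t)) (sym (b-self x)))
      (trans (cong (index ℤ.*_) (trans (sym (b-scale index x x)) (trans (b-cong x (Span.expansion (spans x))) (b-comb n (β x) v x))))
        (trans (sym (sumFin-*ˡ n index (λ i → β x i ℤ.* b (v i) x))) (sumFin-cong n (λ i → trans (eqn index (β x i) (b (v i) x)) (cong (β x i ℤ.*_) (trans (cong (index ℤ.*_) (b-sym (v i) x)) (b-coordinates x i)))))))
      where
      eqn : ∀ d s y → d ℤ.* (s ℤ.* y) ≡ s ℤ.* (d ℤ.* y)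
      eqn = ℤR.solve-∀

    nonneg-square : ∀ (x : ℤ) → + 0 ℤ.≤ x ℤ.* x
    nonneg-square (+ m)    = subst (+ 0 ℤ.≤_) (ℤP.pos-* m m) (ℤ.+≤+ z≤n)
    nonneg-square -[1+ m ] = ℤ.+≤+ z≤n

    nonneg-* : ∀ {x y} → + 0 ℤ.≤ x → + 0 ℤ.≤ y → + 0 ℤ.≤ x ℤ.* y
    nonneg-* {+ p} {+ q} _ _ = subst (+ 0 ℤ.≤_) (ℤP.pos-* p q) (ℤ.+≤+ z≤n)

    sumFin-nonneg : ∀ m (t : Fin m → ℤ) → (∀ i → + 0 ℤ.≤ t i) → + 0 ℤ.≤ sumFin m t
    sumFin-nonneg zero    t _  = ℤP.≤-refl
    sumFin-nonneg (suc m) t nn = ℤP.+-mono-≤ (nn fzero) (sumFin-nonneg m (λ i → t (fsuc i)) (λ i → nn (fsuc i)))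

    cancel-square-nonneg : ∀ d y → d ≢ + 0 → + 0 ℤ.≤ d ℤ.* (d ℤ.* (+ 2 ℤ.* y)) → + 0 ℤ.≤ y
    cancel-square-nonneg d (+ y)    _   _  = ℤ.+≤+ z≤n
    cancel-square-nonneg d -[1+ y ] d≢0 le = ⊥-elim (negative d d≢0 le)
      where
      negative : ∀ d → d ≢ + 0 → + 0 ℤ.≤ d ℤ.* (d ℤ.* (+ 2 ℤ.* -[1+ y ])) → ⊥
      negative (+ zero)  ne _  = ne refl
      negative (+ suc d) _ ()
      negative -[1+ d ]  _ ()

    product : ∀ m → (Fin m → ℤ) → ℤ
    product zero    t = + 1
    product (suc m) t = t fzero ℤ.* product m (λ i → t (fsuc i))

    product-∣ : ∀ m (t : Fin m → ℤ) i → t i S.∣ product m t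
    product-∣ (suc m) t fzero    = S.∣m⇒∣m*n {m = t fzero} (product m (λ i → t (fsuc i))) S.∣-refl
    product-∣ (suc m) t (fsuc i) = S.∣n⇒∣m*n (t fzero) (product-∣ m (λ i → t (fsuc i)) i)

    product-nonzero : ∀ m (t : Fin m → ℤ) → (∀ i → t i ≢ + 0) → product m t ≢ + 0
    product-nonzero zero    t ne ()
    product-nonzero (suc m) t ne = *-nonzero (ne fzero) (product-nonzero m (λ i → t (fsuc i)) (λ i → ne (fsuc i)))

    sumFin-∣ : ∀ {k} m (t : Fin m → ℤ) → (∀ i → k S.∣ t i) → k S.∣ sumFin m t
    sumFin-∣ {k} zero t _  = S.divides (+ 0) (sym (ℤP.*-zeroˡ k))
    sumFin-∣ (suc m) t dv = S.∣m∣n⇒∣m+n (dv fzero) (sumFin-∣ m (λ i → t (fsuc i)) (λ i → dv (fsuc i)))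

    norms : ℤ
    norms = product n norm

    cofactor : ℤ
    cofactor = norms ℤ.* norms ℤ.* (index ℤ.* index ℤ.* + 2)

    cofactor≢0 : cofactor ≢ + 0
    cofactor≢0 = *-nonzero (*-nonzero nz nz) (*-nonzero (*-nonzero index≢0 index≢0) (λ ()))
      where nz = product-nonzero n norm anisotropic

    -- `norm i` times the coordinate `β x i` is `index * b x (v i)`, so `q` divides `norms * β x i`
    -- for every `i`, and the diagonal formula gives the square. It matters that `cofactor` depends
    -- on neither `q` nor `x`.
    square-divides : ∀ q x → (∀ i → q S.∣ b x (v i)) → (q ℤ.* q) S.∣ (cofactor ℤ.* f x)
    square-divides q x dv = S-subst (sym total) (sumFin-∣ n (λ i → norms ℤ.* norms ℤ.* (β x i ℤ.* (β x i ℤ.* norm i))) (λ i → S-subst (sym (square norms (β x i) (norm i))) (S.∣m⇒∣m*n (norm i) (S-square (q∣ i)))))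
      where
      S-square : ∀ {y} → q S.∣ y → (q ℤ.* q) S.∣ (y ℤ.* y)
      S-square (S.divides m refl) = S.divides (m ℤ.* m) (eqn m q)
        where
        eqn : ∀ m q → (m ℤ.* q) ℤ.* (m ℤ.* q) ≡ (m ℤ.* m) ℤ.* (q ℤ.* q)
        eqn = ℤR.solve-∀
      square : ∀ Γ β g → Γ ℤ.* Γ ℤ.* (β ℤ.* (β ℤ.* g)) ≡ (Γ ℤ.* β) ℤ.* (Γ ℤ.* β) ℤ.* g
      square = ℤR.solve-∀
      q∣ : ∀ i → q S.∣ (norms ℤ.* β x i)
      q∣ i with product-∣ n norm i
      ... | S.divides π eq = S-subst (trans (cong (π ℤ.*_) (b-coordinates x i)) (trans (eqn π (β x i) (norm i)) (cong (ℤ._* β x i) (sym eq)))) (S.∣n⇒∣m*n π (S.∣n⇒∣m*n index (dv i)))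
        where
        eqn : ∀ π β g → π ℤ.* (β ℤ.* g) ≡ (π ℤ.* g) ℤ.* β
        eqn = ℤR.solve-∀
      total : cofactor ℤ.* f x ≡ sumFin n (λ i → norms ℤ.* norms ℤ.* (β x i ℤ.* (β x i ℤ.* norm i)))
      total = trans (eqn norms index (f x)) (trans (cong (norms ℤ.* norms ℤ.*_) (f-coordinates x)) (sym (sumFin-*ˡ n (norms ℤ.* norms) (λ i → β x i ℤ.* (β x i ℤ.* norm i)))))
        where
        eqn : ∀ Γ d y → Γ ℤ.* Γ ℤ.* (d ℤ.* d ℤ.* + 2) ℤ.* y ≡ Γ ℤ.* Γ ℤ.* (d ℤ.* (d ℤ.* (+ 2 ℤ.* y)))
        eqn = ℤR.solve-∀

-- Primes

prime≥2 : ∀ {p} → Prime p → 2 ≤ p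
prime≥2 {p} pp = nonTrivial⇒n>1 p ⦃ prime⇒nonTrivial pp ⦄

prime-factor : ∀ n → 2 ≤ n → ∃ λ p → Prime p × p ∣ n
prime-factor n 2≤n = go n n ≤-refl 2≤n
  where
  go : ∀ fuel n → n ≤ fuel → 2 ≤ n → ∃ λ p → Prime p × p ∣ n
  go zero    n n≤ 2≤n = ⊥-elim (<⇒≱ (≤-trans (s≤s z≤n) 2≤n) n≤)
  go (suc k) n n≤ 2≤n with prime? n
  ... | yes pn = n , pn , ∣-refl
  ... | no ¬pn with ¬prime⇒composite ⦃ n>1⇒nonTrivial 2≤n ⦄ ¬pn
  ...   | record { divisor = d ; nontrivial = nt ; divisor-< = d<n ; divisor-∣ = d∣n } =
    let p , pp , p∣d = go k d (≤-pred (≤-trans d<n n≤)) (nonTrivial⇒n>1 d ⦃ nt ⦄) in p , pp , ∣-trans p∣d d∣n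

prime-coprime : ∀ {p} → Prime p → ∀ n → ¬ (p ∣ n) → Coprime n p
prime-coprime pp n p∤n {d} (d∣n , d∣p) with prime⇒irreducible pp d∣p
... | inj₁ d≡1 = d≡1
... | inj₂ refl = ⊥-elim (p∤n d∣n)

coprime-^ : ∀ {x a} k → Coprime x a → Coprime x (a ^ k)
coprime-^ zero    co (_ , d∣1) = ∣1⇒≡1 d∣1
coprime-^ (suc k) co = coprime-* co (coprime-^ k co)

∣-prime-power : ∀ {p q} k → Prime p → p ∣ q ^ k → p ∣ q
∣-prime-power zero    pp p∣1 = ⊥-elim (<⇒≱ (prime≥2 pp) (≤-reflexive (∣1⇒≡1 p∣1)))
∣-prime-power {q = q} (suc k) pp p∣ with euclidsLemma q (q ^ k) pp p∣
... | inj₁ p∣q = p∣q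
... | inj₂ p∣  = ∣-prime-power k pp p∣

-- Truncated at `κ`, so that `b = 0` needs no case of its own.
valuation : ∀ p κ (b : ℤ) → (+ (p ^ suc κ) S.∣ b) ⊎ (∃ λ i → i ≤ κ × ∃ λ ℓ → b ≡ + (p ^ i) ℤ.* ℓ × ¬ (+ p S.∣ ℓ))
valuation p zero b with + p S.∣? b
... | yes d = inj₁ (subst (λ q → + q S.∣ b) (sym (*-identityʳ p)) d)
... | no ¬d = inj₂ (0 , z≤n , b , sym (ℤP.*-identityˡ b) , ¬d)
valuation p (suc κ) b with valuation p κ b
... | inj₂ (i , i≤κ , rest) = inj₂ (i , m≤n⇒m≤1+n i≤κ , rest)
... | inj₁ (S.divides q eq) with + p S.∣? q
...   | no ¬d = inj₂ (suc κ , ≤-refl , q , trans eq (ℤP.*-comm q _) , ¬d)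
...   | yes (S.divides r eq′) = inj₁ (S.divides r (trans eq (trans (cong (ℤ._* + (p ^ suc κ)) eq′) (trans (ℤP.*-assoc r (+ p) (+ (p ^ suc κ))) (cong (r ℤ.*_) (sym (ℤP.pos-* p (p ^ suc κ))))))))

bezout : ∀ m n → Coprime m n → ∃ λ μ → ∃ λ ν → μ ℤ.* + m ℤ.+ ν ℤ.* + n ≡ + 1
bezout m n co with Coprimality.coprime-Bézout co
... | GCD.Bézout.Identity.+- x y eq = + x , ℤ.- + y , trans (cong₂ (λ s t → s ℤ.+ t) (trans (sym (ℤP.pos-* x m)) (trans (cong +_ (sym eq)) (trans (ℤP.pos-+ 1 (y * n)) (cong (ℤ._+_ (+ 1)) (ℤP.pos-* y n))))) refl) (eqn (+ y) (+ n))
  where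
  eqn : ∀ y n → (+ 1 ℤ.+ y ℤ.* n) ℤ.+ ℤ.- y ℤ.* n ≡ + 1
  eqn = ℤR.solve-∀
... | GCD.Bézout.Identity.-+ x y eq = ℤ.- + x , + y , trans (cong (ℤ._+_ (ℤ.- + x ℤ.* + m)) (trans (sym (ℤP.pos-* y n)) (trans (cong +_ (sym eq)) (trans (ℤP.pos-+ 1 (x * m)) (cong (ℤ._+_ (+ 1)) (ℤP.pos-* x m)))))) (eqn (+ x) (+ m))
  where
  eqn : ∀ x m → ℤ.- x ℤ.* m ℤ.+ (+ 1 ℤ.+ x ℤ.* m) ≡ + 1
  eqn = ℤR.solve-∀

abs-unit : ∀ x → ∃ λ s → + ℤ.∣ x ∣ ≡ s ℤ.* x
abs-unit x with ℤP.+∣i∣≡i⊎+∣i∣≡-i x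
... | inj₁ e = + 1 , trans e (sym (ℤP.*-identityˡ x))
... | inj₂ e = ℤ.- + 1 , trans e (sym (ℤP.-1*i≡-i x))

inverse-mod : ∀ {p} → Prime p → ∀ x → ¬ (+ p S.∣ x) → ∃ λ μ → + p S.∣ (x ℤ.* μ ℤ.- + 1)
inverse-mod {p} pp x p∤x =
  let μ , ν , eq = bezout ℤ.∣ x ∣ p (prime-coprime pp ℤ.∣ x ∣ (λ d → p∤x (S.∣ᵤ⇒∣ d)))
      s , abs    = abs-unit x
  in μ ℤ.* s , S.divides (ℤ.- ν) (trans (cong (λ t → x ℤ.* (μ ℤ.* s) ℤ.- t) (trans (sym eq) (cong (λ t → μ ℤ.* t ℤ.+ ν ℤ.* + p) abs))) (eqn x μ s ν (+ p)))
  where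
  eqn : ∀ x μ s ν p → x ℤ.* (μ ℤ.* s) ℤ.- (μ ℤ.* (s ℤ.* x) ℤ.+ ν ℤ.* p) ≡ ℤ.- ν ℤ.* p
  eqn = ℤR.solve-∀

-- Modulo `p` only the linear term and `d` remain, so for `u` prime to `p` there is a root whatever
-- `d` is, also for `p = 2`.
henselValue : ℤ → ℤ → ℤ → ℤ → ℤ → ℤ
henselValue p u B d γ = u ℤ.* γ ℤ.+ p ℤ.* B ℤ.* (γ ℤ.* γ) ℤ.+ d

-- Newton's correction: `τ = - μ q` with `μ` inverse to `u` modulo `p`; the quadratic part of the
-- change has the extra factor `p` from its coefficient.
hensel-step : ∀ p u B d γ P q μ m → henselValue p u B d γ ≡ q ℤ.* P → u ℤ.* μ ℤ.- + 1 ≡ m ℤ.* p →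
  ∃ λ τ → (p ℤ.* P) S.∣ henselValue p u B d (γ ℤ.+ P ℤ.* τ)
hensel-step p u B d γ P q μ m eq eq′ = τ , S.divides (ℤ.- m ℤ.* q ℤ.+ B ℤ.* Q) (trans (expand u p B d γ P τ)
  (trans (cong (ℤ._+ P ℤ.* (u ℤ.* τ ℤ.+ p ℤ.* B ℤ.* Q)) eq) (trans (regroup q P u μ p B Q)
    (trans (cong (λ z → P ℤ.* (ℤ.- z ℤ.* q ℤ.+ p ℤ.* B ℤ.* Q)) eq′) (final P m p q B Q)))))
  where
  τ Q : ℤ
  τ = ℤ.- (μ ℤ.* q)
  Q = + 2 ℤ.* γ ℤ.* τ ℤ.+ P ℤ.* τ ℤ.* τ
  expand : ∀ u p B d γ P τ → u ℤ.* (γ ℤ.+ P ℤ.* τ) ℤ.+ p ℤ.* B ℤ.* ((γ ℤ.+ P ℤ.* τ) ℤ.* (γ ℤ.+ P ℤ.* τ)) ℤ.+ d ≡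
    (u ℤ.* γ ℤ.+ p ℤ.* B ℤ.* (γ ℤ.* γ) ℤ.+ d) ℤ.+ P ℤ.* (u ℤ.* τ ℤ.+ p ℤ.* B ℤ.* (+ 2 ℤ.* γ ℤ.* τ ℤ.+ P ℤ.* τ ℤ.* τ))
  expand = ℤR.solve-∀
  regroup : ∀ q P u μ p B z → q ℤ.* P ℤ.+ P ℤ.* (u ℤ.* (ℤ.- (μ ℤ.* q)) ℤ.+ p ℤ.* B ℤ.* z) ≡ P ℤ.* (ℤ.- (u ℤ.* μ ℤ.- + 1) ℤ.* q ℤ.+ p ℤ.* B ℤ.* z)
  regroup = ℤR.solve-∀
  final : ∀ P m p q B z → P ℤ.* (ℤ.- (m ℤ.* p) ℤ.* q ℤ.+ p ℤ.* B ℤ.* z) ≡ (ℤ.- m ℤ.* q ℤ.+ B ℤ.* z) ℤ.* (p ℤ.* P)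
  final = ℤR.solve-∀

hensel : ∀ {p} → Prime p → ∀ u B d → ¬ (+ p S.∣ u) → ∀ K → ∃ λ γ → + (p ^ K) S.∣ henselValue (+ p) u B d γ
hensel {p} pp u B d p∤u zero = + 0 , S.divides (henselValue (+ p) u B d (+ 0)) (sym (ℤP.*-identityʳ _))
hensel {p} pp u B d p∤u (suc K) = improve (hensel pp u B d p∤u K) (inverse-mod pp u p∤u)
  where
  improve : (∃ λ γ → + (p ^ K) S.∣ henselValue (+ p) u B d γ) → (∃ λ μ → + p S.∣ (u ℤ.* μ ℤ.- + 1)) → ∃ λ γ → + (p ^ suc K) S.∣ henselValue (+ p) u B d γ
  improve (γ , S.divides q eq) (μ , S.divides m eq′) =
    let τ , d = hensel-step (+ p) u B d γ (+ (p ^ K)) q μ m eq eq′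
    in γ ℤ.+ + (p ^ K) ℤ.* τ , subst (S._∣ henselValue (+ p) u B _ (γ ℤ.+ + (p ^ K) ℤ.* τ)) (sym (ℤP.pos-* p (p ^ K))) d

n<p^n : ∀ p n → 2 ≤ p → n < p ^ n
n<p^n p zero    _   = s≤s z≤n
n<p^n p (suc n) 2≤p = begin-strict
  suc n            ≤⟨ n<p^n p n 2≤p ⟩
  p ^ n            <⟨ m<m+n (p ^ n) (≤-trans (s≤s z≤n) (n<p^n p n 2≤p)) ⟩
  p ^ n + p ^ n    ≡⟨ cong (_+_ (p ^ n)) (+-identityʳ (p ^ n)) ⟨
  2 * p ^ n        ≤⟨ *-monoˡ-≤ (p ^ n) 2≤p ⟩
  p ^ suc n        ∎
  where open ≤-Reasoning

valuation-nonzero : ∀ {p} → Prime p → ∀ b → b ≢ + 0 → ∃ λ i → i ≤ ℤ.∣ b ∣ × ∃ λ ℓ → b ≡ + (p ^ i) ℤ.* ℓ × ¬ (+ p S.∣ ℓ)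
valuation-nonzero {p} pp b b≢0 with valuation p ℤ.∣ b ∣ b
... | inj₂ found = found
... | inj₁ d = ⊥-elim (<⇒≱ (<-trans (n<1+n ℤ.∣ b ∣) (n<p^n p (suc ℤ.∣ b ∣) (prime≥2 pp))) (∣⇒≤ ⦃ >-nonZero (abs-pos b≢0) ⦄ (S.∣⇒∣ᵤ d)))

primePower : ℕ → ℕ → ℕ
primePower K q with prime? q
... | yes _ = q ^ K
... | no  _ = 1

-- The product of `p ^ K` over the primes `p ≤ n`; `K = 1` gives the usual primorial.
primorial : ℕ → ℕ → ℕ
primorial K zero    = 1
primorial K (suc n) = primePower K (suc n) * primorial K n

primorial-prime : ∀ K n → Prime (suc n) → primorial K (suc n) ≡ suc n ^ K * primorial K n
primorial-prime K n pn with prime? (suc n)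
... | yes _  = refl
... | no ¬pn = ⊥-elim (¬pn pn)

primorial-composite : ∀ K n → ¬ Prime (suc n) → primorial K (suc n) ≡ primorial K n
primorial-composite K n ¬pn with prime? (suc n)
... | yes pn = ⊥-elim (¬pn pn)
... | no _   = *-identityˡ (primorial K n)

primorial≥1 : ∀ K n → 1 ≤ primorial K n
primorial≥1 K zero    = ≤-refl
primorial≥1 K (suc n) with prime? (suc n)
... | yes _ = *-mono-≤ (m^n>0 (suc n) K) (primorial≥1 K n)
... | no  _ = *-mono-≤ (≤-refl {1}) (primorial≥1 K n)

Smooth : ℕ → ℕ → Set
Smooth w n = ∀ p → Prime p → p ∣ n → p ≤ w

smooth-* : ∀ {w} m n → Smooth w m → Smooth w n → Smooth w (m * n)
smooth-* m n sm sn p pp d with euclidsLemma m n pp d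
... | inj₁ d′ = sm p pp d′
... | inj₂ d′ = sn p pp d′

smooth-≤ : ∀ {w} n → 1 ≤ n → n ≤ w → Smooth w n
smooth-≤ n 1≤n n≤w p pp d = ≤-trans (∣⇒≤ ⦃ >-nonZero 1≤n ⦄ d) n≤w

smooth-primorial : ∀ K n → Smooth n (primorial K n)
smooth-primorial K zero    p pp d = ⊥-elim (<⇒≱ (prime≥2 pp) (≤-reflexive (∣1⇒≡1 d)))
smooth-primorial K (suc n) p pp d with prime? (suc n)
... | no  _ = m≤n⇒m≤1+n (smooth-primorial K n p pp (subst (p ∣_) (*-identityˡ _) d))
... | yes _ with euclidsLemma (suc n ^ K) (primorial K n) pp d
...   | inj₁ d′ = ∣⇒≤ (∣-prime-power K pp d′)
...   | inj₂ d′ = m≤n⇒m≤1+n (smooth-primorial K n p pp d′)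

primePower∣primorial : ∀ K n p → Prime p → p ≤ n → p ^ K ∣ primorial K n
primePower∣primorial K zero    p pp p≤n = ⊥-elim (<⇒≱ (≤-trans (s≤s z≤n) (prime≥2 pp)) p≤n)
primePower∣primorial K (suc n) p pp p≤n with m≤n⇒m<n∨m≡n p≤n
... | inj₁ p<   = ∣n⇒∣m*n (primePower K (suc n)) (primePower∣primorial K n p pp (≤-pred p<))
... | inj₂ refl = subst (suc n ^ K ∣_) (sym (primorial-prime K n pp)) (m∣m*n (primorial K n))

prime∣primorial : ∀ n p → Prime p → p ≤ n → p ∣ primorial 1 n
prime∣primorial n p pp p≤n = subst (_∣ primorial 1 n) (*-identityʳ p) (primePower∣primorial 1 n p pp p≤n)

coprime-smooth : ∀ {w g} m → Coprime g (primorial 1 w) → 1 ≤ m → Smooth w m → Coprime g m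
coprime-smooth {w} {g} m co 1≤m smooth {d} (d∣g , d∣m) with d ≟ 1
... | yes d≡1 = d≡1
... | no  d≢1 = let p , pp , p∣d = prime-factor d (≤∧≢⇒< (n≢0⇒n>0 (λ { refl → <⇒≱ 1≤m (≤-reflexive (0∣⇒≡0 d∣m)) })) (λ e → d≢1 (sym e)))
                    p≡1 = co (∣-trans p∣d d∣g , prime∣primorial w p pp (smooth p pp (∣-trans p∣d d∣m)))
                in ⊥-elim (<⇒≱ (prime≥2 pp) (≤-reflexive p≡1))

coprime-rough : ∀ w g → 2 ≤ w → Coprime g (primorial 1 w) → Rough w g
coprime-rough w g 2≤w co with g ≟ 1 | w <? g
... | yes g≡1 | _      = inj₁ g≡1
... | no _    | yes w<g = inj₂ w<g
... | no g≢1  | no w≮g with g ≟ 0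
-- The prime 2 excludes `g = 0`, which is what `2 ≤ w` is for.
...   | yes refl = ⊥-elim (<⇒≱ ≤-refl (≤-reflexive (co {2} ((2 ∣0) , prime∣primorial w 2 prime[2] 2≤w))))
...   | no g≢0 = let p , pp , p∣g = prime-factor g (≤∧≢⇒< (n≢0⇒n>0 g≢0) (λ e → g≢1 (sym e)))
                     p≡1 = co (p∣g , prime∣primorial w p pp (≤-trans (∣⇒≤ ⦃ ≢-nonZero g≢0 ⦄ p∣g) (≮⇒≥ w≮g)))
                 in ⊥-elim (<⇒≱ (prime≥2 pp) (≤-reflexive p≡1))

-- Local representations

pos-^-+ : ∀ p i j → + (p ^ (i + j)) ≡ + (p ^ i) ℤ.* + (p ^ j)
pos-^-+ p i j = trans (cong +_ (^-distribˡ-+-* p i j)) (ℤP.pos-* (p ^ i) (p ^ j))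

valuation-exact : ∀ {p} → Prime p → ∀ s k u → s ≤ k → + (p ^ suc k) S.∣ (+ (p ^ s) ℤ.* u) → + p S.∣ u
valuation-exact {p} pp s k u s≤k d = S.∣-trans {+ p} {+ (p ^ suc (k ∸ s))} (S.∣ᵤ⇒∣ (m∣m*n (p ^ (k ∸ s))))
  (S.*-cancelˡ-∣ (+ (p ^ s)) {+ (p ^ suc (k ∸ s))} {u} ⦃ m^n≢0 p s ⦃ prime⇒nonZero pp ⦄ ⦄
    (subst (S._∣ (+ (p ^ s) ℤ.* u)) (trans (cong (λ e → + (p ^ e)) (trans (cong suc (sym (m+[n∸m]≡n s≤k))) (sym (+-suc s (k ∸ s))))) (pos-^-+ p s (suc (k ∸ s)))) d))

moved-value : ∀ P R u γ a b T a₂ p R′ b₂ lam → R ≡ p ℤ.* R′ → lam ℤ.* R ≡ P ℤ.* u → b₂ ≡ P ℤ.* T ℤ.* b → let β = P ℤ.* R ℤ.* γ in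
  (β ℤ.* lam ℤ.+ β ℤ.* β ℤ.* a) ℤ.+ (P ℤ.* b₂ ℤ.+ P ℤ.* P ℤ.* a₂) ≡ henselValue p u (R′ ℤ.* R ℤ.* a) (T ℤ.* b ℤ.+ a₂) γ ℤ.* (P ℤ.* P)
moved-value P R u γ a b T a₂ p R′ b₂ lam R-eq lam-eq b₂-eq =
  trans (cong (λ z → (P ℤ.* R ℤ.* γ ℤ.* lam ℤ.+ P ℤ.* R ℤ.* γ ℤ.* (P ℤ.* R ℤ.* γ) ℤ.* a) ℤ.+ (P ℤ.* z ℤ.+ P ℤ.* P ℤ.* a₂)) b₂-eq)
    (trans (first P R γ lam a T b a₂) (trans (cong (λ z → P ℤ.* γ ℤ.* z ℤ.+ P ℤ.* P ℤ.* (R ℤ.* R ℤ.* (γ ℤ.* γ) ℤ.* a ℤ.+ T ℤ.* b ℤ.+ a₂)) lam-eq)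
      (trans (cong (λ z → P ℤ.* γ ℤ.* (P ℤ.* u) ℤ.+ P ℤ.* P ℤ.* (z ℤ.* R ℤ.* (γ ℤ.* γ) ℤ.* a ℤ.+ T ℤ.* b ℤ.+ a₂)) R-eq) (second P u γ p R′ R a T b a₂))))
  where
  first : ∀ P R γ l a T b a₂ → (P ℤ.* R ℤ.* γ ℤ.* l ℤ.+ P ℤ.* R ℤ.* γ ℤ.* (P ℤ.* R ℤ.* γ) ℤ.* a) ℤ.+ (P ℤ.* (P ℤ.* T ℤ.* b) ℤ.+ P ℤ.* P ℤ.* a₂) ≡
    P ℤ.* γ ℤ.* (l ℤ.* R) ℤ.+ P ℤ.* P ℤ.* (R ℤ.* R ℤ.* (γ ℤ.* γ) ℤ.* a ℤ.+ T ℤ.* b ℤ.+ a₂)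
  first = ℤR.solve-∀
  second : ∀ P u γ p R′ R a T b a₂ → P ℤ.* γ ℤ.* (P ℤ.* u) ℤ.+ P ℤ.* P ℤ.* (p ℤ.* R′ ℤ.* R ℤ.* (γ ℤ.* γ) ℤ.* a ℤ.+ T ℤ.* b ℤ.+ a₂) ≡
    (u ℤ.* γ ℤ.+ p ℤ.* (R′ ℤ.* R ℤ.* a) ℤ.* (γ ℤ.* γ) ℤ.+ (T ℤ.* b ℤ.+ a₂)) ℤ.* (P ℤ.* P)
  second = ℤR.solve-∀

shift-∣ : ∀ k q x y z x′ s → s ≡ q ℤ.* k → x′ ≡ x ℤ.+ (s ℤ.* y ℤ.+ s ℤ.* s ℤ.* z) → k S.∣ (x′ ℤ.- x)
shift-∣ k q x y z _ _ refl refl = S.divides (q ℤ.* y ℤ.+ q ℤ.* (q ℤ.* k) ℤ.* z) (eqn x q k y z)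
  where
  eqn : ∀ x q k y z → x ℤ.+ (q ℤ.* k ℤ.* y ℤ.+ q ℤ.* k ℤ.* (q ℤ.* k) ℤ.* z) ℤ.- x ≡ (q ℤ.* y ℤ.+ q ℤ.* (q ℤ.* k) ℤ.* z) ℤ.* k
  eqn = ℤR.solve-∀

∣-chain : ∀ {k} x y z → k S.∣ (x ℤ.- y) → k S.∣ (y ℤ.- z) → k S.∣ (x ℤ.- z)
∣-chain x y z p q = S-subst (eqn x y z) (S.∣m∣n⇒∣m+n p q)
  where
  eqn : ∀ x y z → (x ℤ.- y) ℤ.+ (y ℤ.- z) ≡ x ℤ.- z
  eqn = ℤR.solve-∀

coprime-∣-product : ∀ m k x → Coprime m k → + m S.∣ x → + k S.∣ x → + (m * k) S.∣ x
coprime-∣-product m k x co m∣x (S.divides q eq) = S-subst (sym (trans eq (ℤP.*-comm q (+ k))))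
  (subst (S._∣ (+ k ℤ.* q)) (trans (sym (ℤP.pos-* k m)) (cong +_ (*-comm k m)))
    (S.*-monoʳ-∣ (+ k) {+ m} {q} (∣-coprime q (+ k) co (S-subst (trans eq (ℤP.*-comm q (+ k))) m∣x))))

coprime-shift : ∀ x y Π → Coprime ℤ.∣ x ∣ Π → + Π S.∣ y → Coprime ℤ.∣ x ℤ.+ y ∣ Π
coprime-shift x y Π co Π∣y {e} (e∣ , e∣Π) = co (S.∣⇒∣ᵤ {+ e} {x} (S.∣m+n∣n⇒∣m {+ e} {x} {y} (S.∣ᵤ⇒∣ {+ e} {x ℤ.+ y} e∣) (S.∣-trans {+ e} {+ Π} {y} (S.∣ᵤ⇒∣ {+ e} {+ Π} e∣Π) Π∣y)) , e∣Π)

module Local (n : ℕ) (c : Fin n → Fin n → ℤ) (basis : Form.OrthogonalBasis n c (Form.standard n c)) (i₂ : Fin n) (σ : ℕ) where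

  open Form n c
  open Basis basis

  v₂ : Vector n
  v₂ = v i₂

  N₂ : ℕ
  N₂ = ℤ.∣ norm i₂ ∣

  -- `κ` bounds the power of `p` tolerated in `b x v₂`: `suc σ` from the shift in `move`, and at
  -- most `N₂` from `norm i₂`. `K = 2 κ + 1` leaves a factor `p` in `p ^ K` after the square of that
  -- power is removed.
  κ K : ℕ
  κ = suc σ + N₂
  K = suc (κ + κ)

  GoodAt : ℕ → Vector n → Set
  GoodAt p x = ∃ λ i → i ≤ κ × ∃ λ ℓ → b x v₂ ≡ + (p ^ i) ℤ.* ℓ × ¬ (+ p S.∣ ℓ)

  BadAt : ℕ → Vector n → Set
  BadAt p x = ∀ i → + (p ^ suc σ) S.∣ b x (v i)

  -- A multiple of `v₂` is added to give `b x v₂` a bounded valuation; a multiple of `v i`, which is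
  -- orthogonal to `v₂` and leaves this valuation alone, undoes the change of `f`. With
  -- `P = p ^ suc σ` and `R = p ^ suc (σ ∸ s)` the total change is `P²` times a `henselValue` whose
  -- linear coefficient `u` is a unit.
  move : ∀ {p} → Prime p → ∀ x b′ i s u → b x v₂ ≡ b′ ℤ.* + (p ^ suc κ) → i ≢ i₂ → s ≤ σ → b x (v i) ≡ + (p ^ s) ℤ.* u → ¬ (+ p S.∣ u) →
    ∃ λ x′ → (+ (p ^ K) S.∣ (f x′ ℤ.- f x)) × GoodAt p x′
  move {p} pp x b′ i s u b₂-eq i≢i₂ s≤σ λ-eq p∤u = by (hensel pp u B d p∤u K)
    where
    j r : ℕ
    j = suc σ
    r = σ ∸ s
    P R R′ T : ℤ
    P = + (p ^ j)
    R = + (p ^ suc r)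
    R′ = + (p ^ r)
    T = + (p ^ suc N₂)
    B d : ℤ
    B = R′ ℤ.* R ℤ.* a i
    d = T ℤ.* b′ ℤ.+ a i₂
    by : (∃ λ γ → + (p ^ K) S.∣ henselValue (+ p) u B d γ) → ∃ λ x′ → (+ (p ^ K) S.∣ (f x′ ℤ.- f x)) × GoodAt p x′
    by (γ , root) = x′ , difference , good
     where
      β′ = P ℤ.* R ℤ.* γ
      x₁ x′ : Vector n
      x₁ = lin (+ 1) x β′ (v i)
      x′ = lin (+ 1) x₁ P v₂
      b₂-split : b x v₂ ≡ P ℤ.* T ℤ.* b′
      b₂-split = trans b₂-eq (trans (cong (b′ ℤ.*_) (trans (cong (λ e → + (p ^ e)) (sym (+-suc j N₂))) (pos-^-+ p j (suc N₂)))) (ℤP.*-comm b′ (P ℤ.* T)))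
      λ-split : b x (v i) ℤ.* R ≡ P ℤ.* u
      λ-split = trans (cong (ℤ._* R) λ-eq) (trans (eqn (+ (p ^ s)) u R) (cong (ℤ._* u) (trans (sym (pos-^-+ p s (suc r))) (cong (λ e → + (p ^ e)) (trans (+-suc s r) (cong suc (m+[n∸m]≡n s≤σ)))))))
        where
        eqn : ∀ a u R → a ℤ.* u ℤ.* R ≡ a ℤ.* R ℤ.* u
        eqn = ℤR.solve-∀
      b-x₁ : b x₁ v₂ ≡ b x v₂
      b-x₁ = trans (b-lin (+ 1) x β′ (v i) v₂) (trans (cong (λ z → + 1 ℤ.* b x v₂ ℤ.+ β′ ℤ.* z) (orthogonal i i₂ i≢i₂)) (eqn (b x v₂) β′))
        where
        eqn : ∀ y β → + 1 ℤ.* y ℤ.+ β ℤ.* + 0 ≡ y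
        eqn = ℤR.solve-∀
      change : f x′ ℤ.- f x ≡ henselValue (+ p) u B d γ ℤ.* (P ℤ.* P)
      change = trans (cong (ℤ._- f x) (trans (f-shift x₁ P v₂) (cong₂ (λ y z → y ℤ.+ (P ℤ.* z ℤ.+ P ℤ.* P ℤ.* a i₂)) (f-shift x β′ (v i)) b-x₁)))
        (trans (eqn (f x) (β′ ℤ.* b x (v i) ℤ.+ β′ ℤ.* β′ ℤ.* a i) (P ℤ.* b x v₂ ℤ.+ P ℤ.* P ℤ.* a i₂))
          (moved-value P R u γ (a i) b′ T (a i₂) (+ p) R′ (b x v₂) (b x (v i)) (ℤP.pos-* p (p ^ r)) λ-split b₂-split))
        where
        eqn : ∀ x y z → (x ℤ.+ y) ℤ.+ z ℤ.- x ≡ y ℤ.+ z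
        eqn = ℤR.solve-∀
      difference : + (p ^ K) S.∣ (f x′ ℤ.- f x)
      difference = S-subst (sym change) (S.∣m⇒∣m*n {m = henselValue (+ p) u B d γ} (P ℤ.* P) root)
      b-x′ : b x′ v₂ ≡ P ℤ.* (T ℤ.* b′ ℤ.+ norm i₂)
      b-x′ = trans (b-lin (+ 1) x₁ P v₂ v₂) (trans (cong (λ z → + 1 ℤ.* z ℤ.+ P ℤ.* norm i₂) (trans b-x₁ b₂-split)) (eqn P T b′ (norm i₂)))
        where
        eqn : ∀ P T b g → + 1 ℤ.* (P ℤ.* T ℤ.* b) ℤ.+ P ℤ.* g ≡ P ℤ.* (T ℤ.* b ℤ.+ g)
        eqn = ℤR.solve-∀
      good : GoodAt p x′
      good = let e , e≤N₂ , g′ , g-eq , p∤g′ = valuation-nonzero pp (norm i₂) (anisotropic i₂)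
                 Q = + (p ^ (N₂ ∸ e))
                 T-eq : T ≡ + (p ^ e) ℤ.* (+ p ℤ.* Q)
                 T-eq = trans (cong (λ t → + (p ^ t)) (trans (cong suc (sym (m+[n∸m]≡n e≤N₂))) (sym (+-suc e (N₂ ∸ e))))) (trans (pos-^-+ p e (suc (N₂ ∸ e))) (cong (+ (p ^ e) ℤ.*_) (ℤP.pos-* p (p ^ (N₂ ∸ e)))))
             in j + e , +-monoʳ-≤ j e≤N₂ , + p ℤ.* Q ℤ.* b′ ℤ.+ g′
              , trans b-x′ (trans (cong₂ (λ t g → P ℤ.* (t ℤ.* b′ ℤ.+ g)) T-eq g-eq) (trans (eqn P (+ (p ^ e)) (+ p ℤ.* Q) b′ g′) (cong (ℤ._* (+ p ℤ.* Q ℤ.* b′ ℤ.+ g′)) (sym (pos-^-+ p j e)))))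
              , λ dv → p∤g′ (S.∣m+n∣m⇒∣n {m = + p ℤ.* Q ℤ.* b′} {n = g′} dv (S.∣m⇒∣m*n {m = + p ℤ.* Q} b′ (S.∣m⇒∣m*n {m = + p} Q S.∣-refl)))
        where
        eqn : ∀ P e t b g → P ℤ.* (e ℤ.* t ℤ.* b ℤ.+ e ℤ.* g) ≡ P ℤ.* e ℤ.* (t ℤ.* b ℤ.+ g)
        eqn = ℤR.solve-∀

  at-prime : ∀ {p} → Prime p → ∀ x → BadAt p x ⊎ (∃ λ x′ → (+ (p ^ K) S.∣ (f x′ ℤ.- f x)) × GoodAt p x′)
  at-prime {p} pp x with valuation p κ (b x v₂)
  ... | inj₂ good = inj₂ (x , S.divides (+ 0) (ℤP.+-inverseʳ (f x)) , good)
  ... | inj₁ (S.divides b′ b₂-eq) with FinP.any? (λ i → ¬? (+ (p ^ suc σ) S.∣? b x (v i)))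
  ...   | no none = inj₁ λ i → divisible i (+ (p ^ suc σ) S.∣? b x (v i))
    where
    divisible : ∀ i → Dec (+ (p ^ suc σ) S.∣ b x (v i)) → + (p ^ suc σ) S.∣ b x (v i)
    divisible i (yes d) = d
    divisible i (no ¬d) = ⊥-elim (none (i , ¬d))
  ...   | yes (i , ¬d) with valuation p σ (b x (v i))
  ...     | inj₁ d = ⊥-elim (¬d d)
  ...     | inj₂ (s , s≤σ , u , λ-eq , p∤u) = inj₂ (move pp x b′ i s u b₂-eq i≢i₂ s≤σ λ-eq p∤u)
    where
    -- For `i = i₂` the valuation `s ≤ σ` would contradict the divisibility of `b x v₂` by
    -- `p ^ suc κ`.
    i≢i₂ : i ≢ i₂
    i≢i₂ refl = p∤u (valuation-exact pp s κ u (≤-trans s≤σ (≤-trans (n≤1+n σ) (m≤m+n (suc σ) N₂))) (S-subst λ-eq (S.divides b′ b₂-eq)))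

  -- Moving by `y g M` along `v₂` changes `f` by `g² M` times `ℓ y + M (a i₂) y²`, and `g² M` is the
  -- modulus. So `ℓ` and `M * a i₂` become the coefficients in `y₂`, and `Π∣M` and `coprime` are the
  -- conditions on them at the primes up to `m`.
  record Good (m : ℕ) (x : Vector n) : Set where
    field
      g M     : ℕ
      ℓ       : ℤ
      b-eq    : b x v₂ ≡ + g ℤ.* ℓ
      L-eq    : primorial K m ≡ g * g * M
      Π∣M     : primorial 1 m ∣ M
      coprime : Coprime ℤ.∣ ℓ ∣ (primorial 1 m)

  Bad : ℕ → Vector n → Set
  Bad m x = ∃ λ p → Prime p × p ≤ m × BadAt p x

  f-shift-∣ : ∀ k x q y → k S.∣ (f (lin (+ 1) x (q ℤ.* k) y) ℤ.- f x)
  f-shift-∣ k x q y = shift-∣ k q (f x) (b x y) (f y) (f (lin (+ 1) x (q ℤ.* k) y)) (q ℤ.* k) refl (f-shift x (q ℤ.* k) y)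

  -- Chinese remainder interpolation: with `μ L + ν Q = 1` the vector `y + μ L (z - y)` is congruent
  -- to `y` modulo `L` and to `z` modulo `Q`. Its two expressions give one factorisation of
  -- `b x′ v₂` each, and these are merged.
  combine : ∀ m q → Prime q → Coprime (primorial K m) q → ∀ x y z → + primorial K m S.∣ (f y ℤ.- f x) → Good m y → + (q ^ K) S.∣ (f z ℤ.- f x) → GoodAt q z →
    ∃ λ x′ → (+ (q ^ K * primorial K m) S.∣ (f x′ ℤ.- f x)) × (∃ λ g → ∃ λ M → ∃ λ ℓ → b x′ v₂ ≡ + g ℤ.* ℓ × q ^ K * primorial K m ≡ g * g * M
      × q ^ 1 * primorial 1 m ∣ M × Coprime ℤ.∣ ℓ ∣ (q ^ 1 * primorial 1 m))
  combine m q pq co x y z y≡ good z≡ (i , i≤κ , ℓq , bz-eq , q∤ℓq) = by (bezout (primorial K m) (q ^ K) (coprime-^ K co))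
    where
    module G = Good good
    g = G.g
    L Q : ℕ
    L = primorial K m
    Q = q ^ K
    coQ : Coprime L Q
    coQ = coprime-^ K co
    Result : Set
    Result = ∃ λ x′ → (+ (q ^ K * primorial K m) S.∣ (f x′ ℤ.- f x)) × (∃ λ g → ∃ λ M → ∃ λ ℓ → b x′ v₂ ≡ + g ℤ.* ℓ × q ^ K * primorial K m ≡ g * g * M
      × q ^ 1 * primorial 1 m ∣ M × Coprime ℤ.∣ ℓ ∣ (q ^ 1 * primorial 1 m))
    by : (∃ λ μ → ∃ λ ν → μ ℤ.* + L ℤ.+ ν ℤ.* + Q ≡ + 1) → Result
    by (μ , ν , one) = finish (S.quotient g∣ℓ₂) (S._∣_.equality g∣ℓ₂)
     where
      w x′ : Vector n
      w = lin (+ 1) z (ℤ.- + 1) y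
      x′ = lin (+ 1) y (μ ℤ.* + L) w
      x′-eq : ∀ k → x′ k ≡ lin (+ 1) z (ℤ.- ν ℤ.* + Q) w k
      x′-eq k = trans (eqn₁ (y k) (z k) (μ ℤ.* + L)) (trans (cong (λ t → + 1 ℤ.* y k ℤ.+ (t ℤ.- ν ℤ.* + Q) ℤ.* w k) one) (eqn₂ (y k) (z k) (ν ℤ.* + Q)  (ℤ.- ν ℤ.* + Q) (ℤP.neg-distribˡ-* ν (+ Q))))
        where
        eqn₁ : ∀ y z s → + 1 ℤ.* y ℤ.+ s ℤ.* (+ 1 ℤ.* z ℤ.+ ℤ.- + 1 ℤ.* y) ≡ + 1 ℤ.* y ℤ.+ (s ℤ.+ ν ℤ.* + Q ℤ.- ν ℤ.* + Q) ℤ.* (+ 1 ℤ.* z ℤ.+ ℤ.- + 1 ℤ.* y)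
        eqn₁ y z s = aux y z s (ν ℤ.* + Q)
          where
          aux : ∀ y z s t → + 1 ℤ.* y ℤ.+ s ℤ.* (+ 1 ℤ.* z ℤ.+ ℤ.- + 1 ℤ.* y) ≡ + 1 ℤ.* y ℤ.+ (s ℤ.+ t ℤ.- t) ℤ.* (+ 1 ℤ.* z ℤ.+ ℤ.- + 1 ℤ.* y)
          aux = ℤR.solve-∀
        eqn₂ : ∀ y z t t′ → ℤ.- t ≡ t′ → + 1 ℤ.* y ℤ.+ (+ 1 ℤ.- t) ℤ.* (+ 1 ℤ.* z ℤ.+ ℤ.- + 1 ℤ.* y) ≡ + 1 ℤ.* z ℤ.+ t′ ℤ.* (+ 1 ℤ.* z ℤ.+ ℤ.- + 1 ℤ.* y)
        eqn₂ y z t .(ℤ.- t) refl = aux y z t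
          where
          aux : ∀ y z t → + 1 ℤ.* y ℤ.+ (+ 1 ℤ.- t) ℤ.* (+ 1 ℤ.* z ℤ.+ ℤ.- + 1 ℤ.* y) ≡ + 1 ℤ.* z ℤ.+ ℤ.- t ℤ.* (+ 1 ℤ.* z ℤ.+ ℤ.- + 1 ℤ.* y)
          aux = ℤR.solve-∀
      both : + (Q * L) S.∣ (f x′ ℤ.- f x)
      both = coprime-∣-product Q L (f x′ ℤ.- f x) (Coprimality.sym coQ)
        (∣-chain (f x′) (f z) (f x) (subst (λ t → + Q S.∣ (t ℤ.- f z)) (sym (f-cong x′-eq)) (f-shift-∣ (+ Q) z (ℤ.- ν) w)) z≡)
        (∣-chain (f x′) (f y) (f x) (f-shift-∣ (+ L) y μ w) y≡)
      D₂ : ℤ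
      D₂ = b w v₂
      ℓ₁ ℓ₂ : ℤ
      ℓ₁ = G.ℓ ℤ.+ + g ℤ.* (+ G.M ℤ.* (μ ℤ.* D₂))
      -- The exponent left in `q ^ K` after removing `q ^ (2 i)`. It is positive, so `q` divides the
      -- new `M`.
      e : ℕ
      e = suc (κ + κ ∸ (i + i))
      i+i≤ : i + i ≤ κ + κ
      i+i≤ = +-mono-≤ i≤κ i≤κ
      K-eq : K ≡ i + (i + e)
      K-eq = sym (trans (sym (+-assoc i i e)) (trans (+-suc (i + i) (κ + κ ∸ (i + i))) (cong suc (m+[n∸m]≡n i+i≤))))
      ℓ₂ = ℓq ℤ.+ + (q ^ (i + e)) ℤ.* (ℤ.- ν ℤ.* D₂)
      b-x′₁ : b x′ v₂ ≡ + g ℤ.* ℓ₁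
      b-x′₁ = trans (b-lin (+ 1) y (μ ℤ.* + L) w v₂) (trans (cong₂ (λ s t → + 1 ℤ.* s ℤ.+ μ ℤ.* t ℤ.* D₂) G.b-eq
          (trans (cong +_ G.L-eq) (trans (ℤP.pos-* (g * g) G.M) (cong (ℤ._* + G.M) (ℤP.pos-* g g))))) (eqn (+ g) G.ℓ μ (+ G.M) D₂))
        where
        eqn : ∀ g l μ M d → + 1 ℤ.* (g ℤ.* l) ℤ.+ μ ℤ.* (g ℤ.* g ℤ.* M) ℤ.* d ≡ g ℤ.* (l ℤ.+ g ℤ.* (M ℤ.* (μ ℤ.* d)))
        eqn = ℤR.solve-∀
      b-x′₂ : b x′ v₂ ≡ + (q ^ i) ℤ.* ℓ₂
      b-x′₂ = trans (b-cong v₂ x′-eq) (trans (b-lin (+ 1) z (ℤ.- ν ℤ.* + Q) w v₂) (trans (cong₂ (λ s t → + 1 ℤ.* s ℤ.+ ℤ.- ν ℤ.* t ℤ.* D₂) bz-eq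
          (trans (cong (λ t → + (q ^ t)) K-eq) (pos-^-+ q i (i + e)))) (eqn (+ (q ^ i)) ℓq (ℤ.- ν) (+ (q ^ (i + e))) D₂)))
        where
        eqn : ∀ a l ν c d → + 1 ℤ.* (a ℤ.* l) ℤ.+ ν ℤ.* (a ℤ.* c) ℤ.* d ≡ a ℤ.* (l ℤ.+ c ℤ.* (ν ℤ.* d))
        eqn = ℤR.solve-∀
      g∣L : g ∣ L
      g∣L = subst (g ∣_) (sym G.L-eq) (∣m⇒∣m*n G.M (m∣m*n g))
      g≢0 : NonZero g
      g≢0 = ≢-nonZero (λ g≡0 → <⇒≱ (primorial≥1 K m) (≤-reflexive (trans G.L-eq (cong (λ t → t * t * G.M) g≡0))))
      -- From `g ℓ₁ = q ^ i ℓ₂`, as `g` divides `L` and is therefore prime to `q`.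
      g∣ℓ₂ : + g S.∣ ℓ₂
      g∣ℓ₂ = ∣-coprime ℓ₂ (+ (q ^ i)) (coprime-∣ˡ g∣L (coprime-^ i co)) (S-subst (trans (ℤP.*-comm ℓ₁ (+ g)) (trans (sym b-x′₁) b-x′₂)) (S.divides ℓ₁ refl))
      finish : ∀ ℓ″ → ℓ₂ ≡ ℓ″ ℤ.* + g → Result
      finish ℓ″ ℓ₂-eq = x′ , both , g * q ^ i , q ^ e * G.M , ℓ″ , b-eq″ , L-eq″ , Π∣ , coprime″
       where
        b-eq″ : b x′ v₂ ≡ + (g * q ^ i) ℤ.* ℓ″
        b-eq″ = trans b-x′₂ (trans (cong (+ (q ^ i) ℤ.*_) ℓ₂-eq) (trans (eqn (+ (q ^ i)) ℓ″ (+ g)) (cong (ℤ._* ℓ″) (sym (ℤP.pos-* g (q ^ i))))))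
          where
          eqn : ∀ a l g → a ℤ.* (l ℤ.* g) ≡ g ℤ.* a ℤ.* l
          eqn = ℤR.solve-∀
        ℓ₁-eq : ℓ₁ ≡ + (q ^ i) ℤ.* ℓ″
        ℓ₁-eq = ℤP.*-cancelˡ-≡ (+ g) ℓ₁ (+ (q ^ i) ℤ.* ℓ″) ⦃ g≢0 ⦄ (trans (sym b-x′₁) (trans b-eq″ (trans (cong (ℤ._* ℓ″) (ℤP.pos-* g (q ^ i))) (ℤP.*-assoc (+ g) (+ (q ^ i)) ℓ″))))
        L-eq″ : Q * L ≡ g * q ^ i * (g * q ^ i) * (q ^ e * G.M)
        L-eq″ = trans (cong₂ (λ s t → q ^ s * t) K-eq G.L-eq) (trans (cong (_* (g * g * G.M)) (trans (^-distribˡ-+-* q i (i + e)) (cong (q ^ i *_) (^-distribˡ-+-* q i e)))) (eqn (q ^ i) (q ^ e) g G.M))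
          where
          eqn : ∀ a c g M → a * (a * c) * (g * g * M) ≡ g * a * (g * a) * (c * M)
          eqn = solve-∀
        Π∣ : q ^ 1 * primorial 1 m ∣ q ^ e * G.M
        Π∣ = *-pres-∣ (*-monoʳ-∣ q (1∣ (q ^ (κ + κ ∸ (i + i))))) G.Π∣M
        ∣ℓ″∣∣ℓ₁ : ℤ.∣ ℓ″ ∣ ∣ ℤ.∣ ℓ₁ ∣
        ∣ℓ″∣∣ℓ₁ = subst (ℤ.∣ ℓ″ ∣ ∣_) (sym (trans (cong ℤ.∣_∣ ℓ₁-eq) (ℤP.abs-* (+ (q ^ i)) ℓ″))) (n∣m*n (q ^ i))
        coprime-Π : Coprime ℤ.∣ ℓ″ ∣ (primorial 1 m)
        coprime-Π = coprime-∣ˡ ∣ℓ″∣∣ℓ₁ (coprime-shift G.ℓ (+ g ℤ.* (+ G.M ℤ.* (μ ℤ.* D₂))) (primorial 1 m) G.coprime (S.∣n⇒∣m*n (+ g) (S.∣m⇒∣m*n {m = + G.M} (μ ℤ.* D₂) (S.∣ᵤ⇒∣ G.Π∣M))))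
        q∤ℓ″ : ¬ (q ∣ ℤ.∣ ℓ″ ∣)
        q∤ℓ″ d = q∤ℓq (S.∣m+n∣n⇒∣m {m = ℓq} {n = + (q ^ (i + e)) ℤ.* (ℤ.- ν ℤ.* D₂)} (S-subst (sym ℓ₂-eq) (S.∣m⇒∣m*n {m = ℓ″} (+ g) (S.∣ᵤ⇒∣ d)))
          (S.∣m⇒∣m*n {m = + (q ^ (i + e))} (ℤ.- ν ℤ.* D₂) (S.∣ᵤ⇒∣ (subst (q ∣_) (cong (q ^_) (sym (+-suc i (κ + κ ∸ (i + i))))) (m∣m*n (q ^ (i + (κ + κ ∸ (i + i)))))))))
        coprime″ : Coprime ℤ.∣ ℓ″ ∣ (q ^ 1 * primorial 1 m)
        coprime″ = coprime-* (coprime-^ 1 (prime-coprime pq ℤ.∣ ℓ″ ∣ q∤ℓ″)) coprime-Π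

  Improved : ℕ → Vector n → Set
  Improved m x = ∃ λ x′ → (+ primorial K m S.∣ (f x′ ℤ.- f x)) × Good m x′

  local-composite : ∀ m x → ¬ Prime (suc m) → Improved m x → Improved (suc m) x
  local-composite m x ¬p (y , y≡ , good) = y , subst (λ t → + t S.∣ (f y ℤ.- f x)) (sym (primorial-composite K m ¬p)) y≡
    , record { g = G.g ; M = G.M ; ℓ = G.ℓ ; b-eq = G.b-eq ; L-eq = trans (primorial-composite K m ¬p) G.L-eq
             ; Π∣M = subst (_∣ G.M) (sym (primorial-composite 1 m ¬p)) G.Π∣M ; coprime = subst (Coprime ℤ.∣ G.ℓ ∣) (sym (primorial-composite 1 m ¬p)) G.coprime }
    where module G = Good good

  local-prime : ∀ m x → Prime (suc m) → Improved m x → (∃ λ z → (+ (suc m ^ K) S.∣ (f z ℤ.- f x)) × GoodAt (suc m) z) → Improved (suc m) x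
  local-prime m x pq (y , y≡ , good) (z , z≡ , good-z) =
    let x′ , x′≡ , g , M , ℓ , b-eq , L-eq , Π∣M , co = combine m (suc m) pq coprime x y z y≡ good z≡ good-z
    in x′ , subst (λ t → + t S.∣ (f x′ ℤ.- f x)) (sym (primorial-prime K m pq)) x′≡
     , record { g = g ; M = M ; ℓ = ℓ ; b-eq = b-eq ; L-eq = trans (primorial-prime K m pq) L-eq
              ; Π∣M = subst (_∣ M) (sym (primorial-prime 1 m pq)) Π∣M ; coprime = subst (Coprime ℤ.∣ ℓ ∣) (sym (primorial-prime 1 m pq)) co }
    where
    coprime : Coprime (primorial K m) (suc m)
    coprime = prime-coprime pq (primorial K m) (λ d → <⇒≱ ≤-refl (smooth-primorial K m (suc m) pq d))

  local-step : ∀ m x → Dec (Prime (suc m)) → Bad m x ⊎ Improved m x → Bad (suc m) x ⊎ Improved (suc m) x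
  local-step m x _        (inj₁ (p , pp , p≤m , bad)) = inj₁ (p , pp , m≤n⇒m≤1+n p≤m , bad)
  local-step m x (no ¬p)  (inj₂ improved) = inj₂ (local-composite m x ¬p improved)
  local-step m x (yes pq) (inj₂ improved) = Sum.map (λ bad → suc m , pq , ≤-refl , bad) (local-prime m x pq improved) (at-prime pq x)

  local : ∀ m x → Bad m x ⊎ Improved m x
  local zero x = inj₂ (x , S.divides (+ 0) (ℤP.+-inverseʳ (f x))
    , record { g = 1 ; M = 1 ; ℓ = b x v₂ ; b-eq = sym (ℤP.*-identityˡ _) ; L-eq = refl ; Π∣M = ∣-refl ; coprime = λ (_ , d∣1) → ∣1⇒≡1 d∣1 })
  local (suc m) x = local-step m x (prime? (suc m)) (local m x)

-- Residue classes

nonneg-lift : ∀ y k → 1 ≤ k → ∃ λ m → y ℤ.+ + ℤ.∣ y ∣ ℤ.* + k ≡ + m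
nonneg-lift (+ n) k 1≤k = n + n * k , trans (cong (ℤ._+_ (+ n)) (sym (ℤP.pos-* n k))) (sym (ℤP.pos-+ n (n * k)))
nonneg-lift -[1+ n ] k 1≤k = suc n * k ∸ suc n , trans (cong (ℤ._+_ -[1+ n ]) (sym (ℤP.pos-* (suc n) k))) (ℤP.⊖-≥ (m≤m*n (suc n) k ⦃ >-nonZero 1≤k ⦄))

class-value : ∀ L g M z a c ℓ₁ a₁ ℓ a₂ ℓ₃ a₃ fx → L ≡ g ℤ.* g ℤ.* M →
  fx ℤ.+ (z ℤ.* L ℤ.* ℓ₁ ℤ.+ z ℤ.* L ℤ.* (z ℤ.* L) ℤ.* a₁) ℤ.+ (a ℤ.* (g ℤ.* M) ℤ.* (g ℤ.* ℓ) ℤ.+ a ℤ.* (g ℤ.* M) ℤ.* (a ℤ.* (g ℤ.* M)) ℤ.* a₂)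
    ℤ.+ (c ℤ.* L ℤ.* ℓ₃ ℤ.+ c ℤ.* L ℤ.* (c ℤ.* L) ℤ.* a₃)
  ≡ fx ℤ.+ L ℤ.* ((ℓ₁ ℤ.* z ℤ.+ L ℤ.* a₁ ℤ.* z ℤ.* z) ℤ.+ ((ℓ ℤ.+ M ℤ.* a₂ ℤ.* a) ℤ.* a ℤ.+ (ℓ₃ ℤ.+ L ℤ.* a₃ ℤ.* c) ℤ.* c))
class-value _ g M z a c ℓ₁ a₁ ℓ a₂ ℓ₃ a₃ fx refl = trans (separate g M a ℓ a₂ (fx ℤ.+ (z ℤ.* L ℤ.* ℓ₁ ℤ.+ z ℤ.* L ℤ.* (z ℤ.* L) ℤ.* a₁)) (c ℤ.* L ℤ.* ℓ₃ ℤ.+ c ℤ.* L ℤ.* (c ℤ.* L) ℤ.* a₃)) (gather L M z a c ℓ₁ a₁ ℓ a₂ ℓ₃ a₃ fx)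
  where
  L = g ℤ.* g ℤ.* M
  separate : ∀ g M a ℓ a₂ X Y → X ℤ.+ (a ℤ.* (g ℤ.* M) ℤ.* (g ℤ.* ℓ) ℤ.+ a ℤ.* (g ℤ.* M) ℤ.* (a ℤ.* (g ℤ.* M)) ℤ.* a₂) ℤ.+ Y ≡ X ℤ.+ (g ℤ.* g ℤ.* M) ℤ.* ((ℓ ℤ.+ M ℤ.* a₂ ℤ.* a) ℤ.* a) ℤ.+ Y
  separate = ℤR.solve-∀
  gather : ∀ L M z a c ℓ₁ a₁ ℓ a₂ ℓ₃ a₃ fx → fx ℤ.+ (z ℤ.* L ℤ.* ℓ₁ ℤ.+ z ℤ.* L ℤ.* (z ℤ.* L) ℤ.* a₁) ℤ.+ L ℤ.* ((ℓ ℤ.+ M ℤ.* a₂ ℤ.* a) ℤ.* a) ℤ.+ (c ℤ.* L ℤ.* ℓ₃ ℤ.+ c ℤ.* L ℤ.* (c ℤ.* L) ℤ.* a₃)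
    ≡ fx ℤ.+ L ℤ.* ((ℓ₁ ℤ.* z ℤ.+ L ℤ.* a₁ ℤ.* z ℤ.* z) ℤ.+ ((ℓ ℤ.+ M ℤ.* a₂ ℤ.* a) ℤ.* a ℤ.+ (ℓ₃ ℤ.+ L ℤ.* a₃ ℤ.* c) ℤ.* c))
  gather = ℤR.solve-∀

-- The positive integers congruent to `s` that exceed `∣ s ∣` have the form `s + L t` with `t ≥ 0`.
-- Those up to `∣ s ∣` are counted trivially, and the lower bound for `N` absorbs them.
progression-count : ∀ L s b T₀ → 1 ≤ L → (ν : ℤ → ℕ) → (∀ m → ν m ≤ 1) →
  (∀ T → T₀ ≤ T → b * ∑ T (λ t → ν (s ℤ.+ + L ℤ.* + t)) ≤ 1 * T) →
  ∀ N → L * (T₀ + (b * ℤ.∣ s ∣ + (2 * ℤ.∣ s ∣ + 3))) ≤ N →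
  b * (L * ∑ N (λ j → ⟦ + L S.∣? (+ suc j ℤ.- s) ⟧ * ν (+ suc j))) ≤ 2 * N
progression-count L s b T₀ 1≤L ν ν≤1 almost N N-large = begin
  b * (L * ∑ N G)                           ≤⟨ *-monoʳ-≤ b (*-monoʳ-≤ L (≤-trans (∑-range-mono G (m≤n+m N F₀)) (≤-reflexive (∑-split F₀ N G)))) ⟩
  b * (L * (∑ F₀ G + ∑ N (λ i → G (F₀ + i))))     ≤⟨ *-monoʳ-≤ b (*-monoʳ-≤ L (+-mono-≤ (≤-trans (∑-bound F₀ 1 (λ j _ → G≤1 j)) (≤-reflexive (*-identityʳ F₀))) tail)) ⟩
  b * (L * (F₀ + ∑ T (λ t → ν (s ℤ.+ + L ℤ.* + t))))  ≡⟨ arr b L F₀ (∑ T (λ t → ν (s ℤ.+ + L ℤ.* + t))) ⟩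
  L * (b * F₀) + L * (b * ∑ T (λ t → ν (s ℤ.+ + L ℤ.* + t)))  ≤⟨ +-monoʳ-≤ (L * (b * F₀)) (*-monoʳ-≤ L (≤-trans (almost T T-large) (≤-reflexive (*-identityˡ T)))) ⟩
  L * (b * F₀) + L * T                      ≡⟨ arr′ L (b * F₀) (N / L) (2 * F₀ + 3) ⟩
  N / L * L + L * (b * F₀ + (2 * F₀ + 3))   ≤⟨ +-mono-≤ q≤N (≤-trans (*-monoʳ-≤ L (m≤n+m (b * F₀ + (2 * F₀ + 3)) T₀)) N-large) ⟩
  N + N                                     ≡⟨ cong (_+_ N) (+-identityʳ N) ⟨
  2 * N                                     ∎
  where
  open ≤-Reasoning
  instance
    L≢0 : NonZero L
    L≢0 = >-nonZero 1≤L
  F₀ = ℤ.∣ s ∣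
  -- `L t = j - s` with `j ≤ N + ∣ s ∣` gives `t < T`, with room to spare.
  T = N / L + (2 * F₀ + 3)
  G : ℕ → ℕ
  G j = ⟦ + L S.∣? (+ suc j ℤ.- s) ⟧ * ν (+ suc j)
  G≤1 : ∀ j → G j ≤ 1
  G≤1 j = ⟦⟧-if (+ L S.∣? (+ suc j ℤ.- s)) (λ _ → ν≤1 (+ suc j))
  arr : ∀ b L f s → b * (L * (f + s)) ≡ L * (b * f) + L * (b * s)
  arr = solve-∀
  arr′ : ∀ L x q y → L * x + L * (q + y) ≡ q * L + L * (x + y)
  arr′ = solve-∀
  N≡ : N ≡ N % L + N / L * L
  N≡ = m≡m%n+[m/n]*n N L
  q≤N : N / L * L ≤ N
  q≤N = ≤-trans (m≤n+m _ _) (≤-reflexive (sym N≡))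
  T₀≤q : T₀ ≤ N / L
  T₀≤q = ≮⇒≥ (λ q<T₀ → <-irrefl refl (begin-strict
    N                        ≡⟨ N≡ ⟩
    N % L + N / L * L        <⟨ +-monoˡ-< (N / L * L) (m%n<n N L) ⟩
    L + N / L * L            ≤⟨ *-monoˡ-≤ L q<T₀ ⟩
    T₀ * L                   ≡⟨ *-comm T₀ L ⟩
    L * T₀                   ≤⟨ *-monoʳ-≤ L (m≤m+n T₀ _) ⟩
    L * (T₀ + (b * ℤ.∣ s ∣ + (2 * ℤ.∣ s ∣ + 3)))   ≤⟨ N-large ⟩
    N                        ∎))
  T-large : T₀ ≤ T
  T-large = ≤-trans T₀≤q (m≤m+n (N / L) _)
  gap : ∀ i → ∃ λ e → + suc (F₀ + i) ℤ.- s ≡ + (i + e) × e ≤ 2 * F₀ + 1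
  gap i = let m , eq , m≤ = shift-nonneg (ℤ.- s) F₀ (≤-reflexive (ℤP.∣-i∣≡∣i∣ s)) in
    m + 1 , trans (cong (ℤ._- s) (trans (cong +_ (trans (+-comm 1 (F₀ + i)) (cong (_+ 1) (+-comm F₀ i)))) (trans (ℤP.pos-+ (i + F₀) 1) (cong (ℤ._+ + 1) (ℤP.pos-+ i F₀)))))
      (trans (eqn (+ i) (+ F₀) s) (trans (cong (λ z → + i ℤ.+ (z ℤ.+ + 1)) eq) (trans (cong (ℤ._+_ (+ i)) (sym (ℤP.pos-+ m 1))) (sym (ℤP.pos-+ i (m + 1)))))) , +-monoˡ-≤ 1 m≤
    where
    eqn : ∀ i F s → (i ℤ.+ F ℤ.+ + 1) ℤ.- s ≡ i ℤ.+ ((ℤ.- s ℤ.+ F) ℤ.+ + 1)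
    eqn = ℤR.solve-∀
  quotient-natural : ∀ q m → + m ≡ q ℤ.* + L → ∃ λ t → q ≡ + t × m ≡ t * L
  quotient-natural (+ t) m eq = t , refl , ℤP.+-injective (trans eq (sym (ℤP.pos-* t L)))
  quotient-natural -[1+ t ] m eq = ⊥-elim (negative (trans eq (trans (ℤP.*-comm -[1+ t ] (+ L)) (cong (ℤ._* -[1+ t ]) (cong +_ (sym (suc-pred L)))))))
    where
    negative : ¬ (+ m ≡ + suc (pred L) ℤ.* -[1+ t ])
    negative ()
  located : ∀ i → i < N → + L S.∣ (+ suc (F₀ + i) ℤ.- s) → ∃ λ t → t < T × + suc (F₀ + i) ≡ s ℤ.+ + L ℤ.* + t
  located i i<N (S.divides q eq) with gap i
  ... | e , gap-eq , e≤ with quotient-natural q (i + e) (trans (sym gap-eq) eq)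
  ...   | t , refl , ie≡ = t , *-cancelʳ-< L t T (begin-strict
          t * L                                     ≡⟨ ie≡ ⟨
          i + e                                     <⟨ +-mono-<-≤ i<N e≤ ⟩
          N + (2 * F₀ + 1)                          ≤⟨ +-mono-≤ (≤-trans (≤-reflexive N≡) (+-monoˡ-≤ (N / L * L) (<⇒≤ (m%n<n N L)))) (m≤m*n (2 * F₀ + 1) L) ⟩
          L + N / L * L + (2 * F₀ + 1) * L          ≤⟨ ≤-from L (z≤n {0}) (arr″ L (N / L) F₀) ⟩
          T * L                                     ∎)
        , trans (eqn (+ suc (F₀ + i)) s) (cong (ℤ._+_ s) (trans eq (ℤP.*-comm (+ t) (+ L))))
    where
    eqn : ∀ x s → x ≡ s ℤ.+ (x ℤ.- s)
    eqn = ℤR.solve-∀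
    arr″ : ∀ L q f → L + q * L + (2 * f + 1) * L + 0 + L ≡ (q + (2 * f + 3)) * L + 0
    arr″ = solve-∀
  tail : ∑ N (λ i → G (F₀ + i)) ≤ ∑ T (λ t → ν (s ℤ.+ + L ℤ.* + t))
  tail = begin
    ∑ N (λ i → G (F₀ + i))                                              ≤⟨ ∑-mono N (λ i i<N → ⟦⟧-if (+ L S.∣? (+ suc (F₀ + i) ℤ.- s)) (λ d → placed i (located i i<N d))) ⟩
    ∑ N (λ i → ∑ T (λ t → ⟦ at i t ⟧ * ν (s ℤ.+ + L ℤ.* + t)))          ≡⟨ ∑-swap N T _ ⟩
    ∑ T (λ t → ∑ N (λ i → ⟦ at i t ⟧ * ν (s ℤ.+ + L ℤ.* + t)))          ≡⟨ ∑-cong T (λ t _ → ∑-*ʳ N (ν (s ℤ.+ + L ℤ.* + t)) (λ i → ⟦ at i t ⟧)) ⟩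
    ∑ T (λ t → ∑ N (λ i → ⟦ at i t ⟧) * ν (s ℤ.+ + L ℤ.* + t))          ≤⟨ ∑-mono T (λ t _ → ≤-trans (*-monoˡ-≤ (ν (s ℤ.+ + L ℤ.* + t)) (count-unique (λ i → at i t) N
          (λ i j i<j _ p q → <-irrefl (+-cancelˡ-≡ F₀ i j (suc-injective (ℤP.+-injective (trans p (sym q))))) i<j))) (≤-reflexive (*-identityˡ _))) ⟩
    ∑ T (λ t → ν (s ℤ.+ + L ℤ.* + t))                                   ∎
    where
    at : ∀ i t → Dec (+ suc (F₀ + i) ≡ s ℤ.+ + L ℤ.* + t)
    at i t = + suc (F₀ + i) ℤ.≟ s ℤ.+ + L ℤ.* + t
    placed : ∀ i → (∃ λ t → t < T × + suc (F₀ + i) ≡ s ℤ.+ + L ℤ.* + t) → ν (+ suc (F₀ + i)) ≤ ∑ T (λ t → ⟦ at i t ⟧ * ν (s ℤ.+ + L ℤ.* + t))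
    placed i (t , t<T , eq) = ≤-trans (≤-reflexive (trans (cong ν eq) (trans (sym (*-identityˡ _)) (cong (_* ν (s ℤ.+ + L ℤ.* + t)) (sym (⟦⟧-yes (at i t) eq))))))
      (∑-term T (λ t → ⟦ at i t ⟧ * ν (s ℤ.+ + L ℤ.* + t)) t<T)

module Class (n : ℕ) (c : Fin n → Fin n → ℤ) (basis : Form.OrthogonalBasis n c (Form.standard n c)) (i₁ i₂ i₃ : Fin n)
  (1≢2 : i₁ ≢ i₂) (1≢3 : i₁ ≢ i₃) (2≢3 : i₂ ≢ i₃) (σ w a₁ : ℕ) (1≤a₁ : 1 ≤ a₁) (a₁-eq : Form.Basis.a n c basis i₁ ≡ + a₁)
  (2≤w : 2 ≤ w) (a₁≤w : a₁ ≤ w) (a₂≤w : ℤ.∣ Form.Basis.a n c basis i₂ ∣ ≤ w) (a₃≤w : ℤ.∣ Form.Basis.a n c basis i₃ ∣ ≤ w) where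

  open Form n c
  open Basis basis
  open Local n c basis i₂ σ

  L : ℕ
  L = primorial K w

  1≤L : 1 ≤ L
  1≤L = primorial≥1 K w

  module _ (x : Vector n) (good : Good w x) where

    module G = Good good

    v₁ v₃ : Vector n
    v₁ = v i₁
    v₃ = v i₃

    norm₁ : norm i₁ ≡ + (2 * a₁)
    norm₁ = trans (b-self v₁) (trans (cong (+ 2 ℤ.*_) a₁-eq) (sym (ℤP.pos-* 2 a₁)))

    -- Makes the linear coefficient along `v₁` nonnegative, since the window argument takes `ℓ₁` in
    -- ℕ. The class of `f` modulo `L` and the values of `b` at the two other basis vectors stay the
    -- same.
    x⁺ : Vector n
    x⁺ = lin (+ 1) x (+ ℤ.∣ b x v₁ ∣ ℤ.* + L) v₁

    b-x⁺ : ∀ i → i₁ ≢ i → b x⁺ (v i) ≡ b x (v i)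
    b-x⁺ i ne = trans (b-lin (+ 1) x (+ ℤ.∣ b x v₁ ∣ ℤ.* + L) v₁ (v i)) (trans (cong (λ z → + 1 ℤ.* b x (v i) ℤ.+ + ℤ.∣ b x v₁ ∣ ℤ.* + L ℤ.* z) (orthogonal i₁ i ne)) (eqn (b x (v i)) (+ ℤ.∣ b x v₁ ∣ ℤ.* + L)))
      where
      eqn : ∀ y s → + 1 ℤ.* y ℤ.+ s ℤ.* + 0 ≡ y
      eqn = ℤR.solve-∀

    lifted : ∃ λ m → b x v₁ ℤ.+ + ℤ.∣ b x v₁ ∣ ℤ.* + (L * (2 * a₁)) ≡ + m
    lifted = nonneg-lift (b x v₁) (L * (2 * a₁)) (*-mono-≤ 1≤L (*-mono-≤ (s≤s (z≤n {1})) 1≤a₁))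

    b-x⁺₁ : b x⁺ v₁ ≡ b x v₁ ℤ.+ + ℤ.∣ b x v₁ ∣ ℤ.* + (L * (2 * a₁))
    b-x⁺₁ = trans (b-lin (+ 1) x (+ ℤ.∣ b x v₁ ∣ ℤ.* + L) v₁ v₁) (trans (cong (λ z → + 1 ℤ.* b x v₁ ℤ.+ + ℤ.∣ b x v₁ ∣ ℤ.* + L ℤ.* z) norm₁)
      (trans (eqn (b x v₁) (+ ℤ.∣ b x v₁ ∣) (+ L) (+ (2 * a₁))) (cong (λ z → b x v₁ ℤ.+ + ℤ.∣ b x v₁ ∣ ℤ.* z) (sym (ℤP.pos-* L (2 * a₁))))))
      where
      eqn : ∀ y s L k → + 1 ℤ.* y ℤ.+ s ℤ.* L ℤ.* k ≡ y ℤ.+ s ℤ.* (L ℤ.* k)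
      eqn = ℤR.solve-∀

    M≥1 : 1 ≤ G.M
    M≥1 = n≢0⇒n>0 (λ M≡0 → <⇒≱ 1≤L (≤-reflexive (trans G.L-eq (trans (cong (G.g * G.g *_) M≡0) (*-zeroʳ (G.g * G.g))))))

    A₂ A₃ : ℤ
    A₂ = + G.M ℤ.* a i₂
    A₃ = + L ℤ.* a i₃

    smooth-L : Smooth w L
    smooth-L = smooth-primorial K w

    coprime-A₂ : Coprime ℤ.∣ G.ℓ ∣ ℤ.∣ A₂ ∣
    coprime-A₂ = subst (Coprime ℤ.∣ G.ℓ ∣) (sym (ℤP.abs-* (+ G.M) (a i₂)))
      (coprime-* (coprime-smooth G.M G.coprime M≥1 (λ p pp d → smooth-L p pp (subst (p ∣_) (sym G.L-eq) (∣n⇒∣m*n (G.g * G.g) d))))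
                 (coprime-smooth ℤ.∣ a i₂ ∣ G.coprime (abs-pos (a≢0 i₂)) (smooth-≤ _ (abs-pos (a≢0 i₂)) a₂≤w)))

    -- `Π∣M` puts all primes up to `w` into `A₂`; those of 2, `L`, `a₁` and `a i₃` are among them by
    -- the bounds on `w`.
    rough : ∀ g → Coprime g ℤ.∣ A₂ ∣ → Coprime g 2 × Coprime g (L * a₁) × Coprime g ℤ.∣ A₃ ∣ × Rough w g
    rough g co = coprime-smooth 2 coΠ (s≤s z≤n) (smooth-≤ 2 (s≤s z≤n) 2≤w)
      , coprime-smooth (L * a₁) coΠ (*-mono-≤ 1≤L 1≤a₁) (smooth-* L a₁ smooth-L (smooth-≤ a₁ 1≤a₁ a₁≤w))
      , subst (Coprime g) (sym (ℤP.abs-* (+ L) (a i₃))) (coprime-smooth (L * ℤ.∣ a i₃ ∣) coΠ (*-mono-≤ 1≤L (abs-pos (a≢0 i₃))) (smooth-* L _ smooth-L (smooth-≤ _ (abs-pos (a≢0 i₃)) a₃≤w)))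
      , coprime-rough w g 2≤w coΠ
      where
      coΠ : Coprime g (primorial 1 w)
      coΠ (d∣g , d∣Π) = co (d∣g , ∣-trans d∣Π (∣-trans G.Π∣M (subst (G.M ∣_) (sym (ℤP.abs-* (+ G.M) (a i₂))) (m∣m*n ℤ.∣ a i₂ ∣))))

    A₂≢0 : A₂ ≢ + 0
    A₂≢0 = *-nonzero (λ e → <⇒≱ M≥1 (≤-reflexive (ℤP.+-injective e))) (a≢0 i₂)

    A₃≢0 : A₃ ≢ + 0
    A₃≢0 = *-nonzero (λ e → <⇒≱ 1≤L (≤-reflexive (ℤP.+-injective e))) (a≢0 i₃)

    -- The witness is `x⁺ + z L v₁ + l g M v₂ + k L v₃`. Orthogonality makes the three increments of
    -- `f` independent, and the step `g M` is such that the second one carries the same factor `L`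
    -- as the others.
    represented : ∀ ℓ₁ → b x⁺ v₁ ≡ + ℓ₁ → ∀ z k l →
      ∃ λ y → f y ≡ f x⁺ ℤ.+ + L ℤ.* (+ (ℓ₁ * z + L * a₁ * z * z) ℤ.+ (quad G.ℓ A₂ l ℤ.+ quad (b x v₃) A₃ k))
    represented ℓ₁ ℓ₁-eq z k l = y₃ , trans (f-shift y₂ s₃ v₃) (trans (cong₂ (λ X Y → X ℤ.+ (s₃ ℤ.* Y ℤ.+ s₃ ℤ.* s₃ ℤ.* a i₃)) f-y₂ b-y₂)
        (trans (class-value (+ L) (+ G.g) (+ G.M) (+ z) (+ l) (+ k) (+ ℓ₁) (+ a₁) G.ℓ (a i₂) (b x v₃) (a i₃) (f x⁺) L-eqℤ)
          (cong (λ X → f x⁺ ℤ.+ + L ℤ.* (X ℤ.+ (quad G.ℓ A₂ l ℤ.+ quad (b x v₃) A₃ k))) (sym natural))))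
      where
      s₁ s₂ s₃ : ℤ
      s₁ = + z ℤ.* + L
      s₂ = + l ℤ.* (+ G.g ℤ.* + G.M)
      s₃ = + k ℤ.* + L
      y₁ y₂ y₃ : Vector n
      y₁ = lin (+ 1) x⁺ s₁ v₁
      y₂ = lin (+ 1) y₁ s₂ v₂
      y₃ = lin (+ 1) y₂ s₃ v₃
      L-eqℤ : + L ≡ + G.g ℤ.* + G.g ℤ.* + G.M
      L-eqℤ = trans (cong +_ G.L-eq) (trans (ℤP.pos-* (G.g * G.g) G.M) (cong (ℤ._* + G.M) (ℤP.pos-* G.g G.g)))
      keep : ∀ y s i j → i ≢ j → b (lin (+ 1) y s (v i)) (v j) ≡ b y (v j)
      keep y s i j ne = trans (b-lin (+ 1) y s (v i) (v j)) (trans (cong (λ t → + 1 ℤ.* b y (v j) ℤ.+ s ℤ.* t) (orthogonal i j ne)) (eqn (b y (v j)) s))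
        where
        eqn : ∀ y s → + 1 ℤ.* y ℤ.+ s ℤ.* + 0 ≡ y
        eqn = ℤR.solve-∀
      b-y₂ : b y₂ v₃ ≡ b x v₃
      b-y₂ = trans (keep y₁ s₂ i₂ i₃ 2≢3) (trans (keep x⁺ s₁ i₁ i₃ 1≢3) (b-x⁺ i₃ 1≢3))
      f-y₁ : f y₁ ≡ f x⁺ ℤ.+ (s₁ ℤ.* + ℓ₁ ℤ.+ s₁ ℤ.* s₁ ℤ.* + a₁)
      f-y₁ = trans (f-shift x⁺ s₁ v₁) (cong₂ (λ X Y → f x⁺ ℤ.+ (s₁ ℤ.* X ℤ.+ s₁ ℤ.* s₁ ℤ.* Y)) ℓ₁-eq a₁-eq)
      f-y₂ : f y₂ ≡ f x⁺ ℤ.+ (s₁ ℤ.* + ℓ₁ ℤ.+ s₁ ℤ.* s₁ ℤ.* + a₁) ℤ.+ (s₂ ℤ.* (+ G.g ℤ.* G.ℓ) ℤ.+ s₂ ℤ.* s₂ ℤ.* a i₂)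
      f-y₂ = trans (f-shift y₁ s₂ v₂) (cong₂ (λ X Y → X ℤ.+ (s₂ ℤ.* Y ℤ.+ s₂ ℤ.* s₂ ℤ.* a i₂)) f-y₁ (trans (keep x⁺ s₁ i₁ i₂ 1≢2) (trans (b-x⁺ i₂ 1≢2) G.b-eq)))
      natural : + (ℓ₁ * z + L * a₁ * z * z) ≡ + ℓ₁ ℤ.* + z ℤ.+ + L ℤ.* + a₁ ℤ.* + z ℤ.* + z
      natural = trans (ℤP.pos-+ (ℓ₁ * z) (L * a₁ * z * z)) (cong₂ ℤ._+_ (ℤP.pos-* ℓ₁ z) (trans (ℤP.pos-* (L * a₁ * z) z) (cong (ℤ._* + z) (trans (ℤP.pos-* (L * a₁) z) (cong (ℤ._* + z) (ℤP.pos-* L a₁))))))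

    x⁺≡ : + L S.∣ (f x⁺ ℤ.- f x)
    x⁺≡ = f-shift-∣ (+ L) x (+ ℤ.∣ b x v₁ ∣) v₁

    class-bound : ∀ e → 1 ≤ e → roughness e ≤ w → ∃ λ N₀ → ∀ N → N₀ ≤ N → ∀ (ν : ℤ → ℕ) → (∀ m → ν m ≤ 1) → (∀ y → ν (f y) ≡ 0) →
      e * (L * ∑ N (λ j → ⟦ + L S.∣? (+ suc j ℤ.- f x) ⟧ * ν (+ suc j))) ≤ 2 * N
    class-bound e 1≤e w-large = by lifted
      where
      by : (∃ λ m → b x v₁ ℤ.+ + ℤ.∣ b x v₁ ∣ ℤ.* + (L * (2 * a₁)) ≡ + m) → ∃ λ N₀ → ∀ N → N₀ ≤ N → ∀ (ν : ℤ → ℕ) → (∀ m → ν m ≤ 1) → (∀ y → ν (f y) ≡ 0) →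
        e * (L * ∑ N (λ j → ⟦ + L S.∣? (+ suc j ℤ.- f x) ⟧ * ν (+ suc j))) ≤ 2 * N
      by (ℓ₁ , ℓ₁-eq) = L * (T₀ + (e * ℤ.∣ f x⁺ ∣ + (2 * ℤ.∣ f x⁺ ∣ + 3))) , λ N N-large ν ν≤1 ν-rep →
        ≤-trans (*-monoʳ-≤ e (*-monoʳ-≤ L (∑-mono N (λ j _ → *-monoˡ-≤ (ν (+ suc j)) (⟦⟧-mono (+ L S.∣? (+ suc j ℤ.- f x)) (+ L S.∣? (+ suc j ℤ.- f x⁺)) (λ d →
            ∣-chain (+ suc j) (f x) (f x⁺) d (∣-flip (f x⁺) (f x) x⁺≡)))))))
          (progression-count L (f x⁺) e T₀ 1≤L ν ν≤1 (λ T T-large → proj₂ result T T-large (λ t → ν (f x⁺ ℤ.+ + L ℤ.* + t)) (λ t → ν≤1 _)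
            (λ t (z , k , l , eq) → let y , f-eq = represented ℓ₁ (trans b-x⁺₁ ℓ₁-eq) z k l in
              trans (cong (λ X → ν (f x⁺ ℤ.+ + L ℤ.* X)) eq) (trans (cong ν (sym f-eq)) (ν-rep y)))) N N-large)
        where
        result = AlmostAll.almost-all ℓ₁ (L * a₁) G.ℓ A₂ (b x v₃) A₃ w (*-mono-≤ 1≤L 1≤a₁) coprime-A₂ rough A₂≢0 A₃≢0 e 1≤e w-large
        T₀ = proj₁ result

-- Approximation by periodic sets

-- Only the last, incomplete period causes an error.
periodic-count : ∀ L (G : ℕ → ℕ) → 1 ≤ L → (∀ j → G j ≤ 1) → (∀ j → G (j + L) ≡ G j) → ∀ N → let i = ∑ L G in
  L * ∑ N G ≤ i * N + L * L × i * N ≤ L * ∑ N G + L * L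
periodic-count L G 1≤L G≤1 per N = upper , lower
  where
  open ≤-Reasoning
  instance
    L≢0 : NonZero L
    L≢0 = >-nonZero 1≤L
  i q : ℕ
  i = ∑ L G
  q = N / L
  i≤L : i ≤ L
  i≤L = ≤-trans (∑-bound L 1 (λ j _ → G≤1 j)) (≤-reflexive (*-identityʳ L))
  N≡ : N ≡ N % L + q * L
  N≡ = m≡m%n+[m/n]*n N L
  shifted : ∀ m j → G (m * L + j) ≡ G j
  shifted zero    j = refl
  shifted (suc m) j = trans (cong G (arr L (m * L) j)) (trans (per (m * L + j)) (shifted m j))
    where
    arr : ∀ L x j → L + x + j ≡ x + j + L
    arr = solve-∀
  blocks : ∀ m → ∑ (m * L) G ≡ m * i
  blocks m = trans (∑-block m L G) (trans (∑-cong m (λ l _ → ∑-cong L (λ j _ → shifted l j))) (∑-const m i))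
  q≤N : q * L ≤ N
  q≤N = ≤-trans (m≤n+m _ _) (≤-reflexive (sym N≡))
  N≤ : N ≤ suc q * L
  N≤ = ≤-trans (≤-reflexive N≡) (+-monoˡ-≤ (q * L) (<⇒≤ (m%n<n N L)))
  upper : L * ∑ N G ≤ i * N + L * L
  upper = begin
    L * ∑ N G              ≤⟨ *-monoʳ-≤ L (≤-trans (∑-range-mono G N≤) (≤-reflexive (blocks (suc q)))) ⟩
    L * (i + q * i)        ≡⟨ arr L i q ⟩
    i * (q * L) + L * i    ≤⟨ +-mono-≤ (*-monoʳ-≤ i q≤N) (*-monoʳ-≤ L i≤L) ⟩
    i * N + L * L          ∎
    where
    arr : ∀ L i q → L * (i + q * i) ≡ i * (q * L) + L * i
    arr = solve-∀
  lower : i * N ≤ L * ∑ N G + L * L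
  lower = begin
    i * N                  ≤⟨ *-monoʳ-≤ i N≤ ⟩
    i * (L + q * L)        ≡⟨ arr L i q ⟩
    L * (q * i) + L * i    ≤⟨ +-mono-≤ (*-monoʳ-≤ L (≤-trans (≤-reflexive (sym (blocks q))) (∑-range-mono G q≤N))) (*-monoʳ-≤ L i≤L) ⟩
    L * ∑ N G + L * L      ∎
    where
    arr : ∀ L i q → i * (L + q * L) ≡ L * (q * i) + L * i
    arr = solve-∀

anyVec? : ∀ {L} m {P : Vec (Fin L) m → Set} → (∀ u → Dec (P u)) → Dec (∃ P)
anyVec? zero    P? with P? []
... | yes p = yes ([] , p)
... | no ¬p = no λ { ([] , p) → ¬p p }
anyVec? (suc m) P? with FinP.any? (λ i → anyVec? m (λ u → P? (i ∷ u)))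
... | yes (i , u , p) = yes (i ∷ u , p)
... | no ¬p = no λ { (i ∷ u , p) → ¬p (i , u , p) }

-- Two hits in a block of length `Z` would make `C` times their distance a positive multiple of `q`,
-- although it is at most `C * Z < q`.
sparse-multiples : ∀ C q Z N → 1 ≤ Z → C * Z < q → 1 ≤ C → count (λ j → q ∣? (C * suc j)) N * Z ≤ N + Z
sparse-multiples C q Z N 1≤Z CZ<q 1≤C = begin
  count P? N * Z                ≤⟨ *-monoˡ-≤ Z (≤-trans (∑-range-mono (λ j → ⟦ P? j ⟧) N≤) (count-blocks P? (suc (N / Z)) Z (λ l _ δ ε δ<ε ε<Z p r → clash l δ ε δ<ε ε<Z p r))) ⟩
  suc (N / Z) * Z               ≡⟨ +-comm Z (N / Z * Z) ⟩
  N / Z * Z + Z                 ≤⟨ +-monoˡ-≤ Z (≤-trans (m≤n+m _ _) (≤-reflexive (sym N≡))) ⟩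
  N + Z                         ∎
  where
  open ≤-Reasoning
  instance
    Z≢0 : NonZero Z
    Z≢0 = >-nonZero 1≤Z
  P? : ∀ j → Dec (q ∣ C * suc j)
  P? j = q ∣? (C * suc j)
  N≡ : N ≡ N % Z + N / Z * Z
  N≡ = m≡m%n+[m/n]*n N Z
  N≤ : N ≤ suc (N / Z) * Z
  N≤ = ≤-trans (≤-reflexive N≡) (+-monoˡ-≤ (N / Z * Z) (<⇒≤ (m%n<n N Z)))
  clash : ∀ l δ ε → δ < ε → ε < Z → q ∣ C * suc (l * Z + δ) → q ∣ C * suc (l * Z + ε) → ⊥
  clash l δ ε δ<ε ε<Z p r = <⇒≱ CZ<q (begin
    q                ≤⟨ ∣⇒≤ ⦃ >-nonZero (*-mono-≤ 1≤C (m<n⇒0<n∸m δ<ε)) ⦄ (∣m+n∣m⇒∣n (subst (q ∣_) split r) p) ⟩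
    C * (ε ∸ δ)      ≤⟨ *-monoʳ-≤ C (≤-trans (m∸n≤m ε δ) (<⇒≤ ε<Z)) ⟩
    C * Z            ∎)
    where
    split : C * suc (l * Z + ε) ≡ C * suc (l * Z + δ) + C * (ε ∸ δ)
    split = trans (cong (λ x → C * suc (l * Z + x)) (sym (m+[n∸m]≡n (<⇒≤ δ<ε)))) (arr C (l * Z) δ (ε ∸ δ))
      where
      arr : ∀ C x δ t → C * suc (x + (δ + t)) ≡ C * suc (x + δ) + C * t
      arr = solve-∀

-- Zero beyond `N` and on integers `≤ 0`, so that it vanishes on all values of the form although `T`
-- describes them only up to `N`.
missingAt : ∀ {T : ℕ → Set} → (∀ j → Dec (T j)) → ℕ → ℤ → ℕ
missingAt T? N (+ suc j) = ⟦ ¬? (T? j ⊎-dec (N ≤? j)) ⟧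
missingAt T? N _         = 0

missingAt≤1 : ∀ {T : ℕ → Set} (T? : ∀ j → Dec (T j)) N m → missingAt T? N m ≤ 1
missingAt≤1 T? N (+ zero)  = z≤n
missingAt≤1 T? N (+ suc j) = ⟦⟧≤1 (¬? (T? j ⊎-dec (N ≤? j)))
missingAt≤1 T? N -[1+ _ ]  = z≤n

missingAt-zero : ∀ {T : ℕ → Set} (T? : ∀ j → Dec (T j)) N m → (∀ j → j < N → m ≡ + suc j → T j) → missingAt T? N m ≡ 0
missingAt-zero T? N (+ zero)  _   = refl
missingAt-zero T? N -[1+ _ ]  _   = refl
missingAt-zero T? N (+ suc j) rep = ⟦⟧-no (¬? (T? j ⊎-dec (N ≤? j))) (λ ¬TN → ¬TN (covered (N ≤? j)))
  where
  covered : Dec (N ≤ j) → _ ⊎ (N ≤ j)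
  covered (yes N≤j) = inj₂ N≤j
  covered (no N≰j)  = inj₁ (rep j (≰⇒> N≰j) refl)

missingAt-total : ∀ {T : ℕ → Set} (T? : ∀ j → Dec (T j)) N j → j < N → 1 ≤ ⟦ T? j ⟧ + missingAt T? N (+ suc j)
missingAt-total T? N j j<N with T? j | N ≤? j
... | yes _ | _       = s≤s z≤n
... | no  _ | yes N≤j = ⊥-elim (<⇒≱ j<N N≤j)
... | no  _ | no  _   = ≤-refl

-- `T` is a decidable stand-in for `S` on the integers from 1 to `N`; in the end it is membership in
-- the list that a count provides.
Decides : (ℤ → Set) → ℕ → (ℕ → Set) → Set
Decides S N T = ∀ j → j < N → (T j → S (+ suc j)) × (S (+ suc j) → T j)

-- For large N the proportion count / N is within 1 / E of i / L.
Approximable : (ℤ → Set) → Set₁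
Approximable S = ∀ E → 1 ≤ E → ∃ λ L → ∃ λ i → ∃ λ N₀ → 1 ≤ L × (∀ N → N₀ ≤ N → ∀ {T : ℕ → Set} (T? : ∀ j → Dec (T j)) → Decides S N T →
  E * (L * count T? N) ≤ E * (i * N) + N * L × E * (i * N) ≤ E * (L * count T? N) + N * L)

PositiveLower : (ℤ → Set) → Set₁
PositiveLower S = ∃ λ d → ∃ λ N₀ → ∀ N → N₀ ≤ N → ∀ {T : ℕ → Set} (T? : ∀ j → Dec (T j)) → Decides S N T → N ≤ suc d * count T? N

-- Of the error `N L`, one third goes to the incomplete period and two thirds to `bad` or `miss`;
-- hence `e = 3 E`.
sandwich : ∀ E e → e ≡ 3 * E → ∀ L i N A k bad miss → e * L ≤ N →
  L * A ≤ i * N + L * L → i * N ≤ L * A + L * L → k ≤ A + bad → A ≤ k + miss → e * bad ≤ 2 * N → e * miss ≤ 2 * N →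
  E * (L * k) ≤ E * (i * N) + N * L × E * (i * N) ≤ E * (L * k) + N * L
sandwich E .(3 * E) refl L i N A k bad miss N-large A-upper A-lower k≤ A≤ bad≤ miss≤ = cancelˡ 3 (s≤s z≤n) upper , cancelˡ 3 (s≤s z≤n) lower
  where
  open ≤-Reasoning
  slack : 3 * E * (L * L) ≤ N * L
  slack = ≤-trans (≤-reflexive (sym (*-assoc (3 * E) L L))) (*-monoˡ-≤ L N-large)
  upper : 3 * (E * (L * k)) ≤ 3 * (E * (i * N) + N * L)
  upper = begin
    3 * (E * (L * k))                               ≤⟨ *-monoʳ-≤ 3 (*-monoʳ-≤ E (*-monoʳ-≤ L k≤)) ⟩
    3 * (E * (L * (A + bad)))                       ≡⟨ arr E L A bad ⟩
    3 * E * (L * A) + L * (3 * E * bad)             ≤⟨ +-mono-≤ (*-monoʳ-≤ (3 * E) A-upper) (*-monoʳ-≤ L bad≤) ⟩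
    3 * E * (i * N + L * L) + L * (2 * N)           ≤⟨ ≤-from 0 slack (arr′ E (i * N) L N) ⟩
    3 * (E * (i * N) + N * L)                       ∎
    where
    arr : ∀ E L A b → 3 * (E * (L * (A + b))) ≡ 3 * E * (L * A) + L * (3 * E * b)
    arr = solve-∀
    arr′ : ∀ E x L N → 3 * E * (x + L * L) + L * (2 * N) + N * L + 0 ≡ 3 * (E * x + N * L) + 3 * E * (L * L)
    arr′ = solve-∀
  lower : 3 * (E * (i * N)) ≤ 3 * (E * (L * k) + N * L)
  lower = begin
    3 * (E * (i * N))                               ≤⟨ *-monoʳ-≤ 3 (*-monoʳ-≤ E (≤-trans A-lower (+-monoˡ-≤ (L * L) (*-monoʳ-≤ L A≤)))) ⟩
    3 * (E * (L * (k + miss) + L * L))              ≡⟨ arr E L k miss ⟩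
    3 * E * (L * k) + L * (3 * E * miss) + 3 * E * (L * L)   ≤⟨ +-mono-≤ (+-monoʳ-≤ (3 * E * (L * k)) (*-monoʳ-≤ L miss≤)) slack ⟩
    3 * E * (L * k) + L * (2 * N) + N * L           ≡⟨ arr′ E (L * k) L N ⟩
    3 * (E * (L * k) + N * L)                       ∎
    where
    arr : ∀ E L k m → 3 * (E * (L * (k + m) + L * L)) ≡ 3 * E * (L * k) + L * (3 * E * m) + 3 * E * (L * L)
    arr = solve-∀
    arr′ : ∀ E x L N → 3 * E * x + L * (2 * N) + N * L ≡ 3 * (E * x + N * L)
    arr′ = solve-∀

-- The positive values: lower bound and approximation

module Side (n : ℕ) (c : Fin n → Fin n → ℤ) (basis : Form.OrthogonalBasis n c (Form.standard n c)) (i₁ i₂ i₃ : Fin n)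
  (1≢2 : i₁ ≢ i₂) (1≢3 : i₁ ≢ i₃) (2≢3 : i₂ ≢ i₃) (a₁ : ℕ) (1≤a₁ : 1 ≤ a₁) (a₁-eq : Form.Basis.a n c basis i₁ ≡ + a₁) where

  open Form n c
  open Basis basis

  Value : ℤ → Set
  Value m = ∃ λ y → f y ≡ m

  cutoff : ℕ → ℕ
  cutoff e = roughness e + (2 + (a₁ + (ℤ.∣ a i₂ ∣ + ℤ.∣ a i₃ ∣)))

  module At (e σ : ℕ) (1≤e : 1 ≤ e) where

    w : ℕ
    w = cutoff e

    w-large : roughness e ≤ w
    w-large = m≤m+n (roughness e) (2 + (a₁ + (ℤ.∣ a i₂ ∣ + ℤ.∣ a i₃ ∣)))

    open Local n c basis i₂ σ public
    open Class n c basis i₁ i₂ i₃ 1≢2 1≢3 2≢3 σ w a₁ 1≤a₁ a₁-eq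
      (≤-trans (m≤m+n 2 _) (m≤n+m _ (roughness e)))
      (≤-trans (≤-trans (m≤m+n a₁ _) (m≤n+m _ 2)) (m≤n+m _ (roughness e)))
      (≤-trans (≤-trans (≤-trans (m≤m+n ℤ.∣ a i₂ ∣ ℤ.∣ a i₃ ∣) (m≤n+m _ a₁)) (m≤n+m _ 2)) (m≤n+m _ (roughness e)))
      (≤-trans (≤-trans (≤-trans (m≤n+m ℤ.∣ a i₃ ∣ ℤ.∣ a i₂ ∣) (m≤n+m _ a₁)) (m≤n+m _ 2)) (m≤n+m _ (roughness e)))
      public using (L; 1≤L; class-bound)

    ClassBound : Vector n → ℕ → Set
    ClassBound x N₀ = ∀ N → N₀ ≤ N → ∀ (ν : ℤ → ℕ) → (∀ m → ν m ≤ 1) → (∀ y → ν (f y) ≡ 0) →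
      e * (L * ∑ N (λ j → ⟦ + L S.∣? (+ suc j ℤ.- f x) ⟧ * ν (+ suc j))) ≤ 2 * N

    bound : ∀ x → Good w x → ∃ (ClassBound x)
    bound x good = class-bound x good e 1≤e w-large

residue-in-class : ∀ L s → 1 ≤ L → ∃ λ j → j < L × + L S.∣ (+ suc j ℤ.- s)
residue-in-class L s 1≤L = r , ℤD.n%ℕd<d (s ℤ.- + 1) L , S.divides (ℤ.- q) (trans (cong (λ z → z ℤ.- s) (ℤP.pos-+ 1 r)) (trans (eqn (+ r) s (q ℤ.* + L) (ℤD.a≡a%ℕn+[a/ℕn]*n (s ℤ.- + 1) L)) (ℤP.neg-distribˡ-* q (+ L))))
  where
  instance
    L≢0 : NonZero L
    L≢0 = >-nonZero 1≤L
  r = (s ℤ.- + 1) ℤD.%ℕ L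
  q = (s ℤ.- + 1) ℤD./ℕ L
  eqn : ∀ r s t → s ℤ.- + 1 ≡ r ℤ.+ t → (+ 1 ℤ.+ r) ℤ.- s ≡ ℤ.- t
  eqn r s t e = trans (aux r s t) (trans (cong (λ z → (r ℤ.+ t) ℤ.- z ℤ.- t) e) (aux′ (r ℤ.+ t) t))
    where
    aux : ∀ r s t → (+ 1 ℤ.+ r) ℤ.- s ≡ (r ℤ.+ t) ℤ.- (s ℤ.- + 1) ℤ.- t
    aux = ℤR.solve-∀
    aux′ : ∀ x t → x ℤ.- x ℤ.- t ≡ ℤ.- t
    aux′ = ℤR.solve-∀

class-periodic : ∀ L s j → ⟦ + L S.∣? (+ suc (j + L) ℤ.- s) ⟧ ≡ ⟦ + L S.∣? (+ suc j ℤ.- s) ⟧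
class-periodic L s j = ⟦⟧-cong (+ L S.∣? (+ suc (j + L) ℤ.- s)) (+ L S.∣? (+ suc j ℤ.- s))
  (∣-chain (+ suc j) (+ suc (j + L)) s (∣-flip (+ suc (j + L)) (+ suc j) step)) (∣-chain (+ suc (j + L)) (+ suc j) s step)
  where
  step : + L S.∣ (+ suc (j + L) ℤ.- + suc j)
  step = subst (λ n → + L S.∣ (+ n ℤ.- + suc j)) (trans (cong (_+ suc j) (*-identityˡ L)) (trans (+-comm L (suc j)) refl)) (∣-add-multiple 1 L (suc j))

-- Of the roughly `N / L` integers in one class at most half go to `miss` at precision 4, and at
-- most a quarter to rounding as `N ≥ 4 L²`; a quarter remains.
lower-arithmetic : ∀ L i N A k miss → 1 ≤ i → 4 * (L * L) ≤ N → i * N ≤ L * A + L * L → A ≤ k + miss → 4 * (L * miss) ≤ 2 * N → N ≤ 4 * L * k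
lower-arithmetic L i N A k miss 1≤i N-large A-lower A≤ miss≤ = +-cancelʳ-≤ (3 * N) N (4 * L * k) (begin
  N + 3 * N                                            ≡⟨ refl ⟩
  4 * N                                                ≤⟨ *-monoʳ-≤ 4 (≤-trans (m≤n*m N i ⦃ >-nonZero 1≤i ⦄) (≤-trans A-lower (+-monoˡ-≤ (L * L) (*-monoʳ-≤ L A≤)))) ⟩
  4 * (L * (k + miss) + L * L)                         ≡⟨ arr L k miss ⟩
  4 * L * k + (4 * (L * miss) + 4 * (L * L))           ≤⟨ +-monoʳ-≤ (4 * L * k) (+-mono-≤ miss≤ N-large) ⟩
  4 * L * k + (2 * N + N)                              ≡⟨ cong (_+_ (4 * L * k)) (+-comm (2 * N) N) ⟩
  4 * L * k + 3 * N                                    ∎)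
  where
  open ≤-Reasoning
  arr : ∀ L k m → 4 * (L * (k + m) + L * L) ≡ 4 * L * k + (4 * (L * m) + 4 * (L * L))
  arr = solve-∀

module PositiveSide (n : ℕ) (c : Fin n → Fin n → ℤ) (basis : Form.OrthogonalBasis n c (Form.standard n c)) (i₁ i₂ i₃ : Fin n)
  (1≢2 : i₁ ≢ i₂) (1≢3 : i₁ ≢ i₃) (2≢3 : i₂ ≢ i₃) (a₁ : ℕ) (1≤a₁ : 1 ≤ a₁) (a₁-eq : Form.Basis.a n c basis i₁ ≡ + a₁) where

  open Form n c
  open Basis basis
  open Side n c basis i₁ i₂ i₃ 1≢2 1≢3 2≢3 a₁ 1≤a₁ a₁-eq

  ν-rep : ∀ {N} {T : ℕ → Set} (T? : ∀ j → Dec (T j)) → Decides Value N T → ∀ y → missingAt T? N (f y) ≡ 0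
  ν-rep {N} T? decides y = missingAt-zero T? N (f y) (λ j j<N eq → proj₂ (decides j j<N) (y , eq))

  -- The precision e = 4 is kept abstract: the bound roughness 4 must not be evaluated.
  module Lower (e : ℕ) (1≤e : 1 ≤ e) (e≡4 : e ≡ 4) where

    open At e ℤ.∣ norm i₂ ∣ 1≤e

    -- `b v₂ v₂` is nonzero, and with `σ = ∣ norm i₂ ∣` it is too small to be divisible by
    -- `p ^ suc σ`. So the vector `v₂` itself always yields one good class.
    not-bad : ¬ Bad w v₂
    not-bad (p , pp , _ , bad) = <⇒≱ (<-trans (n<1+n _) (n<p^n p (suc ℤ.∣ norm i₂ ∣) (prime≥2 pp))) (∣⇒≤ ⦃ >-nonZero (abs-pos (anisotropic i₂)) ⦄ (S.∣⇒∣ᵤ (bad i₂)))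

    lower : Improved w v₂ → PositiveLower Value
    lower (x , _ , good) = by (bound x good)
      where
      by : ∃ (ClassBound x) → PositiveLower Value
      by (N₀ , class) = pred (4 * L) , N₀ + 4 * (L * L) , λ N N-large {T} T? decides →
        let ν = missingAt T? N
            G : ℕ → ℕ
            G j = ⟦ + L S.∣? (+ suc j ℤ.- f x) ⟧
            j₀ , j₀<L , hit₀ = residue-in-class L (f x) 1≤L
        in subst (λ m → N ≤ m * count T? N) (sym (suc-pred (4 * L) ⦃ >-nonZero (*-mono-≤ (s≤s (z≤n {3})) 1≤L) ⦄))
          (lower-arithmetic L (∑ L G) N (∑ N G) (count T? N) (∑ N (λ j → G j * ν (+ suc j)))
            (≤-trans (≤-reflexive (sym (⟦⟧-yes (+ L S.∣? (+ suc j₀ ℤ.- f x)) hit₀))) (∑-term L G j₀<L))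
            (≤-trans (m≤n+m _ N₀) N-large)
            (proj₂ (periodic-count L G 1≤L (λ j → ⟦⟧≤1 (+ L S.∣? (+ suc j ℤ.- f x))) (class-periodic L (f x)) N))
            (≤-trans (∑-mono N (λ j j<N → split (G j) ⟦ T? j ⟧ (ν (+ suc j)) (⟦⟧≤1 (+ L S.∣? (+ suc j ℤ.- f x))) (missingAt-total T? N j j<N))) (≤-reflexive (∑-+ N _ _)))
            (subst (λ e → e * (L * ∑ N (λ j → G j * ν (+ suc j))) ≤ 2 * N) e≡4 (class N (≤-trans (m≤m+n N₀ _) N-large) ν (missingAt≤1 T? N) (ν-rep T? decides))))
        where
        split : ∀ g t m → g ≤ 1 → 1 ≤ t + m → g ≤ t + g * m
        split zero          t m _ _  = z≤n
        split (suc zero)    t m _ le = ≤-trans le (≤-reflexive (cong (_+_ t) (sym (*-identityˡ m))))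
        split (suc (suc _)) t m (s≤s ()) _

    positive-lower : PositiveLower Value
    positive-lower = case local w v₂ of λ { (inj₁ bad) → ⊥-elim (not-bad bad) ; (inj₂ improved) → lower improved }

  positive-lower : PositiveLower Value
  positive-lower = Lower.positive-lower 4 (s≤s z≤n) refl

  -- Each `p ≤ w` will have exceptional integers of density about `1 / Z`; the factor
  -- `suc (cutoff e)` in `Z` pays for the number of such `p`. The value of `σ` ensures that
  -- `∣ cofactor ∣ * Z` is below `p ^ suc σ`.
  module Upper (E e Z σ : ℕ) (1≤e : 1 ≤ e) (e-eq : e ≡ 3 * E) (Z-eq : Z ≡ e * suc (cutoff e)) (σ-eq : ℤ.∣ cofactor ∣ * Z ≡ σ) where

    Cf : ℕ
    Cf = ℤ.∣ cofactor ∣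

    open At e σ 1≤e

    instance
      L≢0 : NonZero L
      L≢0 = >-nonZero 1≤L

    vec : Vec (Fin L) n → Vector n
    vec u k = + toℕ (lookup u k)

    -- Refers to the outcome of the procedure `local`, since which case it returns can be decided.
    Chosen : Vector n → Set
    Chosen x = ∃ λ improved → local w x ≡ inj₂ improved

    chosen? : ∀ x → Dec (Chosen x)
    chosen? x with local w x
    ... | inj₁ _        = no λ ()
    ... | inj₂ improved = yes (improved , refl)

    -- The search runs over the finitely many residue vectors modulo `L`, which makes the property
    -- decidable.
    Admissible : ℕ → Set
    Admissible ρ = ∃ λ u → Chosen (vec u) × + L S.∣ (f (vec u) ℤ.- + ρ)

    admissible? : ∀ ρ → Dec (Admissible ρ)
    admissible? ρ = anyVec? n (λ u → chosen? (vec u) ×-dec (+ L S.∣? (f (vec u) ℤ.- + ρ)))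

    I : ℕ → ℕ
    I j = ⟦ admissible? (suc j % L) ⟧

    I-periodic : ∀ j → I (j + L) ≡ I j
    I-periodic j = cong (λ ρ → ⟦ admissible? ρ ⟧) ([m+n]%n≡m%n (suc j) L)

    Exceptional : ℕ → ℕ → Set
    Exceptional p j = 2 ≤ p × p ^ suc σ * p ^ suc σ ∣ Cf * suc j

    exceptional? : ∀ p j → Dec (Exceptional p j)
    exceptional? p j = (2 ≤? p) ×-dec (p ^ suc σ * p ^ suc σ ∣? Cf * suc j)

    exceptions : ℕ → ℕ
    exceptions N = ∑ N (λ j → ∑ (suc w) (λ p → ⟦ exceptional? p j ⟧))

    Cf≥1 : 1 ≤ Cf
    Cf≥1 = abs-pos cofactor≢0

    Z≥1 : 1 ≤ Z
    Z≥1 = ≤-trans (*-mono-≤ 1≤e (s≤s (z≤n {cutoff e}))) (≤-reflexive (sym Z-eq))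

    exceptions-bound : ∀ N → Z ≤ N → e * exceptions N ≤ 2 * N
    exceptions-bound N Z≤N = *-cancelˡ-≤ (suc w) (begin
      suc w * (e * exceptions N)                                          ≡⟨ trans (arr (suc w) e (exceptions N)) (cong (exceptions N *_) (sym Z-eq)) ⟩
      exceptions N * Z                                                    ≡⟨ cong (_* Z) (∑-swap N (suc w) _) ⟩
      ∑ (suc w) (λ p → ∑ N (λ j → ⟦ exceptional? p j ⟧)) * Z              ≡⟨ ∑-*ʳ (suc w) Z _ ⟨
      ∑ (suc w) (λ p → ∑ N (λ j → ⟦ exceptional? p j ⟧) * Z)              ≤⟨ ∑-bound (suc w) (2 * N) (λ p _ → per p) ⟩
      suc w * (2 * N)                                                     ∎)
      where
      open ≤-Reasoning
      arr : ∀ w e x → w * (e * x) ≡ x * (e * w)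
      arr = solve-∀
      per : ∀ p → ∑ N (λ j → ⟦ exceptional? p j ⟧) * Z ≤ 2 * N
      per p = by (2 ≤? p)
        where
        q = p ^ suc σ * p ^ suc σ
        q-large : 2 ≤ p → Cf * Z < q
        q-large 2≤p = ≤-<-trans (≤-reflexive σ-eq) (<-≤-trans (<-trans (n<1+n σ) (n<p^n p (suc σ) 2≤p)) (m≤m*n (p ^ suc σ) (p ^ suc σ) ⦃ >-nonZero (≤-trans (s≤s z≤n) (n<p^n p (suc σ) 2≤p)) ⦄))
        by : Dec (2 ≤ p) → ∑ N (λ j → ⟦ exceptional? p j ⟧) * Z ≤ 2 * N
        by (no  2≰p) = ≤-trans (≤-reflexive (cong (_* Z) (∑-zero N (λ j _ → ⟦⟧-no (exceptional? p j) (λ (2≤p , _) → 2≰p 2≤p))))) z≤n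
        by (yes 2≤p) = begin
          ∑ N (λ j → ⟦ exceptional? p j ⟧) * Z                    ≤⟨ *-monoˡ-≤ Z (∑-mono N (λ j _ → ⟦⟧-mono (exceptional? p j) (q ∣? Cf * suc j) proj₂)) ⟩
          count (λ j → q ∣? (Cf * suc j)) N * Z                   ≤⟨ sparse-multiples Cf q Z N Z≥1 (q-large 2≤p) Cf≥1 ⟩
          N + Z                                                   ≤⟨ +-monoʳ-≤ N Z≤N ⟩
          N + N                                                   ≡⟨ cong (_+_ N) (+-identityʳ N) ⟨
          2 * N                                                   ∎

    reduce : ∀ (y : Vector n) → ∃ λ u → ∃ λ q → ∀ k → y k ≡ lin (+ 1) (vec u) (+ 1 ℤ.* + L) q k
    reduce y = u , q , eq
      where
      u = tabulate (λ k → fromℕ< (ℤD.n%ℕd<d (y k) L))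
      q : Vector n
      q k = y k ℤD./ℕ L
      eq : ∀ k → y k ≡ lin (+ 1) (vec u) (+ 1 ℤ.* + L) q k
      eq k = trans (ℤD.a≡a%ℕn+[a/ℕn]*n (y k) L) (trans (cong (λ m → + m ℤ.+ q k ℤ.* + L) (sym (trans (cong toℕ (VecP.lookup∘tabulate _ k)) (FinP.toℕ-fromℕ< _)))) (eqn (vec u k) (q k) (+ L)))
        where
        eqn : ∀ r q L → r ℤ.+ q ℤ.* L ≡ + 1 ℤ.* r ℤ.+ + 1 ℤ.* L ℤ.* q
        eqn = ℤR.solve-∀

    -- A value at `y` lies in the class of the value at the residue vector of `y`. Either `local`
    -- improves that vector, or the vector is bad at some `p ≤ w`; since `p ^ suc σ` divides `L`,
    -- badness passes to `y` and makes `cofactor * f y` divisible by the square of `p ^ suc σ`.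
    upper-point : ∀ j → Value (+ suc j) → 1 ≤ I j + ∑ (suc w) (λ p → ⟦ exceptional? p j ⟧)
    upper-point j (y , fy) = by (reduce y)
      where
      by : (∃ λ u → ∃ λ q → ∀ k → y k ≡ lin (+ 1) (vec u) (+ 1 ℤ.* + L) q k) → 1 ≤ I j + ∑ (suc w) (λ p → ⟦ exceptional? p j ⟧)
      by (u , q , eq) = split (local w (vec u)) refl
        where
        y≡x : + L S.∣ (f y ℤ.- f (vec u))
        y≡x = subst (λ t → + L S.∣ (t ℤ.- f (vec u))) (sym (f-cong eq)) (f-shift-∣ (+ L) (vec u) (+ 1) q)
        split : ∀ r → local w (vec u) ≡ r → 1 ≤ I j + ∑ (suc w) (λ p → ⟦ exceptional? p j ⟧)
        split (inj₂ improved) e = ≤-trans (≤-reflexive (sym (⟦⟧-yes (admissible? (suc j % L)) (u , (improved , e)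
            , ∣-chain (f (vec u)) (f y) (+ (suc j % L)) (∣-flip (f y) (f (vec u)) y≡x) (subst (λ t → + L S.∣ (t ℤ.- + (suc j % L))) (sym fy) remainder))))) (m≤m+n _ _)
          where
          remainder : + L S.∣ (+ suc j ℤ.- + (suc j % L))
          remainder = subst (λ t → + L S.∣ (+ t ℤ.- + (suc j % L))) (trans (+-comm (suc j / L * L) (suc j % L)) (sym (m≡m%n+[m/n]*n (suc j) L))) (∣-add-multiple (suc j / L) L (suc j % L))
        split (inj₁ (p , pp , p≤w , bad)) _ = ≤-trans (≤-trans (≤-reflexive (sym (⟦⟧-yes (exceptional? p j) (prime≥2 pp , divisible)))) (∑-term (suc w) (λ p → ⟦ exceptional? p j ⟧) (s≤s p≤w))) (m≤n+m _ (I j))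
          where
          Q = p ^ suc σ
          Q∣L : Q ∣ L
          Q∣L = ∣-trans (subst (λ t → Q ∣ p ^ t) (m+[n∸m]≡n σ<K) (subst (Q ∣_) (sym (^-distribˡ-+-* p (suc σ) (K ∸ suc σ))) (m∣m*n _))) (primePower∣primorial K w p pp p≤w)
            where
            σ<K : suc σ ≤ K
            σ<K = ≤-trans (m≤m+n (suc σ) _) (≤-trans (m≤m+n _ _) (n≤1+n _))
          at-y : ∀ i → + Q S.∣ b y (v i)
          at-y i = S-subst (sym (trans (b-cong (v i) eq) (b-lin (+ 1) (vec u) (+ 1 ℤ.* + L) q (v i))))
            (S.∣m∣n⇒∣m+n (S.∣n⇒∣m*n (+ 1) (bad i)) (S.∣m⇒∣m*n {m = + 1 ℤ.* + L} (b q (v i)) (S.∣n⇒∣m*n (+ 1) (S.∣ᵤ⇒∣ Q∣L))))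
          divisible : Q * Q ∣ Cf * suc j
          divisible = subst (Q * Q ∣_) (trans (ℤP.abs-* cofactor (f y)) (cong (λ t → Cf * ℤ.∣ t ∣) fy))
            (S.∣⇒∣ᵤ {+ (Q * Q)} (subst (S._∣ (cofactor ℤ.* f y)) (sym (ℤP.pos-* Q Q)) (square-divides (+ Q) y at-y)))

    class-of : ∀ ρ → Admissible ρ → ∃ λ x → ∃ (ClassBound x) × (+ L S.∣ (f x ℤ.- + ρ))
    class-of ρ (u , ((x , x≡ , good) , _) , d) = x , bound x good , ∣-chain (f x) (f (vec u)) (+ ρ) x≡ d

    thresholdFor : ∀ ρ → Dec (Admissible ρ) → ℕ
    thresholdFor ρ (yes adm) = proj₁ (proj₁ (proj₂ (class-of ρ adm)))
    thresholdFor ρ (no _)    = 0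

    threshold : ℕ → ℕ
    threshold ρ = thresholdFor ρ (admissible? ρ)

    class-missing : ∀ ρ N (ν : ℤ → ℕ) (adm? : Dec (Admissible ρ)) → thresholdFor ρ adm? ≤ N → (∀ m → ν m ≤ 1) → (∀ y → ν (f y) ≡ 0) →
      e * (L * (⟦ adm? ⟧ * ∑ N (λ j → ⟦ suc j % L ≟ ρ ⟧ * ν (+ suc j)))) ≤ 2 * N
    class-missing ρ N ν (no _)    N-large ν≤1 ν-rep = ≤-trans (≤-reflexive (trans (cong (e *_) (*-zeroʳ L)) (*-zeroʳ e))) z≤n
    class-missing ρ N ν (yes adm) N-large ν≤1 ν-rep = by (class-of ρ adm) N-large
      where
      by : (cl : ∃ λ x → ∃ (ClassBound x) × (+ L S.∣ (f x ℤ.- + ρ))) → proj₁ (proj₁ (proj₂ cl)) ≤ N → e * (L * (1 * ∑ N (λ j → ⟦ suc j % L ≟ ρ ⟧ * ν (+ suc j)))) ≤ 2 * N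
      by (x , (N₀ , class) , x≡ρ) N₀≤N = ≤-trans (*-monoʳ-≤ e (*-monoʳ-≤ L (≤-trans (≤-reflexive (*-identityˡ _)) (∑-mono N (λ j _ → *-monoˡ-≤ (ν (+ suc j))
        (⟦⟧-mono (suc j % L ≟ ρ) (+ L S.∣? (+ suc j ℤ.- f x)) (λ eq → ∣-chain (+ suc j) (+ ρ) (f x)
          (subst (λ t → + L S.∣ (+ suc j ℤ.- + t)) eq (remainder j)) (∣-flip (f x) (+ ρ) x≡ρ)))))))) (class N N₀≤N ν ν≤1 ν-rep)
        where
        remainder : ∀ j → + L S.∣ (+ suc j ℤ.- + (suc j % L))
        remainder j = subst (λ t → + L S.∣ (+ t ℤ.- + (suc j % L))) (trans (+-comm (suc j / L * L) (suc j % L)) (sym (m≡m%n+[m/n]*n (suc j) L))) (∣-add-multiple (suc j / L) L (suc j % L))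

    -- Each of the `L` residues loses at most `2 N / (e L)` integers.
    missing-bound : ∀ N (ν : ℤ → ℕ) → ∑ L threshold ≤ N → (∀ m → ν m ≤ 1) → (∀ y → ν (f y) ≡ 0) → e * ∑ N (λ j → I j * ν (+ suc j)) ≤ 2 * N
    missing-bound N ν N-large ν≤1 ν-rep = cancelˡ L 1≤L (begin
      L * (e * ∑ N (λ j → I j * ν (+ suc j)))      ≤⟨ *-monoʳ-≤ L (*-monoʳ-≤ e (∑-mono N (λ j _ → spread j))) ⟩
      L * (e * ∑ N (λ j → ∑ L (λ ρ → ⟦ admissible? ρ ⟧ * (⟦ suc j % L ≟ ρ ⟧ * ν (+ suc j)))))
        ≡⟨ cong (λ t → L * (e * t)) (trans (∑-swap N L _) (∑-cong L (λ ρ _ → ∑-*ˡ N ⟦ admissible? ρ ⟧ _))) ⟩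
      L * (e * ∑ L (λ ρ → ⟦ admissible? ρ ⟧ * ∑ N (λ j → ⟦ suc j % L ≟ ρ ⟧ * ν (+ suc j))))
        ≡⟨ arr L e (∑ L (λ ρ → ⟦ admissible? ρ ⟧ * ∑ N (λ j → ⟦ suc j % L ≟ ρ ⟧ * ν (+ suc j)))) ⟩
      e * L * ∑ L (λ ρ → ⟦ admissible? ρ ⟧ * ∑ N (λ j → ⟦ suc j % L ≟ ρ ⟧ * ν (+ suc j)))
        ≡⟨ ∑-*ˡ L (e * L) (λ ρ → ⟦ admissible? ρ ⟧ * ∑ N (λ j → ⟦ suc j % L ≟ ρ ⟧ * ν (+ suc j))) ⟨
      ∑ L (λ ρ → e * L * (⟦ admissible? ρ ⟧ * ∑ N (λ j → ⟦ suc j % L ≟ ρ ⟧ * ν (+ suc j))))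
        ≤⟨ ∑-bound L (2 * N) (λ ρ ρ<L → ≤-trans (≤-reflexive (*-assoc e L _)) (class-missing ρ N ν (admissible? ρ) (≤-trans (∑-term L threshold ρ<L) N-large) ν≤1 ν-rep)) ⟩
      L * (2 * N)                                  ∎)
      where
      open ≤-Reasoning
      arr : ∀ L e x → L * (e * x) ≡ e * L * x
      arr = solve-∀
      spread : ∀ j → I j * ν (+ suc j) ≤ ∑ L (λ ρ → ⟦ admissible? ρ ⟧ * (⟦ suc j % L ≟ ρ ⟧ * ν (+ suc j)))
      spread j = ≤-trans (≤-reflexive (cong (I j *_) (trans (sym (*-identityˡ _)) (cong (_* ν (+ suc j)) (sym (⟦⟧-yes (suc j % L ≟ suc j % L) refl))))))
        (∑-term L (λ ρ → ⟦ admissible? ρ ⟧ * (⟦ suc j % L ≟ ρ ⟧ * ν (+ suc j))) (m%n<n (suc j) L))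

    approximation : ∃ λ L → ∃ λ i → ∃ λ N₀ → 1 ≤ L × (∀ N → N₀ ≤ N → ∀ {T : ℕ → Set} (T? : ∀ j → Dec (T j)) → Decides Value N T →
      E * (L * count T? N) ≤ E * (i * N) + N * L × E * (i * N) ≤ E * (L * count T? N) + N * L)
    approximation = L , ∑ L I , e * L + (Z + ∑ L threshold) , 1≤L , λ N N-large {T} T? decides →
      let ν = missingAt T? N
          periodic = periodic-count L I 1≤L (λ j → ⟦⟧≤1 (admissible? (suc j % L))) I-periodic N
      in sandwich E e e-eq L (∑ L I) N (∑ N I) (count T? N) (exceptions N) (∑ N (λ j → I j * ν (+ suc j)))
        (≤-trans (m≤m+n (e * L) _) N-large) (proj₁ periodic) (proj₂ periodic)
        (≤-trans (∑-mono N (λ j j<N → ⟦⟧-≤ (T? j) (λ t → upper-point j (proj₁ (decides j j<N) t)))) (≤-reflexive (∑-+ N I (λ j → ∑ (suc w) (λ p → ⟦ exceptional? p j ⟧)))))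
        (≤-trans (∑-mono N (λ j j<N → split (I j) ⟦ T? j ⟧ (ν (+ suc j)) (⟦⟧≤1 (admissible? (suc j % L))) (missingAt-total T? N j j<N))) (≤-reflexive (∑-+ N _ _)))
        (exceptions-bound N (≤-trans (≤-trans (m≤m+n Z _) (m≤n+m _ (e * L))) N-large))
        (missing-bound N ν (≤-trans (≤-trans (m≤n+m _ Z) (m≤n+m _ (e * L))) N-large) (missingAt≤1 T? N) (ν-rep T? decides))
      where
      split : ∀ g t m → g ≤ 1 → 1 ≤ t + m → g ≤ t + g * m
      split zero          t m _ _  = z≤n
      split (suc zero)    t m _ le = ≤-trans le (≤-reflexive (cong (_+_ t) (sym (*-identityˡ m))))
      split (suc (suc _)) t m (s≤s ()) _

  approximable : Approximable Value
  approximable E 1≤E = Upper.approximation E (3 * E) (3 * E * suc (cutoff (3 * E))) _ (*-mono-≤ (s≤s (z≤n {2})) 1≤E) refl refl refl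

-- Counting lists

Signed : ℕ → ℤ → Set
Signed N m = (∃ λ j → j < N × m ≡ + suc j) ⊎ (∃ λ j → j < N × m ≡ -[1+ j ])

positiveCount negativeCount : List ℤ → ℕ → ℕ
positiveCount xs = count (λ j → + suc j ∈? xs)
negativeCount xs = count (λ j → -[1+ j ] ∈? xs)

count-cons : ∀ (φ : ℕ → ℤ) x xs N → All.All (x ≢_) xs →
  count (λ j → φ j ∈? (x ∷ xs)) N ≡ count (λ j → φ j ℤ.≟ x) N + count (λ j → φ j ∈? xs) N
count-cons φ x xs N fresh = trans (∑-cong N (λ j _ → at j)) (∑-+ N _ _)
  where
  at : ∀ j → ⟦ φ j ∈? (x ∷ xs) ⟧ ≡ ⟦ φ j ℤ.≟ x ⟧ + ⟦ φ j ∈? xs ⟧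
  at j with φ j ℤ.≟ x | φ j ∈? xs
  ... | yes e | yes p = ⊥-elim (All.lookup fresh p (sym e))
  ... | yes e | no _  = refl
  ... | no ¬e | yes p = refl
  ... | no ¬e | no ¬p = refl

count-exactly-one : ∀ (φ : ℕ → ℤ) x N j → (∀ {a b} → φ a ≡ φ b → a ≡ b) → j < N → x ≡ φ j → count (λ i → φ i ℤ.≟ x) N ≡ 1
count-exactly-one φ x N j inj j<N refl = ≤-antisym
  (count-unique (λ i → φ i ℤ.≟ φ j) N (λ a b a<b _ p q → <-irrefl (inj (trans p (sym q))) a<b))
  (≤-trans (≤-reflexive (sym (⟦⟧-yes (φ j ℤ.≟ φ j) refl))) (∑-term N (λ i → ⟦ φ i ℤ.≟ φ j ⟧) j<N))

length-count : ∀ xs N → Unique xs → (∀ m → m ∈ xs → Signed N m) → length xs ≡ positiveCount xs N + negativeCount xs N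
length-count [] N _ _ = sym (cong₂ _+_ (count-none (λ j → + suc j ∈? []) N (λ _ _ ())) (count-none (λ j → -[1+ j ] ∈? []) N (λ _ _ ())))
length-count (x ∷ xs) N (fresh ∷ unique) cover = trans (cong suc (length-count xs N unique (λ m m∈ → cover m (there m∈))))
  (trans (one (cover x (here refl))) (sym (cong₂ _+_ (count-cons (λ j → + suc j) x xs N fresh) (count-cons -[1+_] x xs N fresh))))
  where
  P Q p q : ℕ
  P = positiveCount xs N
  Q = negativeCount xs N
  p = count (λ j → + suc j ℤ.≟ x) N
  q = count (λ j → -[1+ j ] ℤ.≟ x) N
  one : Signed N x → suc (P + Q) ≡ (p + P) + (q + Q)
  one (inj₁ (j , j<N , e)) = sym (cong₂ (λ s t → (s + P) + (t + Q)) (count-exactly-one (λ j → + suc j) x N j (λ e → suc-injective (ℤP.+-injective e)) j<N e)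
    (count-none (λ j → -[1+ j ] ℤ.≟ x) N (λ i _ e′ → case trans e′ e of λ ())))
  one (inj₂ (j , j<N , e)) = sym (trans (cong₂ (λ s t → (s + P) + (t + Q)) (count-none (λ j → + suc j ℤ.≟ x) N (λ i _ e′ → case trans e′ e of λ ()))
    (count-exactly-one -[1+_] x N j ℤP.-[1+-injective j<N e)) (+-suc P Q))

-- From approximations to densities

-- Both proportions are compared with `i / L`, which cancels; the Cauchy condition is thus met
-- without naming the limit.
cross : ∀ E L i N N′ k k′ → 1 ≤ L → E * (L * k) ≤ E * (i * N) + N * L → E * (i * N′) ≤ E * (L * k′) + N′ * L →
  E * (k * N′) ≤ E * (k′ * N) + 2 * (N * N′)
cross E L i N N′ k k′ 1≤L upper lower = cancelˡ L 1≤L (≤-from 0 (+-mono-≤ (*-monoʳ-≤ N′ upper) (*-monoʳ-≤ N lower)) (trans (+-identityʳ _) (eqn E L i N N′ k k′)))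
  where
  eqn : ∀ E L i N N′ k k′ → L * (E * (k * N′)) + (N′ * (E * (i * N) + N * L) + N * (E * (L * k′) + N′ * L)) ≡
    L * (E * (k′ * N) + 2 * (N * N′)) + (N′ * (E * (L * k)) + N * (E * (i * N′)))
  eqn = solve-∀

abs-difference : ∀ E p q B → E * p ≤ E * q + B → E * q ≤ E * p + B → E * ℤ.∣ + p ℤ.- + q ∣ ≤ B
abs-difference E p q B pq qp = subst (λ t → E * t ≤ B) (sym (cong ℤ.∣_∣ (ℤP.[+m]-[+n]≡m⊖n p q))) (by (≤-total p q))
  where
  shrink : ∀ x y → x ≤ y → E * y ≤ E * x + B → E * (y ∸ x) ≤ B
  shrink x y x≤y le = +-cancelˡ-≤ (E * x) _ _ (≤-trans (≤-reflexive (trans (sym (*-distribˡ-+ E x (y ∸ x))) (cong (E *_) (m+[n∸m]≡n x≤y)))) le)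
  by : p ≤ q ⊎ q ≤ p → E * ℤ.∣ p ℤ.⊖ q ∣ ≤ B
  by (inj₁ p≤q) = subst (λ t → E * t ≤ B) (sym (ℤP.∣⊖∣-≤ p≤q)) (shrink p q p≤q qp)
  by (inj₂ q≤p) = subst (λ t → E * t ≤ B) (sym (trans (ℤP.∣m⊖n∣≡∣n⊖m∣ p q) (ℤP.∣⊖∣-≤ q≤p))) (shrink q p q≤p pq)

negate : ∀ {n} → (Fin n → Fin n → ℤ) → Fin n → Fin n → ℤ
negate c i j = ℤ.- c i j

sumFin-neg : ∀ n (g : Fin n → ℤ) → sumFin n (λ i → ℤ.- g i) ≡ ℤ.- sumFin n g
sumFin-neg zero    g = refl
sumFin-neg (suc n) g = trans (cong (ℤ._+_ (ℤ.- g fzero)) (sumFin-neg n (λ i → g (fsuc i)))) (sym (ℤP.neg-distrib-+ (g fzero) _))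

evalQF-negate : ∀ n c x → evalQF n (negate c) x ≡ ℤ.- evalQF n c x
evalQF-negate n c x = trans (sumFin-cong n (λ i → trans (sumFin-cong n (λ j → eqn (c i j) (x i) (x j))) (sumFin-neg n (λ j → c i j ℤ.* x i ℤ.* x j)))) (sumFin-neg n (λ i → sumFin n (λ j → c i j ℤ.* x i ℤ.* x j)))
  where
  eqn : ∀ c x y → ℤ.- c ℤ.* x ℤ.* y ≡ ℤ.- (c ℤ.* x ℤ.* y)
  eqn = ℤR.solve-∀

nondegenerate-negate : ∀ n c → Nondegenerate n c → Nondegenerate n (negate c)
nondegenerate-negate n c nondegenerate v perp = nondegenerate v (λ i → trans (sym (ℤP.neg-involutive _))
  (cong ℤ.-_ (trans (sym (sumFin-neg n (λ j → (c i j ℤ.+ c j i) ℤ.* v j))) (trans (sumFin-cong n (λ j → eqn (c i j) (c j i) (v j))) (perp i)))))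
  where
  eqn : ∀ p q x → ℤ.- ((p ℤ.+ q) ℤ.* x) ≡ (ℤ.- p ℤ.+ ℤ.- q) ℤ.* x
  eqn = ℤR.solve-∀

Represents : ∀ n → (Fin n → Fin n → ℤ) → ℤ → Set
Represents n c m = ∃ λ y → evalQF n c y ≡ m

two-others : ∀ {n} → 3 ≤ n → (i : Fin n) → ∃ λ j → ∃ λ k → i ≢ j × i ≢ k × j ≢ k
two-others (s≤s (s≤s (s≤s _))) fzero               = fsuc fzero , fsuc (fsuc fzero) , (λ ()) , (λ ()) , (λ ())
two-others (s≤s (s≤s (s≤s _))) (fsuc fzero)        = fzero , fsuc (fsuc fzero) , (λ ()) , (λ ()) , (λ ())
two-others (s≤s (s≤s (s≤s _))) (fsuc (fsuc i))     = fzero , fsuc fzero , (λ ()) , (λ ()) , (λ ())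

-- Speaks of positive integers only; the negative values of a form are, up to sign, the positive
-- values of its negative.
HalfDensity : (ℤ → Set) → Set₁
HalfDensity S = Approximable S × PositiveLower S

module Diagonal (n : ℕ) (3≤n : 3 ≤ n) (c : Fin n → Fin n → ℤ) (basis : Form.OrthogonalBasis n c (Form.standard n c)) where

  open Form n c
  open Basis basis

  nonzero : Fin n → ∃ λ x → f x ≢ + 0
  nonzero i = v i , a≢0 i

  half : ∀ i → + 1 ℤ.≤ a i → HalfDensity (Represents n c)
  half i pos = by (a i) refl pos
    where
    by : ∀ x → a i ≡ x → + 1 ℤ.≤ x → HalfDensity (Represents n c)
    by (+ a₁) eq (ℤ.+≤+ 1≤a₁) = let j , k , i≢j , i≢k , j≢k = two-others 3≤n i in
      PositiveSide.approximable n c basis i j k i≢j i≢k j≢k a₁ 1≤a₁ eq , PositiveSide.positive-lower n c basis i j k i≢j i≢k j≢k a₁ 1≤a₁ eq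

  -- In the coordinates of the basis `- f` becomes a sum of squares with nonnegative coefficients,
  -- up to the positive factor `2 index²`.
  nonpositive : (∀ i → a i ℤ.≤ + 0) → ∀ x → f x ℤ.≤ + 0
  nonpositive neg x = subst (ℤ._≤ + 0) (ℤP.neg-involutive (f x)) (ℤP.neg-mono-≤ (cancel-square-nonneg index (ℤ.- f x) index≢0
    (subst (+ 0 ℤ.≤_) total (sumFin-nonneg n (λ i → ℤ.- (β x i ℤ.* (β x i ℤ.* norm i))) (λ i →
      subst (+ 0 ℤ.≤_) (eqn (β x i) (norm i)) (nonneg-* (nonneg-square (β x i)) (ℤP.neg-mono-≤ (norm≤0 i))))))))
    where
    norm≤0 : ∀ i → norm i ℤ.≤ + 0
    norm≤0 i = subst (ℤ._≤ + 0) (sym (b-self (v i))) (ℤP.*-monoˡ-≤-nonNeg (+ 2) (neg i))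
    eqn : ∀ β g → (β ℤ.* β) ℤ.* ℤ.- g ≡ ℤ.- (β ℤ.* (β ℤ.* g))
    eqn = ℤR.solve-∀
    eqn′ : ∀ d y → ℤ.- (d ℤ.* (d ℤ.* (+ 2 ℤ.* y))) ≡ d ℤ.* (d ℤ.* (+ 2 ℤ.* ℤ.- y))
    eqn′ = ℤR.solve-∀
    total : sumFin n (λ i → ℤ.- (β x i ℤ.* (β x i ℤ.* norm i))) ≡ index ℤ.* (index ℤ.* (+ 2 ℤ.* ℤ.- f x))
    total = trans (sumFin-neg n (λ i → β x i ℤ.* (β x i ℤ.* norm i))) (trans (cong ℤ.-_ (sym (f-coordinates x))) (eqn′ index (f x)))

  half-of : ¬ (∀ x → f x ℤ.≤ + 0) → HalfDensity (Represents n c)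
  half-of indefinite = by (FinP.any? (λ i → + 1 ℤ.≤? a i))
    where
    by : Dec (∃ λ i → + 1 ℤ.≤ a i) → HalfDensity (Represents n c)
    by (yes (i , pos)) = half i pos
    by (no none) = ⊥-elim (indefinite (nonpositive (λ i → below (a i) (λ pos → none (i , pos)))))
      where
      below : ∀ x → ¬ (+ 1 ℤ.≤ x) → x ℤ.≤ + 0
      below (+ zero)  _  = ℤP.≤-refl
      below (+ suc m) ¬p = ⊥-elim (¬p (ℤ.+≤+ (s≤s z≤n)))
      below -[1+ m ]  _  = ℤ.-≤+

half-density : ∀ n → 3 ≤ n → ∀ c → Nondegenerate n c → ¬ (∀ x → evalQF n c x ℤ.≤ + 0) → HalfDensity (Represents n c)
half-density n 3≤n c nondegenerate = Diagonal.half-of n 3≤n c (Form.orthogonal-basis n c n (Form.standard n c) (Form.nondegenerate-standard n c nondegenerate))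

some-nonzero : ∀ n → 3 ≤ n → ∀ c → Nondegenerate n c → ∃ λ x → evalQF n c x ≢ + 0
some-nonzero n 3≤n c nondegenerate = Diagonal.nonzero n 3≤n c (Form.orthogonal-basis n c n (Form.standard n c) (Form.nondegenerate-standard n c nondegenerate)) (first 3≤n)
  where
  first : ∀ {n} → 3 ≤ n → Fin n
  first (s≤s _) = fzero

half-cauchy : ∀ S → Approximable S → ∀ E → 1 ≤ E → ∃ λ M → ∀ N N′ → M ≤ N → M ≤ N′ →
  ∀ {T T′ : ℕ → Set} (T? : ∀ j → Dec (T j)) (T′? : ∀ j → Dec (T′ j)) → Decides S N T → Decides S N′ T′ →
  E * (count T? N * N′) ≤ E * (count T′? N′ * N) + 2 * (N * N′)
half-cauchy S approx E 1≤E =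
  let L , i , N₀ , 1≤L , bound = approx E 1≤E in
  N₀ , λ N N′ N≥ N′≥ T? T′? dec dec′ → cross E L i N N′ (count T? N) (count T′? N′) 1≤L (proj₁ (bound N N≥ T? dec)) (proj₂ (bound N′ N′≥ T′? dec′))

-- Sign cases

module Theorem (n : ℕ) (3≤n : 3 ≤ n) (c : Fin n → Fin n → ℤ) (nondegenerate : Nondegenerate n c) where

  S : ℤ → Set
  S = D n c

  Up Down : ℤ → Set
  Up   = Represents n c
  Down = Represents n (negate c)

  Members : ℤ → ℤ → List ℤ → Set
  Members lo hi xs = ∀ m → (m ∈ xs → S m × lo ℤ.≤ m × m ℤ.≤ hi) × (S m × lo ℤ.≤ m × m ℤ.≤ hi → m ∈ xs)

  decides-up : ∀ {lo hi} N xs → Members lo hi xs → (∀ j → j < N → lo ℤ.≤ + suc j × + suc j ℤ.≤ hi) → Decides Up N (λ j → + suc j ∈ xs)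
  decides-up N xs members range j j<N = (λ m∈ → proj₂ (proj₁ (proj₁ (members (+ suc j)) m∈)))
    , λ rep → proj₂ (members (+ suc j)) (((λ ()) , rep) , range j j<N)

  decides-down : ∀ {lo hi} N xs → Members lo hi xs → (∀ j → j < N → lo ℤ.≤ -[1+ j ] × -[1+ j ] ℤ.≤ hi) → Decides Down N (λ j → -[1+ j ] ∈ xs)
  decides-down N xs members range j j<N =
    (λ m∈ → let y , e = proj₂ (proj₁ (proj₁ (members -[1+ j ]) m∈)) in y , trans (evalQF-negate n c y) (cong ℤ.-_ e))
    , λ (y , e) → proj₂ (members -[1+ j ]) (((λ ()) , y , trans (sym (ℤP.neg-involutive _)) (cong ℤ.-_ (trans (sym (evalQF-negate n c y)) e))) , range j j<N)

  up : ¬ IsNegative S → HalfDensity Up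
  up ¬negative = half-density n 3≤n c nondegenerate (λ le → ¬negative (λ m (_ , x , e) → subst (ℤ._≤ + 0) e (le x)))

  down : ¬ IsPositive S → HalfDensity Down
  down ¬positive = half-density n 3≤n (negate c) (nondegenerate-negate n c nondegenerate) (λ le → ¬positive (λ m (_ , x , e) →
    subst (+ 0 ℤ.≤_) (trans (ℤP.neg-involutive _) e) (ℤP.neg-mono-≤ (subst (ℤ._≤ + 0) (evalQF-negate n c x) (le x)))))

  -- Some value is nonzero, so a positive set of values is not negative as well; this supplies the
  -- hypotheses of `up` and `down`.
  not-both : IsPositive S → IsNegative S → ⊥
  not-both pos neg = let x , ne = some-nonzero n 3≤n c nondegenerate in ne (ℤP.≤-antisym (neg _ (ne , x , refl)) (pos _ (ne , x , refl)))

  extract : ∀ {lo hi k} → CountIn S lo hi k → ∃ λ xs → Unique xs × length xs ≡ k × Members lo hi xs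
  extract (xs , unique , len , equiv) = xs , unique , len , λ m → Equivalence.to (equiv m) , Equivalence.from (equiv m)

  -- The factor 4 in the precision outweighs the 2 in the error and makes the inequality strict.
  strict : ∀ e x B → 1 ≤ B → 4 * suc e * x ≤ 2 * B → x * suc e < B
  strict e x B 1≤B le = ≰⇒> (λ B≤ → <⇒≱ (double 1≤B) (≤-trans (≤-trans (*-monoʳ-≤ 4 B≤) (≤-reflexive (arr x (suc e)))) le))
    where
    arr : ∀ x e → 4 * (x * e) ≡ 4 * e * x
    arr = solve-∀
    double : 1 ≤ B → 2 * B < 4 * B
    double 1≤B = *-monoˡ-< B ⦃ >-nonZero 1≤B ⦄ {2} {4} (s≤s (s≤s (s≤s z≤n)))

  one-sided : ∀ A → HalfDensity A → ∀ {lo hi : ℕ → ℤ} → (count-at : ∀ {N k} → CountIn S (lo N) (hi N) k → ∃ λ (T : ℕ → Set) → ∃ λ (T? : ∀ j → Dec (T j)) → Decides A N T × k ≡ count T? N) →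
    PositiveDensityWrt S lo hi (λ N → N)
  one-sided A (approx , d , N₀ , lower) count-at = cauchy , d , N₀ , positive
    where
    positive : ∀ N k → N₀ < N → CountIn S _ _ k → N ≤ suc d * k
    positive N k N> counted = let T , T? , dec , eq = count-at counted in subst (λ k → N ≤ suc d * k) (sym eq) (lower N (<⇒≤ N>) T? dec)
    cauchy : ∀ e → ∃ λ M → ∀ N N′ k k′ → M < N → M < N′ → CountIn S _ _ k → CountIn S _ _ k′ →
      ℤ.∣ + k ℤ.* + N′ ℤ.- + k′ ℤ.* + N ∣ * suc e < N * N′
    cauchy e = let M , bound = half-cauchy A approx (4 * suc e) (s≤s z≤n) in M , λ N N′ k k′ N> N′> counted counted′ →
      let T , T? , dec , eq = count-at counted
          T′ , T′? , dec′ , eq′ = count-at counted′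
      in subst (λ t → ℤ.∣ t ∣ * suc e < N * N′) (cong₂ ℤ._-_ (ℤP.pos-* k N′) (ℤP.pos-* k′ N))
        (strict e _ (N * N′) (*-mono-≤ (≤-trans (s≤s z≤n) N>) (≤-trans (s≤s z≤n) N′>)) (abs-difference (4 * suc e) (k * N′) (k′ * N) (2 * (N * N′))
          (subst₂ (λ k k′ → 4 * suc e * (k * N′) ≤ 4 * suc e * (k′ * N) + 2 * (N * N′)) (sym eq) (sym eq′) (bound N N′ (<⇒≤ N>) (<⇒≤ N′>) T? T′? dec dec′))
          (subst₂ (λ k k′ → 4 * suc e * (k′ * N) ≤ 4 * suc e * (k * N′) + 2 * (N * N′)) (sym eq) (sym eq′)
            (subst (λ B → 4 * suc e * (count T′? N′ * N) ≤ 4 * suc e * (count T? N * N′) + 2 * B) (*-comm N′ N) (bound N′ N (<⇒≤ N′>) (<⇒≤ N>) T′? T? dec′ dec)))))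

  positive-case : IsPositive S → PositiveDensityWrt S (λ _ → + 1) (λ N → + N) (λ N → N)
  positive-case pos = one-sided Up (up (not-both pos)) (λ {N} counted → let xs , unique , len , members = extract counted in
    (λ j → + suc j ∈ xs) , (λ j → + suc j ∈? xs) , decides-up N xs members (λ j j<N → ℤ.+≤+ (s≤s z≤n) , ℤ.+≤+ j<N)
    , trans (sym len) (trans (length-count xs N unique (λ m m∈ → signed m (proj₂ (proj₁ (members m) m∈))))
        (trans (cong (_+_ (positiveCount xs N)) (count-none (λ j → -[1+ j ] ∈? xs) N (λ j _ m∈ → impossible (proj₁ (proj₂ (proj₁ (members _) m∈)))))) (+-identityʳ _))))
    where
    impossible : ∀ {j} → + 1 ℤ.≤ -[1+ j ] → ⊥
    impossible ()
    signed : ∀ {N} m → + 1 ℤ.≤ m × m ℤ.≤ + N → Signed N m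
    signed (+ zero)  (ℤ.+≤+ () , _)
    signed (+ suc j) (_ , ℤ.+≤+ j<N) = inj₁ (j , j<N , refl)
    signed -[1+ j ]  (() , _)

  negative-range : ∀ N j → j < N → ℤ.- + N ℤ.≤ -[1+ j ]
  negative-range N j j<N = ℤP.neg-mono-≤ (ℤ.+≤+ j<N)

  negative-range⁻¹ : ∀ N j → ℤ.- + N ℤ.≤ -[1+ j ] → j < N
  negative-range⁻¹ N j le = ℤP.drop‿+≤+ (ℤP.neg-cancel-≤ {+ N} {+ suc j} le)

  negative-case : IsNegative S → PositiveDensityWrt S (λ N → ℤ.- + N) (λ _ → ℤ.- + 1) (λ N → N)
  negative-case neg = one-sided Down (down (λ pos → not-both pos neg)) (λ {N} counted → let xs , unique , len , members = extract counted in
    (λ j → -[1+ j ] ∈ xs) , (λ j → -[1+ j ] ∈? xs) , decides-down N xs members (λ j j<N → negative-range N j j<N , ℤ.-≤- z≤n)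
    , trans (sym len) (trans (length-count xs N unique (λ m m∈ → signed m (proj₂ (proj₁ (members m) m∈))))
        (cong (_+ negativeCount xs N) (count-none (λ j → + suc j ∈? xs) N (λ j _ m∈ → impossible (proj₂ (proj₂ (proj₁ (members _) m∈))))))))
    where
    impossible : ∀ {j} → + suc j ℤ.≤ -[1+ 0 ] → ⊥
    impossible ()
    signed : ∀ {N} m → ℤ.- + N ℤ.≤ m × m ℤ.≤ -[1+ 0 ] → Signed N m
    signed (+ _)    (_ , ())
    signed {N} -[1+ j ] (le , _) = inj₂ (j , negative-range⁻¹ N j le , refl)

  indefinite-case : IsIndefinite S → PositiveDensityWrt S (λ N → ℤ.- + N) (λ N → + N) (λ N → 2 * N)
  indefinite-case (¬pos , ¬neg) = by (up ¬neg) (down ¬pos)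
    where
    signed : ∀ N m → S m → ℤ.- + N ℤ.≤ m × m ℤ.≤ + N → Signed N m
    signed N (+ zero)  (ne , _) _ = ⊥-elim (ne refl)
    signed N (+ suc j) _ (_ , ℤ.+≤+ j<N) = inj₁ (j , j<N , refl)
    signed N -[1+ j ]  _ (le , _) = inj₂ (j , negative-range⁻¹ N j le , refl)
    split : ∀ N k → CountIn S (ℤ.- + N) (+ N) k → ∃ λ xs → Decides Up N (λ j → + suc j ∈ xs) × Decides Down N (λ j → -[1+ j ] ∈ xs) × k ≡ positiveCount xs N + negativeCount xs N
    split N k counted = let xs , unique , len , members = extract counted in
      xs , decides-up N xs members (λ j j<N → ℤP.≤-trans (ℤP.neg-mono-≤ (ℤ.+≤+ (z≤n {N}))) (ℤ.+≤+ z≤n) , ℤ.+≤+ j<N)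
         , decides-down N xs members (λ j j<N → negative-range N j j<N , ℤ.-≤+)
         , trans (sym len) (length-count xs N unique (λ m m∈ → let s , r = proj₁ (members m) m∈ in signed N m s r))
    halves : ∀ E p p′ q q′ N N′ → E * (p * N′) ≤ E * (p′ * N) + 2 * (N * N′) → E * (q * N′) ≤ E * (q′ * N) + 2 * (N * N′) →
      E * ((p + q) * (2 * N′)) ≤ E * ((p′ + q′) * (2 * N)) + 2 * (2 * N * (2 * N′))
    halves E p p′ q q′ N N′ x y = ≤-from 0 (*-monoʳ-≤ 2 (+-mono-≤ x y)) (eqn E p p′ q q′ N N′)
      where
      eqn : ∀ E p p′ q q′ N N′ → E * ((p + q) * (2 * N′)) + 2 * (E * (p′ * N) + 2 * (N * N′) + (E * (q′ * N) + 2 * (N * N′))) + 0 ≡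
        E * ((p′ + q′) * (2 * N)) + 2 * (2 * N * (2 * N′)) + 2 * (E * (p * N′) + E * (q * N′))
      eqn = solve-∀
    by : HalfDensity Up → HalfDensity Down → PositiveDensityWrt S (λ N → ℤ.- + N) (λ N → + N) (λ N → 2 * N)
    -- `suc (d + suc d)` is `2 * suc d`: the positive values alone give the lower bound relative to
    -- `2 * N`.
    by (approx , d , N₀ , lower) (approx⁻ , _) = cauchy , d + suc d , N₀ , positive
      where
      positive : ∀ N k → N₀ < N → CountIn S (ℤ.- + N) (+ N) k → 2 * N ≤ suc (d + suc d) * k
      positive N k N> counted = let xs , dec , _ , eq = split N k counted in
        ≤-trans (*-monoʳ-≤ 2 (lower N (<⇒≤ N>) (λ j → + suc j ∈? xs) dec))
          (≤-trans (≤-reflexive (arr d (positiveCount xs N))) (*-monoʳ-≤ (suc (d + suc d)) (≤-trans (m≤m+n (positiveCount xs N) (negativeCount xs N)) (≤-reflexive (sym eq)))))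
        where
        arr : ∀ d p → 2 * (suc d * p) ≡ suc (d + suc d) * p
        arr = solve-∀
      cauchy : ∀ e → ∃ λ M → ∀ N N′ k k′ → M < N → M < N′ → CountIn S (ℤ.- + N) (+ N) k → CountIn S (ℤ.- + N′) (+ N′) k′ →
        ℤ.∣ + k ℤ.* + (2 * N′) ℤ.- + k′ ℤ.* + (2 * N) ∣ * suc e < 2 * N * (2 * N′)
      cauchy e = let M⁺ , bound⁺ = half-cauchy Up approx (4 * suc e) (s≤s z≤n)
                     M⁻ , bound⁻ = half-cauchy Down approx⁻ (4 * suc e) (s≤s z≤n)
        in M⁺ + M⁻ , λ N N′ k k′ N> N′> counted counted′ →
          let xs , up₁ , down₁ , eq = split N k counted
              ys , up₂ , down₂ , eq′ = split N′ k′ counted′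
              N⁺ = ≤-trans (m≤m+n M⁺ M⁻) (<⇒≤ N>)
              N⁻ = ≤-trans (m≤n+m M⁻ M⁺) (<⇒≤ N>)
              N′⁺ = ≤-trans (m≤m+n M⁺ M⁻) (<⇒≤ N′>)
              N′⁻ = ≤-trans (m≤n+m M⁻ M⁺) (<⇒≤ N′>)
              P = positiveCount xs N ; Q = negativeCount xs N ; P′ = positiveCount ys N′ ; Q′ = negativeCount ys N′
          in subst (λ t → ℤ.∣ t ∣ * suc e < 2 * N * (2 * N′)) (cong₂ ℤ._-_ (ℤP.pos-* k (2 * N′)) (ℤP.pos-* k′ (2 * N)))
            (strict e _ (2 * N * (2 * N′)) (*-mono-≤ (*-mono-≤ (s≤s (z≤n {1})) (≤-trans (s≤s z≤n) N>)) (*-mono-≤ (s≤s (z≤n {1})) (≤-trans (s≤s z≤n) N′>)))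
              (abs-difference (4 * suc e) (k * (2 * N′)) (k′ * (2 * N)) (2 * (2 * N * (2 * N′)))
                (subst₂ (λ k k′ → 4 * suc e * (k * (2 * N′)) ≤ 4 * suc e * (k′ * (2 * N)) + 2 * (2 * N * (2 * N′))) (sym eq) (sym eq′)
                  (halves (4 * suc e) P P′ Q Q′ N N′ (bound⁺ N N′ N⁺ N′⁺ _ _ up₁ up₂) (bound⁻ N N′ N⁻ N′⁻ _ _ down₁ down₂)))
                (subst₂ (λ k k′ → 4 * suc e * (k′ * (2 * N)) ≤ 4 * suc e * (k * (2 * N′)) + 2 * (2 * N * (2 * N′))) (sym eq) (sym eq′)
                  (subst (λ B → 4 * suc e * ((P′ + Q′) * (2 * N)) ≤ 4 * suc e * ((P + Q) * (2 * N′)) + 2 * B) (*-comm (2 * N′) (2 * N))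
                    (halves (4 * suc e) P′ P Q′ Q N′ N (bound⁺ N′ N N′⁺ N⁺ _ _ up₂ up₁) (bound⁻ N′ N N′⁻ N⁻ _ _ down₂ down₁))))))

theorem1p7 : (n : ℕ) → 3 ≤ n → (c : Fin n → Fin n → ℤ) →
    Nondegenerate n c → DensityPositive (D n c)
theorem1p7 n 3≤n c nondegenerate = positive-case , negative-case , indefinite-case
  where open Theorem n 3≤n c nondegenerate
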